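{- For every $\epsilon > 0$ there is $\Delta_0 > 0$ with the following property. Let $G$ be a Borel graph of finite maximum degree $\Delta \geq \Delta_0$ with $\mathrm{asi}(G) < \infty$. If $G$ is triangle-free, then $\chi_{\mathsf{B}}(G) \leq (4+\epsilon)\Delta/\log\Delta$; and if $G$ has no $3$-cycles and no $4$-cycles, then $\chi_{\mathsf{B}}(G) \leq (1+\epsilon)\Delta/\log\Delta$.
   Context: All graphs are undirected and simple; $\mathbb{N}=\{0,1,2,\dots\}$, and $q\in\mathbb{N}$ is identified with $\{0,\dots,q-1\}$. $\log$ is the natural logarithm. A Borel graph is a graph $G$ whose vertex set $V(G)$ is a standard Borel space and whose adjacency relation is a Borel subset of $V(G)^2$. The Borel chromatic number $\chi_{\mathsf{B}}(G)$ is the smallest $q\in\mathbb{N}$ such that there is a Borel function $f\colon V(G)\to q$ with $f(u)\neq f(v)$ for every edge $uv$, and $\infty$ if no such $q$ exists. A graph is component-finite if all its connected components are finite. $G[U]$ denotes the subgraph induced by $U\subseteq V(G)$. For a Borel graph $G$, the separation index $\mathrm{si}(G)$ is the smallest $s\in\mathbb{N}$ for which there is a partition $V(G)=U_0\sqcup\dots\sqcup U_s$ into $s+1$ Borel sets such that every $G[U_i]$ is component-finite ($\infty$ if no such $s$ exists). For $R\in\mathbb{N}$, $G^R$ is the graph on $V(G)$ in which two distinct vertices are adjacent iff they are joined by a path of at most $R$ edges in $G$. The asymptotic separation index is $\mathrm{asi}(G)=\sup_{R\in\mathbb{N}}\mathrm{si}(G^R)$. -}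

module Defs where

open import Data.Empty using (⊥)
open import Data.Fin as Fin using (Fin; inject₁)
open import Data.Integer as ℤ using (+_)
import Data.Integer.Properties as ℤ
open import Data.List using (List; length)
open import Data.List.Membership.Propositional using () renaming (_∈_ to _∈ˡ_)
open import Data.List.Relation.Unary.Unique.Propositional using (Unique)
open import Data.Maybe using (Maybe; just)
open import Data.Nat as ℕ using (ℕ; zero; suc)
import Data.Nat.Properties as ℕ
open import Data.Product using (Σ; Σ-syntax; ∃; ∃-syntax; _×_; _,_; proj₁; proj₂; uncurry)
open import Data.Rational as ℚ using (ℚ; 0ℚ; ½; _+_; _-_; -_; _/_; ∣_∣; mkℚ; _≤_; _<_)
open import Data.Rational.Properties
open import Data.Rational.Solver using (module +-*-Solver)
open import Data.Rational.Unnormalised as ℚᵘ using (mkℚᵘ)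
import Data.Rational.Unnormalised.Properties as ℚᵘ
open import Data.Sum using (inj₁; inj₂)
open import Function.Bundles using (_⇔_)
open import Function.Definitions using (Injective)
open import Function.Metric.Structures using (IsGeneralMetric)
open import Level using (Level; 0ℓ; _⊔_) renaming (suc to lsuc)
open import Relation.Binary.Construct.Closure.ReflexiveTransitive using (Star)
open import Relation.Binary.Core using (Rel)
open import Relation.Binary.Definitions using (Symmetric; Irreflexive)
open import Relation.Binary.PropositionalEquality
open import Relation.Nullary using (¬_)
open import Relation.Unary using (Pred; _∈_; _≐_; ∅; ∁; ⋃; _⟨×⟩_)

-- Reals are Cauchy sequences of rationals, taken up to _≈ℝ_.

IsCauchy : (ℕ → ℚ) → Set
IsCauchy f = ∀ ε → 0ℚ < ε →
  ∃[ N ] ∀ m n → N ℕ.≤ m → N ℕ.≤ n → ∣ f m - f n ∣ ≤ ε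

record ℝ : Set where
  constructor mkℝ
  field
    seq    : ℕ → ℚ
    cauchy : IsCauchy seq

open ℝ public

infix 4 _≤ℝ_ _<ℝ_ _≈ℝ_

_≤ℝ_ : Rel ℝ 0ℓ
x ≤ℝ y = ∀ ε → 0ℚ < ε → ∃[ N ] ∀ n → N ℕ.≤ n → seq x n ≤ seq y n + ε

_<ℝ_ : Rel ℝ 0ℓ
x <ℝ y = Σ[ ε ∈ ℚ ] 0ℚ < ε × ∃[ N ] ∀ n → N ℕ.≤ n → seq x n + ε ≤ seq y n

_≈ℝ_ : Rel ℝ 0ℓ
x ≈ℝ y = x ≤ℝ y × y ≤ℝ x

abstract
  const-cauchy : ∀ q → IsCauchy (λ _ → q)
  const-cauchy q ε 0<ε = 0 , λ _ _ _ _ →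
    subst (_≤ ε) (sym (cong ∣_∣ (+-inverseʳ q))) (<⇒≤ 0<ε)

fromℚ : ℚ → ℝ
fromℚ q = mkℝ (λ _ → q) (const-cauchy q)

fromℕ : ℕ → ℝ
fromℕ n = fromℚ (+ n / 1)

0ℝ : ℝ
0ℝ = fromℚ 0ℚ

infixl 6 _+ℝ_
infixl 7 _·ℝ_

abstract
  +-cauchy : ∀ {f g} → IsCauchy f → IsCauchy g → IsCauchy (λ n → f n + g n)
  +-cauchy {f} {g} f-cauchy g-cauchy ε 0<ε = M ℕ.⊔ N , λ m n ≤m ≤n →
    ≤-trans
      (≤-reflexive (cong ∣_∣ (interchange (f m) (f n) (g m) (g n))))
      (≤-trans (∣p+q∣≤∣p∣+∣q∣ (f m - f n) (g m - g n))
      (≤-trans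
        (+-mono-≤
          (f-close m n (ℕ.m⊔n≤o⇒m≤o M N ≤m) (ℕ.m⊔n≤o⇒m≤o M N ≤n))
          (g-close m n (ℕ.m⊔n≤o⇒n≤o M N ≤m) (ℕ.m⊔n≤o⇒n≤o M N ≤n)))
      (≤-reflexive (halves ε))))
    where
    open +-*-Solver
    0<ε/2 : 0ℚ < ε ℚ.* ½
    0<ε/2 = subst (_< ε ℚ.* ½) (*-zeroˡ ½) (*-monoˡ-<-pos ½ 0<ε)
    M N : ℕ
    M = proj₁ (f-cauchy (ε ℚ.* ½) 0<ε/2)
    N = proj₁ (g-cauchy (ε ℚ.* ½) 0<ε/2)
    f-close : ∀ m n → M ℕ.≤ m → M ℕ.≤ n → ∣ f m - f n ∣ ≤ ε ℚ.* ½
    f-close = proj₂ (f-cauchy (ε ℚ.* ½) 0<ε/2)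
    g-close : ∀ m n → N ℕ.≤ m → N ℕ.≤ n → ∣ g m - g n ∣ ≤ ε ℚ.* ½
    g-close = proj₂ (g-cauchy (ε ℚ.* ½) 0<ε/2)
    interchange : ∀ a b c d → (a + c) - (b + d) ≡ (a - b) + (c - d)
    interchange = solve 4 (λ a b c d →
      (a :+ c) :- (b :+ d) := (a :- b) :+ (c :- d)) refl
    halves : ∀ e → e ℚ.* ½ + e ℚ.* ½ ≡ e
    halves e = trans (sym (*-distribˡ-+ e ½ ½)) (*-identityʳ e)

_+ℝ_ : ℝ → ℝ → ℝ
x +ℝ y = mkℝ (λ n → seq x n + seq y n) (+-cauchy {seq x} {seq y} (cauchy x) (cauchy y))

_·ℝ_ : ℕ → ℝ → ℝ
zero  ·ℝ x = 0ℝ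
suc n ·ℝ x = x +ℝ n ·ℝ x

harmonic : ℕ → ℚ
harmonic zero    = 0ℚ
harmonic (suc j) = harmonic j + + 1 / suc j

-- With k = suc i, this is the sum of 1/j over k < j ≤ kn, that is, the
-- lower Riemann sum of ∫₁ⁿ dt/t for the uniform partition of mesh 1/k.
logSum : ℕ → ℕ → ℚ
logSum n i = harmonic (suc i ℕ.* n) - harmonic (suc i)

abstract
  frac-≤ : ∀ a b c d → a ℕ.* suc d ℕ.≤ c ℕ.* suc b → + a / suc b ≤ + c / suc d
  frac-≤ a b c d le = toℚᵘ-cancel-≤
    (ℚᵘ.≤-respˡ-≃ (ℚᵘ.≃-sym (toℚᵘ-fromℚᵘ (mkℚᵘ (+ a) b)))
    (ℚᵘ.≤-respʳ-≃ (ℚᵘ.≃-sym (toℚᵘ-fromℚᵘ (mkℚᵘ (+ c) d)))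
    (ℚᵘ.*≤* (subst₂ ℤ._≤_ (ℤ.pos-* a (suc d)) (ℤ.pos-* c (suc b)) (ℤ.+≤+ le)))))

  frac-+1 : ∀ a b → + a / suc b + + 1 / suc b ≡ + suc a / suc b
  frac-+1 a b = toℚᵘ-injective
    (ℚᵘ.≃-trans (toℚᵘ-homo-+ (+ a / suc b) (+ 1 / suc b))
    (ℚᵘ.≃-trans (ℚᵘ.+-cong (toℚᵘ-fromℚᵘ (mkℚᵘ (+ a) b)) (toℚᵘ-fromℚᵘ (mkℚᵘ (+ 1) b)))
    (ℚᵘ.≃-trans (ℚᵘ.*≡* eq) (ℚᵘ.≃-sym (toℚᵘ-fromℚᵘ (mkℚᵘ (+ suc a) b))))))
    where
    B : ℤ.ℤ
    B = + suc b
    eq : (+ a ℤ.* B ℤ.+ + 1 ℤ.* B) ℤ.* B ≡ + suc a ℤ.* (B ℤ.* B)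
    eq = trans (cong (ℤ._* B) (trans (sym (ℤ.*-distribʳ-+ B (+ a) (+ 1)))
                 (cong (λ z → + z ℤ.* B) (ℕ.+-comm a 1))))
               (ℤ.*-assoc (+ suc a) B B)

  frac-0 : ∀ b → + 0 / suc b ≡ 0ℚ
  frac-0 b = fromℚᵘ-cong {mkℚᵘ (+ 0) b} {mkℚᵘ (+ 0) 0} (ℚᵘ.*≡* refl)

  harmonic-upper : ∀ n j → harmonic (n ℕ.+ j) ≤ harmonic j + + n / suc j
  harmonic-upper zero j = ≤-reflexive
    (sym (trans (cong (λ z → harmonic j + z) (frac-0 j)) (+-identityʳ _)))
  harmonic-upper (suc n) j = ≤-trans
    (+-mono-≤ (harmonic-upper n j) (frac-≤ 1 (n ℕ.+ j) 1 j
      (ℕ.*-monoʳ-≤ 1 (ℕ.s≤s (ℕ.m≤n+m j n)))))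
    (≤-reflexive (trans (+-assoc (harmonic j) _ _)
      (cong (λ z → harmonic j + z) (frac-+1 n j))))

  harmonic-lower : ∀ n j d → n ℕ.+ j ℕ.≤ suc d →
    harmonic j + + n / suc d ≤ harmonic (n ℕ.+ j)
  harmonic-lower zero j d _ = ≤-reflexive
    (trans (cong (λ z → harmonic j + z) (frac-0 d)) (+-identityʳ _))
  harmonic-lower (suc n) j d le = ≤-trans
    (≤-reflexive (trans (cong (λ z → harmonic j + z) (sym (frac-+1 n d)))
      (sym (+-assoc (harmonic j) _ _))))
    (+-mono-≤ (harmonic-lower n j d (ℕ.≤-trans (ℕ.n≤1+n _) le))
      (frac-≤ 1 d 1 (n ℕ.+ j) (ℕ.*-monoʳ-≤ 1 le)))

  logSum-≤ : ∀ m i → logSum (suc m) i ≤ logSum (suc m) (suc i)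
  logSum-≤ m i = ≤-trans
    (≤-reflexive (solve 3 (λ a b r → a :- b := (a :+ r) :- (b :+ r)) refl
      (harmonic (suc i ℕ.* suc m)) (harmonic (suc i)) (+ 1 / suc (suc i))))
    (+-monoˡ-≤ (- harmonic (suc (suc i))) (≤-trans
      (+-monoʳ-≤ (harmonic (suc i ℕ.* suc m))
        (frac-≤ 1 (suc i) (suc m) (m ℕ.+ suc i ℕ.* suc m) (ℕ.≤-reflexive
          (trans (ℕ.*-identityˡ _) (ℕ.*-comm (suc (suc i)) (suc m))))))
      (harmonic-lower (suc m) (suc i ℕ.* suc m) (m ℕ.+ suc i ℕ.* suc m) ℕ.≤-refl)))
    where open +-*-Solver

  logSum-+-≤ : ∀ m i →
    logSum (suc m) (suc i) + + 1 / suc (suc i) ≤ logSum (suc m) i + + 1 / suc i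
  logSum-+-≤ m i = ≤-trans
    (≤-reflexive (solve 3 (λ a b r → (a :- (b :+ r)) :+ r := a :- b) refl
      (harmonic (suc m ℕ.+ suc i ℕ.* suc m)) (harmonic (suc i)) (+ 1 / suc (suc i))))
    (≤-trans (+-monoˡ-≤ (- harmonic (suc i)) (≤-trans
      (harmonic-upper (suc m) (suc i ℕ.* suc m))
      (+-monoʳ-≤ (harmonic (suc i ℕ.* suc m))
        (frac-≤ (suc m) (suc i ℕ.* suc m) 1 i
          (ℕ.≤-trans (ℕ.≤-reflexive (ℕ.*-comm (suc m) (suc i)))
          (ℕ.≤-trans (ℕ.n≤1+n _) (ℕ.≤-reflexive (sym (ℕ.*-identityˡ _)))))))))
    (≤-reflexive (solve 3 (λ a b r → (a :+ r) :- b := (a :- b) :+ r) refl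
      (harmonic (suc i ℕ.* suc m)) (harmonic (suc i)) (+ 1 / suc i))))
    where open +-*-Solver

  logSum-mono : ∀ m N p → logSum (suc m) N ≤ logSum (suc m) (p ℕ.+ N)
  logSum-mono m N zero    = ≤-refl
  logSum-mono m N (suc p) = ≤-trans (logSum-mono m N p) (logSum-≤ m (p ℕ.+ N))

  logSum-bound : ∀ m N p →
    logSum (suc m) (p ℕ.+ N) + + 1 / suc (p ℕ.+ N) ≤ logSum (suc m) N + + 1 / suc N
  logSum-bound m N zero    = ≤-refl
  logSum-bound m N (suc p) = ≤-trans (logSum-+-≤ m (p ℕ.+ N)) (logSum-bound m N p)

  archimedean : ∀ ε → 0ℚ < ε → ∃[ N ] + 1 / suc N ≤ ε
  archimedean (mkℚ (+ 0) b _) (ℚ.*<* (ℤ.+<+ ()))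
  archimedean ε@(mkℚ (+ suc a) b _) _ = b , ≤-trans
    (frac-≤ 1 b (suc a) b (ℕ.*-monoˡ-≤ (suc b) {1} {suc a} (ℕ.s≤s ℕ.z≤n)))
    (≤-reflexive (↥p/↧p≡p ε))
  archimedean (mkℚ (ℤ.-[1+ a ]) b _) (ℚ.*<* ())

  ∣-∣-≤ : ∀ {p q lo r} → lo ≤ p → p ≤ lo + r → lo ≤ q → q ≤ lo + r → ∣ p - q ∣ ≤ r
  ∣-∣-≤ {p} {q} {lo} {r} lo≤p p≤hi lo≤q q≤hi with ∣p∣≡p∨∣p∣≡-p (p - q)
  ... | inj₁ eq = ≤-trans (≤-reflexive eq)
        (≤-trans (+-mono-≤ p≤hi (neg-antimono-≤ lo≤q))
        (≤-reflexive (solve 2 (λ l r → (l :+ r) :- l := r) refl lo r)))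
    where open +-*-Solver
  ... | inj₂ eq = ≤-trans (≤-reflexive (trans eq
          (solve 2 (λ p q → :- (p :- q) := q :- p) refl p q)))
        (≤-trans (+-mono-≤ q≤hi (neg-antimono-≤ lo≤p))
        (≤-reflexive (solve 2 (λ l r → (l :+ r) :- l := r) refl lo r)))
    where open +-*-Solver

  logSum-cauchy : ∀ m → IsCauchy (logSum (suc m))
  logSum-cauchy m ε 0<ε with archimedean ε 0<ε
  ... | N , 1/N≤ε = N , λ i j N≤i N≤j →
        ≤-trans (∣-∣-≤ (lower i N≤i) (upper i N≤i) (lower j N≤j) (upper j N≤j)) 1/N≤ε
    where
    lower : ∀ i → N ℕ.≤ i → logSum (suc m) N ≤ logSum (suc m) i
    lower i N≤i = subst (λ z → logSum (suc m) N ≤ logSum (suc m) z)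
      (ℕ.m∸n+n≡m N≤i) (logSum-mono m N (i ℕ.∸ N))

    upper : ∀ i → N ℕ.≤ i → logSum (suc m) i ≤ logSum (suc m) N + + 1 / suc N
    upper i N≤i = ≤-trans
      (≤-trans (≤-reflexive (sym (+-identityʳ _)))
        (+-monoʳ-≤ (logSum (suc m) i) (≤-trans (≤-reflexive (sym (frac-0 i)))
          (frac-≤ 0 i 1 i ℕ.z≤n))))
      (subst (λ z → logSum (suc m) z + + 1 / suc z ≤ logSum (suc m) N + + 1 / suc N)
        (ℕ.m∸n+n≡m N≤i) (logSum-bound m N (i ℕ.∸ N)))

-- log n = ∫₁ⁿ dt/t for n ≥ 1; the value at 0 is arbitrary.
log : ℕ → ℝ
log zero    = 0ℝ
log (suc m) = mkℝ (logSum (suc m)) (logSum-cauchy m)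

data σ⟨_⟩ {X : Set} {ℓ : Level} (𝒢 : Pred (Pred X 0ℓ) ℓ) :
          Pred (Pred X 0ℓ) (lsuc 0ℓ ⊔ ℓ) where
  generator  : ∀ {U} → U ∈ 𝒢 → U ∈ σ⟨ 𝒢 ⟩
  empty      : ∅ ∈ σ⟨ 𝒢 ⟩
  complement : ∀ {U} → U ∈ σ⟨ 𝒢 ⟩ → ∁ U ∈ σ⟨ 𝒢 ⟩
  union      : (U : ℕ → Pred X 0ℓ) → (∀ n → U n ∈ σ⟨ 𝒢 ⟩) → ⋃ ℕ U ∈ σ⟨ 𝒢 ⟩
  -- Sets are predicates, so extensionally equal ones must be identified.
  respects   : ∀ {U W} → U ≐ W → U ∈ σ⟨ 𝒢 ⟩ → W ∈ σ⟨ 𝒢 ⟩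

module _ {X : Set} (d : X → X → ℝ) where

  IsMetric : Set
  IsMetric = IsGeneralMetric _≡_ _≈ℝ_ _≤ℝ_ 0ℝ _+ℝ_ d

  IsOpen : Pred (Pred X 0ℓ) 0ℓ
  IsOpen U = ∀ x → x ∈ U → Σ[ r ∈ ℝ ] 0ℝ <ℝ r × (∀ y → d x y <ℝ r → y ∈ U)

  Complete : Set
  Complete = (s : ℕ → X) →
    (∀ ε → 0ℝ <ℝ ε → ∃[ N ] ∀ m n → N ℕ.≤ m → N ℕ.≤ n → d (s m) (s n) <ℝ ε) →
    Σ[ x ∈ X ] ∀ ε → 0ℝ <ℝ ε → ∃[ N ] ∀ n → N ℕ.≤ n → d (s n) x <ℝ ε

  -- The dense sequence is partial so that the empty space is separable.
  Separable : Set
  Separable = Σ[ s ∈ (ℕ → Maybe X) ] ∀ x ε → 0ℝ <ℝ ε →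
    ∃[ n ] Σ[ y ∈ X ] s n ≡ just y × d x y <ℝ ε

-- 𝔅 is the Borel σ-algebra of the complete separable metric d.
record IsPolish {X : Set} (𝔅 : Pred (Pred X 0ℓ) (lsuc 0ℓ)) (d : X → X → ℝ) : Set₁ where
  field
    isMetric  : IsMetric d
    complete  : Complete d
    separable : Separable d
    generated : ∀ U → U ∈ 𝔅 ⇔ U ∈ σ⟨ IsOpen d ⟩

record StandardBorelSpace : Set₂ where
  field
    Carrier : Set
    IsBorel : Pred (Pred Carrier 0ℓ) (lsuc 0ℓ)
    polish  : ∃ (IsPolish IsBorel)

  data IsRectangle : Pred (Pred (Carrier × Carrier) 0ℓ) (lsuc 0ℓ) where
    rectangle : ∀ {A B} → A ∈ IsBorel → B ∈ IsBorel → (A ⟨×⟩ B) ∈ IsRectangle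

  IsBorel² : Pred (Pred (Carrier × Carrier) 0ℓ) (lsuc 0ℓ)
  IsBorel² = σ⟨ IsRectangle ⟩

-- Membership proofs need not be unique, so cardinality is defined by
-- enumerating elements rather than by counting Σ X P.
HasCardinality : {X : Set} → Pred X 0ℓ → ℕ → Set
HasCardinality {X} P k =
  Σ[ l ∈ List X ] Unique l × length l ≡ k × (∀ x → x ∈ˡ l ⇔ x ∈ P)

Finite : {X : Set} → Pred X 0ℓ → Set
Finite P = ∃[ k ] HasCardinality P k

IsLeast : ∀ {ℓ} → Pred ℕ ℓ → ℕ → Set ℓ
IsLeast P n = P n × (∀ m → P m → n ℕ.≤ m)

module _ {X : Set} (_~_ : Rel X 0ℓ) where

  Degree : X → ℕ → Set
  Degree x k = HasCardinality (x ~_) k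

  MaxDegree : ℕ → Set
  MaxDegree Δ = (∀ x → ∃[ k ] Degree x k × k ℕ.≤ Δ) × (∃[ x ] Degree x Δ)

  Path : ℕ → Rel X 0ℓ
  Path k x y = Σ[ p ∈ (Fin (suc k) → X) ]
    Injective _≡_ _≡_ p ×
    (∀ i → p (inject₁ i) ~ p (Fin.suc i)) ×
    p Fin.zero ≡ x × p (Fin.fromℕ k) ≡ y

  -- Only meaningful for n ≥ 3.
  HasCycle : ℕ → Set
  HasCycle zero    = ⊥
  HasCycle (suc k) = ∃[ x ] ∃[ y ] Path k x y × y ~ x

  Power : ℕ → Rel X 0ℓ
  Power R x y = x ≢ y × ∃[ k ] k ℕ.≤ R × Path k x y

  Induced : Pred X 0ℓ → Rel X 0ℓ
  Induced U x y = x ∈ U × y ∈ U × x ~ y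

  -- Every connected component of the subgraph induced by U is finite.
  ComponentFiniteOn : Pred X 0ℓ → Set
  ComponentFiniteOn U = ∀ x → x ∈ U → Finite (Star (Induced U) x)

module _ (V : StandardBorelSpace) where
  open StandardBorelSpace V

  SeparatingPartition : Rel Carrier 0ℓ → ℕ → Set₁
  SeparatingPartition _~_ s = Σ[ U ∈ (Fin (suc s) → Pred Carrier 0ℓ) ]
    (∀ i → U i ∈ IsBorel) ×
    (∀ x → ∃[ i ] x ∈ U i) ×
    (∀ x i j → x ∈ U i → x ∈ U j → i ≡ j) ×
    (∀ i → ComponentFiniteOn _~_ (U i))

  SeparationIndex : Rel Carrier 0ℓ → ℕ → Set₁
  SeparationIndex _~_ = IsLeast (SeparatingPartition _~_)

record BorelGraph : Set₂ where
  infix 4 _~_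
  field
    V           : StandardBorelSpace
  open StandardBorelSpace V public
  field
    _~_         : Rel Carrier 0ℓ
    symmetric   : Symmetric _~_
    irreflexive : Irreflexive _≡_ _~_
    borel       : uncurry _~_ ∈ IsBorel²

module _ (G : BorelGraph) where
  open BorelGraph G

  BorelColouring : ℕ → Set₁
  BorelColouring q = Σ[ f ∈ (Carrier → Fin q) ]
    (∀ c → (λ x → f x ≡ c) ∈ IsBorel) ×
    (∀ x y → x ~ y → f x ≢ f y)

  BorelChromaticNumber : ℕ → Set₁
  BorelChromaticNumber = IsLeast BorelColouring

  -- asi(G) < ∞: every si(G^R) is finite, with a bound independent of R.
  FiniteAsi : Set₁
  FiniteAsi = ∃[ s ] ∀ R → ∃[ t ] t ℕ.≤ s × SeparationIndex V (Power _~_ R) t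

  FiniteMaxDegree : ℕ → Set
  FiniteMaxDegree = MaxDegree _~_

  NoCycle : ℕ → Set
  NoCycle n = ¬ HasCycle _~_ n

  -- χ_B(G) ≤ c · Δ / log Δ, with the denominator cleared (log Δ > 0 as
  -- soon as Δ ≥ 2).
  ChromaticBound : ℝ → ℕ → Set₁
  ChromaticBound c Δ =
    ∃[ χ ] BorelChromaticNumber χ × χ ·ℝ log Δ ≤ℝ Δ ·ℝ c

-- Finite asi gives a Borel local lemma. For every R the vertices split into s + 1 Borel sets, s not depending on R, on which G^R has
-- finite components; there, conditional expectations let one choose values in a Borel way. Variables are set class by class, freezing
-- those near an event whose conditional probability has become dangerous; two such sweeps leave finite components, and the finite local
-- lemma finishes. The resulting criterion is polynomial: exponential in the radius of an event only.
--
-- It drives a nibble. With n rounds left a vertex is activated with probability 1/n and picks a uniform colour of its list, which it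
-- keeps unless a neighbour picked it too. Coin flips equalise the survival probabilities of colours. A colour that is on the lists of too
-- many neighbours of v is declared dead at v; the hits on different colours are negatively associated, so few colours die. If lists have
-- size b y and n e y bounds the degrees of live colours, then b and n drop by one per round while y shrinks geometrically. The number of
-- colours is about θ² Δ / log Δ: without 4-cycles no colour dies and θ = 1, otherwise half of a list may be dead and θ = 2.
module Submission where

-- The criterion does not mention asi(G), so Δ₀ depends on ε alone: the asi only fixes the number of
-- stages of a sweep, which is paid for by long tuples. A stage multiplies the potential of a tuple
-- family by at most 4D, where D is the number of families that can interact with it, whereas n + 1
-- events that all become dangerous need a factor of at least 2^(n+1). Tuples of length n spread
-- over a radius proportional to n, so in a single sweep D is exponential in n and nothing is
-- gained. The first sweep therefore bounds clusters only inside a ball of fixed radius; in the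
-- second, interaction passes through these clusters, D is linear in n, and n can be chosen.
--
-- The factor 4 = θ² has two sources. With 4-cycles the degree of a single colour need not
-- concentrate, and only the total weight of a list is controlled: colours may reach twice the
-- initial degree bound before they die, and half of a list may die.
--
-- Edges are only given as a Borel relation. Borel functions that name the neighbours come from
-- Novikov separation of analytic sets.

open import Axiom.ExcludedMiddle using (ExcludedMiddle)
open import Data.Nat using (ℕ; zero; suc)
open import Data.Product using (Σ; Σ-syntax; ∃-syntax; _×_; _,_) renaming (proj₁ to fst; proj₂ to snd)
open import Data.Bool using (Bool; true; false; if_then_else_; not)
import Data.Bool as Bool
open import Data.Empty using (⊥; ⊥-elim)
open import Data.Fin using (Fin; toℕ; fromℕ<) renaming (zero to fzero; suc to fsuc)
import Data.Fin as Fin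
import Data.Fin.Properties as Fin
open import Data.Fin.Properties using (toℕ<n; toℕ-injective; toℕ-fromℕ<; fromℕ<-toℕ)
open import Data.List using (List; []; _∷_; _++_; map; length; concatMap; filter; allFin)
import Data.List as List
import Data.List.Properties as List
open import Data.List.Membership.Propositional using (_∈_; _∉_)
import Data.List.Membership.Propositional.Properties as Mem
open import Data.List.Membership.Propositional.Properties using (∈-map⁺; ∈-map⁻; ∈-allFin; ∈-++⁺ˡ; ∈-++⁺ʳ; ∈-++⁻; ∈-upTo⁻; ∈-lookup)
open import Data.List.Properties using (length-map; length-++)
open import Data.List.Relation.Unary.All as ListAll using (All; []; _∷_) renaming (lookup to All-∈)
open import Data.List.Relation.Unary.AllPairs using (AllPairs; []; _∷_)
open import Data.List.Relation.Unary.Any as ListAny using (Any; here; there; index)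
open import Data.List.Relation.Unary.Any.Properties using (lookup-index)
open import Data.List.Relation.Unary.Unique.Propositional using (Unique)
import Data.List.Relation.Unary.Unique.Propositional.Properties as Uniq
open import Data.List.Relation.Unary.Unique.Propositional.Properties using (allFin⁺; upTo⁺)
import Data.List.Relation.Unary.Unique.DecPropositional.Properties as Dedup
open import Data.Maybe using (Maybe; just; nothing)
import Data.Nat as ℕ
open import Data.Nat.Induction using (<-rec)
import Data.Nat.Properties as ℕ
open import Data.Nat.Properties using (≤-refl; ≤-trans; ≤-total; <⇒≤; ≮⇒≥; ≰⇒>; <-≤-trans; ≤-<-trans;
  <-irrefl; +-comm; +-assoc; +-identityʳ; +-suc; *-comm; *-assoc; *-identityˡ; *-identityʳ; *-zeroʳ; *-distribˡ-+;
  *-distribʳ-+; m≤m+n; m≤n+m; n≤1+n; m≤n⇒m<n∨m≡n;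
  m≤m⊔n; m≤n⊔m; *-cancelˡ-≤; *-cancelʳ-≤; +-cancelˡ-≤; +-cancelʳ-≤; m∸n+n≡m; n≤0⇒n≡0; ^-monoˡ-≤; ^-monoʳ-≤;
  ^-distribˡ-+-*; ^-*-assoc; 1+n≰n; <⇒≱; m+[n∸m]≡n; 1+n≢0; suc-injective; ≤-pred; module ≤-Reasoning;
  m<1+n⇒m<n∨m≡n; <-cmp; n<1+n; ^-monoˡ-<; m≤m*n; ^-monoʳ-<)
open import Data.Nat.Properties using () renaming (≤-trans to infixr 5 _»_; ≤-reflexive to from≡;
  *-monoˡ-≤ to *≤ˡ; *-monoʳ-≤ to *≤ʳ; +-monoˡ-≤ to +≤ˡ; +-monoʳ-≤ to +≤ʳ; *-mono-≤ to *≤; +-mono-≤ to +≤)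
open import Algebra.Properties.CommutativeSemigroup ℕ.*-commutativeSemigroup
  using (x∙yz≈y∙xz; x∙yz≈yx∙z; xy∙z≈xz∙y; xy∙z≈x∙zy; xy∙z≈y∙xz; x∙yz≈xz∙y) renaming (interchange to *-interchange)
open import Data.Rational as ℚ using (ℚ; 0ℚ; ½; _/_)
import Data.Rational.Properties as ℚ
open import Data.Rational.Properties using () renaming (≤-trans to infixr 5 _⟫_)
open import Data.Rational.Solver using (module +-*-Solver)
open import Data.Sum using (_⊎_; inj₁; inj₂)
open import Data.Unit using (⊤; tt)
open import Function using (_∘_; id; const; case_of_)
open import Function.Bundles using (Equivalence)
open import Function.Metric.Structures using (IsGeneralMetric)
open import Level using (Level; 0ℓ) renaming (suc to lsuc; _⊔_ to _⊔ˡ_)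
open import Relation.Binary.Core using (Rel)
open import Relation.Binary.Definitions using (tri<; tri≈; tri>)
open import Relation.Binary.PropositionalEquality using (_≡_; _≢_; refl; sym; trans; cong; cong₂; subst; subst₂)
open import Relation.Binary.PropositionalEquality using () renaming (trans to infixr 5 _∙_)
open import Relation.Nullary using (¬_; Dec; yes; no)
open import Relation.Nullary.Decidable using (from-yes)
open import Relation.Unary using (Pred)

-- Reflective proofs of polynomial identities over ℕ.

module Polynomials where
 open import Data.Nat using (_+_; _*_; _<ᵇ_; _≡ᵇ_)
 open import Algebra.Properties.CommutativeSemigroup ℕ.+-commutativeSemigroup using () renaming (x∙yz≈y∙xz to swap)

 infix 4 _:=_
 infixl 6 _:+_
 infixl 7 _:*_

 data Expr : Set where
  var con : ℕ -> Expr
  _:+_ _:*_ : Expr -> Expr -> Expr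

 _:=_ : Expr -> Expr -> Expr × Expr
 _:=_ = _,_

 -- A monomial is the sorted list of its variables with repetitions. Sorting only decides whether
 -- equal polynomials reach the same form; soundness does not rest on it.
 Mono Poly : Set
 Mono = List ℕ
 Poly = List (Mono × ℕ)

 insert : ℕ -> Mono -> Mono
 insert i [] = i ∷ []
 insert i (j ∷ m) = if i <ᵇ j then i ∷ j ∷ m else j ∷ insert i m

 merge : Mono -> Mono -> Mono
 merge [] m' = m'
 merge (i ∷ m) m' = insert i (merge m m')

 before : Mono -> Mono -> Bool
 before [] _ = true
 before (_ ∷ _) [] = false
 before (i ∷ m) (j ∷ m') = if i ≡ᵇ j then before m m' else i <ᵇ j

 add : Mono -> ℕ -> Poly -> Poly
 add m c [] = (m , c) ∷ []
 add m c ((m' , c') ∷ p) with List.≡-dec ℕ._≟_ m m'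
 ... | yes _ = (m , c + c') ∷ p
 ... | no _ = if before m m' then (m , c) ∷ (m' , c') ∷ p else (m' , c') ∷ add m c p

 plus : Poly -> Poly -> Poly
 plus [] q = q
 plus ((m , c) ∷ p) q = add m c (plus p q)

 scale : Mono -> ℕ -> Poly -> Poly
 scale m c [] = []
 scale m c ((m' , c') ∷ q) = add (merge m m') (c * c') (scale m c q)

 times : Poly -> Poly -> Poly
 times [] q = []
 times ((m , c) ∷ p) q = plus (scale m c q) (times p q)

 norm : Expr -> Poly
 norm (var i) = (i ∷ [] , 1) ∷ []
 -- An explicit term with coefficient 0 would make equal normal forms differ.
 norm (con zero) = []
 norm (con n) = ([] , n) ∷ []
 norm (e :+ f) = plus (norm e) (norm f)
 norm (e :* f) = times (norm e) (norm f)

 ⟦_⟧ : Expr -> (ℕ -> ℕ) -> ℕ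
 ⟦ var i ⟧ ρ = ρ i
 ⟦ con n ⟧ ρ = n
 ⟦ e :+ f ⟧ ρ = ⟦ e ⟧ ρ + ⟦ f ⟧ ρ
 ⟦ e :* f ⟧ ρ = ⟦ e ⟧ ρ * ⟦ f ⟧ ρ

 module _ (ρ : ℕ -> ℕ) where
  mono : Mono -> ℕ
  mono [] = 1
  mono (i ∷ m) = ρ i * mono m

  poly : Poly -> ℕ
  poly [] = 0
  poly ((m , c) ∷ p) = c * mono m + poly p

  insert-mono : ∀ i m -> mono (insert i m) ≡ ρ i * mono m
  insert-mono i [] = refl
  insert-mono i (j ∷ m) with i <ᵇ j
  ... | true = refl
  ... | false = trans (cong (ρ j *_) (insert-mono i m)) (x∙yz≈y∙xz (ρ j) (ρ i) (mono m))

  merge-mono : ∀ m m' -> mono (merge m m') ≡ mono m * mono m'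
  merge-mono [] m' = sym (*-identityˡ _)
  merge-mono (i ∷ m) m' = trans (insert-mono i (merge m m')) (trans (cong (ρ i *_) (merge-mono m m')) (sym (*-assoc (ρ i) _ _)))

  add-poly : ∀ m c p -> poly (add m c p) ≡ c * mono m + poly p
  add-poly m c [] = refl
  add-poly m c ((m' , c') ∷ p) with List.≡-dec ℕ._≟_ m m'
  ... | yes refl = trans (cong (_+ poly p) (*-distribʳ-+ (mono m) c c')) (+-assoc (c * mono m) _ _)
  ... | no _ with before m m'
  ...   | true = refl
  ...   | false = trans (cong (c' * mono m' +_) (add-poly m c p)) (swap (c' * mono m') (c * mono m) (poly p))

  plus-poly : ∀ p q -> poly (plus p q) ≡ poly p + poly q
  plus-poly [] q = refl
  plus-poly ((m , c) ∷ p) q = trans (add-poly m c (plus p q)) (trans (cong (c * mono m +_) (plus-poly p q)) (sym (+-assoc (c * mono m) _ _)))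

  scale-poly : ∀ m c q -> poly (scale m c q) ≡ c * mono m * poly q
  scale-poly m c [] = sym (*-zeroʳ (c * mono m))
  scale-poly m c ((m' , c') ∷ q) = trans (add-poly (merge m m') (c * c') (scale m c q)) (trans
   (cong₂ _+_ (trans (cong (c * c' *_) (merge-mono m m')) (*-interchange c c' (mono m) (mono m'))) (scale-poly m c q)) (sym (*-distribˡ-+ (c * mono m) _ _)))

  times-poly : ∀ p q -> poly (times p q) ≡ poly p * poly q
  times-poly [] q = refl
  times-poly ((m , c) ∷ p) q = trans (plus-poly (scale m c q) (times p q))
   (trans (cong₂ _+_ (scale-poly m c q) (times-poly p q)) (sym (*-distribʳ-+ (poly q) (c * mono m) _)))

  norm-sound : ∀ e -> poly (norm e) ≡ ⟦ e ⟧ ρ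
  norm-sound (var i) = trans (+-identityʳ _) (trans (*-identityˡ _) (*-identityʳ _))
  norm-sound (con zero) = refl
  norm-sound (con (suc n)) = trans (+-identityʳ _) (*-identityʳ _)
  norm-sound (e :+ f) = trans (plus-poly (norm e) (norm f)) (cong₂ _+_ (norm-sound e) (norm-sound f))
  norm-sound (e :* f) = trans (times-poly (norm e) (norm f)) (cong₂ _*_ (norm-sound e) (norm-sound f))

 -- An identity is a function of its variables, so that `Holds` unfolds to the universally
 -- quantified equation with both sides evaluated.
 Identity : ℕ -> Set
 Identity zero = Expr × Expr
 Identity (suc n) = Expr -> Identity n

 sides : ∀ n -> ℕ -> Identity n -> Expr × Expr
 sides zero i e = e
 sides (suc n) i f = sides n (suc i) (f (var i))

 Holds : ∀ n -> ℕ -> (ℕ -> ℕ) -> Identity n -> Set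
 Holds zero i ρ (l , r) = ⟦ l ⟧ ρ ≡ ⟦ r ⟧ ρ
 Holds (suc n) i ρ f = ∀ x -> Holds n (suc i) (λ j -> if i ≡ᵇ j then x else ρ j) (f (var i))

 -- Equality of normal forms is checked on closed terms.
 ring : ∀ n f -> norm (fst (sides n 0 f)) ≡ norm (snd (sides n 0 f)) -> Holds n 0 (const 0) f
 ring n f = holds n 0 (const 0) f
  where
  holds : ∀ n i ρ f -> norm (fst (sides n i f)) ≡ norm (snd (sides n i f)) -> Holds n i ρ f
  holds zero i ρ (l , r) e = trans (sym (norm-sound ρ l)) (trans (cong (poly ρ) e) (norm-sound ρ r))
  holds (suc n) i ρ f e x = holds n (suc i) _ (f (var i)) e

module Identities where
 open Polynomials using (ring; con; _:=_) renaming (_:+_ to infixl 6 _+_; _:*_ to infixl 7 _*_)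

 ring1 = ring 4 (λ a b c d -> a + b + (c + d) := a + c + (b + d)) refl
 ring2 = ring 1 (λ a -> (con 1 + (a + (a + con 0))) := a + (con 1 + (a + con 0))) refl
 ring3 = ring 2 (λ a b -> a * b + a * b := con 2 * a * b) refl
 ring4 = ring 3 (λ a b c -> con 2 * a * b + a * c := a * c + a * (con 2 * b)) refl
 ring5 = ring 2 (λ a b -> con 2 * (con 2 * a * b) := con 4 * a * b) refl
 ring6 = ring 1 (λ a -> a + a + (a + a) := con 4 * a) refl
 ring7 = ring 6 (λ a b c d e f -> con 48 * a * b * c * d * e + con 4 * (con 1 + (a * (con 2 + b * (con 14 * f)) * d)) := con 4 * (con 1 + (a * (con 2 + b * (f + f + ((e + e) * c + (f + f) + (e + e) * c + (e + e) * c) + (f + f) + f + (f + (f + f + ((e + e) * c + (f + f) + (e + e) * c + (e + e) * c) + (f + f))))) * d))) refl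
 ring8 = ring 1 (λ a -> (con 1 + ((con 1 + (a + a)))) := con 2 * (con 1 + a)) refl
 ring9 = ring 4 (λ a b c d -> a * (b * (c * d)) := c * (a * b * d)) refl
 ring10 = ring 4 (λ a b c d -> a * (b * (c * d)) := b * (a * c * d)) refl
 ring11 = ring 4 (λ a b c d -> a * b * c * d := a * c * (b * d)) refl
 ring12 = ring 4 (λ a b c d -> a * b * (c * d) := a * (d * (c * b))) refl
 ring13 = ring 3 (λ a b c -> con 4 * a * b * c := b * (con 4 * c * a)) refl
 ring14 = ring 1 (λ a -> con 2 * (con 1 + a) := con 1 * (con 1 + ((con 1 + (a + a))))) refl
 ring15 = ring 3 (λ a b c -> a * (con 1 + ((con 1 + b) * c)) + c * a := a * (con 1 + ((con 2 + b) * c))) refl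
 ring16 = ring 1 (λ a -> (con 1 + ((con 1 + a) * (con 3 + a))) := (con 2 + a) * (con 2 + a)) refl
 ring17 = ring 2 (λ a b -> a * ((con 1 + b) * (con 2 + b)) + (con 2 + b) * a := a * ((con 2 + b) * (con 2 + b))) refl
 ring18 = ring 3 (λ a b c -> (a * b) * ((con 2 + c) * (con 2 + c)) * ((con 2 + c) * (con 2 + c)) := a * b * (con 2 + c) * ((con 2 + c) * (con 2 + c) * (con 2 + c))) refl
 ring19 = ring 1 (λ a -> (con 2 + a) * (con 2 + a) * (con 2 + a) + (con 1 + con 3 * a + a * a) := (con 3 + a) * (con 3 + a) * (con 1 + a)) refl
 ring20 = ring 3 (λ a b c -> a * b * (con 2 + c) * ((con 3 + c) * (con 3 + c) * (con 1 + c)) := a * ((con 3 + c) * ((con 3 + c) * b)) * ((con 1 + c) * (con 2 + c))) refl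
 ring21 = ring 3 (λ a b c -> a * b * c := b * c * a) refl
 ring22 = ring 2 (λ a b -> a * con 2 * b := (b + b) * a) refl
 ring23 = ring 5 (λ a b c d e -> a * b * (c * (d * e)) := a * (c * b) * d * e) refl
 ring24 = ring 5 (λ a b c d e -> a * b * c * (d * e) := b * c * (e * (d * a))) refl
 ring25 = ring 4 (λ a b c d -> (con 1 + a) * (b * (con 1 + a) + c * d) := a * b * (con 1 + a) + ((con 1 + a) * b + c * ((con 1 + a) * d))) refl
 ring26 = ring 3 (λ a b c -> (a + (con 1 + b)) * (a * c) + b * c := (con 1 + a) * ((a + b) * c)) refl
 ring27 = ring 2 (λ a b -> (con 1 + a) * (con 1 + ((con 2 + a) * b)) + con 1 := (con 2 + a) * (con 1 + ((con 1 + a) * b))) refl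
 ring28 = ring 2 (λ a b -> a * ((con 2 + b) * ((con 2 + b) * a)) * ((con 1 + b) * (con 2 + b)) := (a * a) * ((con 1 + b) * (con 2 + b)) * ((con 2 + b) * (con 2 + b))) refl
 ring29 = ring 5 (λ a b c d e -> a * b * c * (d * e) := a * (b * d) * e * c) refl
 ring30 = ring 4 (λ a b c d -> a * b * c * d := a * (b * c * d)) refl
 ring31 = ring 4 (λ a b c d -> a * (b * c * d) := a * b * (c * d)) refl
 ring32 = ring 2 (λ a b -> a * b := b * con 1 * a) refl
 ring33 = ring 3 (λ a b c -> (con 1 + ((con 1 + a) + b * (con 2 + a))) * c := (con 2 + a) * c * (con 1 + b)) refl
 ring34 = ring 3 (λ a b c -> a * (b + a + (c + b)) + b * (b + c) := (b + a + c) * (b + a)) refl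
 ring35 = ring 4 (λ a b c d -> a * b * (c * d) := a * c * (d * b)) refl
 ring36 = ring 4 (λ a b c d -> a * b * (c * d) := a * (b * c * d)) refl
 ring37 = ring 2 (λ a b -> a * b + a := a * (con 1 + b)) refl
 ring38 = ring 2 (λ a b -> a * (con 1 + b) := a * b + a) refl
 ring39 = ring 3 (λ a b c -> a * (con 1 + b) + c * a := a * (con 1 + (b + c))) refl
 ring40 = ring 2 (λ a b -> a * (con 1 + b) := a + a * b) refl
 ring41 = ring 4 (λ a b c d -> a * b * c * d := a * d * (b * c)) refl
 ring42 = ring 4 (λ a b c d -> a * b * (c * d) := a * (c * b) * d) refl
 ring43 = ring 3 (λ a b c -> a * (b * c) * b := a * c * (b * b)) refl
 ring44 = ring 2 (λ a b -> a * a * b := a * b * a) refl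
 ring45 = ring 1 (λ a -> (con 1 + (a * (con 1 + ((con 1 + a))))) := (con 1 + a) * (con 1 + a)) refl
 ring46 = ring 1 (λ a -> con 1 * (a * a) := a * con 1 * a) refl
 ring47 = ring 4 (λ a b c d -> a * b * (c * d) := c * a * b * d) refl
 ring48 = ring 3 (λ a b c -> a * (b * b) * c := b * c * b * a) refl
 ring49 = ring 3 (λ a b c -> a * (b * c) * b := a * (b * b) * c) refl
 ring50 = ring 4 (λ a b c d -> a * (b * (c * c)) * d := a * (b * c) * (d * c)) refl
 ring51 = ring 5 (λ a b c d e -> a * (b * c) * (d * e) := a * (d * (c * (con 1 * b))) * e) refl
 ring52 = ring 3 (λ a b c -> a * b * (c * c) := a * c * (b * c)) refl
 ring53 = ring 3 (λ a b c -> a * b * (c * b) := a * c * (b * b)) refl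
 ring54 = ring 4 (λ a b c d -> a * b * (c * d) := a * (c * (b * (con 1 * d)))) refl
 ring55 = ring 5 (λ a b c d e -> a * (b * c) * d + a * (c * e) := a * (c * (b * d + e))) refl
 ring56 = ring 4 (λ a b c d -> a * (b * c * d) := a * c * d * b) refl
 ring57 = ring 4 (λ a b c d -> a * b * c * d := a * (b * c) * d) refl
 ring58 = ring 5 (λ a b c d e -> a * (b * (c * d)) * e := a * b * c * (d * e)) refl
 ring59 = ring 4 (λ a b c d -> a * b * (c * d) := a * d * (b * c)) refl
 ring60 = ring 4 (λ a b c d -> (a + (con 1 + b) * a) * c * d := (con 2 + b) * c * (a * d)) refl
 ring61 = ring 3 (λ a b c -> (a + (con 1 + b) * a) * c := (con 2 + b) * c * a) refl
 ring62 = ring 5 (λ a b c d e -> (a * b + c) * (d * e) := a * (d * b) * e + c * d * e) refl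
 ring63 = ring 6 (λ a b c d e f -> a * (b * c + d) * e + f * d * e := c * (a * e) * b + d * e * (a + f)) refl
 ring64 = ring 4 (λ a b c d -> a * (b * c + d) := b * (a * c) + d * a) refl
 ring65 = ring 5 (λ a b c d e -> a * b * (c * d * e) := a * b * d * (c * e)) refl
 ring66 = ring 4 (λ a b c d -> (con 2 + a) * (con 1 + b) * c * (con 1 + d) := (con 1 + (d + b * (con 1 + d) + (con 1 + a) * ((con 1 + b) * (con 1 + d)))) * c) refl
 ring67 = ring 4 (λ a b c d -> a * b * ((con 1 + c) * (con 1 + d)) := a * (con 1 + d) * (b * (con 1 + c))) refl
 ring68 = ring 5 (λ a b c d e -> a * (con 1 + b) * ((con 2 + c) * (con 2 + d) * e) := (con 1 + (b + d * (con 1 + b) + (con 1 + b) + (con 1 + c) * ((con 1 + d) * (con 1 + b) + (con 1 + b)))) * (a * e)) refl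
 ring69 = ring 3 (λ a b c -> a * b * ((con 1 + c) * b) := a * b * (b * (con 1 + c))) refl
 ring70 = ring 4 (λ a b c d -> a * b * ((con 2 + c) * d) := a * d * ((con 1 + c) * b + b)) refl
 ring71 = ring 4 (λ a b c d -> a * b * c * d := a * b * (d * c)) refl
 ring72 = ring 7 (λ a b c d e f g -> a * b * c * (d * (e * f)) + e * c * f * (g * (a * b)) := (d + g) * (a * b) * (e * c * f)) refl
 ring73 = ring 4 (λ a b c d -> a * (b * c) + b * d := b * (a * c + d)) refl
 ring74 = ring 3 (λ a b c -> (con 1 + ((con 1 + a))) * ((con 1 + ((con 1 + b))) * c) * (con 1 + a) := (con 1 + ((con 1 + b) + (con 1 + a) * (con 2 + b))) * ((con 1 + a) * c)) refl
 ring75 = ring 1 (λ a -> (con 1 + ((con 4 + (con 1 + ((con 1 + a)))) * (con 5 + (con 1 + ((con 1 + a)))))) + (con 1 + (a + a)) := (con 2 + (con 1 + ((con 1 + a)))) * (con 9 + (con 1 + ((con 1 + a))))) refl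
 ring76 = ring 3 (λ a b c -> (a * (b * b) * (con 9 + c) + (con 1 + b) * (con 4 + c) * (con 1 + a) + b * b) * con 2 + b * b * (con 18 + (c + c)) := (con 1 + a) * (b * (con 1 + b) * (con 2 + c)) * con 2 + (con 14 * (con 1 + a) * (b * b) + con 4 * (con 1 + a) * b + con 2 * (con 1 + a) * (con 4 + c) + con 2 * (b * b))) refl
 ring77 = ring 3 (λ a b c -> con 14 * a * (b * b) + con 4 * a * (b * b) + b * b * (con 4 + c) + con 2 * (b * b) := b * b * (con 18 * a) + b * b * (con 6 + c)) refl
 ring78 = ring 2 (λ a b -> a * b + a * (con 6 + b) := a * (con 6 + (b + b))) refl
 ring79 = ring 3 (λ a b c -> (a + b * a) * c := (con 1 + b) * c * a) refl
 ring80 = ring 4 (λ a b c d -> ((con 4 + a) * b + (con 2 + a) * c) * ((con 2 + a) * ((con 2 + a) * d)) := (con 4 + a) * (con 2 + a) * ((con 2 + a) * d * b) + (con 2 + a) * ((con 2 + a) * d) * ((con 2 + a) * c)) refl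
 ring81 = ring 4 (λ a b c d -> (con 4 + a) * (con 2 + a) * (b * c + (con 2 + a) * (con 1 + c)) + (con 2 + a) * ((con 2 + a) * (con 1 + c)) * ((con 2 + a) * d) := (con 4 + a) * c * ((con 2 + a) * b) + (con 2 + a) * (con 2 + a) * (con 1 + c) * (con 4 + a + (con 2 + a) * d)) refl
 ring82 = ring 3 (λ a b c -> a * (con 2 * b) * c := b * (con 2 * a * c)) refl
 ring83 = ring 4 (λ a b c d -> (con 4 + a) * b * ((con 5 + a) * (c * d)) + b * (c * d) := (con 1 + ((con 4 + a) * (con 5 + a))) * (c * (b * d))) refl
 ring84 = ring 4 (λ a b c d -> a * b * (c * d) := c * a * (b * d)) refl
 ring85 = ring 4 (λ a b c d -> a * b * ((b + c * b) * d) := a * d * (b * (b * (con 1 + c)))) refl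
 ring86 = ring 4 (λ a b c d -> ((con 4 + a) * b + (con 2 + a) * c) * ((con 2 + a) * d) := (con 4 + a) * ((con 2 + a) * d * b) + (con 2 + a) * d * ((con 2 + a) * c)) refl
 ring87 = ring 5 (λ a b c d e -> (con 4 + a) * ((b + c) * d + (con 2 + a) * (con 1 + d)) + (con 2 + a) * (con 1 + d) * ((con 2 + a) * e) := (con 4 + a) * (d * b) + (d * ((con 4 + a) * c) + (con 1 + d) * ((con 2 + a) * (con 4 + a + (con 2 + a) * e)))) refl
 ring88 = ring 2 (λ a b -> (con 4 + a) * b + (b + b) := (con 6 + a) * b) refl
 ring89 = ring 4 (λ a b c d -> a * (b * (c * d)) := c * (a * (b * d))) refl
 ring90 = ring 4 (λ a b c d -> a * ((b + c * b) * d) := a * d * (b * (con 1 + c))) refl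
 ring91 = ring 3 (λ a b c -> con 2 * a * (b * c) := a * (con 2 * b * c)) refl
 ring92 = ring 4 (λ a b c d -> (con 2 + a) * b * ((con 4 + a) * c + (con 2 + a) * d) := (con 4 + a) * ((con 2 + a) * b * c) + (con 2 + a) * b * ((con 2 + a) * d)) refl
 ring93 = ring 4 (λ a b c d -> (con 4 + a) * (b + (con 2 + a) * c) + (con 2 + a) * c * ((con 2 + a) * d) := (con 4 + a) * b + (con 2 + a) * c * (con 4 + a + (con 2 + a) * d)) refl
 ring94 = ring 5 (λ a b c d e -> (a * b + c) * (d * (con 1 + d) * e) := a * d * ((e + d * e) * b) + (con 1 + d) * (e * d * c)) refl
 ring95 = ring 5 (λ a b c d e -> a * b * ((con 9 + c) * (b * d) + ((con 2 + c) + b * (con 2 + c))) + (con 1 + b) * ((con 4 + c) * ((con 1 + a) * d) + (con 2 + c) * b * e) := (a * (b * b) * (con 9 + c) + (con 1 + b) * (con 4 + c) * (con 1 + a)) * d + (con 1 + b) * (b * ((con 2 + c) * (a + e)))) refl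
 ring96 = ring 2 (λ a b -> con 2 * a * (a * b) := a * a * (con 2 * b)) refl
 ring97 = ring 3 (λ a b c -> (a + con 1) * b + (c * b + b) := (a + (c + con 2)) * b) refl
 ring98 = ring 4 (λ a b c d -> a * ((con 5 + b) * (c * d)) := (a * c) * (con 2 + b) * d + con 3 * (a * c) * d) refl
 ring99 = ring 3 (λ a b c -> a * b * c + b * c := (a + con 1) * c * b) refl
 ring100 = ring 1 (λ a -> con 4 + a + a := con 2 * (con 2 + a)) refl
 ring101 = ring 3 (λ a b c -> a * b * c := c * a * b) refl
 ring102 = ring 3 (λ a b c -> con 2 * a * (b * c) + a * (b * c) := con 3 * (b * c) * a) refl
 ring103 = ring 3 (λ a b c -> con 3 * (con 6 * (a * b) * c) := con 18 * (a * (b * c))) refl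
 ring104 = ring 3 (λ a b c -> (con 2 + a) * ((con 4 + a) * b + (con 2 + a) * c) := (con 4 + a) * ((con 2 + a) * b) + (con 2 + a) * ((con 2 + a) * c)) refl
 ring105 = ring 3 (λ a b c -> (con 4 + a) * (b + (con 2 + a)) + (con 2 + a) * ((con 2 + a) * c) := (con 4 + a) * b + (con 2 + a) * (con 4 + a + (con 2 + a) * c)) refl
 ring106 = ring 4 (λ a b c d -> a * (b * c) * d := a * (b * (c * d))) refl
 ring107 = ring 2 (λ a b -> con 2 * a * (con 18 * b) := con 36 * a * b) refl
 ring108 = ring 4 (λ a b c d -> a * b * c * d := a * d * c * b) refl
 ring109 = ring 1 (λ a -> (con 1 + (con 2 * (con 1 + a))) := con 3 + con 2 * a) refl
 ring110 = ring 2 (λ a b -> con 2 * a * b := (b + b) * a) refl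
 ring111 = ring 1 (λ a -> con 2 * a + a + a := con 2 * (con 2 * a)) refl
 ring112 = ring 1 (λ a -> (con 1 + ((con 1 + (a + a * a)))) + (con 2 + con 3 * a) := (con 2 + a) * (con 2 + a)) refl
 ring113 = ring 1 (λ a -> con 4 + con 2 * a := con 2 * (con 2 + a)) refl
 ring114 = ring 3 (λ a b c -> a + (b + (c + con 2)) := b + con 2 + a + c) refl
 ring115 = ring 1 (λ a -> (con 1 + (con 8 * (con 1 + a) * a + (a + con 7 * (con 1 + a)))) := con 8 * (con 1 + a) * (con 1 + a)) refl
 ring116 = ring 2 (λ a b -> (con 1 + a) * a * b := a * a * b + a * b) refl
 ring117 = ring 1 (λ a -> (con 1 + ((con 1 + a) + a)) := con 2 * (con 1 + a)) refl
 ring118 = ring 2 (λ a b -> (con 1 + a) * (con 8 * (con 1 + b)) * (con 1 + b) + (con 8 + con 8 * b) + con 8 * (con 1 + b) * b := (con 2 + a) * (con 8 * (con 1 + b) * (con 1 + b))) refl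
 ring119 = ring 2 (λ a b -> con 2 * (con 2 * ((con 2 + a) * (con 8 * b * b))) + con 32 * (con 2 * a * a + con 3 * a) * (b * b) := (con 1 + a) * (con 8 * b) * ((con 1 + a) * (con 8 * b))) refl
 ring120 = ring 2 (λ a b -> con 2 * ((con 2 + a) * (con 8 * b * b)) + (con 4 * a + con 2) * (con 8 * b * b) := con 6 * ((con 1 + a) * (con 8 * b) * b)) refl
 ring121 = ring 3 (λ a b c -> con 2 * (a * b) * c := con 2 * a * c * b) refl
 ring122 = ring 3 (λ a b c -> (con 4 + a) * b + c := (con 2 + a) * b + (con 2 * b + c)) refl
 ring123 = ring 3 (λ a b c -> a * b * (c + c) := con 2 * a * (c * b)) refl
 ring124 = ring 4 (λ a b c d -> con 2 * a * (con 4 * b + c * d + c) := con 8 * a * b + con 2 * a * (con 1 + d) * c) refl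
 ring125 = ring 2 (λ a b -> a * b + b * a := b * (a + a)) refl
 ring126 = ring 3 (λ a b c -> a * (con 1 + (b * c)) + c * a := a * (con 1 + ((con 1 + b) * c))) refl
 ring127 = ring 3 (λ a b c -> a * (b * (con 1 + ((con 1 + a) * c))) := (a * (con 1 + a) * c + a) * b) refl
 ring128 = ring 3 (λ a b c -> (a * (con 1 + a) * b + (con 1 + a)) * c := (con 1 + a) * c * (con 1 + (a * b))) refl
 ring129 = ring 4 (λ a b c d -> a * b * (c * d) := a * (c * b * d)) refl
 ring130 = ring 4 (λ a b c d -> a * b * (c * d) := b * c * (a * d)) refl
 ring131 = ring 4 (λ a b c d -> a * b * (c * d) := b * c * a * d) refl
 ring132 = ring 4 (λ a b c d -> a * (b * c) * d := b * (a * d * c)) refl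
 ring133 = ring 5 (λ a b c d e -> a * (b * c + d * e) := b * a * c + a * d * e) refl
 ring134 = ring 5 (λ a b c d e -> a * (b * c) * d + e * c := (a * b * d + e) * c) refl
 ring135 = ring 4 (λ a b c d -> a + (b + c + d) := a + b + c + d) refl
 ring136 = ring 1 (λ a -> (con 1 + (con 4 * (con 4 + a))) + (con 16 * a + con 20 * a * a + con 20 * a + con 3) := (con 1 + a) * (con 1 + a) * con 20) refl
 ring137 = ring 4 (λ a b c d -> a * ((con 4 + b) * c + (con 2 + b) * d) * (con 2 + b) := (con 4 + b) * ((con 2 + b) * a * c) + (con 2 + b) * a * ((con 2 + b) * d)) refl
 ring138 = ring 4 (λ a b c d -> (con 4 + a) * (con 36 * b + (con 2 + a) * c) + (con 2 + a) * c * ((con 2 + a) * d) := (con 4 + a) * (con 36 * b) + c * (con 4 + a + (con 2 + a) * d) * (con 2 + a)) refl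
 ring139 = ring 2 (λ a b -> (con 4 + a + a) * (con 36 * b) := con 72 * b * (con 2 + a)) refl
 ring140 = ring 5 (λ a b c d e -> a * b * (con 72 * c + d * e) := a * c * (con 72 * b) + a * b * e * d) refl
 ring141 = ring 3 (λ a b c -> a * (con 5 * b) + c * b := (con 5 * a + c) * b) refl
 ring142 = ring 2 (λ a b -> con 72 * a + (con 8 + con 40 * b) * a := con 5 * ((con 1 + ((con 1 + b))) * (con 8 * a))) refl
 ring143 = ring 6 (λ a b c d e f -> a * (b + (con 1 + (c * (con 2 * d) + e * f))) := a * b + (con 2 * (c * a * d) + e * a * f + a)) refl
 ring144 = ring 5 (λ a b c d e -> a + b + (con 2 * c + (con 5 * c + d) + e) := a + (con 7 * c + (b + (d + e)))) refl
 ring145 = ring 6 (λ a b c d e f -> a + (con 7 * (b + c) + (d + (e + f))) := a + (con 7 * b + (d + (con 7 * c + e + f)))) refl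
 ring146 = ring 3 (λ a b c -> a * b * c + (con 7 * c + c) := a * b * c + con 1 * (con 8 * c)) refl
 ring147 = ring 3 (λ a b c -> a * (con 3 + b) * c + a * (con 8 * c) := a * (con 11 + b) * c) refl
 ring148 = ring 3 (λ a b c -> a * b + a * (c * b) := a * (con 1 + c) * b) refl
 ring149 = ring 1 (λ a -> con 1 * (a + con 1) := con 1 * con 1 * (con 1 + a)) refl
 ring150 = ring 1 (λ a -> con 2 * (a + a) + con 4 := con 2 * con 2 * (con 1 + a)) refl
 ring151 = ring 3 (λ a b c -> (a + a) * b * c := a * b * (con 2 * c)) refl
 ring152 = ring 4 (λ a b c d -> a * b * (c * d * b) := a * b * (d * (c * b))) refl
 ring153 = ring 2 (λ a b -> (con 1 + a) * a * b := a * ((con 1 + a) * b)) refl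
 ring154 = ring 3 (λ a b c -> a * (b + con 47 * c) := a * b + a * con 47 * c) refl
 ring155 = ring 1 (λ a -> con 2 * con 2 * a * con 47 := con 188 * a) refl
 ring156 = ring 2 (λ a b -> a * (b * b * b) + b * (b * b) := (con 1 + a) * (b * b * b)) refl
 ring157 = ring 1 (λ a -> (con 11 + (con 1 + a)) * ((con 1 + ((con 1 + a))) * (con 1 + ((con 1 + a)))) + (con 34 * a * a + con 45 * a) := (con 1 + a) * (con 1 + a) * (con 1 + a) + con 47 * ((con 1 + a) * (con 1 + a))) refl
 ring158 = ring 4 (λ a b c d -> a * ((con 1 + b) * b * (con 1 + c)) * d * (b * b * c * b) := b * b * c * a * ((con 1 + b) * b * d * (b * (con 1 + c)))) refl
 ring159 = ring 5 (λ a b c d e -> a * (con 11 + b) * c * ((con 1 + b) * b * d * ((con 1 + b) * e)) := a * d * ((con 11 + b) * ((con 1 + b) * (con 1 + b))) * (b * e * c)) refl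
 ring160 = ring 4 (λ a b c d -> a * (b * b * b) * (b * c * d) := d * a * b * (b * b * c * b)) refl

open Identities public

open import Data.Nat using (_+_; _*_; _∸_; _^_; _≤_; _<_; z≤n; s≤s; _⊔_; _⊓_; pred; _≤?_; _<?_)

module _ (em : ∀ {ℓ} -> ExcludedMiddle ℓ) where

 -- Classical logic, finite sums and products, counting in lists.

 module Classical where

  private variable
   a b p q : Level
   A : Set a
   B : Set b

  dec : (P : Set p) -> Dec P
  dec P = em {P = P}

  byContra : {P : Set p} -> ¬ ¬ P -> P
  byContra {P = P} nn with dec P
  ... | yes x = x
  ... | no n = ⊥-elim (nn n)

  -- Case analysis that does not abstract over the goal.
  cases : ∀ {q} (P : Set p) {Q : Set q} -> (P -> Q) -> (¬ P -> Q) -> Q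
  cases P f g with dec P
  ... | yes x = f x
  ... | no n = g n

  casesB : ∀ {q} {Q : Set q} (b : Bool) -> (b ≡ true -> Q) -> (b ≡ false -> Q) -> Q
  casesB true f g = f refl
  casesB false f g = g refl

  casesN : ∀ {q} {Q : Set q} (n : ℕ) -> (n ≡ 0 -> Q) -> (∀ m -> n ≡ suc m -> Q) -> Q
  casesN zero f g = f refl
  casesN (suc m) f g = g m refl

  ¬∀⇒∃¬ : {P : A -> Set p} -> ¬ (∀ x -> P x) -> ∃[ x ] ¬ P x
  ¬∀⇒∃¬ {P = P} n with dec (∃[ x ] ¬ P x)
  ... | yes e = e
  ... | no ne = ⊥-elim (n λ x -> byContra λ np -> ne (x , np))

  -- The Iverson bracket. Counts and unnormalised probabilities are sums of these, so that all
  -- estimates take place in ℕ.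
  ⟦_⟧ : Set p -> ℕ
  ⟦ P ⟧ with dec P
  ... | yes _ = 1
  ... | no _ = 0

  ⟦⟧-yes : {P : Set p} -> P -> ⟦ P ⟧ ≡ 1
  ⟦⟧-yes {P = P} x with dec P
  ... | yes _ = refl
  ... | no n = ⊥-elim (n x)

  ⟦⟧-no : {P : Set p} -> ¬ P -> ⟦ P ⟧ ≡ 0
  ⟦⟧-no {P = P} n with dec P
  ... | yes x = ⊥-elim (n x)
  ... | no _ = refl

  ⟦⟧≤1 : (P : Set p) -> ⟦ P ⟧ ≤ 1
  ⟦⟧≤1 P with dec P
  ... | yes _ = ≤-refl
  ... | no _ = z≤n

  ⟦⟧-holds : {P : Set p} -> 1 ≤ ⟦ P ⟧ -> P
  ⟦⟧-holds {P = P} h with dec P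
  ... | yes x = x

  ⟦⟧-≡1 : {P : Set p} -> ⟦ P ⟧ ≡ 1 -> P
  ⟦⟧-≡1 e = ⟦⟧-holds (from≡ (sym e))

  yes* : {P : Set p} {n : ℕ} -> P -> ⟦ P ⟧ * n ≡ n
  yes* {n = n} x = cong (_* n) (⟦⟧-yes x) ∙ *-identityˡ n

  no* : {P : Set p} {n : ℕ} -> ¬ P -> ⟦ P ⟧ * n ≡ 0
  no* {n = n} x = cong (_* n) (⟦⟧-no x)

  pick2 : {P : Set p} {m n : ℕ} -> P -> ⟦ P ⟧ * m + ⟦ ¬ P ⟧ * n ≡ m
  pick2 x = cong₂ _+_ (yes* x) (no* λ n -> n x) ∙ +-identityʳ _

  pick2' : {P : Set p} {m n : ℕ} -> ¬ P -> ⟦ P ⟧ * m + ⟦ ¬ P ⟧ * n ≡ n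
  pick2' x = cong₂ _+_ (no* x) (yes* x)

  ⟦⟧-mono : {P : Set p} {Q : Set q} -> (P -> Q) -> ⟦ P ⟧ ≤ ⟦ Q ⟧
  ⟦⟧-mono {P = P} {Q = Q} f with dec P
  ... | yes x = from≡ (sym (⟦⟧-yes (f x)))
  ... | no _ = z≤n

  ⟦⟧-cong : {P : Set p} {Q : Set q} -> (P -> Q) -> (Q -> P) -> ⟦ P ⟧ ≡ ⟦ Q ⟧
  ⟦⟧-cong {P = P} f g with dec P
  ... | yes x = sym (⟦⟧-yes (f x))
  ... | no n = sym (⟦⟧-no (n ∘ g))

  least : (P : ℕ -> Set p) -> ∀ n -> P n -> ∃[ k ] P k × (∀ j -> P j -> k ≤ j) × k ≤ n
  least P = <-rec _ step
   where
   step : ∀ n -> (∀ {m} -> m < n -> P m -> ∃[ k ] P k × (∀ j -> P j -> k ≤ j) × k ≤ m) ->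
    P n -> ∃[ k ] P k × (∀ j -> P j -> k ≤ j) × k ≤ n
   step n rec pn with dec (∃[ m ] m < n × P m)
   ... | yes (m , m<n , pm) with rec m<n pm
   ...   | k , pk , lk , k≤m = k , pk , lk , k≤m » <⇒≤ m<n
   step n rec pn | no none = n , pn , (λ j pj -> ≮⇒≥ λ j<n -> none (j , j<n , pj)) , ≤-refl

  ∑ : List A -> (A -> ℕ) -> ℕ
  ∑ [] f = 0
  ∑ (x ∷ xs) f = f x + ∑ xs f

  ∏ : List A -> (A -> ℕ) -> ℕ
  ∏ [] f = 1
  ∏ (x ∷ xs) f = f x * ∏ xs f

  module _ {A : Set a} where

   ∑-cong∈ : ∀ (xs : List A) {f g} -> (∀ x -> x ∈ xs -> f x ≡ g x) -> ∑ xs f ≡ ∑ xs g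
   ∑-cong∈ [] h = refl
   ∑-cong∈ (x ∷ xs) h = cong₂ _+_ (h x (here refl)) (∑-cong∈ xs λ y m -> h y (there m))

   ∑-cong : ∀ (xs : List A) {f g} -> (∀ x -> f x ≡ g x) -> ∑ xs f ≡ ∑ xs g
   ∑-cong xs h = ∑-cong∈ xs λ x _ -> h x

   ∑-mono∈ : ∀ (xs : List A) {f g} -> (∀ x -> x ∈ xs -> f x ≤ g x) -> ∑ xs f ≤ ∑ xs g
   ∑-mono∈ [] h = z≤n
   ∑-mono∈ (x ∷ xs) h = +≤ (h x (here refl)) (∑-mono∈ xs λ y m -> h y (there m))

   ∑-mono : ∀ (xs : List A) {f g} -> (∀ x -> f x ≤ g x) -> ∑ xs f ≤ ∑ xs g
   ∑-mono xs h = ∑-mono∈ xs λ x _ -> h x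

   ∑-zero : ∀ (xs : List A) {f} -> (∀ x -> x ∈ xs -> f x ≡ 0) -> ∑ xs f ≡ 0
   ∑-zero [] h = refl
   ∑-zero (x ∷ xs) h = cong₂ _+_ (h x (here refl)) (∑-zero xs λ y m -> h y (there m))

   ∑-+ : ∀ (xs : List A) f g -> ∑ xs (λ x -> f x + g x) ≡ ∑ xs f + ∑ xs g
   ∑-+ [] f g = refl
   ∑-+ (x ∷ xs) f g = cong (f x + g x +_) (∑-+ xs f g) ∙ ring1 (f x) (g x) (∑ xs f) (∑ xs g)

   ∑-*ˡ : ∀ (xs : List A) c f -> ∑ xs (λ x -> c * f x) ≡ c * ∑ xs f
   ∑-*ˡ [] c f = sym (*-zeroʳ c)
   ∑-*ˡ (x ∷ xs) c f = cong (c * f x +_) (∑-*ˡ xs c f) ∙ sym (*-distribˡ-+ c (f x) _)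

   ∑-*ʳ : ∀ (xs : List A) f c -> ∑ xs (λ x -> f x * c) ≡ ∑ xs f * c
   ∑-*ʳ [] f c = refl
   ∑-*ʳ (x ∷ xs) f c = cong (f x * c +_) (∑-*ʳ xs f c) ∙ sym (*-distribʳ-+ c (f x) _)

   ∑-const : ∀ (xs : List A) c -> ∑ xs (λ _ -> c) ≡ length xs * c
   ∑-const [] c = refl
   ∑-const (x ∷ xs) c = cong (c +_) (∑-const xs c)

   ∑-≤const : ∀ (xs : List A) {f} c -> (∀ x -> x ∈ xs -> f x ≤ c) -> ∑ xs f ≤ length xs * c
   ∑-≤const xs c h = ∑-mono∈ xs h » from≡ (∑-const xs c)

   ∑-++ : ∀ (xs ys : List A) f -> ∑ (xs ++ ys) f ≡ ∑ xs f + ∑ ys f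
   ∑-++ [] ys f = refl
   ∑-++ (x ∷ xs) ys f = cong (f x +_) (∑-++ xs ys f) ∙ sym (+-assoc (f x) _ _)

   ∑-member : ∀ (xs : List A) f {x} -> x ∈ xs -> f x ≤ ∑ xs f
   ∑-member (x ∷ xs) f (here refl) = m≤m+n _ _
   ∑-member (x ∷ xs) f (there m) = ∑-member xs f m » m≤n+m _ _

   ∏-cong∈ : ∀ (xs : List A) {f g} -> (∀ x -> x ∈ xs -> f x ≡ g x) -> ∏ xs f ≡ ∏ xs g
   ∏-cong∈ [] h = refl
   ∏-cong∈ (x ∷ xs) h = cong₂ _*_ (h x (here refl)) (∏-cong∈ xs λ y m -> h y (there m))

   ∏-mono∈ : ∀ (xs : List A) {f g} -> (∀ x -> x ∈ xs -> f x ≤ g x) -> ∏ xs f ≤ ∏ xs g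
   ∏-mono∈ [] h = ≤-refl
   ∏-mono∈ (x ∷ xs) h = *≤ (h x (here refl)) (∏-mono∈ xs λ y m -> h y (there m))

   ∏-const : ∀ (xs : List A) c -> ∏ xs (λ _ -> c) ≡ c ^ length xs
   ∏-const [] c = refl
   ∏-const (x ∷ xs) c = cong (c *_) (∏-const xs c)

   ∏-* : ∀ (xs : List A) f g -> ∏ xs (λ x -> f x * g x) ≡ ∏ xs f * ∏ xs g
   ∏-* [] f g = refl
   ∏-* (x ∷ xs) f g = cong (f x * g x *_) (∏-* xs f g) ∙ *-interchange (f x) (g x) (∏ xs f) (∏ xs g)

  ∑-swap : ∀ (xs : List A) (ys : List B) (f : A -> B -> ℕ) -> ∑ xs (λ x -> ∑ ys (f x)) ≡ ∑ ys (λ y -> ∑ xs λ x -> f x y)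
  ∑-swap [] ys f = sym (∑-zero ys λ _ _ -> refl)
  ∑-swap (x ∷ xs) ys f = cong (∑ ys (f x) +_) (∑-swap xs ys f) ∙ sym (∑-+ ys (f x) _)

  ∑-map : ∀ (h : A -> B) xs f -> ∑ (map h xs) f ≡ ∑ xs (f ∘ h)
  ∑-map h [] f = refl
  ∑-map h (x ∷ xs) f = cong (f (h x) +_) (∑-map h xs f)

  ∏-map : ∀ (h : A -> B) xs f -> ∏ (map h xs) f ≡ ∏ xs (f ∘ h)
  ∏-map h [] f = refl
  ∏-map h (x ∷ xs) f = cong (f (h x) *_) (∏-map h xs f)

  sel : {A : Set a} -> (A -> Set p) -> List A -> List A
  sel P = filter λ x -> dec (P x)

  module _ {A : Set a} {P : A -> Set p} where

   sel⊆ : ∀ (xs : List A) {x} -> x ∈ sel P xs -> x ∈ xs × P x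
   sel⊆ xs = Mem.∈-filter⁻ _ {xs = xs}

   ∈sel : ∀ (xs : List A) {x} -> x ∈ xs -> P x -> x ∈ sel P xs
   ∈sel xs = Mem.∈-filter⁺ _

   sel-unique : ∀ {xs} -> Unique xs -> Unique (sel P xs)
   sel-unique = Uniq.filter⁺ _

   sel-length : ∀ xs -> length (sel P xs) ≡ ∑ xs (λ x -> ⟦ P x ⟧)
   sel-length [] = refl
   sel-length (x ∷ xs) with dec (P x)
   ... | yes _ = cong suc (sel-length xs)
   ... | no _ = sel-length xs

   ∏-sel : ∀ xs f -> ∏ xs f ≡ ∏ (sel P xs) f * ∏ (sel (λ x -> ¬ P x) xs) f
   ∏-sel [] f = refl
   ∏-sel (x ∷ xs) f with dec (P x) | dec (¬ P x)
   ... | yes px | yes np = ⊥-elim (np px)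
   ... | yes px | no _ = cong (f x *_) (∏-sel xs f) ∙ sym (*-assoc (f x) _ _)
   ... | no np | yes _ = cong (f x *_) (∏-sel xs f) ∙ x∙yz≈y∙xz (f x) (∏ (sel P xs) f) _
   ... | no np | no nnp = ⊥-elim (nnp np)

  sel-¬-< : ∀ {A : Set a} {P : A -> Set p} (xs : List A) {x} -> x ∈ xs -> P x -> length (sel (λ y -> ¬ P y) xs) < length xs
  sel-¬-< xs x∈ px = List.filter-notAll _ xs (ListAny.map (λ { refl np -> np px }) x∈)

  All-tab : ∀ {A : Set a} {P : A -> Set p} (xs : List A) -> (∀ x -> x ∈ xs -> P x) -> All P xs
  All-tab xs h = ListAll.tabulate (h _)

  dedup : {A : Set a} -> List A -> List A
  dedup = List.deduplicate λ x y -> dec (x ≡ y)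

  ∈dedup : ∀ {A : Set a} (xs : List A) {x} -> x ∈ xs -> x ∈ dedup xs
  ∈dedup xs = Mem.∈-deduplicate⁺ _

  dedup⊆ : ∀ {A : Set a} (xs : List A) {x} -> x ∈ dedup xs -> x ∈ xs
  dedup⊆ xs = Mem.∈-deduplicate⁻ _ xs

  dedup-unique : ∀ {A : Set a} (xs : List A) -> Unique (dedup xs)
  dedup-unique = Dedup.deduplicate-! λ x y -> dec (x ≡ y)

  remove : {A : Set a} (xs : List A) {x : A} -> x ∈ xs -> List A
  remove (x ∷ xs) (here _) = xs
  remove (x ∷ xs) (there m) = x ∷ remove xs m

  length-remove : ∀ {A : Set a} (xs : List A) {x : A} (m : x ∈ xs) -> length xs ≡ suc (length (remove xs m))
  length-remove (x ∷ xs) (here _) = refl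
  length-remove (x ∷ xs) (there m) = cong suc (length-remove xs m)

  ∈-remove : ∀ {A : Set a} (xs : List A) {x y : A} (m : x ∈ xs) -> y ∈ xs -> y ≢ x -> y ∈ remove xs m
  ∈-remove (x ∷ xs) (here refl) (here refl) ne = ⊥-elim (ne refl)
  ∈-remove (x ∷ xs) (here refl) (there m') ne = m'
  ∈-remove (x ∷ xs) (there m) (here refl) ne = here refl
  ∈-remove (x ∷ xs) (there m) (there m') ne = there (∈-remove xs m m' ne)

  unique-length : ∀ {A : Set a} {xs ys : List A} -> Unique xs -> (∀ {x} -> x ∈ xs -> x ∈ ys) -> length xs ≤ length ys
  unique-length [] h = z≤n
  unique-length {xs = x ∷ xs} {ys} (nx ∷ u) h = subst (suc (length xs) ≤_) (sym (length-remove ys (h (here refl))))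
   (s≤s (unique-length u λ m -> ∈-remove ys (h (here refl)) (h (there m)) λ { refl -> All-∈ nx m refl }))

  ∑-sel : ∀ {A : Set a} {P : A -> Set p} (xs : List A) f -> ∑ (sel P xs) f ≡ ∑ xs (λ x -> ⟦ P x ⟧ * f x)
  ∑-sel [] f = refl
  ∑-sel {P = P} (x ∷ xs) f with dec (P x)
  ... | yes _ = cong₂ _+_ (sym (+-identityʳ (f x))) (∑-sel xs f)
  ... | no _ = ∑-sel xs f

  pow-++ : ∀ {A : Set a} k (xs ys : List A) -> k ^ length xs * k ^ length ys ≡ k ^ length (xs ++ ys)
  pow-++ k xs ys = sym (^-distribˡ-+-* k (length xs) _) ∙ cong (k ^_) (sym (length-++ xs))

  pow-concatMap : ∀ {A : Set a} {B : Set b} k (f : A -> List B) xs -> ∏ xs (λ x -> k ^ length (f x)) ≡ k ^ length (concatMap f xs)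
  pow-concatMap k f [] = refl
  pow-concatMap k f (x ∷ xs) = cong (k ^ length (f x) *_) (pow-concatMap k f xs) ∙ pow-++ k (f x) _

  seqs : {A : Set a} -> List A -> ℕ -> List (List A)
  seqs xs zero = [] ∷ []
  seqs xs (suc n) = concatMap (λ x -> map (x ∷_) (seqs xs n)) xs

  pairs∈ : ∀ {A : Set} {R : A -> A -> Set} (l : List A) -> Unique l -> (∀ i j -> i ∈ l -> j ∈ l -> i ≢ j -> R i j) -> AllPairs R l
  pairs∈ [] u h = []
  pairs∈ (x ∷ l) (nx ∷ u) h = All-tab l (λ y m -> h x y (here refl) (there m) (All-∈ nx m)) ∷ pairs∈ l u λ i j i∈ j∈ -> h i j (there i∈) (there j∈)

 open Classical

 -- Polish metrics through dyadic neighbourhoods.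

 module PolishSpaces where
  open import Data.Integer using (+_)
  open import Defs

  private
   -- `suc (p n)` is 2ⁿ in the form that a denominator needs, so `slack n` is 2⁻ⁿ.
   p : ℕ -> ℕ
   p zero = 0
   p (suc n) = suc (p n + p n)

   n≤p : ∀ n -> n ≤ p n
   n≤p zero = z≤n
   n≤p (suc n) = s≤s (n≤p n » m≤m+n _ _)

  abstract
   slack : ℕ -> ℚ
   slack n = + 1 / suc (p n)

   δ-pos : ∀ n -> 0ℚ ℚ.< slack n
   δ-pos n = ℚ.positive⁻¹ (slack n) {{ℚ.normalize-pos 1 (suc (p n))}}

   δ-half : ∀ n -> slack (suc n) ℚ.+ slack (suc n) ≡ slack n
   δ-half n = frac-+1 1 (p (suc n)) ∙ (ℚ.≤-antisym
    (frac-≤ 2 (p (suc n)) 1 (p n) (from≡ (ring14 (p n)))) (frac-≤ 1 (p n) 2 (p (suc n)) (from≡ (sym (ring14 (p n))))))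

   δ-small : ∀ ε -> 0ℚ ℚ.< ε -> ∃[ n ] slack n ℚ.≤ ε
   δ-small ε 0<ε = let (N , le) = archimedean ε 0<ε in
    N , frac-≤ 1 (p N) 1 N (*≤ʳ 1 (s≤s (n≤p N))) ⟫ le

  δ-mono : ∀ n -> slack (suc n) ℚ.≤ slack n
  δ-mono n = ℚ.≤-reflexive (sym (ℚ.+-identityʳ _)) ⟫ ℚ.+-monoʳ-≤ (slack (suc n)) (ℚ.<⇒≤ (δ-pos (suc n))) ⟫ ℚ.≤-reflexive (δ-half n)

  private
   half : ∀ ε -> 0ℚ ℚ.< ε -> ∃[ η ] 0ℚ ℚ.< η × η ℚ.+ η ℚ.≤ ε
   half ε 0<ε = let (n , le) = δ-small ε 0<ε in slack (suc n) , δ-pos (suc n) , ℚ.≤-reflexive (δ-half n) ⟫ le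

  ≤<-trans : ∀ {x y z} -> x ≤ℝ y -> y <ℝ z -> x <ℝ z
  ≤<-trans {x} {y} {z} xy (ε , 0<ε , N , h) = let (η , 0<η , le) = half ε 0<ε ; (M , g) = xy η 0<η in
   η , 0<η , N ⊔ M , λ n n≥ -> begin
    _ ≤⟨ ℚ.+-monoˡ-≤ η (g n (m≤n⊔m N M » n≥)) ⟩
    _ ≡⟨ ℚ.+-assoc (seq y n) η η ⟩
    _ ≤⟨ ℚ.+-monoʳ-≤ (seq y n) le ⟩
    _ ≤⟨ h n (m≤m⊔n N M » n≥) ⟩
    seq z n ∎
   where open ℚ.≤-Reasoning

  <-mono-δ : ∀ {x p q} -> x <ℝ fromℚ p -> p ℚ.≤ q -> x <ℝ fromℚ q
  <-mono-δ (ε , 0<ε , N , h) le = ε , 0<ε , N , λ n n≥ -> h n n≥ ⟫ le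

  +-<-δ : ∀ {x y} n -> x <ℝ fromℚ (slack (suc n)) -> y <ℝ fromℚ (slack (suc n)) -> (x +ℝ y) <ℝ fromℚ (slack n)
  +-<-δ {x} {y} n (ε , 0<ε , N , h) (η , 0<η , M , g) = ε , 0<ε , N ⊔ M , λ m m≥ -> begin
    _ ≡⟨ lem (seq x m) (seq y m) ε ⟩
    _ ≤⟨ ℚ.+-mono-≤ (h m (m≤m⊔n N M » m≥)) (≤y m (g m (m≤n⊔m N M » m≥))) ⟩
    _ ≡⟨ δ-half n ⟩
    slack n ∎
   where
   open ℚ.≤-Reasoning
   open +-*-Solver
   lem : ∀ a b c -> a ℚ.+ b ℚ.+ c ≡ a ℚ.+ c ℚ.+ b
   lem = solve 3 (λ a b c -> a :+ b :+ c := a :+ c :+ b) refl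
   ≤y : ∀ m -> seq y m ℚ.+ η ℚ.≤ slack (suc n) -> seq y m ℚ.≤ slack (suc n)
   ≤y m le = (ℚ.≤-reflexive (sym (ℚ.+-identityʳ _)) ⟫ ℚ.+-monoʳ-≤ (seq y m) (ℚ.<⇒≤ 0<η)) ⟫ le

  0<δ : ∀ n -> 0ℝ <ℝ fromℚ (slack n)
  0<δ n = slack n , δ-pos n , 0 , λ _ _ -> ℚ.≤-reflexive (ℚ.+-identityˡ (slack n))

  -- A metric seen through the entourages d < 2⁻ⁿ.
  record Space (X : Set) (d : X -> X -> ℝ) : Set₁ where
   Near : ℕ -> X -> X -> Set
   Near n x y = d x y <ℝ fromℚ (slack n)
   field
    n-refl : ∀ n x -> Near n x x
    n-sym : ∀ {n x y} -> Near n x y -> Near n y x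
    n-tri : ∀ {n x y z} -> Near (suc n) x y -> Near (suc n) y z -> Near n x z
    n-mono : ∀ {n x y} -> Near (suc n) x y -> Near n x y
    n-open : ∀ {n x y} -> Near n x y -> ∃[ m ] ∀ z -> Near m y z -> Near n x z
    n-eq : ∀ {x y} -> (∀ n -> Near n x y) -> x ≡ y
    -- The index is shifted by two, once for the sum of the tail and once for the passage to the
    -- limit; each costs a factor 2 through `n-tri`.
    n-complete : ∀ (s : ℕ -> X) -> (∀ n -> Near n (s n) (s (suc n))) -> Σ[ x ∈ X ] ∀ n -> Near n (s (suc (suc n))) x
    pts : ℕ -> X
    dense : ∀ x n -> ∃[ i ] Near n x (pts i)
    open⇒near : ∀ {U} -> IsOpen d U -> ∀ x -> U x -> ∃[ n ] ∀ y -> Near n x y -> U y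
    near⇒open : ∀ {U} -> (∀ x -> U x -> ∃[ n ] ∀ y -> Near n x y -> U y) -> IsOpen d U

  space : ∀ {X : Set} {𝔅 : Pred (Pred X 0ℓ) (lsuc 0ℓ)} {d : X -> X -> ℝ} -> IsPolish 𝔅 d -> X -> Space X d
  space {X} {𝔅} {d} polish x₀ = record
   { n-refl = n-refl ; n-sym = n-sym ; n-tri = λ {n} -> n-tri {n} ; n-mono = λ {n} -> n-mono {n} ; n-open = λ {n} -> n-open {n} ; n-eq = n-eq ; n-complete = n-complete
   ; pts = pts ; dense = dense
   ; open⇒near = λ {U} o x u -> let (r , 0<r , h) = o x u ; (n , f) = below r 0<r in n , λ y ny -> h y (f (d x y) ny)
   ; near⇒open = λ {U} h x u -> let (n , f) = h x u in fromℚ (slack n) , 0<δ n , f }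
   where
   open IsPolish polish
   open IsGeneralMetric isMetric using (nonNegative; ≈⇒0; 0⇒≈; triangle) renaming (sym to d-sym)
   Near : ℕ -> X -> X -> Set
   Near n x y = d x y <ℝ fromℚ (slack n)
   n-refl : ∀ n x -> Near n x x
   n-refl n x = ≤<-trans {d x x} {0ℝ} {fromℚ (slack n)} (fst (≈⇒0 refl)) (0<δ n)
   n-sym : ∀ {n x y} -> Near n x y -> Near n y x
   n-sym {n} {x} {y} h = ≤<-trans {d y x} {d x y} {fromℚ (slack n)} (fst (d-sym y x)) h
   n-tri : ∀ {n x y z} -> Near (suc n) x y -> Near (suc n) y z -> Near n x z
   n-tri {n} {x} {y} {z} h g = ≤<-trans {d x z} {d x y +ℝ d y z} {fromℚ (slack n)} (triangle x y z) (+-<-δ {d x y} {d y z} n h g)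
   n-mono : ∀ {n x y} -> Near (suc n) x y -> Near n x y
   n-mono {n} {x} {y} h = <-mono-δ {d x y} {slack (suc n)} {slack n} h (δ-mono n)
   n-open : ∀ {n x y} -> Near n x y -> ∃[ m ] ∀ z -> Near m y z -> Near n x z
   n-open {n} {x} {y} (ε , 0<ε , N , h) = let (η , 0<η , le) = half ε 0<ε ; (m , le') = δ-small η 0<η in
    m , λ z (ζ , 0<ζ , M , g) -> ≤<-trans {d x z} {d x y +ℝ d y z} {fromℚ (slack n)} (triangle x y z) (η , 0<η , N ⊔ M , λ i i≥ -> sum η ε ζ (slack m) (seq (d x y) i) (seq (d y z) i) le le' (ℚ.<⇒≤ 0<ζ) (h i (m≤m⊔n N M » i≥)) (g i (m≤n⊔m N M » i≥)))
    where
    sum : ∀ η ε ζ δm a b -> η ℚ.+ η ℚ.≤ ε -> δm ℚ.≤ η -> 0ℚ ℚ.≤ ζ -> a ℚ.+ ε ℚ.≤ slack n -> b ℚ.+ ζ ℚ.≤ δm -> a ℚ.+ b ℚ.+ η ℚ.≤ slack n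
    sum η ε ζ δm a b le le' 0≤ζ p q = begin
     _ ≤⟨ ℚ.+-monoˡ-≤ η (ℚ.+-monoʳ-≤ a (ℚ.≤-reflexive (sym (ℚ.+-identityʳ b)) ⟫ ℚ.+-monoʳ-≤ b 0≤ζ ⟫ q ⟫ le')) ⟩
     _ ≡⟨ ℚ.+-assoc a η η ⟩
     _ ≤⟨ ℚ.+-monoʳ-≤ a le ⟩
     _ ≤⟨ p ⟩
     slack n ∎
     where open ℚ.≤-Reasoning
   n-eq : ∀ {x y} -> (∀ n -> Near n x y) -> x ≡ y
   n-eq {x} {y} h = 0⇒≈ (below0 , nonNegative {x} {y})
    where
    below0 : d x y ≤ℝ 0ℝ
    below0 ε 0<ε = let (n , le) = δ-small ε 0<ε ; (η , 0<η , N , f) = h n in N , λ m m≥ -> (ℚ.≤-reflexive (sym (ℚ.+-identityʳ _)) ⟫ ℚ.+-monoʳ-≤ (seq (d x y) m) (ℚ.<⇒≤ 0<η))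
     ⟫ f m m≥ ⟫ le ⟫ ℚ.≤-reflexive (sym (ℚ.+-identityˡ ε))
   below : ∀ r -> 0ℝ <ℝ r -> ∃[ n ] ∀ x -> x <ℝ fromℚ (slack n) -> x <ℝ r
   below r (ε , 0<ε , N , h) = let (n , le) = δ-small ε 0<ε in n , λ { x (η , 0<η , M , f) -> η , 0<η , N ⊔ M , λ m m≥ ->
    f m (m≤n⊔m N M » m≥) ⟫ le ⟫ ℚ.≤-reflexive (sym (ℚ.+-identityˡ ε)) ⟫ h m (m≤m⊔n N M » m≥) }
   n-complete : ∀ (s : ℕ -> X) -> (∀ n -> Near n (s n) (s (suc n))) -> Σ[ x ∈ X ] ∀ n -> Near n (s (suc (suc n))) x
   n-complete s h = x , λ n -> let (N , f) = lim (fromℚ (slack (suc n))) (0<δ (suc n)) in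
     n-tri {n} {s (suc (suc n))} {s (suc (suc n) + N)} {x} (tail (suc n) N) (f (suc (suc n) + N) (m≤n+m N (suc (suc n))))
    where
    tail : ∀ n j -> Near n (s (suc n)) (s (suc n + j))
    tail n zero = subst (λ k -> Near n (s (suc n)) (s (suc k))) (sym (+-identityʳ n)) (n-refl n (s (suc n)))
    tail n (suc j) = n-tri {n} {s (suc n)} {s (suc (suc n))} {s (suc n + suc j)} (h (suc n)) (subst (λ k -> Near (suc n) (s (suc (suc n))) (s (suc k))) (sym (+-suc n j)) (tail (suc n) j))
    after : ∀ n m -> suc n ≤ m -> Near n (s (suc n)) (s m)
    after n m le = subst (λ k -> Near n (s (suc n)) (s k)) (m+[n∸m]≡n le) (tail n (m ∸ suc n))
    limit = complete s λ ε 0<ε -> let (n , f) = below ε 0<ε in suc (suc n) , λ i j i≥ j≥ ->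
     f (d (s i) (s j)) (n-tri {n} {s i} {s (suc (suc n))} {s j} (n-sym {suc n} (after (suc n) i i≥)) (after (suc n) j j≥))
    x = fst limit
    lim = snd limit
   pts : ℕ -> X
   pts n with fst separable n
   ... | just y = y
   ... | nothing = x₀
   dense : ∀ x n -> ∃[ i ] Near n x (pts i)
   dense x n with snd separable x (fromℚ (slack n)) (0<δ n)
   ... | i , y , e , ny = i , subst (Near n x) (found i y e) ny
    where
    found : ∀ i y -> fst separable i ≡ just y -> y ≡ pts i
    found i y e with fst separable i | e
    ... | just y | refl = refl

 open ≤-Reasoning hiding (start; stop)

 open import Relation.Binary.Construct.Closure.ReflexiveTransitive using (Star; _◅_; _◅◅_) renaming (ε to nil)

 length-allFin : ∀ k -> length (allFin k) ≡ k
 length-allFin k = List.length-tabulate id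

 -- Unnormalised conditional expectations.

 module Prob {Z : Set} (k : ℕ) where

  Asg : Set
  Asg = Z -> Fin k

  Mask : Set
  Mask = Z -> Bool

  vals : List (Fin k)
  vals = allFin k

  upd : Z -> Fin k -> Asg -> Asg
  upd x a ω z with dec (z ≡ x)
  ... | yes _ = a
  ... | no _ = ω z

  upd-same : ∀ x a ω -> upd x a ω x ≡ a
  upd-same x a ω with dec (x ≡ x)
  ... | yes _ = refl
  ... | no n = ⊥-elim (n refl)

  upd-other : ∀ x a ω z -> z ≢ x -> upd x a ω z ≡ ω z
  upd-other x a ω z ne with dec (z ≡ x)
  ... | yes e = ⊥-elim (ne e)
  ... | no _ = refl

  upd-agree : ∀ x a ω ω' z -> (z ≢ x -> ω z ≡ ω' z) -> upd x a ω z ≡ upd x a ω' z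
  upd-agree x a ω ω' z h with dec (z ≡ x)
  ... | yes _ = refl
  ... | no ne = h ne

  upd-twice : ∀ x a b ω z -> upd x b (upd x a ω) z ≡ upd x b ω z
  upd-twice x a b ω z with dec (z ≡ x)
  ... | yes _ = refl
  ... | no ne = upd-other x a ω z ne

  upd-comm : ∀ x y a b ω -> x ≢ y -> ∀ z -> upd x a (upd y b ω) z ≡ upd y b (upd x a ω) z
  upd-comm x y a b ω ne z with dec (z ≡ x)
  ... | yes refl = sym (upd-other y b _ z ne ∙ upd-same z a ω)
  ... | no n = upd-agree y b ω (upd x a ω) z λ _ -> sym (upd-other x a ω z n)

  put : Mask -> Z -> Fin k -> Asg -> Asg
  put S x a ω = if S x then ω else upd x a ω

  none : Mask
  none _ = false

  -- The expectation times k ^ length xs. Masked variables keep their value but are summed over as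
  -- well, so the normalising factor is the same for every mask. A variable listed twice is merely
  -- resampled and contributes another factor k.
  E : Mask -> List Z -> (Asg -> ℕ) -> Asg -> ℕ
  E S [] G ω = G ω
  E S (x ∷ xs) G ω = ∑ vals λ a -> E S xs G (put S x a ω)

  DependsOn : (Z -> Set) -> (Asg -> ℕ) -> Set
  DependsOn D G = ∀ ω ω' -> (∀ z -> D z -> ω z ≡ ω' z) -> G ω ≡ G ω'

  Resp : (Asg -> ℕ) -> Set
  Resp = DependsOn (λ _ -> ⊤)

  dep⇒resp : ∀ {D G} -> DependsOn D G -> Resp G
  dep⇒resp d ω ω' h = d ω ω' λ z _ -> h z tt

  E-cong : ∀ S xs {G H} -> (∀ ω -> G ω ≡ H ω) -> ∀ ω -> E S xs G ω ≡ E S xs H ω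
  E-cong S [] h ω = h ω
  E-cong S (x ∷ xs) h ω = ∑-cong vals λ a -> E-cong S xs h _

  E-mono : ∀ S xs {G H} -> (∀ ω -> G ω ≤ H ω) -> ∀ ω -> E S xs G ω ≤ E S xs H ω
  E-mono S [] h ω = h ω
  E-mono S (x ∷ xs) h ω = ∑-mono vals λ a -> E-mono S xs h _

  E-+ : ∀ S xs G H ω -> E S xs (λ ω -> G ω + H ω) ω ≡ E S xs G ω + E S xs H ω
  E-+ S [] G H ω = refl
  E-+ S (x ∷ xs) G H ω = (∑-cong vals λ a -> E-+ S xs G H _) ∙ ∑-+ vals _ _

  E-*ˡ : ∀ S xs c G ω -> E S xs (λ ω -> c * G ω) ω ≡ c * E S xs G ω
  E-*ˡ S [] c G ω = refl
  E-*ˡ S (x ∷ xs) c G ω = (∑-cong vals λ a -> E-*ˡ S xs c G _) ∙ ∑-*ˡ vals c _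

  E-*ʳ : ∀ S xs G c ω -> E S xs (λ ω -> G ω * c) ω ≡ E S xs G ω * c
  E-*ʳ S xs G c ω = E-cong S xs (λ ω -> *-comm (G ω) c) ω ∙ E-*ˡ S xs c G ω ∙ *-comm c _

  E-∑ : ∀ {a} {I : Set a} S xs (is : List I) (G : I -> Asg -> ℕ) ω ->
   E S xs (λ ω -> ∑ is λ i -> G i ω) ω ≡ ∑ is λ i -> E S xs (G i) ω
  E-∑ S xs [] G ω = E-*ˡ S xs 0 (λ _ -> 0) ω ∙ refl
  E-∑ S xs (i ∷ is) G ω = E-+ S xs _ _ ω ∙ cong (E S xs (G i) ω +_) (E-∑ S xs is G ω)

  vals-const : ∀ c -> ∑ vals (λ _ -> c) ≡ k * c
  vals-const c = ∑-const vals c ∙ cong (_* c) (length-allFin k)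

  E-fixed : ∀ S xs G ω c -> (∀ ω' -> (∀ z -> z ∉ xs -> ω' z ≡ ω z) -> G ω' ≡ c) -> E S xs G ω ≡ k ^ length xs * c
  E-fixed S [] G ω c h = (h ω λ _ _ -> refl) ∙ sym (+-identityʳ c)
  E-fixed S (x ∷ xs) G ω c h = (∑-cong vals λ a -> E-fixed S xs G (put S x a ω) c λ ω' h' -> h ω' λ z z∉ ->
    h' z (z∉ ∘ there) ∙ puts a z (z∉ ∘ here))
   ∙ vals-const _ ∙ sym (*-assoc k _ c)
   where
   puts : ∀ a z -> z ≢ x -> put S x a ω z ≡ ω z
   puts a z ne with S x
   ... | true = refl
   ... | false = upd-other x a ω z ne

  E-const : ∀ S xs c ω -> E S xs (λ _ -> c) ω ≡ k ^ length xs * c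
  E-const S xs c ω = E-fixed S xs _ ω c λ _ _ -> refl

  E-null : ∀ S xs {f : Asg -> ℕ} -> (∀ ω -> f ω ≡ 0) -> ∀ ω -> E S xs f ω ≡ 0
  E-null S xs h ω = E-cong S xs h ω ∙ E-const S xs 0 ω ∙ *-zeroʳ (k ^ length xs)

  E-dep : ∀ {D G} -> DependsOn D G -> ∀ S xs ω ω' ->
   (∀ z -> D z -> S z ≡ true ⊎ z ∉ xs -> ω z ≡ ω' z) -> E S xs G ω ≡ E S xs G ω'
  E-dep d S [] ω ω' h = d ω ω' λ z dz -> h z dz (inj₂ λ ())
  E-dep {D} d S (x ∷ xs) ω ω' h = ∑-cong vals λ a -> E-dep d S xs _ _ λ z dz c -> agree a z dz c
   where
   agree : ∀ a z -> D z -> S z ≡ true ⊎ z ∉ xs -> put S x a ω z ≡ put S x a ω' z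
   agree a z dz c with S x in eq
   agree a z dz (inj₁ sz) | true = h z dz (inj₁ sz)
   agree a z dz (inj₂ z∉) | true with dec (z ≡ x)
   ... | yes refl = h z dz (inj₁ eq)
   ... | no ne = h z dz (inj₂ λ { (here e) -> ne e ; (there m) -> z∉ m })
   agree a z dz c | false = upd-agree x a ω ω' z λ ne -> h z dz (case c of λ
    { (inj₁ sz) -> inj₁ sz ; (inj₂ z∉) -> inj₂ λ { (here e) -> ne e ; (there m) -> z∉ m } })

  E-depends : ∀ {D G} -> DependsOn D G -> ∀ S xs -> DependsOn D (E S xs G)
  E-depends d S xs ω ω' h = E-dep d S xs ω ω' λ z dz _ -> h z dz

  E-mask : ∀ {S S'} xs -> (∀ z -> z ∈ xs -> S z ≡ S' z) -> ∀ G ω -> E S xs G ω ≡ E S' xs G ω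
  E-mask [] h G ω = refl
  E-mask {S} {S'} (x ∷ xs) h G ω with S x | S' x | h x (here refl)
  ... | s | _ | refl = ∑-cong vals λ a -> E-mask xs (λ z m -> h z (there m)) G _

  -- If x occurs in xs, it is resampled on both sides and the value given to it from outside is
  -- forgotten; otherwise the two sums commute.
  E-∑vals : ∀ {G} -> Resp G -> ∀ S xs x ω -> S x ≡ false ->
   ∑ vals (λ a -> E S xs G (upd x a ω)) ≡ E S xs (λ ω -> ∑ vals λ a -> G (upd x a ω)) ω
  E-∑vals r S [] x ω sx = refl
  E-∑vals {G} r S (y ∷ xs) x ω sx with dec (y ≡ x)
  ... | yes refl rewrite sx = (∑-cong vals λ a -> (∑-cong vals λ b -> E-depends r S xs _ _ λ z _ -> upd-twice y a b ω z)
      ∙ E-∑vals r S xs y ω sx)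
     ∙ (∑-cong vals λ b -> E-dep r' S xs _ _ λ z ne _ -> sym (upd-other y b ω z ne))
   where
   r' : DependsOn (_≢ y) (λ ω -> ∑ vals λ a -> G (upd y a ω))
   r' ω₁ ω₂ h = ∑-cong vals λ a -> r _ _ λ z _ -> upd-agree y a ω₁ ω₂ z (h z)
  ... | no ne = ∑-swap vals vals _ ∙ (∑-cong vals λ b -> (∑-cong vals λ a -> E-depends r S xs _ _ λ z _ -> put-comm a b z)
      ∙ E-∑vals r S xs x (put S y b ω) sx)
   where
   put-comm : ∀ a b z -> put S y b (upd x a ω) z ≡ upd x a (put S y b ω) z
   put-comm a b z with S y
   ... | true = refl
   ... | false = upd-comm y x b a ω ne z

  E-blind : ∀ S xs G ω c -> (∀ ω' -> (∀ z -> S z ≡ true ⊎ z ∉ xs -> ω' z ≡ ω z) -> G ω' ≡ c) -> E S xs G ω ≡ k ^ length xs * c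
  E-blind S [] G ω c h = (h ω λ _ _ -> refl) ∙ sym (+-identityʳ c)
  E-blind S (x ∷ xs) G ω c h = (∑-cong vals λ a -> E-blind S xs G (put S x a ω) c λ ω' h' -> h ω' λ
    { z (inj₁ t) -> h' z (inj₁ t) ∙ puts a z (inj₁ t) ; z (inj₂ z∉) -> h' z (inj₂ (z∉ ∘ there)) ∙ puts a z (inj₂ (z∉ ∘ here)) })
   ∙ vals-const _ ∙ sym (*-assoc k _ c)
   where
   puts : ∀ a z -> S z ≡ true ⊎ z ≢ x -> put S x a ω z ≡ ω z
   puts a z t with S x in eq
   puts a z t | true = refl
   puts a z (inj₁ t) | false = upd-other x a ω z λ { refl -> case trans (sym t) eq of λ () }
   puts a z (inj₂ ne) | false = upd-other x a ω z ne

  E₀ : List Z -> (Asg -> ℕ) -> Asg -> ℕ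
  E₀ = E none

  E-comm : ∀ {G} -> Resp G -> ∀ xs ys ω -> E₀ xs (E₀ ys G) ω ≡ E₀ ys (E₀ xs G) ω
  E-comm r [] ys ω = refl
  E-comm r (x ∷ xs) ys ω = (∑-cong vals λ a -> E-comm r xs ys (upd x a ω))
   ∙ E-∑vals (E-depends r none xs) none ys x ω refl

  E-comm-mask : ∀ {G} -> Resp G -> ∀ S xs ys ω -> (∀ x -> x ∈ xs -> S x ≡ false) -> E₀ xs (E S ys G) ω ≡ E S ys (E₀ xs G) ω
  E-comm-mask r S [] ys ω h = refl
  E-comm-mask r S (x ∷ xs) ys ω h = (∑-cong vals λ a -> E-comm-mask r S xs ys (upd x a ω) λ z m -> h z (there m))
   ∙ E-∑vals (E-depends r none xs) S ys x ω (h x (here refl))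

  E-tower : ∀ {G} -> Resp G -> ∀ xs b ω -> (∀ {z} -> z ∈ b -> z ∈ xs) -> E₀ xs (E₀ b G) ω ≡ k ^ length b * E₀ xs G ω
  E-tower r xs b ω b⊆ = E-comm r xs b ω ∙ (E-fixed none b _ ω _ λ ω' h ->
   E-dep r none xs ω' ω λ { z _ (inj₂ z∉) -> h z (z∉ ∘ b⊆) })

  -- Averaging over the block b first: a bound valid for all values of the other variables survives
  -- averaging over these.
  E-bound : ∀ {G} -> Resp G -> ∀ xs b ω P Q -> (∀ {z} -> z ∈ b -> z ∈ xs) -> 1 ≤ k ^ length b ->
   (∀ ω -> E₀ b G ω * P ≤ k ^ length b * Q) -> E₀ xs G ω * P ≤ k ^ length xs * Q
  E-bound {G} r xs b ω P Q b⊆ pos h = *-cancelˡ-≤ (k ^ length b) {{ℕ.>-nonZero pos}} (begin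
   _ ≡⟨ sym (*-assoc (k ^ length b) _ _) ⟩
   _ ≡⟨ cong (_* P) (sym (E-tower r xs b ω b⊆)) ⟩
   _ ≡⟨ sym (E-*ʳ none xs (E₀ b G) P ω) ⟩
   _ ≤⟨ E-mono none xs h ω ⟩
   _ ≡⟨ E-const none xs _ ω ⟩
   _ ≡⟨ x∙yz≈y∙xz (k ^ length xs) (k ^ length b) Q ⟩
   _ ∎)

  -- Each variable of the list is seen by at most one factor, so the sum over it passes through the
  -- other one.
  E-indep : ∀ {DG DH G H} -> DependsOn DG G -> DependsOn DH H -> ∀ xs ω -> (∀ x -> x ∈ xs -> DG x -> ¬ DH x) ->
   E₀ xs (λ ω -> G ω * H ω) ω * k ^ length xs ≡ E₀ xs G ω * E₀ xs H ω
  E-indep dG dH [] ω h = *-identityʳ _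
  E-indep {DG} {DH} {G} {H} dG dH (x ∷ xs) ω h = begin-equality
   _ ≡⟨ x∙yz≈y∙xz (∑ vals λ a -> E₀ xs GH (upd x a ω)) k (k ^ length xs) ⟩
   _ ≡⟨ cong (k *_) (sym (∑-*ʳ vals _ _)) ⟩
   _ ≡⟨ cong (k *_) (∑-cong vals λ a -> E-indep dG dH xs _ λ y m -> h y (there m)) ⟩
   _ ≡⟨ split ⟩
   _ ∎
   where
   GH = λ ω -> G ω * H ω
   blind : ∀ {D F} -> DependsOn D F -> ¬ D x -> ∀ a -> E₀ xs F (upd x a ω) ≡ E₀ xs F ω
   blind d nx a = E-depends d none xs _ _ λ z dz -> upd-other x a ω z λ { refl -> nx dz }
   split : k * ∑ vals (λ a -> E₀ xs G (upd x a ω) * E₀ xs H (upd x a ω)) ≡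
    ∑ vals (λ a -> E₀ xs G (upd x a ω)) * ∑ vals (λ a -> E₀ xs H (upd x a ω))
   split with dec (DG x)
   ... | yes dx = begin-equality
    _ ≡⟨ cong (k *_) (∑-cong vals λ a -> cong (E₀ xs G (upd x a ω) *_) (blind dH (h x (here refl) dx) a)) ⟩
    _ ≡⟨ cong (k *_) (∑-*ʳ vals _ _) ⟩
    _ ≡⟨ x∙yz≈y∙xz k (∑ vals λ a -> E₀ xs G (upd x a ω)) _ ⟩
    _ ≡⟨ cong (∑ vals (λ a -> E₀ xs G (upd x a ω)) *_) (sym (∑-cong vals (blind dH (h x (here refl) dx)) ∙ vals-const _)) ⟩
    _ ∎
   ... | no nx = begin-equality
    _ ≡⟨ cong (k *_) (∑-cong vals λ a -> cong (_* E₀ xs H (upd x a ω)) (blind dG nx a)) ⟩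
    _ ≡⟨ cong (k *_) (∑-*ˡ vals (E₀ xs G ω) _) ⟩
    _ ≡⟨ sym (*-assoc k _ _) ⟩
    _ ≡⟨ cong (_* ∑ vals (λ a -> E₀ xs H (upd x a ω))) (sym (∑-cong vals (blind dG nx) ∙ vals-const _)) ⟩
    _ ∎

  E-positive : ∀ S xs G ω -> 1 ≤ E S xs G ω -> ∃[ ω' ] 1 ≤ G ω' × (∀ z -> z ∉ xs -> ω' z ≡ ω z)
  E-positive S [] G ω h = ω , h , λ _ _ -> refl
  E-positive S (x ∷ xs) G ω h with dec (∃[ a ] 1 ≤ E S xs G (put S x a ω))
  ... | no ne = ⊥-elim (1+n≰n (h » from≡ (∑-zero vals λ a _ -> n≤0⇒n≡0 (≤-pred (≰⇒> λ p -> ne (a , p))))))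
  ... | yes (a , p) with E-positive S xs G (put S x a ω) p
  ...   | ω' , q , off = ω' , q , λ z z∉ -> off z (z∉ ∘ there) ∙ puts z (z∉ ∘ here)
   where
   puts : ∀ z -> z ≢ x -> put S x a ω z ≡ ω z
   puts z ne with S x
   ... | true = refl
   ... | false = upd-other x a ω z ne

  add : Mask -> Z -> Mask
  add S x z with dec (z ≡ x)
  ... | yes _ = true
  ... | no _ = S z

  add-same : ∀ S x -> add S x x ≡ true
  add-same S x with dec (x ≡ x)
  ... | yes _ = refl
  ... | no n = ⊥-elim (n refl)

  add-other : ∀ S x z -> z ≢ x -> add S x z ≡ S z
  add-other S x z ne with dec (z ≡ x)
  ... | yes e = ⊥-elim (ne e)
  ... | no _ = refl

  private
   reveal : ∀ {G} -> Resp G -> ∀ S xs x ω -> S x ≡ false ->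
    ∑ vals (λ a -> E (add S x) xs G (upd x a ω)) ≡ ∑ vals (λ a -> E S xs G (upd x a ω))
   reveal r S [] x ω sx = refl
   reveal {G} r S (y ∷ xs) x ω sx with dec (y ≡ x)
   ... | yes refl rewrite sx = (∑-cong vals λ a -> vals-const _) ∙ (∑-*ˡ vals k _
      ∙ (cong (k *_) (reveal r S xs y ω sx) ∙ (sym ((∑-cong vals λ a -> ∑-cong vals λ b -> E-depends r S xs _ _ λ z _ -> upd-twice y a b ω z)
       ∙ vals-const _))))
   ... | no ne = ∑-swap vals vals _ ∙ ((∑-cong vals λ b -> (∑-cong vals λ a -> E-depends r (add S x) xs _ _ λ z _ -> put-comm a b z)
       ∙ (reveal r S xs x (put S y b ω) sx
        ∙ (∑-cong vals λ a -> E-depends r S xs _ _ λ z _ -> sym (put-comm a b z))))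
       ∙ ∑-swap vals vals _)
    where
    put-comm : ∀ a b z -> put S y b (upd x a ω) z ≡ upd x a (put S y b ω) z
    put-comm a b z with S y
    ... | true = refl
    ... | false = upd-comm y x b a ω ne z

  -- By `reveal`, masking x no longer matters once x has been summed over. The value written to x is
  -- then forgotten, because x is unmasked and is either in xs or irrelevant to G.
  martingale : ∀ {D G} -> DependsOn D G -> ∀ S xs x ω -> (∀ z -> D z -> z ∈ xs) -> S x ≡ false ->
   ∑ vals (λ a -> E (add S x) xs G (upd x a ω)) ≡ k * E S xs G ω
  martingale {D} d S xs x ω D⊆ sx = reveal (dep⇒resp d) S xs x ω sx
   ∙ (∑-cong vals λ a -> E-dep d S xs _ _ (agree a)) ∙ vals-const _
   where
   agree : ∀ a z -> D z -> S z ≡ true ⊎ z ∉ xs -> upd x a ω z ≡ ω z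
   agree a z dz (inj₁ sz) = upd-other x a ω z λ { refl -> case trans (sym sx) sz of λ () }
   agree a z dz (inj₂ z∉) = ⊥-elim (z∉ (D⊆ z dz))

 ⟦⟧-compl : ∀ {p} (P : Set p) -> ⟦ P ⟧ + ⟦ ¬ P ⟧ ≡ 1
 ⟦⟧-compl P with dec P
 ... | yes x = cong suc (⟦⟧-no λ n -> n x)
 ... | no n = ⟦⟧-yes n

 -- The symmetric local lemma for finitely many variables.

 module LLL {Z : Set} (k : ℕ) (0<k : 1 ≤ k) {Y : Set} where
  open Prob {Z} k

  module _ (Bad : Y -> Asg -> Set) (dep : Y -> Z -> Set)
   (local : ∀ y ω ω' -> (∀ z -> dep y z -> ω z ≡ ω' z) -> Bad y ω -> Bad y ω')
   (xs : List Z) (ω₀ : Asg) (D : ℕ) (0<D : 1 ≤ D) (nb : Y -> List Y) (nb-≤ : ∀ y -> length (nb y) ≤ D) where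

   private
    b c : Y -> Asg -> ℕ
    b y ω = ⟦ Bad y ω ⟧
    c y ω = ⟦ ¬ Bad y ω ⟧

    av : List Y -> Asg -> ℕ
    av L ω = ∏ L λ y -> c y ω

    K : ℕ
    K = k ^ length xs

    K-pos : 1 ≤ K
    K-pos = from≡ (sym (ℕ.^-zeroˡ (length xs))) » ^-monoˡ-≤ (length xs) 0<k

    𝔼 : (Asg -> ℕ) -> ℕ
    𝔼 G = E₀ xs G ω₀

    b-dep : ∀ y -> DependsOn (dep y) (b y)
    b-dep y ω ω' h = ⟦⟧-cong (local y ω ω' h) (local y ω' ω λ z d -> sym (h z d))

    depL : List Y -> Z -> Set
    depL L z = ∃[ y ] y ∈ L × dep y z

    av-dep : ∀ L -> DependsOn (depL L) (av L)
    av-dep L ω ω' h = ∏-cong∈ L λ y m -> ⟦⟧-cong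
     (λ nb' bad -> nb' (local y ω' ω (λ z d -> sym (h z (y , m , d))) bad))
     (λ nb' bad -> nb' (local y ω ω' (λ z d -> h z (y , m , d)) bad))

    av≤1 : ∀ L ω -> av L ω ≤ 1
    av≤1 L ω = (∏-mono∈ L λ y _ -> ⟦⟧≤1 _) » from≡ (∏-const L 1 ∙ ℕ.^-zeroˡ (length L))

    union : ∀ L ω -> 1 ≤ av L ω + ∑ L λ y -> b y ω
    union [] ω = ≤-refl
    union (y ∷ L) ω with dec (Bad y ω) | dec (¬ Bad y ω)
    ... | yes bad | _ = s≤s z≤n » m≤n+m _ _
    ... | no nbad | yes _ = union L ω » from≡ (cong (_+ ∑ L (λ y -> b y ω)) (sym (+-identityʳ (av L ω))))
    ... | no nbad | no n = ⊥-elim (n nbad)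

    meets : Y -> Y -> Set
    meets y y' = ∃[ z ] z ∈ xs × dep y z × dep y' z

   module _ (ys : List Y)
    (nbs : ∀ y y' z -> y ∈ ys -> y' ∈ ys -> z ∈ xs -> dep y z -> dep y' z -> y' ∈ nb y)
    (prob : ∀ y -> y ∈ ys -> 4 * D * E₀ xs (λ ω -> ⟦ Bad y ω ⟧) ω₀ ≤ k ^ length xs) where

    private
     far near' : Y -> List Y -> List Y
     far y = sel (λ y' -> ¬ meets y y')
     near' y = sel (meets y)

     far-bound : ∀ y L -> y ∈ ys -> 4 * D * 𝔼 (λ ω -> b y ω * av (far y L) ω) ≤ 𝔼 (av (far y L))
     far-bound y L y∈ = *-cancelʳ-≤ _ _ K {{ℕ.>-nonZero K-pos}} (begin
      _ ≡⟨ *-assoc (4 * D) _ _ ⟩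
      _ ≡⟨ cong (4 * D *_) (E-indep (b-dep y) (av-dep L₂) xs ω₀ disjoint) ⟩
      _ ≡⟨ sym (*-assoc (4 * D) _ _) ⟩
      _ ≤⟨ *≤ˡ _ (prob y y∈) ⟩
      _ ≡⟨ *-comm K _ ⟩
      _ ∎)
      where
      L₂ = far y L
      disjoint : ∀ z -> z ∈ xs -> dep y z -> ¬ depL L₂ z
      disjoint z z∈ d (y' , y'∈ , d') = snd (sel⊆ L y'∈) (z , z∈ , d , d')

     -- The usual induction hypothesis, cleared of denominators: given that no event of L occurs, y
     -- occurs with conditional probability at most 1/(2D).
     Small : List Y -> Set
     Small L = Unique L -> (∀ {y} -> y ∈ L -> y ∈ ys) -> ∀ y -> y ∈ ys -> 2 * D * 𝔼 (λ ω -> b y ω * av L ω) ≤ 𝔼 (av L)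

    -- Drop from L the events that share a variable with y. The others are independent of y, which
    -- gives 1/(4D); by induction each of the at most D dropped events has conditional probability
    -- at most 1/(2D), so dropping them costs a factor of at most 2.
    conditional : ∀ L -> (∀ L' -> length L' < length L -> Small L') -> Small L
    conditional L rec u L⊆ y y∈ = *-cancelˡ-≤ 2 (begin
     _ ≡⟨ ring5 D _ ⟩
     _ ≤⟨ *≤ʳ (4 * D) (E-mono none xs (λ ω -> *≤ʳ (b y ω) (drop ω)) ω₀) ⟩
     _ ≤⟨ far-bound y L y∈ ⟩
     _ ≤⟨ double ⟩
     _ ∎)
     where
     L₁ = near' y L
     L₂ = far y L
     drop : ∀ ω -> av L ω ≤ av L₂ ω
     drop ω = from≡ (∏-sel {P = meets y} L (λ y -> c y ω))
      » *≤ˡ (av L₂ ω) (av≤1 L₁ ω) » from≡ (*-identityˡ _)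
     few : length L₁ ≤ D
     few = (unique-length (sel-unique u) λ m -> case sel⊆ L m of
      λ { (y'∈ , z , z∈ , d , d') -> nbs y _ z y∈ (L⊆ y'∈) z∈ d d' }) » nb-≤ y
     expand : 𝔼 (av L₂) ≤ 𝔼 (av L) + ∑ L₁ λ y' -> 𝔼 (λ ω -> b y' ω * av L₂ ω)
     expand = begin
      _ ≤⟨ E-mono none xs (λ ω -> begin
       _ ≡⟨ sym (*-identityˡ _) ⟩
       _ ≤⟨ *≤ˡ (av L₂ ω) (union L₁ ω) ⟩
       _ ≡⟨ *-distribʳ-+ (av L₂ ω) (av L₁ ω) _ ⟩
       _ ≡⟨ cong₂ _+_ (sym (∏-sel {P = meets y} L (λ y -> c y ω))) (sym (∑-*ʳ L₁ _ _)) ⟩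
       _ ∎) ω₀ ⟩
      _ ≡⟨ E-+ none xs _ _ ω₀ ⟩
      _ ≡⟨ cong (𝔼 (av L) +_) (E-∑ none xs L₁ _ ω₀) ⟩
      _ ∎
     ih : ∀ y' -> y' ∈ L₁ -> 2 * D * 𝔼 (λ ω -> b y' ω * av L₂ ω) ≤ 𝔼 (av L₂)
     ih y' y'∈ = rec L₂ (sel-¬-< L (fst (sel⊆ L y'∈)) (snd (sel⊆ L y'∈))) (sel-unique u)
      (λ m -> L⊆ (fst (sel⊆ L m))) y' (L⊆ (fst (sel⊆ L y'∈)))
     sums : 2 * D * ∑ L₁ (λ y' -> 𝔼 (λ ω -> b y' ω * av L₂ ω)) ≤ D * 𝔼 (av L₂)
     sums = begin
      _ ≡⟨ sym (∑-*ˡ L₁ (2 * D) _) ⟩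
      _ ≤⟨ ∑-≤const L₁ (𝔼 (av L₂)) ih ⟩
      _ ≤⟨ *≤ˡ _ few ⟩
      _ ∎
     double : 𝔼 (av L₂) ≤ 2 * 𝔼 (av L)
     double = *-cancelˡ-≤ D {{ℕ.>-nonZero 0<D}} (+-cancelˡ-≤ (D * 𝔼 (av L₂)) _ _ (begin
      _ ≡⟨ ring3 D _ ⟩
      _ ≤⟨ *≤ʳ (2 * D) expand ⟩
      _ ≡⟨ *-distribˡ-+ (2 * D) (𝔼 (av L)) _ ⟩
      _ ≤⟨ +≤ʳ (2 * D * 𝔼 (av L)) sums ⟩
      _ ≡⟨ ring4 D (𝔼 (av L)) (𝔼 (av L₂)) ⟩
      _ ∎))

    private
     small : ∀ n L -> length L ≤ n -> Small L
     small zero L len = conditional L λ L' lt -> ⊥-elim (1+n≰n ((s≤s z≤n » lt) » len))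
     small (suc n) L len = conditional L λ L' lt -> small n L' (≤-pred (lt » len))

     positive : ∀ L -> Unique L -> (∀ {y} -> y ∈ L -> y ∈ ys) -> 1 ≤ 𝔼 (av L)
     positive [] u L⊆ = K-pos » from≡ (sym (E-const none xs 1 ω₀ ∙ *-identityʳ K))
     positive (y ∷ L) (ny ∷ u) L⊆ = halve (positive L u (L⊆ ∘ there) » from≡ whole)
       (*≤ˡ _ (*≤ʳ 2 0<D) » small (length L) L ≤-refl u (L⊆ ∘ there) y (L⊆ (here refl)) » from≡ whole)
      where
      whole : 𝔼 (av L) ≡ 𝔼 (av (y ∷ L)) + 𝔼 (λ ω -> b y ω * av L ω)
      whole = (E-cong none xs (λ ω -> sym (*-identityˡ _) ∙ (cong (_* av L ω) (sym (+-comm (c y ω) (b y ω) ∙ ⟦⟧-compl (Bad y ω)))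
       ∙ *-distribʳ-+ (av L ω) (c y ω) (b y ω))) ω₀) ∙ E-+ none xs _ _ ω₀
      halve : ∀ {p q} -> 1 ≤ p + q -> 2 * 1 * q ≤ p + q -> 1 ≤ p
      halve {zero} {suc q} h h' = ⊥-elim (1+n≰n {q} (s≤s (m≤m+n q (q + 0))
       » from≡ (ring2 q) » ≤-pred h'))
      halve {suc p} h h' = s≤s z≤n

    LLL : ∃[ ω ] (∀ z -> z ∉ xs -> ω z ≡ ω₀ z) × (∀ y -> y ∈ ys -> ¬ Bad y ω)
    LLL with E-positive none xs (av (dedup ys)) ω₀ (positive (dedup ys) (dedup-unique ys) (dedup⊆ ys))
    ... | ω , pos , off = ω , off , λ y y∈ bad -> 1+n≰n (pos » from≡ (zero-prod (dedup ys) (∈dedup ys y∈) bad))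
     where
     zero-prod : ∀ L {y} -> y ∈ L -> Bad y ω -> av L ω ≡ 0
     zero-prod (y ∷ L) (here refl) bad = cong (_* av L ω) (⟦⟧-no λ n -> n bad)
     zero-prod (y ∷ L) (there m) bad = cong (c y ω *_) (zero-prod L m bad) ∙ *-zeroʳ (c y ω)

 -- Countable enumerations.

 private
  diagonal : ℕ × ℕ -> ℕ × ℕ
  diagonal (zero , b) = suc b , zero
  diagonal (suc a , b) = a , suc b

 unpair : ℕ -> ℕ × ℕ
 unpair zero = 0 , 0
 unpair (suc n) = diagonal (unpair n)

 unpair-surj : ∀ a b -> ∃[ n ] unpair n ≡ (a , b)
 unpair-surj a b = reach (a + b) b a refl
  where
  reach : ∀ s b a -> a + b ≡ s -> ∃[ n ] unpair n ≡ (a , b)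
  reach s (suc b) a e = let (n , p) = reach s b (suc a) (sym (+-suc a b) ∙ e) in suc n , cong diagonal p
  reach zero zero zero e = 0 , refl
  reach (suc s) zero (suc a) e = let (n , p) = reach s a 0 (sym (+-identityʳ a) ∙ suc-injective e) in suc n , cong diagonal p

 -- Partial, to make room for finite and empty index sets.
 Enum : Set -> Set
 Enum I = Σ[ e ∈ (ℕ -> Maybe I) ] ∀ i -> ∃[ n ] e n ≡ just i

 enum-ℕ : Enum ℕ
 enum-ℕ = just , λ i -> i , refl

 enum-Bool : Enum Bool
 enum-Bool = (λ { 0 -> just true ; _ -> just false }) , λ { true -> 0 , refl ; false -> 1 , refl }

 enum-Fin : ∀ k -> Enum (Fin k)
 enum-Fin k = e , λ i -> toℕ i , found i
  where
  e : ℕ -> Maybe (Fin k)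
  e n with n <? k
  ... | yes lt = just (fromℕ< lt)
  ... | no _ = nothing
  found : ∀ i -> e (toℕ i) ≡ just i
  found i with toℕ i <? k
  ... | yes lt = cong just (fromℕ<-toℕ i lt)
  ... | no n = ⊥-elim (n (toℕ<n i))

 private
  pairM : {A B : Set} -> Maybe A -> Maybe B -> Maybe (A × B)
  pairM (just a) (just b) = just (a , b)
  pairM _ _ = nothing

 enum-× : {A B : Set} -> Enum A -> Enum B -> Enum (A × B)
 enum-× (e , s) (f , t) = (λ n -> pairM (e (fst (unpair n))) (f (snd (unpair n)))) , λ (a , b) ->
  let (i , p) = s a ; (j , q) = t b ; (n , r) = unpair-surj i j in
  n , cong₂ pairM (cong (e ∘ fst) r ∙ p) (cong (f ∘ snd) r ∙ q)

 enum-List : {A : Set} -> Enum A -> Enum (List A)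
 enum-List {A} (e , s) = (λ n -> decode (fst (unpair n)) (snd (unpair n))) , λ l ->
  let (m , p) = code l ; (n , r) = unpair-surj (length l) m in
  n , cong₂ decode (cong fst r) (cong snd r) ∙ p
  where
  consM : Maybe A -> Maybe (List A) -> Maybe (List A)
  consM (just a) (just l) = just (a ∷ l)
  consM _ _ = nothing
  decode : ℕ -> ℕ -> Maybe (List A)
  decode zero _ = just []
  decode (suc f) n = consM (e (fst (unpair n))) (decode f (snd (unpair n)))
  code : ∀ l -> ∃[ n ] decode (length l) n ≡ just l
  code [] = 0 , refl
  code (x ∷ l) = let (i , p) = s x ; (j , q) = code l ; (n , r) = unpair-surj i j in
   n , cong₂ consM (cong (e ∘ fst) r ∙ p) (cong (decode (length l) ∘ snd) r ∙ q)

 -- Borel sets, Borel maps and countable logic.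

 record Sys : Set₂ where
  field
   X : Set
   Borel : (X -> Set) -> Set₁
   b-resp : ∀ {P Q} -> (∀ x -> P x -> Q x) -> (∀ x -> Q x -> P x) -> Borel P -> Borel Q
   b-¬ : ∀ {P} -> Borel P -> Borel (λ x -> ¬ P x)
   b-∃ℕ : ∀ {P : ℕ -> X -> Set} -> (∀ n -> Borel (P n)) -> Borel (λ x -> ∃[ n ] P n x)
   -- A countable separating family of Borel sets is all that the combinatorial part needs from the
   -- topology.
   base : ℕ -> X -> Set
   base-borel : ∀ n -> Borel (base n)
   separates : ∀ x y -> (∀ n -> (base n x -> base n y) × (base n y -> base n x)) -> x ≡ y

 module Logic (S : Sys) where
  open Sys S public

  private variable
   P Q : X -> Set

  -- The closure properties alone do not produce any set; a basic set together with its complement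
  -- does.
  b-⊤ : Borel (λ _ -> ⊤)
  b-⊤ = b-resp {P = λ x -> ∃[ n ] Two n x} (λ _ _ -> tt) total (b-∃ℕ two)
   where
   Two : ℕ -> X -> Set
   Two zero x = base 0 x
   Two (suc _) x = ¬ base 0 x
   two : ∀ n -> Borel (Two n)
   two zero = base-borel 0
   two (suc _) = b-¬ (base-borel 0)
   total : ∀ x -> ⊤ -> ∃[ n ] Two n x
   total x _ with dec (base 0 x)
   ... | yes b = 0 , b
   ... | no n = 1 , n

  b-const : (C : Set) -> Borel (λ _ -> C)
  b-const C with dec C
  ... | yes c = b-resp (λ _ _ -> c) (λ _ _ -> tt) b-⊤
  ... | no n = b-resp (λ _ f -> ⊥-elim (f tt)) (λ _ c -> ⊥-elim (n c)) (b-¬ b-⊤)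

  b-∃ : {I : Set} -> Enum I -> {P : I -> X -> Set} -> (∀ i -> Borel (P i)) -> Borel (λ x -> ∃[ i ] P i x)
  b-∃ {I} (e , s) {P} b = b-resp {P = λ x -> ∃[ n ] P' (e n) x} to from (b-∃ℕ (λ n -> b' (e n)))
   where
   P' : Maybe I -> X -> Set
   P' nothing x = ⊥
   P' (just i) x = P i x
   b' : ∀ m -> Borel (P' m)
   b' nothing = b-const ⊥
   b' (just i) = b i
   to : ∀ x -> ∃[ n ] P' (e n) x -> ∃[ i ] P i x
   to x (n , p) with e n
   ... | just i = i , p
   from : ∀ x -> ∃[ i ] P i x -> ∃[ n ] P' (e n) x
   from x (i , p) = fst (s i) , subst (λ m -> P' m x) (sym (snd (s i))) p

  b-∀ : {I : Set} -> Enum I -> {P : I -> X -> Set} -> (∀ i -> Borel (P i)) -> Borel (λ x -> ∀ i -> P i x)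
  b-∀ e {P} b = b-resp (λ x n i -> byContra λ np -> n (i , np)) (λ x h (i , np) -> np (h i)) (b-¬ (b-∃ e λ i -> b-¬ (b i)))

  b-⊎ : Borel P -> Borel Q -> Borel (λ x -> P x ⊎ Q x)
  b-⊎ {P} {Q} p q = b-resp {P = λ x -> ∃[ b ] (if b then P else Q) x}
   (λ { x (true , h) -> inj₁ h ; x (false , h) -> inj₂ h }) (λ { x (inj₁ h) -> true , h ; x (inj₂ h) -> false , h })
   (b-∃ enum-Bool λ { true -> p ; false -> q })

  b-× : Borel P -> Borel Q -> Borel (λ x -> P x × Q x)
  b-× p q = b-resp (λ x n -> byContra (n ∘ inj₁) , byContra (n ∘ inj₂)) (λ { x (h , h') (inj₁ n) -> n h ; x (h , h') (inj₂ n) -> n h' })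
   (b-¬ (b-⊎ (b-¬ p) (b-¬ q)))

  b-→ : Borel P -> Borel Q -> Borel (λ x -> P x -> Q x)
  b-→ {P} p q = b-resp (λ { x (inj₁ n) h -> ⊥-elim (n h) ; x (inj₂ h) _ -> h }) (λ x f -> case dec (P x) of λ
   { (yes h) -> inj₂ (f h) ; (no n) -> inj₁ n }) (b-⊎ (b-¬ p) q)

  b-any : {I : Set} (is : List I) {P : I -> X -> Set} -> (∀ i -> i ∈ is -> Borel (P i)) -> Borel (λ x -> Any (λ i -> P i x) is)
  b-any [] b = b-resp (λ x ()) (λ x ()) (b-const ⊥)
  b-any (i ∷ is) b = b-resp (λ { x (inj₁ h) -> here h ; x (inj₂ h) -> there h }) (λ { x (here h) -> inj₁ h ; x (there h) -> inj₂ h })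
   (b-⊎ (b i (here refl)) (b-any is λ j m -> b j (there m)))

  -- Borel maps. Several points of one formula are written as images g x, h x of a single x, so that
  -- composition of maps does the work of product spaces.
  Pt : (X -> X) -> Set₁
  Pt g = ∀ {U : X -> Set} -> Borel U -> Borel (λ x -> U (g x))

  pt-id : Pt id
  pt-id b = b

  pt-∘ : ∀ {g h} -> Pt g -> Pt h -> Pt (λ x -> g (h x))
  pt-∘ g h b = h (g b)

  b-≡ : ∀ {g h} -> Pt g -> Pt h -> Borel (λ x -> g x ≡ h x)
  b-≡ {g} {h} mg mh = b-resp (λ x -> separates (g x) (h x)) (λ x e n -> subst (base n) e , subst (base n) (sym e))
   (b-∀ enum-ℕ λ n -> b-× (b-→ (mg (base-borel n)) (mh (base-borel n))) (b-→ (mh (base-borel n)) (mg (base-borel n))))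

  -- Adequate for countable V, where every set of values is a countable union of points.
  Meas : {V : Set} -> (X -> V) -> Set₁
  Meas F = ∀ v -> Borel (λ x -> F x ≡ v)

  meas-const : {V : Set} (c : V) -> Meas (λ _ -> c)
  meas-const c v = b-const (c ≡ v)

  meas-pre : {V : Set} -> Enum V -> {F : X -> V} -> Meas F -> (Q : V -> Set) -> Borel (λ x -> Q (F x))
  meas-pre e {F} m Q = b-resp (λ { x (v , refl , q) -> q }) (λ x q -> F x , refl , q) (b-∃ e λ v -> b-× (m v) (b-const (Q v)))

  meas-map : {V W : Set} -> Enum V -> {F : X -> V} -> Meas F -> (h : V -> W) -> Meas (λ x -> h (F x))
  meas-map e m h w = meas-pre e m (λ v -> h v ≡ w)

  meas-map₂ : {U V W : Set} -> Enum U -> Enum V -> {F : X -> U} {G : X -> V} -> Meas F -> Meas G -> (h : U -> V -> W) -> Meas (λ x -> h (F x) (G x))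
  meas-map₂ e f mF mG h = meas-map (enum-× e f) {F = λ x -> _ , _} (λ (u , v) -> b-resp (λ { x (refl , refl) -> refl }) (λ { x refl -> refl , refl }) (b-× (mF u) (mG v))) λ (u , v) -> h u v

  meas-⟦⟧ : Borel P -> Meas (λ x -> ⟦ P x ⟧)
  meas-⟦⟧ p zero = b-resp (λ x n -> ⟦⟧-no n) (λ x e h -> 1+n≢0 (sym (⟦⟧-yes h) ∙ e)) (b-¬ p)
  meas-⟦⟧ p (suc zero) = b-resp (λ x h -> ⟦⟧-yes h) (λ x -> ⟦⟧-≡1) p
  meas-⟦⟧ {P} p (suc (suc n)) = b-resp (λ x ()) (λ x e -> case ≤-trans (from≡ (sym e)) (⟦⟧≤1 (P x)) of λ { (s≤s ()) }) (b-const ⊥)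

  meas-∑ : ∀ {a} {I : Set a} (is : List I) {F : I -> X -> ℕ} -> (∀ i -> i ∈ is -> Meas (F i)) -> Meas (λ x -> ∑ is λ i -> F i x)
  meas-∑ [] m = meas-const 0
  meas-∑ (i ∷ is) m = meas-map₂ enum-ℕ enum-ℕ (m i (here refl)) (meas-∑ is λ j j∈ -> m j (there j∈)) _+_

  b-rel : {V W : Set} -> Enum V -> Enum W -> {F : X -> V} {G : X -> W} -> Meas F -> Meas G -> (R : V -> W -> Set) -> Borel (λ x -> R (F x) (G x))
  b-rel e f mF mG R = b-resp (λ { x (v , w , refl , refl , r) -> r }) (λ x r -> _ , _ , refl , refl , r)
   (b-∃ e λ v -> b-∃ f λ w -> b-× (mF v) (b-× (mG w) (b-const (R v w))))

  b-≤ : {F G : X -> ℕ} -> Meas F -> Meas G -> Borel (λ x -> F x ≤ G x)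
  b-≤ mF mG = b-rel enum-ℕ enum-ℕ mF mG _≤_

  meas-pt : {V : Set} {F : X -> V} {g : X -> X} -> Meas F -> Pt g -> Meas (λ x -> F (g x))
  meas-pt m mg v = mg (m v)

  -- Minimisation, with value 0 where there is no solution.
  minimum : (ℕ -> X -> Set) -> X -> ℕ
  minimum H x with dec (∃[ n ] H n x)
  ... | yes (n , h) = fst (least (λ n -> H n x) n h)
  ... | no _ = 0

  minimum-spec : ∀ H x -> ∃[ n ] H n x -> H (minimum H x) x × (∀ j -> H j x -> minimum H x ≤ j)
  minimum-spec H x e with dec (∃[ n ] H n x)
  ... | yes (n , h) = fst (snd (least (λ n -> H n x) n h)) , fst (snd (snd (least (λ n -> H n x) n h)))
  ... | no ne = ⊥-elim (ne e)

  minimum-none : ∀ H x -> ¬ (∃[ n ] H n x) -> minimum H x ≡ 0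
  minimum-none H x ne with dec (∃[ n ] H n x)
  ... | yes e = ⊥-elim (ne e)
  ... | no _ = refl

  minimum-cong : ∀ H x y -> (∀ n -> (H n x -> H n y) × (H n y -> H n x)) -> minimum H x ≡ minimum H y
  minimum-cong H x y h with dec (∃[ n ] H n x)
  ... | no ne = sym (minimum-none H y λ (n , p) -> ne (n , snd (h n) p))
  ... | yes (n , p) = ℕ.≤-antisym
    (fst (snd (snd (least (λ n -> H n x) n p))) _ (snd (h _) (fst specy)))
    (snd specy _ (fst (h _) (fst (snd (least (λ n -> H n x) n p)))))
   where
   specy = minimum-spec H y (n , fst (h n) p)

  meas-minimum : ∀ {H} -> (∀ n -> Borel (H n)) -> Meas (minimum H)
  meas-minimum {H} b n = b-resp to from
   (b-⊎ (b-× (b n) (b-∀ enum-ℕ λ j -> b-→ (b j) (b-const (n ≤ j)))) (b-× (b-const (n ≡ 0)) (b-¬ (b-∃ enum-ℕ b))))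
   where
   to : ∀ x -> (H n x × (∀ j -> H j x -> n ≤ j)) ⊎ (n ≡ 0 × ¬ (∃[ j ] H j x)) -> minimum H x ≡ n
   to x (inj₁ (h , l)) = let (h' , l') = minimum-spec H x (n , h) in ℕ.≤-antisym (l' n h) (l _ h')
   to x (inj₂ (refl , ne)) = minimum-none H x ne
   from : ∀ x -> minimum H x ≡ n -> (H n x × (∀ j -> H j x -> n ≤ j)) ⊎ (n ≡ 0 × ¬ (∃[ j ] H j x))
   from x refl with dec (∃[ j ] H j x)
   ... | yes (j , h) = inj₁ (let (_ , h' , l' , _) = least (λ n -> H n x) j h in h' , l')
   ... | no ne = inj₂ (refl , ne)

 fresh : ∀ d (l : List ℕ) -> length l ≤ d -> ∃[ m ] m ≤ d × m ∉ l
 fresh d l len with dec (∃[ m ] m ≤ d × m ∉ l)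
 ... | yes e = e
 ... | no ne = ⊥-elim (1+n≰n ((from≡ (sym (List.length-upTo (suc d)))
   » (unique-length (upTo⁺ (suc d)) λ {m} m∈ -> byContra λ m∉ -> ne (m , ≤-pred (∈-upTo⁻ m∈) , m∉))) » len))

 -- Borel greedy colourings of locally finite relations.

 module Colouring (S : Sys) where
  open Logic S

  record Relation : Set₁ where
   field
    I : Set
    enum : Enum I
    fam : I -> X -> X
    fam-pt : ∀ i -> Pt (fam i)
    _~_ : X -> X -> Set
    ~-sym : ∀ {x y} -> x ~ y -> y ~ x
    ~-irrefl : ∀ {x} -> ¬ (x ~ x)
    ~-fam : ∀ {x y} -> x ~ y -> ∃[ i ] fam i x ≡ y
    b-~ : ∀ {g h} -> Pt g -> Pt h -> Borel (λ x -> g x ~ h x)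
    nbrs : X -> List X
    ∈nbrs : ∀ {x y} -> x ~ y -> y ∈ nbrs x

  module Greedy (R : Relation) where
   open Relation R

   b-∃~ : ∀ (P : X -> Set) -> Borel P -> Borel (λ x -> ∃[ y ] x ~ y × P y)
   b-∃~ P bP = b-resp (λ { x (i , e , p) -> fam i x , e , p }) (λ { x (y , e , p) -> let (i , q) = ~-fam e in
     i , subst (x ~_) (sym q) e , subst P (sym q) p })
    (b-∃ enum λ i -> b-× (b-~ pt-id (fam-pt i)) (fam-pt i bP))

   private
    Lit : ℕ × Bool -> X -> Set
    Lit (n , true) x = base n x
    Lit (n , false) x = ¬ base n x

    Sat : List (ℕ × Bool) -> X -> Set
    Sat [] x = ⊤
    Sat (l ∷ c) x = Lit l x × Sat c x

    b-Lit : ∀ l -> Borel (Lit l)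
    b-Lit (n , true) = base-borel n
    b-Lit (n , false) = b-¬ (base-borel n)

    b-Sat : ∀ c -> Borel (Sat c)
    b-Sat [] = b-⊤
    b-Sat (l ∷ c) = b-× (b-Lit l) (b-Sat c)

    clauses : Enum (List (ℕ × Bool))
    clauses = enum-List (enum-× enum-ℕ enum-Bool)

    clause : ℕ -> X -> Set
    clause n x = ∃[ c ] fst clauses n ≡ just c × Sat c x

    -- Finitely many literals on basic sets tell x from its finitely many neighbours. The least
    -- number of a clause that does so is a proper colouring with countably many colours.
    Isolates : ℕ -> X -> Set
    Isolates n x = clause n x × ¬ (∃[ y ] x ~ y × clause n y)

    b-clause : ∀ n -> Borel (clause n)
    b-clause n = b-∃ clauses λ c -> b-× (b-const _) (b-Sat c)

    b-Isolates : ∀ n -> Borel (Isolates n)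
    b-Isolates n = b-× (b-clause n) (b-¬ (b-∃~ (clause n) (b-clause n)))

    isolate : ∀ x L -> (∀ y -> y ∈ L -> y ≢ x) -> ∃[ c ] Sat c x × (∀ y -> y ∈ L -> ¬ Sat c y)
    isolate x [] h = [] , tt , λ y ()
    isolate x (z ∷ L) h with isolate x L (λ y m -> h y (there m)) | dec (∃[ l ] Lit l x × ¬ Lit l z)
    ... | c , s , u | yes (l , lx , lz) = l ∷ c , (lx , s) , λ { y (here refl) (ly , _) -> lz ly ; y (there m) (_ , t) -> u y m t }
    ... | c , s , u | no nl = ⊥-elim (h z (here refl) (separates z x λ n ->
      (λ bz -> byContra λ bx -> nl ((n , false) , bx , λ nb -> nb bz)) , (λ bx -> byContra λ bz -> nl ((n , true) , bx , bz))))

    isolated : ∀ x -> ∃[ n ] Isolates n x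
    isolated x with isolate x (sel (x ~_) (nbrs x)) (λ { y m refl -> ~-irrefl (snd (sel⊆ (nbrs x) m)) })
    ... | c , s , u = let (n , e) = snd clauses c in n , (c , e , s) , λ { (y , a , c' , e' , s') ->
        u y (∈sel (nbrs x) (∈nbrs a) a) (subst (λ c -> Sat c y) (just-inj (sym e' ∙ e)) s') }
     where
     just-inj : ∀ {A : Set} {a b : A} -> just a ≡ just b -> a ≡ b
     just-inj refl = refl

    c : X -> ℕ
    c = minimum Isolates

    c-meas : Meas c
    c-meas = meas-minimum b-Isolates

    c-proper : ∀ {x y} -> x ~ y -> c x ≢ c y
    c-proper {x} {y} a e = snd (fst (minimum-spec Isolates x (isolated x)))
     (y , a , subst (λ n -> clause n y) (sym e) (fst (fst (minimum-spec Isolates y (isolated y)))))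

    Free : (X -> ℕ) -> ℕ -> ℕ -> X -> Set
    Free g n m x = ¬ (∃[ y ] x ~ y × (c y < n × g y ≡ m))

    -- Greedy recolouring along the classes of the countable colouring `c`: no two vertices of a
    -- class are adjacent, so a whole class is treated at once.
    g : ℕ -> X -> ℕ
    g zero x = 0
    g (suc n) x = if ℕ._≡ᵇ_ (c x) n then minimum (Free (g n) n) x else g n x

    g-now : ∀ n x -> c x ≡ n -> g (suc n) x ≡ minimum (Free (g n) n) x
    g-now n x e rewrite e with ℕ._≡ᵇ_ n n in eq
    ... | true = refl
    ... | false = ⊥-elim (subst Bool.T eq (ℕ.≡⇒≡ᵇ n n refl))

    g-later : ∀ n x -> c x ≢ n -> g (suc n) x ≡ g n x
    g-later n x ne with ℕ._≡ᵇ_ (c x) n in eq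
    ... | true = ⊥-elim (ne (ℕ.≡ᵇ⇒≡ (c x) n (subst Bool.T (sym eq) tt)))
    ... | false = refl

    meas-g : ∀ n -> Meas (g n)
    b-Free : ∀ n m -> Borel (Free (g n) n m)
    b-Free n m = b-¬ (b-∃~ (λ y -> c y < n × g n y ≡ m) (b-× (b-≤ (meas-map enum-ℕ c-meas suc) (meas-const n)) (meas-g n m)))
    meas-g zero = meas-const 0
    meas-g (suc n) v = b-resp
     (λ { x (inj₁ (e , q)) -> g-now n x e ∙ q ; x (inj₂ (ne , q)) -> g-later n x ne ∙ q })
     (λ x q -> case dec (c x ≡ n) of λ { (yes e) -> inj₁ (e , sym (g-now n x e) ∙ q) ; (no ne) -> inj₂ (ne , sym (g-later n x ne) ∙ q) })
     (b-⊎ (b-× (c-meas n) (meas-minimum (b-Free n) v)) (b-× (b-¬ (c-meas n)) (meas-g n v)))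

    stable : ∀ n x -> c x < n -> g n x ≡ g (suc (c x)) x
    stable (suc n) x lt with m<1+n⇒m<n∨m≡n lt
    ... | inj₂ refl = refl
    ... | inj₁ lt' = (g-later n x λ { refl -> <-irrefl refl lt' }) ∙ stable n x lt'

   colour : X -> ℕ
   colour x = g (suc (c x)) x

   colour-meas : Meas colour
   colour-meas v = b-resp (λ { x (n , refl , q) -> q }) (λ x q -> c x , refl , q)
    (b-∃ enum-ℕ λ n -> b-× (c-meas n) (meas-g (suc n) v))

   private
    free-of : ∀ x d -> (∀ L -> Unique L -> (∀ {y} -> y ∈ L -> x ~ y) -> length L ≤ d) -> ∃[ m ] m ≤ d × Free (g (c x)) (c x) m x
    free-of x d bound = m , m≤ , λ { (y , a , _ , q) -> m∉ (subst (_∈ map (g (c x)) l) q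
      (∈-map⁺ (g (c x)) (∈dedup _ (∈sel (nbrs x) (∈nbrs a) a)))) }
     where
     l = dedup (sel (x ~_) (nbrs x))
     found = fresh d (map (g (c x)) l) (from≡ (length-map _ l)
      » (bound l (dedup-unique (sel (x ~_) (nbrs x))) λ y∈ -> snd (sel⊆ (nbrs x) (dedup⊆ _ y∈))))
     m = fst found
     m≤ = fst (snd found)
     m∉ = snd (snd found)

    colour-free : ∀ x -> Free (g (c x)) (c x) (colour x) x
    colour-free x = let l = nbrs x ; (m , _ , f) = free-of x (length l) (λ L u h -> unique-length u λ m -> ∈nbrs (h m)) in
     subst (λ v -> Free (g (c x)) (c x) v x) (sym (g-now (c x) x refl)) (fst (minimum-spec (Free (g (c x)) (c x)) x (m , f)))

    half : ∀ {x y} -> x ~ y -> c y < c x -> colour x ≢ colour y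
    half {x} {y} a lt e = colour-free x (y , a , lt , stable (c x) y lt ∙ sym e)

   colour-proper : ∀ {x y} -> x ~ y -> colour x ≢ colour y
   colour-proper {x} {y} a e = case <-cmp (c x) (c y) of λ
    { (tri< lt _ _) -> half (~-sym a) lt (sym e) ; (tri≈ _ eq _) -> c-proper a eq ; (tri> _ _ gt) -> half a gt e }

   colour-≤ : ∀ x d -> (∀ L -> Unique L -> (∀ {y} -> y ∈ L -> x ~ y) -> length L ≤ d) -> colour x ≤ d
   colour-≤ x d bound = let (m , m≤ , f) = free-of x d bound in
    from≡ (g-now (c x) x refl) » snd (minimum-spec (Free (g (c x)) (c x)) x (m , f)) m f » m≤

 ∈-concatMap : ∀ {a b} {A : Set a} {B : Set b} (f : A -> List B) xs {x y} -> x ∈ xs -> y ∈ f x -> y ∈ concatMap f xs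
 ∈-concatMap f (x ∷ xs) (here refl) m = ∈-++⁺ˡ m
 ∈-concatMap f (x ∷ xs) (there m') m = ∈-++⁺ʳ (f x) (∈-concatMap f xs m' m)

 concatMap-∈ : ∀ {a b} {A : Set a} {B : Set b} (f : A -> List B) xs {y} -> y ∈ concatMap f xs -> ∃[ x ] x ∈ xs × y ∈ f x
 concatMap-∈ f (x ∷ xs) m with ∈-++⁻ (f x) m
 ... | inj₁ m' = x , here refl , m'
 ... | inj₂ m' = let (x' , x∈ , y∈) = concatMap-∈ f xs m' in x' , there x∈ , y∈

 length-concatMap : ∀ {a b} {A : Set a} {B : Set b} (f : A -> List B) xs n -> (∀ x -> length (f x) ≡ n) -> length (concatMap f xs) ≡ length xs * n
 length-concatMap f [] n h = refl
 length-concatMap f (x ∷ xs) n h = length-++ (f x) ∙ cong₂ _+_ (h x) (length-concatMap f xs n h)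

 -- Walks along finitely many Borel maps, and Borel choices on finite components.

 record Ports (S : Sys) : Set₁ where
  open Logic S
  field
   B : ℕ
   port : Fin B -> X -> X
   port-pt : ∀ c -> Pt (port c)
   -- `stay` makes balls grow with the radius, `back` makes nearness symmetric.
   stay : Fin B
   stay-id : ∀ x -> port stay x ≡ x
   back : ∀ c x -> ∃[ c' ] port c' (port c x) ≡ x

 module Geometry (S : Sys) (G : Ports S) where
  open Logic S public
  open Ports G public

  walks : ℕ -> List (X -> X)
  walks zero = id ∷ []
  walks (suc r) = concatMap (λ c -> map (_∘ port c) (walks r)) (allFin B)

  walks-length : ∀ r -> length (walks r) ≡ B ^ r
  walks-length zero = refl
  walks-length (suc r) = (length-concatMap _ (allFin B) (B ^ r) λ c -> length-map _ (walks r) ∙ walks-length r)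
   ∙ cong (_* B ^ r) (length-allFin B)

  walks-pt : ∀ r g -> g ∈ walks r -> Pt g
  walks-pt zero g (here refl) b = b
  walks-pt (suc r) g m b with concatMap-∈ (λ c -> map (_∘ port c) (walks r)) (allFin B) m
  ... | c , _ , m' with ∈-map⁻ (_∘ port c) m'
  ...   | h , h∈ , refl = port-pt c (walks-pt r h h∈ b)

  record near (r : ℕ) (x y : X) : Set where
   constructor via
   field
    {walk} : X -> X
    walk∈ : walk ∈ walks r
    reaches : walk x ≡ y

  ball : ℕ -> X -> List X
  ball r x = map (λ g -> g x) (walks r)

  ball-length : ∀ r x -> length (ball r x) ≡ B ^ r
  ball-length r x = length-map _ (walks r) ∙ walks-length r

  any⇒ : ∀ {a p} {I : Set a} {P : I -> Set p} {is : List I} -> Any P is -> ∃[ i ] i ∈ is × P i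
  any⇒ (here p) = _ , here refl , p
  any⇒ (there a) = let (i , m , p) = any⇒ a in i , there m , p

  ⇒any : ∀ {a p} {I : Set a} {P : I -> Set p} {is : List I} {i} -> i ∈ is -> P i -> Any P is
  ⇒any (here refl) p = here p
  ⇒any (there m) p = there (⇒any m p)

  near⇒ball : ∀ {r x y} -> near r x y -> y ∈ ball r x
  near⇒ball {r} {x} (via g∈ e) = subst (_∈ ball r x) e (∈-map⁺ (λ g -> g x) g∈)

  ball⇒near : ∀ {r x y} -> y ∈ ball r x -> near r x y
  ball⇒near {x = x} m = let (g , g∈ , e) = ∈-map⁻ (λ g -> g x) m in via g∈ (sym e)

  near-step : ∀ {r} c x {y} -> near r (port c x) y -> near (suc r) x y
  near-step {r} c x (via g∈ e) = via (∈-concatMap (λ c -> map (_∘ port c) (walks r)) (allFin B) (∈-allFin c) (∈-map⁺ (_∘ port c) g∈)) e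

  near-unstep : ∀ {r x y} -> near (suc r) x y -> ∃[ c ] near r (port c x) y
  near-unstep {r} (via m e) with concatMap-∈ (λ c -> map (_∘ port c) (walks r)) (allFin B) m
  ... | c , _ , m' with ∈-map⁻ (_∘ port c) m'
  ...   | h , h∈ , refl = c , via h∈ e

  near-refl : ∀ r x -> near r x x
  near-refl zero x = via (here refl) refl
  near-refl (suc r) x = near-step stay x (subst (λ z -> near r z x) (sym (stay-id x)) (near-refl r x))

  near-trans : ∀ {r t x y z} -> near r x y -> near t y z -> near (r + t) x z
  near-trans {zero} (via (here refl) refl) n = n
  near-trans {suc r} {x = x} n n' = let (c , m) = near-unstep n in near-step c x (near-trans m n')

  near-mono : ∀ {r t x y} -> r ≤ t -> near r x y -> near t x y
  near-mono {zero} z≤n (via (here refl) refl) = near-refl _ _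
  near-mono {suc r} {x = x} (s≤s le) n = let (c , m) = near-unstep n in near-step c x (near-mono le m)

  near-sym : ∀ {r x y} -> near r x y -> near r y x
  near-sym {zero} (via (here refl) refl) = near-refl 0 _
  near-sym {suc r} {x} {y} n = let (c , m) = near-unstep n ; (c' , e) = back c x in
   subst (λ t -> near t y x) (+-comm r 1) (near-trans (near-sym m) (near-step {0} c' _ (subst (λ z -> near 0 z x) (sym e) (near-refl 0 x))))

  b-∃near : ∀ {r} (P : X -> X -> Set) -> (∀ g -> Pt g -> Borel (λ x -> P x (g x))) -> Borel (λ x -> ∃[ y ] near r x y × P x y)
  b-∃near {r} P h = b-resp (λ x a -> let (g , g∈ , p) = any⇒ a in g x , via g∈ refl , p)
   (λ { x (y , via g∈ e , p) -> ⇒any g∈ (subst (P x) (sym e) p) })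
   (b-any (walks r) λ g g∈ -> h g (λ b -> walks-pt r g g∈ b))

  b-near : ∀ {g h} r -> Pt g -> Pt h -> Borel (λ x -> near r (g x) (h x))
  b-near r mg mh = b-resp (λ x a -> let (w , w∈ , p) = any⇒ a in via w∈ p) (λ { x (via w∈ e) -> ⇒any w∈ e })
   (b-any (walks r) λ w w∈ -> b-≡ (λ b -> mg (walks-pt r w w∈ b)) mh)

  In : (X -> Set) -> ℕ -> X -> X -> Set
  In W R x y = W x × W y × near R x y

  Conn : (X -> Set) -> ℕ -> X -> X -> Set
  Conn W R = Star (In W R)

  conn-sym : ∀ {W R x y} -> Conn W R x y -> Conn W R y x
  conn-sym nil = nil
  conn-sym ((wx , wy , n) ◅ s) = conn-sym s ◅◅ ((wy , wx , near-sym n) ◅ nil)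

  ComponentFinite : (X -> Set) -> ℕ -> Set
  ComponentFinite W R = ∀ x -> W x -> ∃[ L ] ∀ y -> Conn W R x y -> y ∈ L

  b-reach : ∀ {W P} R -> Borel W -> Borel P -> Borel (λ x -> ∃[ y ] Conn W R x y × P y)
  b-reach {W} {P} R bW bP = b-resp (λ x (m , h) -> to m x h) (λ x (y , s , p) -> from x y s p) (b-∃ enum-ℕ bm)
   where
   Reach : ℕ -> X -> Set
   Reach zero x = P x
   Reach (suc m) x = ∃[ y ] near R x y × (In W R x y × Reach m y)
   bm : ∀ m -> Borel (Reach m)
   bm zero = bP
   bm (suc m) = b-∃near (λ x y -> In W R x y × Reach m y) λ g mg -> b-× (b-× bW (b-× (mg bW) (b-near R pt-id mg))) (mg (bm m))
   to : ∀ m x -> Reach m x -> ∃[ y ] Conn W R x y × P y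
   to zero x p = x , nil , p
   to (suc m) x (y , _ , i , h) = let (z , s , p) = to m y h in z , i ◅ s , p
   from : ∀ x y -> Conn W R x y -> P y -> ∃[ m ] Reach m x
   from x .x nil p = 0 , p
   from x y (i ◅ s) p = let (m , h) = from _ y s p in suc m , _ , snd (snd i) , i , h

  -- A solution on a finite component is chosen through its number in a countable family. The least
  -- good number depends only on the component, and reachability is a countable union over path
  -- lengths, so the choice is Borel.
  module Selection (W : X -> Set) (R ρ : ℕ) (bW : Borel W) (good : ℕ -> X -> Set) (b-good : ∀ n -> Borel (good n))
   (solvable : ∀ x -> W x -> ∃[ n ] ∀ x' -> Conn W R x x' -> ∀ y -> near ρ x' y -> good n y) where

   private
    H : ℕ -> X -> Set
    H n x = ¬ (∃[ x' ] Conn W R x x' × (∃[ y ] near ρ x' y × ¬ good n y))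

    b-H : ∀ n -> Borel (H n)
    b-H n = b-¬ (b-reach R bW (b-∃near (λ _ y -> ¬ good n y) λ g mg -> b-¬ (mg (b-good n))))

   choice : X -> ℕ
   choice = minimum H

   choice-meas : Meas choice
   choice-meas = meas-minimum b-H

   choice-const : ∀ x x' -> In W R x x' -> choice x ≡ choice x'
   choice-const x x' i@(w , w' , n) = minimum-cong H x x' λ n ->
    (λ { h (z , s , bad) -> h (z , i ◅ s , bad) }) , λ { h (z , s , bad) -> h (z , (w' , w , near-sym (snd (snd i))) ◅ s , bad) }

   choice-good : ∀ x y -> W x -> near ρ x y -> good (choice x) y
   choice-good x y w n = byContra λ bad -> fst (minimum-spec H x (let (m , g) = solvable x w in
    m , λ { (x' , s , y' , n' , bad') -> bad' (g x' s y' n') })) (x , nil , y , n , bad)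

  -- A countable family of Borel assignments that realises every pattern on a finite set: decision
  -- lists whose entries are guarded by finite conjunctions of basic sets and their complements. On
  -- a finite set such conjunctions isolate points.
  module Dense (κ k : ℕ) (0<k : 1 ≤ k) where

   private
    Clause : Set
    Clause = List (ℕ × Bool)

    Lit : ℕ × Bool -> X -> Set
    Lit (n , true) x = base n x
    Lit (n , false) x = ¬ base n x

    Sat : Clause -> X -> Set
    Sat [] x = ⊤
    Sat (l ∷ c) x = Lit l x × Sat c x

    Entry : Set
    Entry = Clause × Fin κ × Fin k

    default : Fin k
    default = fromℕ< 0<k

    Fires : Entry -> X -> Fin κ -> Set
    Fires (c , i' , _) x i = i' ≡ i × Sat c x

    eval : List Entry -> X -> Fin κ -> Fin k
    eval [] x i = default
    eval (e ∷ es) x i with dec (Fires e x i)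
    ... | yes _ = snd (snd e)
    ... | no _ = eval es x i

    enum-Entry : Enum (List Entry)
    enum-Entry = enum-List (enum-× (enum-List (enum-× enum-ℕ enum-Bool)) (enum-× (enum-Fin κ) (enum-Fin k)))

    b-Lit : ∀ l -> Borel (Lit l)
    b-Lit (n , true) = base-borel n
    b-Lit (n , false) = b-¬ (base-borel n)

    b-Sat : ∀ c -> Borel (Sat c)
    b-Sat [] = b-⊤
    b-Sat (l ∷ c) = b-× (b-Lit l) (b-Sat c)

    meas-eval : ∀ es i -> Meas (λ x -> eval es x i)
    meas-eval [] i = meas-const default
    meas-eval (e@(c , i' , a) ∷ es) i v = b-resp to from
     (b-⊎ (b-× bF (b-const (a ≡ v))) (b-× (b-¬ bF) (meas-eval es i v)))
     where
     bF : Borel (λ x -> Fires e x i)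
     bF = b-× (b-const (i' ≡ i)) (b-Sat c)
     to : ∀ x -> (Fires e x i × a ≡ v) ⊎ (¬ Fires e x i × eval es x i ≡ v) -> eval (e ∷ es) x i ≡ v
     to x h with dec (Fires e x i)
     to x (inj₁ (_ , q)) | yes f = q
     to x (inj₂ (n , _)) | yes f = ⊥-elim (n f)
     to x (inj₁ (f , _)) | no n = ⊥-elim (n f)
     to x (inj₂ (_ , q)) | no n = q
     from : ∀ x -> eval (e ∷ es) x i ≡ v -> (Fires e x i × a ≡ v) ⊎ (¬ Fires e x i × eval es x i ≡ v)
     from x q with dec (Fires e x i)
     ... | yes f = inj₁ (f , q)
     ... | no n = inj₂ (n , q)

    fromEntries : Maybe (List Entry) -> List Entry
    fromEntries (just es) = es
    fromEntries nothing = []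

   assignment : ℕ -> X -> Fin κ -> Fin k
   assignment n = eval (fromEntries (fst enum-Entry n))

   assignment-meas : ∀ n i -> Meas (λ x -> assignment n x i)
   assignment-meas n = meas-eval (fromEntries (fst enum-Entry n))

   private
    isolate : ∀ x (L : List X) -> ∃[ c ] Sat c x × (∀ y -> y ∈ L -> Sat c y -> y ≡ x)
    isolate x [] = [] , tt , λ y ()
    isolate x (z ∷ L) with isolate x L | dec (z ≡ x)
    ... | c , s , u | yes refl = c , s , λ { y (here e) _ -> e ; y (there m) t -> u y m t }
    ... | c , s , u | no ne with dec (∃[ l ] Lit l x × ¬ Lit l z)
    ...   | yes (l , lx , lz) = l ∷ c , (lx , s) , λ { y (here refl) (ly , _) -> ⊥-elim (lz ly) ; y (there m) (_ , t) -> u y m t }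
    ...   | no nl = ⊥-elim (ne (separates z x λ n ->
      (λ bz -> byContra λ bx -> nl ((n , false) , bx , λ nb -> nb bz)) , (λ bx -> byContra λ bz -> nl ((n , true) , bx , bz))))

    entries : (X -> Fin κ -> Fin k) -> List X -> List X -> List Entry
    entries a L [] = []
    entries a L (x ∷ xs) = map (λ i -> fst (isolate x L) , i , a x i) (allFin κ) ++ entries a L xs

    eval-correct : ∀ a L xs x i -> (∀ {z} -> z ∈ xs -> z ∈ L) -> x ∈ L -> x ∈ xs -> eval (entries a L xs) x i ≡ a x i
    eval-correct a L (z ∷ xs) x i ⊆L x∈L m = go (allFin κ) (case m of λ { (here e) -> inj₁ (e , ∈-allFin i) ; (there m') -> inj₂ m' })
     where
     rest = entries a L xs
     go : ∀ js -> (x ≡ z × i ∈ js) ⊎ x ∈ xs -> eval (map (λ i -> fst (isolate z L) , i , a z i) js ++ rest) x i ≡ a x i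
     go [] (inj₂ m) = eval-correct a L xs x i (⊆L ∘ there) x∈L m
     go (j ∷ js) h with dec (Fires (fst (isolate z L) , j , a z j) x i)
     ... | yes (refl , s) = cong (λ z -> a z i) (sym (snd (snd (isolate z L)) x x∈L s))
     ... | no nf = go js (case h of λ
      { (inj₂ m) -> inj₂ m ; (inj₁ (e , there m)) -> inj₁ (e , m)
      ; (inj₁ (refl , here refl)) -> ⊥-elim (nf (refl , fst (snd (isolate z L)))) })

   assignment-dense : ∀ (L : List X) (a : X -> Fin κ -> Fin k) -> ∃[ n ] ∀ x -> x ∈ L -> ∀ i -> assignment n x i ≡ a x i
   assignment-dense L a = let (n , e) = snd enum-Entry (entries a L L) in
    n , λ x m i -> cong (λ es -> eval (fromEntries es) x i) e ∙ eval-correct a L L x i id m m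

 seqs-length : ∀ {A : Set} (xs : List A) n -> length (seqs xs n) ≡ length xs ^ n
 seqs-length xs zero = refl
 seqs-length xs (suc n) = length-concatMap (λ x -> map (x ∷_) (seqs xs n)) xs (length xs ^ n) λ x -> length-map (x ∷_) (seqs xs n) ∙ seqs-length xs n

 ∈seqs : ∀ {A : Set} (xs : List A) l -> All (_∈ xs) l -> l ∈ seqs xs (length l)
 ∈seqs xs [] [] = here refl
 ∈seqs xs (x ∷ l) (m ∷ ms) = ∈-concatMap (λ x -> map (x ∷_) (seqs xs (length l))) xs m (∈-map⁺ (x ∷_) (∈seqs xs l ms))

 seqs∈ : ∀ {A : Set} (xs : List A) n {l} -> l ∈ seqs xs n -> All (_∈ xs) l × length l ≡ n
 seqs∈ xs zero (here refl) = [] , refl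
 seqs∈ xs (suc n) m with concatMap-∈ (λ x -> map (x ∷_) (seqs xs n)) xs m
 ... | x , x∈ , m' with ∈-map⁻ (x ∷_) m'
 ...   | l , l∈ , refl = let (a , e) = seqs∈ xs n l∈ in x∈ ∷ a , cong suc e

 1≤* : ∀ {a b} -> 1 ≤ a -> 1 ≤ b -> 1 ≤ a * b
 1≤* p q = *≤ p q

 1≤^ : ∀ {a} n -> 1 ≤ a -> 1 ≤ a ^ n
 1≤^ zero p = ≤-refl
 1≤^ (suc n) p = 1≤* p (1≤^ n p)

 *-cancel : ∀ {a b c} -> 1 ≤ c -> a * c ≤ b * c -> a ≤ b
 *-cancel {c = c} p = *-cancelʳ-≤ _ _ c {{ℕ.>-nonZero p}}

 ^-* : ∀ a b n -> (a * b) ^ n ≡ a ^ n * b ^ n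
 ^-* a b zero = refl
 ^-* a b (suc n) = cong (a * b *_) (^-* a b n) ∙ *-interchange a b (a ^ n) (b ^ n)

 n≤2^n : ∀ n -> n ≤ 2 ^ n
 n≤2^n zero = z≤n
 n≤2^n (suc n) = +≤ (1≤^ {2} n (s≤s z≤n)) (n≤2^n n) » from≡ (cong (2 ^ n +_) (sym (+-identityʳ _)))

 n<2^n : ∀ n -> n < 2 ^ n
 n<2^n zero = s≤s z≤n
 n<2^n (suc n) = +≤ (1≤^ {2} n (s≤s z≤n)) (n<2^n n) » from≡ (cong (2 ^ n +_) (sym (+-identityʳ _)))

 b^x≤ : ∀ b x -> b ^ x ≤ 2 ^ (b * x)
 b^x≤ b x = ^-monoˡ-≤ x (n≤2^n b) » from≡ (^-*-assoc 2 b x)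

 -- Polynomial against exponential growth.

 Poly : (ℕ -> ℕ) -> Set
 Poly f = ∃[ a ] ∃[ d ] ∀ x -> f x ≤ a * suc x ^ d

 p-≤ : ∀ {f f'} -> (∀ x -> f x ≤ f' x) -> Poly f' -> Poly f
 p-≤ le (a , d , h) = a , d , λ x -> le x » h x

 p-const : ∀ c -> Poly (λ _ -> c)
 p-const c = c , 0 , λ x -> from≡ (sym (*-identityʳ c))

 p-id : Poly (λ x -> x)
 p-id = 1 , 1 , λ x -> n≤1+n x » from≡ (sym (*-identityˡ _ ∙ *-identityʳ _))

 p-+ : ∀ {f f'} -> Poly f -> Poly f' -> Poly (λ x -> f x + f' x)
 p-+ {f} {f'} (a , d , h) (a' , d' , h') = a + a' , d + d' , λ x -> begin
  _ ≤⟨ +≤ (h x) (h' x) ⟩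
  _ ≤⟨ +≤ (*≤ʳ a (^-monoʳ-≤ (suc x) (m≤m+n d d'))) (*≤ʳ a' (^-monoʳ-≤ (suc x) (m≤n+m d' d))) ⟩
  _ ≡⟨ sym (*-distribʳ-+ (suc x ^ (d + d')) a a') ⟩
  _ ∎

 p-* : ∀ {f f'} -> Poly f -> Poly f' -> Poly (λ x -> f x * f' x)
 p-* {f} {f'} (a , d , h) (a' , d' , h') = a * a' , d + d' , λ x -> begin
  _ ≤⟨ *≤ (h x) (h' x) ⟩
  _ ≡⟨ *-interchange a (suc x ^ d) a' (suc x ^ d') ⟩
  _ ≡⟨ cong (a * a' *_) (sym (^-distribˡ-+-* (suc x) d d')) ⟩
  _ ∎

 p-^ : ∀ {f} t -> Poly f -> Poly (λ x -> f x ^ t)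
 p-^ zero p = p-const 1
 p-^ (suc t) p = p-* p (p-^ t p)

 halved : ∀ x -> ∃[ z ] z + z ≤ x × x ≤ suc (z + z)
 halved zero = 0 , z≤n , z≤n
 halved (suc zero) = 0 , z≤n , ≤-refl
 halved (suc (suc x)) = let (z , lo , hi) = halved x in suc z , s≤s (from≡ (+-suc z z) » s≤s lo) , s≤s (s≤s hi » from≡ (cong suc (sym (+-suc z z))))

 monomial<exp : ∀ d a -> ∃[ x₀ ] ∀ x -> x₀ ≤ x -> a * suc x ^ d ≤ 2 ^ x
 monomial<exp zero a = a , λ x le -> from≡ (*-identityʳ a) » n≤2^n a » ^-monoʳ-≤ 2 le
 monomial<exp (suc d) a = let (z₀ , ih) = monomial<exp d (a * 2 ^ suc d) in suc (z₀ + z₀) , λ x le -> let (z , lo , hi) = halved x in begin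
   _ ≤⟨ *≤ʳ a (^-monoˡ-≤ (suc d) (s≤s hi » from≡ (ring8 z))) ⟩
   _ ≡⟨ cong (a *_) (^-* 2 (suc z) (suc d)) ⟩
   _ ≡⟨ ring9 a (2 ^ suc d) (suc z) (suc z ^ d) ⟩
   _ ≤⟨ *≤ (n<2^n z) (ih z (≮⇒≥ λ lt -> <⇒≱ (+≤ lt (<⇒≤ lt)) (≤-pred (le » hi)))) ⟩
   _ ≡⟨ sym (^-distribˡ-+-* 2 z z) ⟩
   _ ≤⟨ ^-monoʳ-≤ 2 lo ⟩
   2 ^ x ∎

 abstract
  poly≤exp : ∀ {f} -> Poly f -> ∃[ x₀ ] ∀ x -> x₀ ≤ x -> f x ≤ 2 ^ x
  poly≤exp (a , d , h) = let (x₀ , le) = monomial<exp d a in x₀ , λ x l -> h x » le x l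

  -- Supplies the tuple length of the second sweep: t is the number of stages, and an + b bounds the
  -- growth in one stage.
  poly<exp : ∀ a b t -> ∃[ n ] (a * n + b) ^ t < 2 ^ suc n
  poly<exp a b t = let (n , h) = poly≤exp (p-^ t (p-+ (p-* (p-const a) p-id) (p-const b))) in
   n , ≤-<-trans (h n ≤-refl) (^-monoʳ-< 2 (s≤s (s≤s z≤n)) (n<1+n n))

 -- All members of a tuple dangerous at the end would cost more than the potential can gain.
 squeeze : ∀ n {K P q L pot₀ pot₁} -> 1 ≤ K -> 1 ≤ P -> 1 ≤ q ->
  pot₀ * (2 * (q * q) * P) ^ suc n ≤ q ^ (n + n) * K ^ suc n -> pot₁ ≤ L * pot₀ -> K ^ suc n ≤ pot₁ * P ^ suc n -> 2 ^ suc n ≤ L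
 squeeze n {K} {P} {q} {L} {pot₀} {pot₁} 0<K 0<P 0<q init gain end =
  *-cancel (1≤* (1≤^ m 0<K) (1≤* (1≤^ m (1≤* 0<q 0<q)) (1≤^ m 0<P))) (begin
   _ ≡⟨ ring10 (2 ^ m) (K ^ m) ((q * q) ^ m) (P ^ m) ⟩
   _ ≡⟨ cong (K ^ m *_) (sym (^-* (2 * (q * q)) P m ∙ cong (_* P ^ m) (^-* 2 (q * q) m))) ⟩
   _ ≤⟨ *≤ˡ ((2 * (q * q) * P) ^ m) end ⟩
   _ ≤⟨ *≤ˡ ((2 * (q * q) * P) ^ m) (*≤ˡ (P ^ m) gain) ⟩
   _ ≡⟨ ring11 L pot₀ (P ^ m) ((2 * (q * q) * P) ^ m) ⟩
   _ ≤⟨ *≤ʳ (L * P ^ m) init ⟩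
   _ ≤⟨ *≤ʳ (L * P ^ m) (*≤ˡ (K ^ m) bigger) ⟩
   _ ≡⟨ ring12 L (P ^ m) ((q * q) ^ m) (K ^ m) ⟩
   _ ∎)
  where
  m = suc n
  bigger : q ^ (n + n) ≤ (q * q) ^ m
  bigger = from≡ (^-distribˡ-+-* q n n ∙ sym (^-* q q n)) » ^-monoʳ-≤ (q * q) {{ℕ.>-nonZero (1≤* 0<q 0<q)}} (n≤1+n n)

 -- Bernoulli inequalities and Chernoff bounds in integers.

 -- (1 − 1/M)ⁿ ≥ 1 − n/M for M = a + 1.
 bernoulli⁻ : ∀ a n -> suc a ^ n * suc a ≤ a ^ n * suc a + n * suc a ^ n
 bernoulli⁻ a zero = from≡ (sym (+-identityʳ _))
 bernoulli⁻ a (suc n) = begin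
  _ ≡⟨ *-assoc M (M ^ n) M ⟩
  _ ≤⟨ *≤ʳ M (bernoulli⁻ a n) ⟩
  _ ≡⟨ ring25 a (a ^ n) n (M ^ n) ⟩
  _ ≤⟨ +≤ʳ (a * a ^ n * M) (+≤ˡ (n * (M * M ^ n)) (*≤ʳ M (^-monoˡ-≤ n (n≤1+n a)))) ⟩
  _ ∎
  where
  M = suc a

 -- (1 + 1/N)ʳ ≥ 1 + r/N
 bernoulli⁺ : ∀ N r -> (N + r) * N ^ r ≤ N * suc N ^ r
 bernoulli⁺ N zero = from≡ (cong (_* 1) (+-identityʳ N))
 bernoulli⁺ N (suc r) = begin
  _ ≤⟨ m≤m+n _ (r * N ^ r) ⟩
  _ ≡⟨ ring26 N r (N ^ r) ⟩
  _ ≤⟨ *≤ʳ (suc N) (bernoulli⁺ N r) ⟩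
  _ ≡⟨ x∙yz≈y∙xz (suc N) N (suc N ^ r) ⟩
  _ ∎

 -- With G = g + 2: (1 + 1/(Gℓ))^ℓ ≤ G/(G − 1).
 step₁ : ∀ g ℓ -> 1 ≤ ℓ -> suc ((2 + g) * ℓ) ^ ℓ * suc g ≤ ((2 + g) * ℓ) ^ ℓ * (2 + g)
 step₁ g ℓ 0<ℓ = *-cancel {c = suc N} (s≤s z≤n) (begin
  _ ≡⟨ *-assoc M^ (suc g) (suc N) ⟩
  _ ≤⟨ *≤ʳ M^ (m≤m+n _ 1 » from≡ (ring27 g ℓ)) ⟩
  _ ≡⟨ x∙yz≈y∙xz M^ G (suc (suc g * ℓ)) ⟩
  _ ≤⟨ *≤ʳ G bern ⟩
  _ ≡⟨ x∙yz≈yx∙z G (N ^ ℓ) (suc N) ⟩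
  _ ∎)
  where
  G = 2 + g
  N = G * ℓ
  M^ = suc N ^ ℓ
  bern : M^ * suc (suc g * ℓ) ≤ N ^ ℓ * suc N
  bern = +-cancelʳ-≤ (ℓ * M^) _ _ (from≡ (ring15 M^ g ℓ) » bernoulli⁻ N ℓ)

 -- With G = g + 2: Bernoulli gives (1 - 1/G²)^G ≥ 1 - 1/G, and (1 - 1/G)(1 + 1/G)² ≥ 1; hence (G/(G
 -- - 1))^G ≤ ((G + 1)/G)^(G + 2).
 step₂ : ∀ g -> (2 + g) ^ (2 + g) * (2 + g) ^ (4 + g) ≤ suc g ^ (2 + g) * (3 + g) ^ (4 + g)
 step₂ g = *-cancel {c = suc g * G} (s≤s z≤n) (begin
  _ ≡⟨ ring28 (G ^ G) g ⟩
  _ ≤⟨ *≤ˡ (G * G) bern ⟩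
  _ ≤⟨ rest ⟩
  _ ∎)
  where
  G = 2 + g
  a : ℕ
  a = suc g * (3 + g)
  sq : suc a ≡ G * G
  sq = ring16 g
  bern : (G ^ G * G ^ G) * (suc g * G) ≤ (suc g ^ G * (3 + g) ^ G) * (G * G)
  bern = +-cancelʳ-≤ (G * (G ^ G * G ^ G)) _ _ (begin
   _ ≡⟨ ring17 (G ^ G * G ^ G) g ⟩
   _ ≡⟨ cong₂ _*_ (sym (^-* G G G)) refl ⟩
   _ ≡⟨ cong (λ s -> s ^ G * s) (sym sq) ⟩
   _ ≤⟨ bernoulli⁻ a G ⟩
   _ ≡⟨ cong₂ _+_ (cong₂ _*_ (^-* (suc g) (3 + g) G) sq) (cong (G *_) (cong (_^ G) sq ∙ ^-* G G G)) ⟩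
   _ ∎)
  rest : (suc g ^ G * (3 + g) ^ G) * (G * G) * (G * G) ≤ suc g ^ G * ((3 + g) * ((3 + g) * (3 + g) ^ G)) * (suc g * G)
  rest = (from≡ (ring18 (suc g ^ G) ((3 + g) ^ G) g) » *≤ʳ (suc g ^ G * (3 + g) ^ G * (2 + g)) (m≤m+n _ (1 + 3 * g + g * g) » from≡ (ring19 g))) » from≡ (ring20 (suc g ^ G) ((3 + g) ^ G) g)

 -- Powers of `step₁` and `step₂` combined. The exponential moment of a sum of mean Gν is at most (1
 -- + 1/G)^((G+2)ν); this fixes the relative deviation 2/G allowed everywhere below.
 step₃ : ∀ g ℓ ν -> 1 ≤ ℓ -> suc ((2 + g) * ℓ) ^ ((2 + g) * ν * ℓ) * (2 + g) ^ ((4 + g) * ν) ≤ ((2 + g) * ℓ) ^ ((2 + g) * ν * ℓ) * (3 + g) ^ ((4 + g) * ν)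
 step₃ g ℓ ν 0<ℓ = subst₂ _≤_ (pow (suc N) G) (pow N (3 + g)) (^-monoˡ-≤ ν one)
  where
  G = 2 + g
  N = G * ℓ
  pow : ∀ x y -> (x ^ (ℓ * G) * y ^ (4 + g)) ^ ν ≡ x ^ (G * ν * ℓ) * y ^ ((4 + g) * ν)
  pow x y = ^-* (x ^ (ℓ * G)) (y ^ (4 + g)) ν ∙ cong₂ _*_ (^-*-assoc x (ℓ * G) ν ∙ cong (x ^_) (ring21 ℓ G ν)) (^-*-assoc y (4 + g) ν)
  one : suc N ^ (ℓ * G) * G ^ (4 + g) ≤ N ^ (ℓ * G) * (3 + g) ^ (4 + g)
  one = *-cancel {c = suc g ^ G} (1≤^ G (s≤s z≤n)) (begin
   _ ≡⟨ cong (λ x -> x * G ^ (4 + g) * suc g ^ G) (sym (^-*-assoc (suc N) ℓ G)) ⟩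
   _ ≡⟨ xy∙z≈xz∙y ((suc N ^ ℓ) ^ G) (G ^ (4 + g)) (suc g ^ G) ⟩
   _ ≡⟨ cong (_* G ^ (4 + g)) (sym (^-* (suc N ^ ℓ) (suc g) G)) ⟩
   _ ≤⟨ *≤ˡ (G ^ (4 + g)) (^-monoˡ-≤ G (step₁ g ℓ 0<ℓ)) ⟩
   _ ≡⟨ cong (_* G ^ (4 + g)) (^-* (N ^ ℓ) G G) ⟩
   _ ≡⟨ *-assoc ((N ^ ℓ) ^ G) (G ^ G) _ ⟩
   _ ≤⟨ *≤ʳ ((N ^ ℓ) ^ G) (step₂ g) ⟩
   _ ≡⟨ cong (_* (suc g ^ G * (3 + g) ^ (4 + g))) (^-*-assoc N ℓ G) ⟩
   _ ≡⟨ x∙yz≈xz∙y (N ^ (ℓ * G)) (suc g ^ G) ((3 + g) ^ (4 + g)) ⟩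
   _ ∎)

 -- From (1 + 1/G)^G ≥ 2 for G = g + 1: every further G units of deviation halve the probability.
 doubling : ∀ g h -> suc g ^ (suc g * h) * 2 ^ h ≤ (2 + g) ^ (suc g * h)
 doubling g h = subst₂ _≤_ (^-* (G ^ G) 2 h ∙ cong (_* 2 ^ h) (^-*-assoc G G h)) (^-*-assoc (suc G) G h) (^-monoˡ-≤ h base)
  where
  G = suc g
  base : G ^ G * 2 ≤ suc G ^ G
  base = *-cancel {c = G} (s≤s z≤n) (from≡ (ring22 (G ^ G) G) » bernoulli⁺ G G » from≡ (*-comm G _))

 moment⇒tail : ∀ g ℓ ν h (e K : ℕ) -> 1 ≤ ℓ ->
  e * (3 + g) ^ ((4 + g) * ν + (2 + g) * h) * ((2 + g) * ℓ) ^ ((2 + g) * ν * ℓ) ≤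
   (2 + g) ^ ((4 + g) * ν + (2 + g) * h) * K * suc ((2 + g) * ℓ) ^ ((2 + g) * ν * ℓ) ->
  e * 2 ^ h ≤ K
 moment⇒tail g ℓ ν h e K 0<ℓ hyp = *-cancel {c = G ^ y} (1≤^ y (s≤s z≤n)) (begin
   _ ≡⟨ xy∙z≈x∙zy e (2 ^ h) (G ^ y) ⟩
   _ ≤⟨ *≤ʳ e (doubling (suc g) h) ⟩
   _ ≤⟨ *-cancel {c = H ^ x * (N ^ z * G ^ x)} (1≤* (1≤^ x (s≤s z≤n)) (1≤* (1≤^ z (1≤* {G} (s≤s z≤n) 0<ℓ)) (1≤^ x (s≤s z≤n)))) big ⟩
   _ ≡⟨ *-comm (G ^ y) K ⟩
   _ ∎)
  where
  G = 2 + g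
  H = 3 + g
  N = G * ℓ
  x = (4 + g) * ν
  y = G * h
  z = G * ν * ℓ
  big : e * H ^ y * (H ^ x * (N ^ z * G ^ x)) ≤ G ^ y * K * (H ^ x * (N ^ z * G ^ x))
  big = begin
   _ ≡⟨ ring23 e (H ^ y) (H ^ x) (N ^ z) (G ^ x) ⟩
   _ ≡⟨ cong (λ t -> e * t * N ^ z * G ^ x) (sym (^-distribˡ-+-* H x y)) ⟩
   _ ≤⟨ *≤ˡ (G ^ x) hyp ⟩
   _ ≡⟨ *-assoc (G ^ (x + y) * K) (suc N ^ z) (G ^ x) ⟩
   _ ≤⟨ *≤ʳ (G ^ (x + y) * K) (step₃ g ℓ ν 0<ℓ) ⟩
   _ ≡⟨ cong (λ t -> t * K * (N ^ z * H ^ x)) (^-distribˡ-+-* G x y) ⟩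
   _ ≡⟨ ring24 (G ^ x) (G ^ y) K (N ^ z) (H ^ x) ⟩
   _ ∎

 ∏-bernoulli : ∀ {a} {I : Set a} N (is : List I) (r : I -> ℕ) -> ∏ is (λ i -> N + r i) * N ^ ∑ is r ≤ N ^ length is * suc N ^ ∑ is r
 ∏-bernoulli N [] r = ≤-refl
 ∏-bernoulli N (i ∷ is) r = begin
  _ ≡⟨ cong ((N + r i) * ∏ is (λ i -> N + r i) *_) (^-distribˡ-+-* N (r i) _) ⟩
  _ ≡⟨ *-interchange (N + r i) _ (N ^ r i) _ ⟩
  _ ≤⟨ *≤ (bernoulli⁺ N (r i)) (∏-bernoulli N is r) ⟩
  _ ≡⟨ *-interchange N (suc N ^ r i) (N ^ length is) _ ⟩
  _ ≡⟨ cong (N * N ^ length is *_) (sym (^-distribˡ-+-* (suc N) (r i) _)) ⟩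
  _ ∎

 ∏-bernoulli-≤ : ∀ {a} {I : Set a} N (is : List I) (r : I -> ℕ) R -> ∑ is r ≤ R -> ∏ is (λ i -> N + r i) * N ^ R ≤ N ^ length is * suc N ^ R
 ∏-bernoulli-≤ N is r R le = begin
  _ ≡⟨ cong (λ t -> ∏ is (λ i -> N + r i) * N ^ t) (sym (m+[n∸m]≡n le)) ⟩
  _ ≡⟨ cong (∏ is (λ i -> N + r i) *_) (^-distribˡ-+-* N s _) ⟩
  _ ≡⟨ sym (*-assoc (∏ is (λ i -> N + r i)) _ _) ⟩
  _ ≤⟨ *≤ (∏-bernoulli N is r) (^-monoˡ-≤ (R ∸ s) (n≤1+n N)) ⟩
  _ ≡⟨ *-assoc (N ^ length is) _ _ ⟩
  _ ≡⟨ cong (N ^ length is *_) (sym (^-distribˡ-+-* (suc N) s _)) ⟩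
  _ ≡⟨ cong (λ t -> N ^ length is * suc N ^ t) (m+[n∸m]≡n le) ⟩
  _ ∎
  where
  s = ∑ is r

 module Tails {Z : Set} (k : ℕ) where
  open Prob {Z} k

  E-++ : ∀ S xs ys G ω -> E S (xs ++ ys) G ω ≡ E S xs (E S ys G) ω
  E-++ S [] ys G ω = refl
  E-++ S (x ∷ xs) ys G ω = ∑-cong vals λ a -> E-++ S xs ys G _

  E-pull : ∀ {D g} -> DependsOn D g -> ∀ xs F ω -> (∀ z -> z ∈ xs -> ¬ D z) -> E₀ xs (λ ω -> g ω * F ω) ω ≡ g ω * E₀ xs F ω
  E-pull d [] F ω h = refl
  E-pull {D} {g} d (x ∷ xs) F ω h = (∑-cong vals λ a -> (E-pull d xs F (upd x a ω) λ z m -> h z (there m))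
    ∙ cong (_* E₀ xs F (upd x a ω)) (d _ _ λ z dz -> upd-other x a ω z λ { refl -> h z (here refl) dz })) ∙ ∑-*ˡ vals (g ω) _

  E-pullʳ : ∀ {D g} -> DependsOn D g -> ∀ xs F ω -> (∀ z -> z ∈ xs -> ¬ D z) -> E₀ xs (λ ω -> F ω * g ω) ω ≡ E₀ xs F ω * g ω
  E-pullʳ {g = g} d xs F ω h = E-cong none xs (λ ω -> *-comm (F ω) (g ω)) ω ∙ E-pull d xs F ω h ∙ *-comm (g ω) _

 ∑-tabulate : ∀ {a} {A : Set a} n (f : Fin n -> A) F -> ∑ (List.tabulate f) F ≡ ∑ (allFin n) (F ∘ f)
 ∑-tabulate zero f F = refl
 ∑-tabulate (suc n) f F = cong (F (f fzero) +_) (∑-tabulate n (f ∘ fsuc) F ∙ sym (∑-tabulate n fsuc (F ∘ f)))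

 ∑-Fin-suc : ∀ n (F : Fin (suc n) -> ℕ) -> ∑ (allFin (suc n)) F ≡ F fzero + ∑ (allFin n) (F ∘ fsuc)
 ∑-Fin-suc n F = cong (F fzero +_) (∑-tabulate n fsuc F)

 -- ⌈a / (b + 1)⌉. A divisor d is passed as d - 1 in the form to which it unfolds: `suc g + n' * G`
 -- stands for the divisor (n' + 1) G, where G = g + 2.
 ceil : ℕ -> ℕ -> ℕ
 ceil a b with dec (∃[ ν ] a ≤ suc b * ν)
 ... | yes (ν , le) = fst (least (λ ν -> a ≤ suc b * ν) ν le)
 ... | no _ = 0

 ceil-≥ : ∀ a b -> a ≤ suc b * ceil a b
 ceil-≥ a b with dec (∃[ ν ] a ≤ suc b * ν)
 ... | yes (ν , le) = fst (snd (least (λ ν -> a ≤ suc b * ν) ν le))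
 ... | no n = ⊥-elim (n (a , m≤m+n a (b * a)))

 ceil-least : ∀ a b ν -> a ≤ suc b * ν -> ceil a b ≤ ν
 ceil-least a b ν le with dec (∃[ ν ] a ≤ suc b * ν)
 ... | yes (ν' , le') = fst (snd (snd (least (λ ν -> a ≤ suc b * ν) ν' le'))) ν le
 ... | no n = z≤n

 ceil-< : ∀ a b -> suc b * ceil a b ≤ a + suc b
 ceil-< a b = go (ceil a b) refl
  where
  go : ∀ ν -> ceil a b ≡ ν -> suc b * ν ≤ a + suc b
  go zero e = from≡ (*-zeroʳ b) » z≤n
  go (suc ν) e = from≡ (cong (suc b *_) (+-comm 1 ν) ∙ *-distribˡ-+ (suc b) ν 1 ∙ cong (suc b * ν +_) (*-identityʳ (suc b)))
   » +≤ˡ (suc b) (<⇒≤ (≰⇒> λ le -> 1+n≰n (from≡ (sym e) » ceil-least a b ν le)))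

 root-≤ : ∀ {a b} n -> a ^ suc n ≤ b ^ suc n -> a ≤ b
 root-≤ {a} {b} n h = ≮⇒≥ λ lt -> <⇒≱ (ℕ.^-monoˡ-< (suc n) lt) h

 -- ((N+X)/N)^(1/X) decreases in X.
 power-step : ∀ N X -> (N + suc X) ^ X * N ≤ (N + X) ^ X * (N + X)
 power-step N X = +-cancelʳ-≤ (M ^ X) _ _ (begin
  _ ≡⟨ ring37 (M ^ X) N ⟩
  _ ≤⟨ +-cancelʳ-≤ (X * M ^ X) _ _ bern ⟩
  _ ≡⟨ ring38 (a ^ X) a ⟩
  _ ≤⟨ +≤ʳ (a ^ X * a) (^-monoˡ-≤ X (n≤1+n a » from≡ (sym (+-suc N X)))) ⟩
  _ ∎)
  where
  a = N + X
  M = N + suc X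
  bern : M ^ X * suc N + X * M ^ X ≤ a ^ X * suc a + X * M ^ X
  bern = begin
   _ ≡⟨ ring39 (M ^ X) N X ⟩
   _ ≡⟨ cong (λ m -> m ^ X * suc a) (+-suc N X) ⟩
   _ ≤⟨ bernoulli⁻ a X ⟩
   _ ≡⟨ cong (λ m -> a ^ X * suc a + X * m ^ X) (sym (+-suc N X)) ⟩
   _ ∎

 -- Concavity of the logarithm, X log(1 + τ/N) ≤ τ log(1 + X/N), by downward induction from X = τ.
 -- `power-step` compares X + 1 with X, and the common exponent X + 1 is removed by taking a root.
 concave : ∀ N τ X j -> X + j ≡ τ -> (N + τ) ^ X * N ^ τ ≤ (N + X) ^ τ * N ^ X
 concave N τ X zero e = from≡ (*-comm ((N + τ) ^ X) (N ^ τ) ∙ cong₂ (λ x t -> N ^ t * (N + τ) ^ x) x≡τ (sym x≡τ) ∙ *-comm (N ^ X) _ ∙ cong (λ x -> (N + x) ^ τ * N ^ X) (sym x≡τ))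
  where
  x≡τ = sym (+-identityʳ X) ∙ e
 concave N τ X (suc j) e = root-≤ X (begin
  _ ≡⟨ ^-* ((N + τ) ^ X) (N ^ τ) (suc X) ∙ cong₂ _*_ (^-*-assoc (N + τ) X (suc X)) (^-*-assoc N τ (suc X)) ⟩
  _ ≡⟨ cong₂ _*_ (cong ((N + τ) ^_) (*-comm X (suc X))) (cong (N ^_) (ring40 τ X) ∙ ^-distribˡ-+-* N τ (τ * X)) ⟩
  _ ≡⟨ x∙yz≈y∙xz ((N + τ) ^ (suc X * X)) (N ^ τ) (N ^ (τ * X)) ⟩
  _ ≡⟨ cong (N ^ τ *_) (sym (^-* ((N + τ) ^ suc X) (N ^ τ) X ∙ cong₂ _*_ (^-*-assoc (N + τ) (suc X) X) (^-*-assoc N τ X))) ⟩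
  _ ≤⟨ *≤ʳ (N ^ τ) (^-monoˡ-≤ X (concave N τ (suc X) j (sym (+-suc X j) ∙ e))) ⟩
  _ ≡⟨ cong (N ^ τ *_) (^-* ((N + suc X) ^ τ) (N ^ suc X) X ∙ cong₂ _*_ (^-*-assoc (N + suc X) τ X ∙ cong ((N + suc X) ^_) (*-comm τ X) ∙ sym (^-*-assoc (N + suc X) X τ)) (^-*-assoc N (suc X) X)) ⟩
  _ ≡⟨ x∙yz≈yx∙z (N ^ τ) (((N + suc X) ^ X) ^ τ) (N ^ (suc X * X)) ⟩
  _ ≡⟨ cong (_* N ^ (suc X * X)) (sym (^-* ((N + suc X) ^ X) N τ)) ⟩
  _ ≤⟨ *≤ˡ (N ^ (suc X * X)) (^-monoˡ-≤ τ (power-step N X)) ⟩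
  _ ≡⟨ cong₂ _*_ (cong (_^ τ) (*-comm ((N + X) ^ X) (N + X)) ∙ ^-*-assoc (N + X) (suc X) τ ∙ cong ((N + X) ^_) (*-comm (suc X) τ) ∙ sym (^-*-assoc (N + X) τ (suc X))) (cong (N ^_) (*-comm (suc X) X) ∙ sym (^-*-assoc N X (suc X))) ⟩
  _ ≡⟨ sym (^-* ((N + X) ^ τ) (N ^ X) (suc X)) ⟩
  _ ∎)

 -- (1 − 1/k)ᵗ (1 − (a − t)/k) ≤ k/(k + a)
 survival : ∀ k' t b -> t + b ≤ suc k' -> k' ^ t * (suc k' ∸ b) * (suc k' + (t + b)) ≤ suc k' ^ t * (suc k' * suc k')
 survival k' t b le = *-cancel {c = k ^ t} (1≤^ t (s≤s z≤n)) (begin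
  _ ≡⟨ ring41 (k' ^ t) (k ∸ b) (k + (t + b)) (k ^ t) ⟩
  _ ≤⟨ *≤ʳ (k' ^ t * k ^ t) coin ⟩
  _ ≡⟨ ring42 (k' ^ t) (k ^ t) (k + t) k ⟩
  _ ≤⟨ *≤ˡ k (*≤ʳ (k' ^ t) (bernoulli⁺ k t)) ⟩
  _ ≡⟨ ring43 (k' ^ t) k (suc k ^ t) ⟩
  _ ≤⟨ *≤ˡ (k * k) (from≡ (sym (^-* k' (suc k) t)) » ^-monoˡ-≤ t (n≤1+n _ » from≡ (ring45 k')) » from≡ (^-* k k t)) ⟩
  _ ≡⟨ ring44 (k ^ t) (k * k) ⟩
  _ ∎)
  where
  k = suc k'
  coin : (k ∸ b) * (k + (t + b)) ≤ (k + t) * k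
  coin = from≡ (cong (λ x -> (k ∸ b) * (x + (t + b))) (sym e)) » m≤m+n _ (b * (b + t)) » from≡ (ring34 (k ∸ b) b t ∙ cong₂ (λ x y -> (x + t) * y) e e)
   where
   e : b + (k ∸ b) ≡ k
   e = m+[n∸m]≡n (m≤n+m b t » le)

 -- At each a at most one factor is below its maximum. Where the first factor is, the product of the
 -- others is maximal, so the two are negatively correlated (`chebyshev`), and induction splits off
 -- one factor after the other.
 ∑∏-negative : ∀ {A C : Set} (as : List A) (cs : List C) (z : C -> A -> ℕ) (x : C -> ℕ) -> (∀ c a -> z c a ≤ x c) ->
  AllPairs (λ c c' -> ∀ a -> z c a ≡ x c ⊎ z c' a ≡ x c') cs ->
  length as ^ length cs * ∑ as (λ a -> ∏ cs λ c -> z c a) ≤ length as * ∏ cs (λ c -> ∑ as (z c))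
 ∑∏-negative as [] z x le ap = from≡ (*-identityˡ _ ∙ ∑-const as 1 ∙ refl)
 ∑∏-negative as (c ∷ cs) z x le (one ∷ ap) = begin
   _ ≡⟨ xy∙z≈y∙xz k (k ^ length cs) _ ⟩
   _ ≤⟨ *≤ʳ (k ^ length cs) chebyshev ⟩
   _ ≡⟨ x∙yz≈y∙xz (k ^ length cs) (∑ as (z c)) (∑ as Π) ⟩
   _ ≤⟨ *≤ʳ (∑ as (z c)) (∑∏-negative as cs z x le ap) ⟩
   _ ≡⟨ x∙yz≈y∙xz (∑ as (z c)) k _ ⟩
   _ ∎
  where
  k = length as
  Π = λ a -> ∏ cs λ c -> z c a
  Πmax = ∏ cs x
  d = λ a -> x c ∸ z c a
  Π≤ : ∀ a -> Π a ≤ Πmax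
  Π≤ a = ∏-mono∈ cs λ c _ -> le c a
  zd : ∀ a -> z c a + d a ≡ x c
  zd a = m+[n∸m]≡n (le c a)
  full : ∀ a -> d a * Π a ≡ d a * Πmax
  full a = cases (z c a ≡ x c) (λ e -> cong (_* Π a) (zero' e) ∙ sym (cong (_* Πmax) (zero' e)))
   (λ ne -> cong (d a *_) (∏-cong∈ cs λ c' m -> case All-∈ one m a of λ { (inj₁ e) -> ⊥-elim (ne e) ; (inj₂ e) -> e }))
   where
   zero' : z c a ≡ x c -> d a ≡ 0
   zero' e = cong (x c ∸_) e ∙ ℕ.n∸n≡0 (x c)
  chebyshev : k * ∑ as (λ a -> z c a * Π a) ≤ ∑ as (z c) * ∑ as Π
  chebyshev = +-cancelʳ-≤ (∑ as d * ∑ as Π) _ _ (begin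
   _ ≤⟨ +≤ʳ (k * ∑ as (λ a -> z c a * Π a)) (begin
    _ ≤⟨ *≤ʳ (∑ as d) (∑-≤const as Πmax λ a _ -> Π≤ a) ⟩
    _ ≡⟨ x∙yz≈y∙xz (∑ as d) k Πmax ⟩
    _ ≡⟨ cong (k *_) (sym (∑-*ʳ as d Πmax) ∙ (∑-cong as λ a -> sym (full a))) ⟩
    _ ∎) ⟩
   _ ≡⟨ sym (*-distribˡ-+ k _ _) ⟩
   _ ≡⟨ cong (k *_) (sym (∑-+ as _ _) ∙ (∑-cong as λ a -> sym (*-distribʳ-+ (Π a) (z c a) (d a)) ∙ cong (_* Π a) (zd a)) ∙ ∑-*ˡ as (x c) Π) ⟩
   _ ≡⟨ sym (*-assoc k (x c) _) ⟩
   _ ≡⟨ cong (_* ∑ as Π) (sym (∑-const as (x c)) ∙ (∑-cong as λ a -> sym (zd a)) ∙ ∑-+ as (z c) d) ⟩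
   _ ≡⟨ *-distribʳ-+ (∑ as Π) (∑ as (z c)) (∑ as d) ⟩
   _ ∎)

 -- Exponential moments of independent and of weighted sums.

 module Products {Z : Set} (k : ℕ) where
  open Prob {Z} k
  open Tails {Z} k

  E-∏ : ∀ {I : Set} (blk : I -> List Z) (D : I -> Z -> Set) (f : I -> Asg -> ℕ) (dep : ∀ i -> DependsOn (D i) (f i)) is ->
   AllPairs (λ i j -> (∀ z -> z ∈ blk j -> ¬ D i z) × (∀ z -> z ∈ blk i -> ¬ D j z)) is ->
   ∀ ω -> E₀ (concatMap blk is) (λ ω -> ∏ is λ i -> f i ω) ω ≡ ∏ is λ i -> E₀ (blk i) (f i) ω
  E-∏ blk D f dep [] ap ω = refl
  E-∏ blk D f dep (i ∷ is) (ind ∷ ap) ω = E-++ none (blk i) (concatMap blk is) _ ω ∙ ((E-cong none (blk i) (λ ω -> E-pull (dep i) (concatMap blk is) (λ ω -> ∏ is λ j -> f j ω) ω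
     λ z m -> let (j , j∈ , z∈) = concatMap-∈ blk is m in fst (All-∈ ind j∈) z z∈) ω)
    ∙ ((E-pullʳ (E-depends rest-dep none (concatMap blk is)) (blk i) (f i) ω λ z z∈ (j , j∈ , d) -> snd (All-∈ ind j∈) z z∈ d)
     ∙ cong (E₀ (blk i) (f i) ω *_) (E-∏ blk D f dep is ap ω)))
   where
   rest-dep : DependsOn (λ z -> ∃[ j ] j ∈ is × D j z) (λ ω -> ∏ is λ j -> f j ω)
   rest-dep ω ω' h = ∏-cong∈ is λ j m -> dep j ω ω' λ z d -> h z (j , m , d)

  -- Weighted sums: the exponential moment of Σ (Xᵢ/τ) over factors bounded by τ.
  weighted : ∀ {I : Set} (is : List I) (X : I -> ℕ) G τ m -> 1 ≤ τ -> 1 ≤ G -> (∀ i -> X i ≤ τ) -> m * τ ≤ ∑ is X ->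
   suc G ^ m * (G * τ) ^ length is ≤ G ^ m * ∏ is (λ i -> G * τ + X i)
  -- The exponents Xᵢ/τ are not integers: both sides are raised to the power τ, compared factor by
  -- factor through `concave`, and the root is taken at the end.
  weighted is X G τ@(suc τ') m 0<τ 0<G X≤ big = root-≤ τ' (*-cancel {c = N ^ ∑ is X} (1≤^ (∑ is X) (1≤* 0<G 0<τ)) (begin
    _ ≡⟨ cong (_* N ^ s) (^-* (suc G ^ m) (N ^ n) τ) ⟩
    _ ≡⟨ cong₂ (λ p r -> p * r * N ^ s) (^-*-assoc (suc G) m τ) (^-*-assoc N n τ ∙ cong (N ^_) (*-comm n τ) ∙ sym (^-*-assoc N τ n)) ⟩
    _ ≡⟨ cong (suc G ^ (m * τ) * (N ^ τ) ^ n *_) (^-* G τ s) ⟩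
    _ ≡⟨ ring35 (suc G ^ (m * τ)) ((N ^ τ) ^ n) (G ^ s) (τ ^ s) ⟩
    _ ≤⟨ *≤ˡ (τ ^ s * (N ^ τ) ^ n) (exchange (m * τ) s big) ⟩
    _ ≡⟨ ring36 (G ^ (m * τ)) (suc G ^ s) (τ ^ s) ((N ^ τ) ^ n) ⟩
    _ ≡⟨ cong (λ t -> G ^ (m * τ) * (t * (N ^ τ) ^ n)) (sym (^-* (suc G) τ s) ∙ cong (_^ s) (+-comm τ N)) ⟩
    _ ≤⟨ *≤ʳ (G ^ (m * τ)) (product is) ⟩
    _ ≡⟨ sym (*-assoc (G ^ (m * τ)) _ _) ⟩
    _ ≡⟨ cong (_* N ^ s) (sym (^-* (G ^ m) _ τ ∙ cong (_* ∏ is (λ i -> N + X i) ^ τ) (^-*-assoc G m τ))) ⟩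
    _ ∎))
   where
   N = G * τ
   n = length is
   s = ∑ is X
   exchange : ∀ p r -> p ≤ r -> suc G ^ p * G ^ r ≤ G ^ p * suc G ^ r
   exchange p r le = begin
    _ ≡⟨ cong (λ t -> suc G ^ p * G ^ t) (sym (m+[n∸m]≡n le)) ⟩
    _ ≡⟨ cong (suc G ^ p *_) (^-distribˡ-+-* G p _) ⟩
    _ ≤⟨ *≤ʳ (suc G ^ p) (*≤ʳ (G ^ p) (^-monoˡ-≤ (r ∸ p) (n≤1+n G))) ⟩
    _ ≡⟨ x∙yz≈y∙xz (suc G ^ p) (G ^ p) _ ⟩
    _ ≡⟨ cong (G ^ p *_) (sym (^-distribˡ-+-* (suc G) p _)) ⟩
    _ ≡⟨ cong (λ t -> G ^ p * suc G ^ t) (m+[n∸m]≡n le) ⟩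
    _ ∎
   product : ∀ is -> (N + τ) ^ ∑ is X * (N ^ τ) ^ length is ≤ ∏ is (λ i -> N + X i) ^ τ * N ^ ∑ is X
   product [] = from≡ (sym (*-identityʳ (1 ^ τ) ∙ ℕ.^-zeroˡ τ))
   product (i ∷ is) = begin
    _ ≡⟨ cong (_* (N ^ τ * (N ^ τ) ^ length is)) (^-distribˡ-+-* (N + τ) (X i) _) ⟩
    _ ≡⟨ *-interchange ((N + τ) ^ X i) ((N + τ) ^ ∑ is X) (N ^ τ) _ ⟩
    _ ≤⟨ *≤ (concave N τ (X i) (τ ∸ X i) (m+[n∸m]≡n (X≤ i))) (product is) ⟩
    _ ≡⟨ *-interchange ((N + X i) ^ τ) (N ^ X i) (∏ is (λ i -> N + X i) ^ τ) _ ⟩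
    _ ≡⟨ cong₂ _*_ (sym (^-* (N + X i) _ τ)) (sym (^-distribˡ-+-* N (X i) _)) ⟩
    _ ∎

  -- Markov's inequality for the exponential moment Π (1 + Xᵢ/(Gτ)), G = g + 2.
  exp-tail : ∀ {I : Set} (xs : List Z) (is : List I) (X : I -> Asg -> ℕ) (r : I -> ℕ) g ν h τ ℓ -> 1 ≤ τ -> 1 ≤ ℓ -> (∀ i ω -> X i ω ≤ τ) ->
   ∑ is r ≤ (2 + g) * ν * ℓ -> ∀ ω ->
   E₀ xs (λ ω -> ∏ is λ i -> (2 + g) * τ + X i ω) ω * ℓ ^ length is ≤ k ^ length xs * (τ ^ length is * ∏ is (λ i -> (2 + g) * ℓ + r i)) ->
   E₀ xs (λ ω -> ⟦ ((4 + g) * ν + (2 + g) * h) * τ ≤ ∑ is (λ i -> X i ω) ⟧) ω * 2 ^ h ≤ k ^ length xs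
  exp-tail xs is X r g ν h τ ℓ 0<τ 0<ℓ X≤ mean ω moment = moment⇒tail g ℓ ν h e K 0<ℓ (*-cancel {c = N ^ n * ℓ ^ n} (1≤* (1≤^ n (1≤* {G} (s≤s z≤n) 0<τ)) (1≤^ n 0<ℓ)) (begin
    _ ≡⟨ ring29 e Hm (M ^ z) (N ^ n) (ℓ ^ n) ⟩
    _ ≤⟨ *≤ˡ (M ^ z) (*≤ˡ (ℓ ^ n) markov) ⟩
    _ ≡⟨ ring57 Gm (E₀ xs Π ω) (ℓ ^ n) (M ^ z) ⟩
    _ ≤⟨ *≤ˡ (M ^ z) (*≤ʳ Gm moment) ⟩
    _ ≡⟨ ring58 Gm K (τ ^ n) _ (M ^ z) ⟩
    _ ≤⟨ *≤ʳ (Gm * K * τ ^ n) (∏-bernoulli-≤ M is r z mean) ⟩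
    _ ≡⟨ ring59 (Gm * K) (τ ^ n) (M ^ n) (suc M ^ z) ⟩
    _ ≡⟨ cong (Gm * K * suc M ^ z *_) (sym (^-* τ M n) ∙ cong (_^ n) (x∙yz≈yx∙z τ G ℓ) ∙ ^-* N ℓ n) ⟩
    _ ∎))
   where
   G = 2 + g
   N = G * τ
   M = G * ℓ
   n = length is
   m = (4 + g) * ν + G * h
   Hm = (3 + g) ^ m
   Gm = G ^ m
   K = k ^ length xs
   z = G * ν * ℓ
   Π : Asg -> ℕ
   Π ω = ∏ is λ i -> N + X i ω
   e = E₀ xs (λ ω -> ⟦ m * τ ≤ ∑ is (λ i -> X i ω) ⟧) ω
   markov : e * (Hm * N ^ n) ≤ Gm * E₀ xs Π ω
   markov = from≡ (sym (E-*ʳ none xs _ _ ω)) » ((E-mono none xs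
    (λ ω -> cases (m * τ ≤ ∑ is (λ i -> X i ω))
     (λ big -> from≡ (yes* big) » weighted is (λ i -> X i ω) G τ m 0<τ (s≤s z≤n) (λ i -> X≤ i ω) big)
     (λ n≰ -> from≡ (no* n≰) » z≤n)) ω)
    » from≡ (E-*ˡ none xs Gm Π ω))

  module Chernoff {I : Set} (blk : I -> List Z) (D : I -> Z -> Set) (f : I -> Asg -> ℕ)
   (dep : ∀ i -> DependsOn (D i) (f i)) (f≤1 : ∀ i ω -> f i ω ≤ 1) (r : I -> ℕ) (ℓ : ℕ) (0<ℓ : 1 ≤ ℓ)
   (small : ∀ i ω -> E₀ (blk i) (f i) ω * ℓ ≤ k ^ length (blk i) * r i) where

   blocks : List I -> List Z
   blocks = concatMap blk

   tail : ∀ g ν h is -> AllPairs (λ i j -> (∀ z -> z ∈ blk j -> ¬ D i z) × (∀ z -> z ∈ blk i -> ¬ D j z)) is -> ∑ is r ≤ (2 + g) * ν * ℓ ->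
    ∀ ω -> E₀ (blocks is) (λ ω -> ⟦ (4 + g) * ν + (2 + g) * h ≤ (∑ is λ i -> f i ω) ⟧) ω * 2 ^ h ≤ k ^ length (blocks is)
   tail g ν h is ap mean ω = *≤ˡ (2 ^ h) (E-mono none (blocks is) (λ ω -> ⟦⟧-mono (≤-trans (from≡ (*-identityʳ _)))) ω)
     » (exp-tail (blocks is) is f r g ν h 1 ℓ ≤-refl 0<ℓ f≤1 mean ω (begin
      _ ≡⟨ cong₂ _*_ (E-∏ blk D (λ i ω -> N + f i ω) (λ i ω ω' h -> cong (N +_) (dep i ω ω' h)) is ap ω) (sym (∏-const is ℓ)) ⟩
      _ ≡⟨ sym (∏-* is _ _) ⟩
      _ ≤⟨ ∏-mono∈ is (λ i _ -> first i) ⟩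
      _ ≡⟨ ∏-* is (λ i -> k ^ length (blk i)) (λ i -> (2 + g) * ℓ + r i) ⟩
      _ ≡⟨ cong₂ _*_ (pow-concatMap k blk is) (sym (cong (_* ∏ is (λ i -> (2 + g) * ℓ + r i)) (ℕ.^-zeroˡ (length is)) ∙ *-identityˡ _)) ⟩
      _ ∎))
    where
    N = (2 + g) * 1
    first : ∀ i -> E₀ (blk i) (λ ω -> N + f i ω) ω * ℓ ≤ k ^ length (blk i) * ((2 + g) * ℓ + r i)
    first i = begin
     _ ≡⟨ cong (_* ℓ) (E-+ none (blk i) (λ _ -> N) (f i) ω ∙ cong (_+ E₀ (blk i) (f i) ω) (E-const none (blk i) N ω)) ⟩
     _ ≡⟨ *-distribʳ-+ ℓ (k ^ length (blk i) * N) _ ⟩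
     _ ≤⟨ +≤ (from≡ (*-assoc (k ^ length (blk i)) N ℓ ∙ cong (λ m -> k ^ length (blk i) * (m * ℓ)) (*-identityʳ (2 + g)))) (small i ω) ⟩
     _ ≡⟨ sym (*-distribˡ-+ (k ^ length (blk i)) ((2 + g) * ℓ) (r i)) ⟩
     _ ∎

 -- Negative association of hits on different colours.

 module Association {Z : Set} (k : ℕ) where
  open Prob {Z} k

  E-cong-off : ∀ xs {G H : Asg -> ℕ} ω -> (∀ ω' -> (∀ z -> z ∉ xs -> ω' z ≡ ω z) -> G ω' ≡ H ω') -> E₀ xs G ω ≡ E₀ xs H ω
  E-cong-off [] ω h = h ω λ _ _ -> refl
  E-cong-off (x ∷ xs) ω h = ∑-cong vals λ a -> E-cong-off xs (upd x a ω) λ ω' e -> h ω' λ z z∉ -> e z (z∉ ∘ there) ∙ upd-other x a ω z (z∉ ∘ here)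

  module _ {C : Set} (Hit : C -> Z -> Fin k -> Set) (one : ∀ {c c' z a} -> Hit c z a -> Hit c' z a -> c ≡ c')
   (F : C -> (Z -> Set) -> ℕ) (antitone : ∀ c {h h'} -> (∀ z -> h z -> h' z) -> F c h' ≤ F c h) where

   H : List Z -> C -> (Z -> Set) -> Asg -> Z -> Set
   H ws c b ω z = b z ⊎ (z ∈ ws × Hit c z (ω z))

   private
    F-cong : ∀ c {h h'} -> (∀ z -> h z -> h' z) -> (∀ z -> h' z -> h z) -> F c h ≡ F c h'
    F-cong c f g = ℕ.≤-antisym (antitone c g) (antitone c f)

    mean : List Z -> C -> (Z -> Set) -> Asg -> ℕ
    mean ws c b ω = E₀ ws (λ ω -> F c (H ws c b ω)) ω

    joint : List Z -> List C -> (C -> Z -> Set) -> Asg -> ℕ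
    joint ws cs b ω = E₀ ws (λ ω -> ∏ cs λ c -> F c (H ws c (b c) ω)) ω

    add' : C -> Z -> Fin k -> (Z -> Set) -> Z -> Set
    add' c w a b z = b z ⊎ (z ≡ w × Hit c w a)

    shift : ∀ w ws -> w ∉ ws -> ∀ c a b ω -> ω w ≡ a -> F c (H (w ∷ ws) c b ω) ≡ F c (H ws c (add' c w a b) ω)
    shift w ws w∉ c a b ω refl = F-cong c
     (λ { z (inj₁ h) -> inj₁ (inj₁ h) ; z (inj₂ (here refl , h)) -> inj₁ (inj₂ (refl , h)) ; z (inj₂ (there m , h)) -> inj₂ (m , h) })
     (λ { z (inj₁ (inj₁ h)) -> inj₁ h ; z (inj₁ (inj₂ (refl , h))) -> inj₂ (here refl , h) ; z (inj₂ (m , h)) -> inj₂ (there m , h) })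

    mean-blind : ∀ ws c b ω ω' -> mean ws c b ω ≡ mean ws c b ω'
    mean-blind ws c b ω ω' = E-dep {D = _∈ ws} (λ ω₁ ω₂ h -> F-cong c
      (λ { z (inj₁ t) -> inj₁ t ; z (inj₂ (m , t)) -> inj₂ (m , subst (Hit c z) (h z m) t) })
      (λ { z (inj₁ t) -> inj₁ t ; z (inj₂ (m , t)) -> inj₂ (m , subst (Hit c z) (sym (h z m)) t) }))
     none ws ω ω' λ { z m (inj₂ n) -> ⊥-elim (n m) }

    mean-step : ∀ w ws -> w ∉ ws -> ∀ c b ω -> mean (w ∷ ws) c b ω ≡ ∑ vals λ a -> mean ws c (add' c w a b) ω
    mean-step w ws w∉ c b ω = ∑-cong vals λ a -> (E-cong-off ws (upd w a ω) λ ω' e -> shift w ws w∉ c a b ω' (e w w∉ ∙ upd-same w a ω))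
     ∙ mean-blind ws c (add' c w a b) (upd w a ω) ω

   -- The variables are revealed one by one and their hits are added to `b`. A value hits at most
   -- one colour, so given the value all conditional means but one stay at their maximum and
   -- `∑∏-negative` applies.
   negative : ∀ ws -> Unique ws -> ∀ cs -> Unique cs -> ∀ b ω ->
    joint ws cs b ω * (k ^ length ws) ^ length cs ≤ k ^ length ws * ∏ cs λ c -> mean ws c (b c) ω
   negative [] u cs uc b ω = from≡ (cong (joint [] cs b ω *_) (ℕ.^-zeroˡ (length cs)) ∙ *-identityʳ _ ∙ sym (*-identityˡ _))
   negative (w ∷ ws) (nw ∷ u) cs uc b ω = begin
     _ ≡⟨ cong₂ _*_ (∑-cong vals λ a -> E-cong-off ws (upd w a ω) λ ω' e -> ∏-cong∈ cs λ c _ -> shift w ws w∉ c a (b c) ω' (e w w∉ ∙ upd-same w a ω)) (^-* k K n) ⟩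
     _ ≡⟨ x∙yz≈y∙xz (∑ vals λ a -> joint ws cs (b^ a) (upd w a ω)) (k ^ n) (K ^ n) ⟩
     _ ≡⟨ cong (k ^ n *_) (sym (∑-*ʳ vals _ (K ^ n))) ⟩
     _ ≤⟨ *≤ʳ (k ^ n) (∑-mono vals λ a -> negative ws u cs uc (b^ a) (upd w a ω)
       » from≡ (cong (K *_) (∏-cong∈ cs λ c _ -> mean-blind ws c (b^ a c) (upd w a ω) ω))) ⟩
     _ ≡⟨ cong (k ^ n *_) (∑-*ˡ vals K _) ⟩
     _ ≡⟨ x∙yz≈y∙xz (k ^ n) K _ ⟩
     _ ≤⟨ *≤ʳ K (subst (λ l -> l ^ n * ∑ vals (λ a -> ∏ cs λ c -> z c a) ≤ l * ∏ cs (λ c -> ∑ vals (z c))) (length-allFin k) (∑∏-negative vals cs z x z≤x (pairs cs uc))) ⟩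
     _ ≡⟨ x∙yz≈yx∙z K k _ ⟩
     _ ≡⟨ cong (k * K *_) (∏-cong∈ cs λ c _ -> sym (mean-step w ws w∉ c (b c) ω)) ⟩
     _ ∎
    where
    K = k ^ length ws
    n = length cs
    w∉ : w ∉ ws
    w∉ m = All-∈ nw m refl
    b^ : Fin k -> C -> Z -> Set
    b^ a c = add' c w a (b c)
    z : C -> Fin k -> ℕ
    z c a = mean ws c (b^ a c) ω
    x : C -> ℕ
    x c = mean ws c (b c) ω
    z≤x : ∀ c a -> z c a ≤ x c
    z≤x c a = E-mono none ws (λ ω -> antitone c λ { t (inj₁ h) -> inj₁ (inj₁ h) ; t (inj₂ h) -> inj₂ h }) ω
    same : ∀ c a -> ¬ Hit c w a -> z c a ≡ x c
    same c a nh = E-cong none ws (λ ω -> F-cong c (λ { t (inj₁ (inj₁ h)) -> inj₁ h ; t (inj₁ (inj₂ (_ , h))) -> ⊥-elim (nh h) ; t (inj₂ h) -> inj₂ h })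
     λ { t (inj₁ h) -> inj₁ (inj₁ h) ; t (inj₂ h) -> inj₂ h }) ω
    pairs : ∀ cs -> Unique cs -> AllPairs (λ c c' -> ∀ a -> z c a ≡ x c ⊎ z c' a ≡ x c') cs
    pairs [] [] = []
    pairs (c ∷ cs) (nc ∷ uc) = All-tab cs (λ c' m a -> cases (Hit c w a)
     (λ h -> inj₂ (same c' a λ h' -> All-∈ nc m (one h h'))) (λ nh -> inj₁ (same c a nh))) ∷ pairs cs uc

 nthM : {A : Set} -> List A -> ℕ -> Maybe A
 nthM [] n = nothing
 nthM (x ∷ l) zero = just x
 nthM (x ∷ l) (suc n) = nthM l n

 nthM-∈ : ∀ {A : Set} (l : List A) n {x} -> nthM l n ≡ just x -> x ∈ l
 nthM-∈ (y ∷ l) zero refl = here refl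
 nthM-∈ (y ∷ l) (suc n) e = there (nthM-∈ l n e)

 nthM-< : ∀ {A : Set} (l : List A) n -> n < length l -> ∃[ x ] nthM l n ≡ just x
 nthM-< (x ∷ l) zero lt = x , refl
 nthM-< (x ∷ l) (suc n) (s≤s lt) = nthM-< l n lt

 nthM-inj : ∀ {A : Set} (l : List A) -> Unique l -> ∀ m n {x} -> nthM l m ≡ just x -> nthM l n ≡ just x -> m ≡ n
 nthM-inj (y ∷ l) u zero zero e e' = refl
 nthM-inj (y ∷ l) (ny ∷ u) zero (suc n) refl e' = ⊥-elim (All-∈ ny (nthM-∈ l n e') refl)
 nthM-inj (y ∷ l) (ny ∷ u) (suc m) zero e refl = ⊥-elim (All-∈ ny (nthM-∈ l m e) refl)
 nthM-inj (y ∷ l) (_ ∷ u) (suc m) (suc n) e e' = cong suc (nthM-inj l u m n e e')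

 ∑-unique≤1 : ∀ {A : Set} (l : List A) (Q : A -> Set) -> Unique l -> (∀ {x y} -> Q x -> Q y -> x ≡ y) -> ∑ l (λ x -> ⟦ Q x ⟧) ≤ 1
 ∑-unique≤1 [] Q u h = z≤n
 ∑-unique≤1 (x ∷ l) Q (nx ∷ u) h = cases (Q x)
  (λ qx -> from≡ (cong₂ _+_ (⟦⟧-yes qx) (∑-zero l λ y m -> ⟦⟧-no λ qy -> All-∈ nx m (h qx qy))))
  (λ n -> from≡ (cong (_+ ∑ l (λ x -> ⟦ Q x ⟧)) (⟦⟧-no n)) » ∑-unique≤1 l Q u h)

 ∑-below : ∀ k θ -> ∑ (allFin k) (λ a -> ⟦ toℕ a < θ ⟧) ≤ θ
 ∑-below zero θ = z≤n
 ∑-below (suc k) zero = from≡ (∑-zero (allFin (suc k)) λ a _ -> ⟦⟧-no λ ())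
 ∑-below (suc k) (suc θ) = from≡ (∑-Fin-suc k _) » (+≤ (⟦⟧≤1 _)
  (∑-mono (allFin k) (λ a -> ⟦⟧-mono ≤-pred) » ∑-below k θ))

 ∑-above : ∀ k θ -> ∑ (allFin k) (λ a -> ⟦ ¬ (toℕ a < θ) ⟧) ≤ k ∸ θ
 ∑-above zero θ = z≤n
 ∑-above (suc k) zero = (∑-≤const (allFin (suc k)) 1 λ a _ -> ⟦⟧≤1 _) » from≡ (*-identityʳ _ ∙ length-allFin (suc k))
 ∑-above (suc k) (suc θ) = from≡ (∑-Fin-suc k _) » (+≤ (from≡ (⟦⟧-no λ n -> n (s≤s z≤n)))
  (∑-mono (allFin k) (λ a -> ⟦⟧-mono λ n lt -> n (s≤s lt)) » ∑-above k θ))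

 ∑-unique≤ : ∀ {A : Set} (l : List A) (Q : A -> Set) -> Unique l -> (∀ {x y} -> Q x -> Q y -> x ≡ y) -> ∑ l (λ x -> ⟦ Q x ⟧) ≤ ⟦ (∃[ x ] Q x) ⟧
 ∑-unique≤ l Q u h = cases (∃[ x ] Q x) (λ e -> ∑-unique≤1 l Q u h » from≡ (sym (⟦⟧-yes e)))
  (λ n -> from≡ (∑-zero l λ x _ -> ⟦⟧-no λ t -> n (x , t)) » z≤n)

 ⟦∃⟧≤∑ : ∀ {A : Set} (l : List A) (Q : A -> Set) -> ⟦ (∃[ x ] x ∈ l × Q x) ⟧ ≤ ∑ l (λ x -> ⟦ Q x ⟧)
 ⟦∃⟧≤∑ l Q = cases (∃[ x ] x ∈ l × Q x) (λ { e@(x , m , t) -> from≡ (⟦⟧-yes e ∙ sym (⟦⟧-yes t)) » ∑-member l (λ x -> ⟦ Q x ⟧) m })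
  (λ n -> from≡ (⟦⟧-no n) » z≤n)

 -- `overcrowded` controls the degree of a single colour and is guarded by the absence of 4-cycles;
 -- `overweight` controls the sum over a list.
 data Event (q : ℕ) : Set where
  overhit overweight overclash : Event q
  overcrowded : Fin q -> Event q

 module Trim where
  before : ∀ {n} -> (Fin n -> Set) -> Fin n -> ℕ
  before {n} Q c = ∑ (allFin n) λ c' -> ⟦ toℕ c' < toℕ c × Q c' ⟧

  -- Cutting a set back to its first elements makes list sizes exact. `s` counts the elements
  -- already met and is what the induction varies.
  kept : ∀ n (Q : Fin n -> Set) s ℓ -> ∑ (allFin n) (λ c -> ⟦ Q c × s + before Q c < ℓ ⟧) ≡ ∑ (allFin n) (λ c -> ⟦ Q c ⟧) ⊓ (ℓ ∸ s)
  kept zero Q s ℓ = refl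
  kept (suc n) Q s ℓ = begin-equality
    _ ≡⟨ ∑-Fin-suc n _ ⟩
    _ ≡⟨ cong₂ _+_
     (cong (λ b -> ⟦ Q fzero × b < ℓ ⟧) (cong (s +_) (∑-zero (allFin (suc n)) λ c _ -> ⟦⟧-no λ ()) ∙ +-identityʳ s))
     ((∑-cong (allFin n) λ c -> cong (λ b -> ⟦ Q (fsuc c) × b < ℓ ⟧) (shift c)) ∙ kept n (Q ∘ fsuc) (s + ⟦ Q fzero ⟧) ℓ) ⟩
    _ ≡⟨ cases (Q fzero) yes' no' ⟩
    _ ≡⟨ cong (_⊓ (ℓ ∸ s)) (sym (∑-Fin-suc n λ c -> ⟦ Q c ⟧)) ⟩
    _ ∎
   where
   S = ∑ (allFin n) λ c -> ⟦ Q (fsuc c) ⟧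
   shift : ∀ c -> s + before Q (fsuc c) ≡ s + ⟦ Q fzero ⟧ + before (Q ∘ fsuc) c
   shift c = (cong (s +_) (∑-Fin-suc n _ ∙ (cong₂ _+_ (⟦⟧-cong snd (s≤s z≤n ,_))
    (∑-cong (allFin n) λ c' -> ⟦⟧-cong (λ (lt , t) -> ≤-pred lt , t) (λ (lt , t) -> s≤s lt , t))))) ∙ sym (+-assoc s _ _)
   room : ∀ s -> ⟦ s < ℓ ⟧ + S ⊓ (ℓ ∸ suc s) ≡ suc S ⊓ (ℓ ∸ s)
   room s = cases (s < ℓ)
    (λ lt -> cong (_+ S ⊓ (ℓ ∸ suc s)) (⟦⟧-yes lt) ∙ cong (suc S ⊓_) (sym (ℕ.+-∸-assoc 1 lt)))
    (λ n -> cong₂ _+_ (⟦⟧-no n) (cong (S ⊓_) (ℕ.m≤n⇒m∸n≡0 (≮⇒≥ n » n≤1+n s)) ∙ ℕ.⊓-zeroʳ S)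
     ∙ sym (cong (suc S ⊓_) (ℕ.m≤n⇒m∸n≡0 (≮⇒≥ n)) ∙ refl))
   yes' : Q fzero -> ⟦ Q fzero × s < ℓ ⟧ + S ⊓ (ℓ ∸ (s + ⟦ Q fzero ⟧)) ≡ (⟦ Q fzero ⟧ + S) ⊓ (ℓ ∸ s)
   yes' t = cong₂ _+_ (⟦⟧-cong snd (t ,_)) (cong (λ x -> S ⊓ (ℓ ∸ x)) (cong (s +_) (⟦⟧-yes t) ∙ +-comm s 1)) ∙ room s ∙ cong (λ x -> (x + S) ⊓ (ℓ ∸ s)) (sym (⟦⟧-yes t))
   no' : ¬ Q fzero -> ⟦ Q fzero × s < ℓ ⟧ + S ⊓ (ℓ ∸ (s + ⟦ Q fzero ⟧)) ≡ (⟦ Q fzero ⟧ + S) ⊓ (ℓ ∸ s)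
   no' n = cong₂ _+_ (⟦⟧-no (n ∘ fst)) (cong (λ x -> S ⊓ (ℓ ∸ x)) (cong (s +_) (⟦⟧-no n) ∙ +-identityʳ s)) ■ cong (λ x -> (x + S) ⊓ (ℓ ∸ s)) (sym (⟦⟧-no n))
    where
    _■_ : ∀ {x y z : ℕ} -> x ≡ y -> y ≡ z -> x ≡ z
    _■_ = trans

 -- Parameters of the nibble and the arithmetic of one round.

 record Constants : Set where
  field
   -- `g` sets the relative deviation 2/(g + 2), `h` its probability 2^(-h). Lists have size b y,
   -- live colours have degree at most n α y, and the weight of a list is at most δ y such caps.
   -- With R = R' + 1, a vertex is offered R a colours when at most a activated neighbours compete
   -- for each.
   g h ρ R' α δ E T Bₘ b₀ n₁ J γ ι ν₄ y₀ q K : ℕ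
   2≤ρ : 2 ≤ ρ
   1≤α : 1 ≤ α
   1≤δ : 1 ≤ δ
   2≤g : 2 ≤ g
   1≤T : 1 ≤ T
   3Rα≤G : 3 * (suc R' * α) ≤ 2 + g
   18B≤g : 18 * Bₘ ≤ g
   2B≤R² : 2 * Bₘ ≤ suc R' * suc R'
   B≤6Rα : Bₘ ≤ 6 * (suc R' * α)
   T₁ : 2 * ((2 + g) * (2 + g)) * (4 + g + (2 + g) * h) ≤ T
   T₂ : (4 + g) * E ≤ T
   T₃ : 2 * (2 + g) * (Bₘ + (4 + g + (2 + g) * h)) ≤ T
   T₄ : suc R' * (4 + g + (2 + g) * h) ≤ T
   J+b₀≤B : J + b₀ ≤ Bₘ
   enough-lists : suc R' * α + (δ + 2) ≤ b₀
   enough-dead : Bₘ * (4 + g + (2 + g) * h) ≤ E * (suc n₁ * α)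
   degree-step : ∀ x -> x ≤ 2 * γ -> (4 + g) * ceil x (suc g) + (2 + g) * h ≤ x + ι
   degree-total : J * ι ≤ γ
   clash-rate : 36 * γ ≤ (2 + g) * suc R' * ν₄
   threshold : T * suc (suc R') ^ J ≤ y₀ * suc R' ^ J
   q-is : q ≡ (J + b₀) * y₀
   q≤K : q ≤ K
   n≤K : suc (J + n₁) ≤ K

  -- `ω₀` bounds the neighbours lost to clashes in one round; `p` bounds the degree left to the
  -- final greedy colouring, undecided neighbours and losses of all rounds together.
  ω₀ p : ℕ
  ω₀ = (4 + g) * ν₄ + (2 + g) * h
  p = suc n₁ * (2 * γ) + J * ω₀

 module Bounds (g h : ℕ) where

  G σ : ℕ
  G = 2 + g
  σ = 4 + g + G * h

  -- The Chernoff thresholds: a sum of mean at most G ν reaches `dv ν` with probability at most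
  -- 2^(-h), and `up x` is the threshold for mean x.
  dv up : ℕ -> ℕ
  dv ν = (4 + g) * ν + (2 + g) * h
  up x = dv (ceil x (suc g))

  up≥ : ∀ x -> x ≤ up x
  up≥ x = ceil-≥ x (suc g) » *≤ˡ (ceil x (suc g)) (n≤1+n G » n≤1+n (3 + g)) » m≤m+n _ ((2 + g) * h)

  G*up : ∀ x -> G * up x ≤ (4 + g) * x + G * σ
  G*up x = begin
   _ ≡⟨ ring104 g c h ⟩
   _ ≤⟨ +≤ˡ (G * (G * h)) (*≤ʳ (4 + g) (ceil-< x (suc g))) ⟩
   _ ≡⟨ ring105 g x h ⟩
   _ ∎
   where
   c = ceil x (suc g)

 module Arithmetic (C : Constants) where
  open Constants C
  open Bounds g h

  R : ℕ
  R = suc R'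

  module At (y : ℕ) (T≤y : T ≤ y) where
   Gσ≤y : 2 * (G * G) * σ ≤ y
   Gσ≤y = T₁ » T≤y

   -- The next y. The ideal factor is R/(R + 1); the correction (9 + g)/(2 + g) = 1 + 7/G absorbs
   -- the deviations in `A-next` and `D-next`.
   ŷ : ℕ
   ŷ = ceil ((9 + g) * (R * y)) (suc g + R * G)

   ŷ-lo : (9 + g) * (R * y) ≤ (G + R * G) * ŷ
   ŷ-lo = ceil-≥ _ _

   ŷ-hi : (G + R * G) * ŷ ≤ (9 + g) * (R * y) + (G + R * G)
   ŷ-hi = ceil-< _ _

   decay : R * y ≤ suc R * ŷ
   decay = *-cancel {c = G} (s≤s z≤n) (begin
    _ ≡⟨ *-comm (R * y) G ⟩
    _ ≤⟨ *≤ˡ (R * y) (m≤n+m G 7) ⟩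
    _ ≤⟨ ŷ-lo ⟩
    _ ≡⟨ ring79 G R ŷ ⟩
    _ ∎)

   a : ℕ
   a = up (α * y)

   Ga : G * a ≤ (5 + g) * (α * y)
   Ga = begin
    G * a ≤⟨ G*up (α * y) ⟩
    _ ≤⟨ +≤ʳ _ (begin
     G * σ ≤⟨ *≤ˡ σ (m≤m+n G (suc g * G) » m≤m+n (G * G) _) ⟩
     _ ≤⟨ Gσ≤y ⟩
     y ≡⟨ sym (*-identityˡ y) ⟩
     1 * y ≤⟨ *≤ˡ y 1≤α ⟩
     α * y ∎) ⟩
    _ ≡⟨ +-comm ((4 + g) * (α * y)) _ ⟩
    _ ∎

   a≥ : α * y ≤ a
   a≥ = up≥ (α * y)

   νA : ℕ
   νA = ceil (a * R) (suc R' + suc g * suc R)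

   rateA : a * R ≤ G * suc R * νA
   rateA = ceil-≥ _ _

   R+1≤2R : suc R ≤ 2 * R
   R+1≤2R = s≤s (m≤n+m R R') » from≡ (cong (R +_) (sym (+-identityʳ R)))

   A-next : dv νA ≤ α * ŷ
   A-next = *-cancel {c = G * (G * suc R)} (1≤* {G} {G * suc R} (s≤s z≤n) (s≤s z≤n)) (begin
    _ ≡⟨ ring80 g νA h (suc R) ⟩
    _ ≤⟨ +≤ˡ (G * (G * suc R) * (G * h)) (*≤ʳ ((4 + g) * G) (ceil-< (a * R) (suc R' + suc g * suc R))) ⟩
    _ ≡⟨ ring81 g a R h ⟩
    _ ≤⟨ +≤ (*≤ʳ ((4 + g) * R) Ga) (*≤ˡ σ (*≤ʳ (G * G) R+1≤2R) » from≡ (ring82 (G * G) R σ)) ⟩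
    _ ≤⟨ +≤ʳ ((4 + g) * R * ((5 + g) * (α * y))) (*≤ʳ R (Gσ≤y » from≡ (sym (*-identityˡ y)) » *≤ˡ y 1≤α)) ⟩
    _ ≡⟨ ring83 g R α y ⟩
    _ ≤⟨ *≤ˡ (α * (R * y)) (quad g 2≤g) ⟩
    _ ≡⟨ ring84 G (9 + g) α (R * y) ⟩
    _ ≤⟨ *≤ʳ (α * G) ŷ-lo ⟩
    _ ≡⟨ ring85 α G R ŷ ⟩
    _ ∎)
    where
    -- (1 + 2/G)(1 + 3/G) + 1/G² ≤ 1 + 7/G: the deviations of survival and activation, and a
    -- remainder. This is the origin of the 9 in `ŷ`.
    quad : ∀ g -> 2 ≤ g -> suc ((4 + g) * (5 + g)) ≤ (2 + g) * (9 + g)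
    quad (suc (suc x)) (s≤s (s≤s z≤n)) = m≤m+n _ _ » from≡ (ring75 x)

   νD : ℕ
   νD = ceil ((δ * y + E) * R) (suc R' + suc g * suc R)

   rateD : (δ * y + E) * R ≤ G * suc R * νD
   rateD = ceil-≥ _ _

   y≤δy : y ≤ δ * y
   y≤δy = from≡ (sym (*-identityˡ y)) » *≤ˡ y 1≤δ

   D-next : dv νD ≤ δ * ŷ
   D-next = *-cancel {c = G * suc R} (s≤s z≤n) (begin
    _ ≡⟨ ring86 g νD h (suc R) ⟩
    _ ≤⟨ +≤ˡ (G * suc R * (G * h)) (*≤ʳ (4 + g) (ceil-< ((δ * y + E) * R) (suc R' + suc g * suc R))) ⟩
    _ ≡⟨ ring87 g (δ * y) E R h ⟩
    _ ≤⟨ +≤ʳ ((4 + g) * (R * (δ * y))) (+≤ (*≤ʳ R (T₂ » T≤y » y≤δy)) small) ⟩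
    _ ≡⟨ ring88 g (R * (δ * y)) ⟩
    _ ≤⟨ *≤ˡ (R * (δ * y)) (m≤n+m (6 + g) 3) ⟩
    _ ≡⟨ ring89 (9 + g) R δ y ⟩
    _ ≤⟨ *≤ʳ δ ŷ-lo ⟩
    _ ≡⟨ ring90 δ G R ŷ ⟩
    _ ∎)
    where
    small : suc R * (G * σ) ≤ R * (δ * y)
    small = begin
     _ ≤⟨ *≤ˡ _ R+1≤2R ⟩
     _ ≡⟨ ring91 R G σ ⟩
     _ ≤⟨ *≤ʳ R (*≤ˡ σ (*≤ʳ 2 (m≤m+n G (suc g * G))) » Gσ≤y » y≤δy) ⟩
     _ ∎

   ν₁ : ℕ -> ℕ
   ν₁ b = ceil (suc b * y) (R' + suc g * R)

   rateℓ : ∀ b -> suc b * y ≤ G * R * ν₁ b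
   rateℓ b = ceil-≥ _ _

   hits-hi : ∀ b -> G * R * dv (ν₁ b) ≤ (4 + g) * (suc b * y) + G * R * σ
   hits-hi b = begin
    _ ≡⟨ ring92 g R (ν₁ b) h ⟩
    _ ≤⟨ +≤ˡ (G * R * (G * h)) (*≤ʳ (4 + g) (ceil-< (suc b * y) (R' + suc g * R))) ⟩
    _ ≡⟨ ring93 g (suc b * y) R h ⟩
    _ ∎

   -- A list loses about a fraction 1/R while y loses 1/(R + 1), so the list measured in units of y
   -- shrinks only by about (b/R + 1)/R. Since 2 Bₘ ≤ R² and 18 Bₘ ≤ g, this and the deviations fit
   -- into one unit.
   ℓ-next : ∀ b -> suc b ≤ Bₘ -> b * ŷ + dv (ν₁ b) ≤ suc b * y
   ℓ-next b b<B = *-cancel {c = R * suc R * G} (s≤s z≤n) (begin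
    _ ≡⟨ ring94 b ŷ _ R G ⟩
    _ ≤⟨ +≤ (*≤ʳ (b * R) ŷ-hi) (*≤ʳ (suc R) (hits-hi b)) ⟩
    _ ≡⟨ ring95 b R g y σ ⟩
    _ ≤⟨ +≤ʳ ((b * (R * R) * (9 + g) + suc R * (4 + g) * suc b) * y) const≤ ⟩
    _ ≡⟨ sym (*-distribʳ-+ y (b * (R * R) * (9 + g) + suc R * (4 + g) * suc b) (R * R)) ⟩
    _ ≤⟨ *≤ˡ y main ⟩
    _ ≡⟨ xy∙z≈xz∙y (suc b) (R * suc R * G) y ⟩
    _ ∎)
    where
    const≤ : suc R * (R * (G * (b + σ))) ≤ R * R * y
    const≤ = begin
     _ ≤⟨ *≤ˡ (R * (G * (b + σ))) R+1≤2R ⟩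
     _ ≡⟨ ring96 R (G * (b + σ)) ⟩
     _ ≤⟨ *≤ʳ (R * R) (from≡ (sym (*-assoc 2 G (b + σ))) » *≤ʳ (2 * G) (+≤ˡ σ (n≤1+n b » b<B)) » T₃ » T≤y) ⟩
     _ ∎
    main : b * (R * R) * (9 + g) + suc R * (4 + g) * suc b + R * R ≤ suc b * (R * suc R * G)
    main = *-cancel {c = 2} (s≤s z≤n) (+-cancelʳ-≤ _ _ _ (begin
     _ ≡⟨ ring76 b R g ⟩
     _ ≤⟨ +≤ʳ (suc b * (R * suc R * G) * 2) small ⟩
     _ ∎))
     where
     small : 14 * suc b * (R * R) + 4 * suc b * R + 2 * suc b * (4 + g) + 2 * (R * R) ≤ R * R * (18 + (g + g))
     small = begin
      _ ≤⟨ +≤ˡ (2 * (R * R)) (+≤ (+≤ʳ (14 * suc b * (R * R)) (*≤ʳ (4 * suc b) (m≤m+n R (R' * R)))) (*≤ˡ (4 + g) (*≤ʳ 2 b<B » 2B≤R²))) ⟩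
      _ ≡⟨ ring77 (suc b) R g ⟩
      _ ≤⟨ +≤ˡ (R * R * (6 + g)) (*≤ʳ (R * R) (*≤ʳ 18 b<B » 18B≤g)) ⟩
      _ ≡⟨ ring78 (R * R) g ⟩
      _ ≤⟨ *≤ʳ (R * R) (m≤n+m (6 + (g + g)) 12) ⟩
      _ ∎

   -- The 2 in the hypothesis pays for the excess of R a over R α y and for E, each at most y.
   room : ∀ b -> R * α + (δ + 2) ≤ b -> R * a + (δ * y + E) ≤ b * y
   room b le = begin
    _ ≤⟨ +≤ Ra (+≤ʳ (δ * y) E≤y) ⟩
    _ ≡⟨ ring97 (R * α) y δ ⟩
    _ ≤⟨ *≤ˡ y le ⟩
    b * y ∎
    where
    E≤y : E ≤ y
    E≤y = m≤m+n E _ » T₂ » T≤y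
    Ra : R * a ≤ (R * α + 1) * y
    Ra = *-cancel {c = G} (s≤s z≤n) (begin
     _ ≡⟨ xy∙z≈x∙zy R a G ⟩
     _ ≤⟨ *≤ʳ R Ga ⟩
     _ ≡⟨ ring98 R g α y ⟩
     _ ≤⟨ +≤ʳ (R * α * G * y) (*≤ˡ y 3Rα≤G) ⟩
     _ ≡⟨ ring99 (R * α) G y ⟩
     _ ∎)

   few-hits : ∀ b -> suc b ≤ Bₘ -> R * dv (ν₁ b) ≤ 18 * (R * a)
   few-hits b b<B = *-cancel {c = G} (s≤s z≤n) (begin
    _ ≡⟨ ring101 R _ G ⟩
    _ ≤⟨ hits-hi b ⟩
    _ ≤⟨ +≤ (*≤ˡ (suc b * y) (m≤m+n (4 + g) g » from≡ (ring100 g)) » *≤ʳ (2 * G) (*≤ˡ y b<B))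
     (from≡ (*-assoc G R σ) » *≤ʳ G (T₄ » T≤y » from≡ (sym (*-identityˡ y)) » *≤ˡ y (s≤s z≤n » b<B))) ⟩
    _ ≡⟨ ring102 G Bₘ y ⟩
    _ ≤⟨ *≤ˡ G (*≤ʳ 3 (*≤ˡ y B≤6Rα)) ⟩
    _ ≡⟨ cong (_* G) (ring103 R α y) ⟩
    _ ≤⟨ *≤ˡ G (*≤ʳ 18 (*≤ʳ R a≥)) ⟩
    _ ∎)

 -- Constraint systems on a space with ports.

 module Structure (S : Sys) (𝒫 : Ports S) where
  open Geometry S 𝒫 public

  module Vars (κ k : ℕ) where
   Var : Set
   Var = X × Fin κ

   open Prob {Var} k public

   -- Borel families of assignments, tested only by evaluation at Borel points; no Borel structure
   -- on the space of assignments is involved.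
   Plot : (X -> Asg) -> Set₁
   Plot Ω = ∀ {h} -> Pt h -> ∀ (i : Fin κ) -> Meas (λ x -> Ω x (h x , i))

   b-var : ∀ {g h} -> Pt g -> Pt h -> ∀ (i j : Fin κ) -> Borel (λ x -> (g x , i) ≡ (h x , j))
   b-var {g} {h} mg mh i j = b-resp (λ x (e , e') -> cong₂ _,_ e e') (λ x e -> cong fst e , cong snd e) (b-× (b-≡ mg mh) (b-const (i ≡ j)))

   plot-upd : ∀ {Ω g} -> Plot Ω -> Pt g -> ∀ i a -> Plot (λ x -> upd (g x , i) a (Ω x))
   plot-upd {Ω} {g} pΩ mg i a {h} mh j v = b-resp to from
    (b-⊎ (b-× (b-var mh mg j i) (b-const (a ≡ v))) (b-× (b-¬ (b-var mh mg j i)) (pΩ mh j v)))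
    where
    to : ∀ x -> (((h x , j) ≡ (g x , i)) × a ≡ v) ⊎ ((h x , j) ≢ (g x , i) × Ω x (h x , j) ≡ v) -> upd (g x , i) a (Ω x) (h x , j) ≡ v
    to x t with dec ((h x , j) ≡ (g x , i))
    to x (inj₁ (_ , q)) | yes e = q
    to x (inj₂ (n , _)) | yes e = ⊥-elim (n e)
    to x (inj₁ (e , _)) | no n = ⊥-elim (n e)
    to x (inj₂ (_ , q)) | no n = q
    from : ∀ x -> upd (g x , i) a (Ω x) (h x , j) ≡ v -> (((h x , j) ≡ (g x , i)) × a ≡ v) ⊎ ((h x , j) ≢ (g x , i) × Ω x (h x , j) ≡ v)
    from x q with dec ((h x , j) ≡ (g x , i))
    ... | yes e = inj₁ (e , q)
    ... | no n = inj₂ (n , q)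

   plot-if : ∀ {Ω Ω'} {b : X -> Bool} -> Meas b -> Plot Ω -> Plot Ω' -> Plot (λ x -> if b x then Ω x else Ω' x)
   plot-if {Ω} {Ω'} {b} mb p q {h} mh i v = b-resp to from
    (b-⊎ (b-× (mb true) (p mh i v)) (b-× (mb false) (q mh i v)))
    where
    to : ∀ x -> (b x ≡ true × Ω x (h x , i) ≡ v) ⊎ (b x ≡ false × Ω' x (h x , i) ≡ v) -> (if b x then Ω x else Ω' x) (h x , i) ≡ v
    to x (inj₁ (e , q)) rewrite e = q
    to x (inj₂ (e , q)) rewrite e = q
    from : ∀ x -> (if b x then Ω x else Ω' x) (h x , i) ≡ v -> (b x ≡ true × Ω x (h x , i) ≡ v) ⊎ (b x ≡ false × Ω' x (h x , i) ≡ v)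
    from x q with b x
    ... | true = inj₁ (refl , q)
    ... | false = inj₂ (refl , q)

   record BState (ω : Asg) (T : Mask) : Set₁ where
    constructor bstate
    field
     b-asg : ∀ i -> Meas (λ x -> ω (x , i))
     b-mask : ∀ i -> Meas (λ x -> T (x , i))

   open BState public

   plot-const : ∀ {ω T} -> BState ω T -> Plot (λ _ -> ω)
   plot-const b mh i = meas-pt (b-asg b i) mh

  record CSP : Set₁ where
   field
    κ k ρ : ℕ
    0<k : 1 ≤ k
   open Vars κ k public
   field
    A : X -> Asg -> Set
    local : ∀ v ω ω' -> (∀ z i -> near ρ v z -> ω (z , i) ≡ ω' (z , i)) -> A v ω -> A v ω'
    measurable : ∀ {Ω} -> Plot Ω -> Borel (λ x -> A x (Ω x))

  record Asi : Set₁ where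
   field
    -- One number for all R: it makes the number of stages of a sweep independent of the radius.
    s : ℕ
    U : ℕ -> Fin (suc s) -> X -> Set
    U-borel : ∀ R u -> Borel (U R u)
    U-cover : ∀ R x -> ∃[ u ] U R u x
    U-finite : ∀ R u -> ComponentFinite (U R u) R

  record Graph : Set₁ where
   infix 4 _~_
   field
    _~_ : X -> X -> Set
    ~-sym : ∀ {x y} -> x ~ y -> y ~ x
    ~-irrefl : ∀ {x} -> ¬ (x ~ x)
    b-~ : ∀ {g h} -> Pt g -> Pt h -> Borel (λ x -> g x ~ h x)
    port-all : ∀ {x y} -> x ~ y -> ∃[ c ] port c x ≡ y
    -- Different ports lead to different neighbours, so sums over `nbrs` count each neighbour once.
    port-inj : ∀ {x c c'} -> x ~ port c x -> x ~ port c' x -> port c x ≡ port c' x -> c ≡ c'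

   nbrs : X -> List X
   nbrs x = map (λ c -> port c x) (sel (λ c -> x ~ port c x) (allFin B))

   ∈nbrs : ∀ {x y} -> x ~ y -> y ∈ nbrs x
   ∈nbrs {x} e = let (c , q) = port-all e in subst (_∈ nbrs x) q
    (∈-map⁺ (λ c -> port c x) (∈sel (allFin B) (∈-allFin c) (subst (x ~_) (sym q) e)))

   nbrs∈ : ∀ {x y} -> y ∈ nbrs x -> x ~ y
   nbrs∈ {x} m = case ∈-map⁻ (λ c -> port c x) m of λ { (c , c∈ , refl) -> snd (sel⊆ (allFin B) c∈) }

   nbrs-unique : ∀ x -> Unique (nbrs x)
   nbrs-unique x = go (sel (λ c -> x ~ port c x) (allFin B)) (λ c m -> snd (sel⊆ (allFin B) m)) (sel-unique (allFin⁺ B))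
    where
    go : ∀ cs -> (∀ c -> c ∈ cs -> x ~ port c x) -> Unique cs -> Unique (map (λ c -> port c x) cs)
    go [] h [] = []
    go (c ∷ cs) h (nc ∷ u) = All-tab (map (λ c -> port c x) cs) (λ y m e -> case ∈-map⁻ (λ c -> port c x) m of λ
     { (c' , c'∈ , refl) -> All-∈ nc c'∈ (port-inj (h c (here refl)) (h c' (there c'∈)) e) }) ∷ go cs (λ c m -> h c (there m)) u

   nbrs-near : ∀ {x y} -> y ∈ nbrs x -> near 1 x y
   nbrs-near {x} m = let (c , q) = port-all (nbrs∈ m) in near-step c x (subst (λ z -> near 0 z _) (sym q) (near-refl 0 _))

   meas-nbrs : ∀ {F : X -> X -> ℕ} {g} -> Pt g -> (∀ {h} -> Pt h -> Meas (λ x -> F x (h x))) -> Meas (λ x -> ∑ (nbrs (g x)) (F x))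
   meas-nbrs {F} {g} mg mF v = b-resp (λ x -> trans (expand x)) (λ x -> trans (sym (expand x)))
    (meas-∑ (allFin B) (λ c _ -> meas-map₂ enum-ℕ enum-ℕ (meas-⟦⟧ (b-~ mg (λ u -> mg (port-pt c u)))) (mF (λ u -> mg (port-pt c u))) _*_) v)
    where
    expand : ∀ x -> ∑ (nbrs (g x)) (F x) ≡ ∑ (allFin B) (λ c -> ⟦ g x ~ port c (g x) ⟧ * F x (port c (g x)))
    expand x = ∑-map (λ c -> port c (g x)) (sel (λ c -> g x ~ port c (g x)) (allFin B)) (F x) ∙ ∑-sel (allFin B) _

   b-∃~ : ∀ {R : X -> X -> Set} {g} -> Pt g -> (∀ {h} -> Pt h -> Borel (λ x -> R x (h x))) -> Borel (λ x -> ∃[ u ] g x ~ u × R x u)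
   b-∃~ {R} {g} mg mR = b-resp (λ { x (c , e , r) -> port c (g x) , e , r })
    (λ { x (u , e , r) -> let (c , q) = port-all e in c , subst (g x ~_) (sym q) e , subst (R x) (sym q) r })
    (b-∃ (enum-Fin B) λ c -> b-× (b-~ mg (λ u -> mg (port-pt c u))) (mR (λ u -> mg (port-pt c u))))

  -- The Borel local lemma.

  module LocalLemma (asi : Asi) (C : CSP) where

   open CSP C public

   varW : List ((X -> X) × Fin κ)
   varW = concatMap (λ g -> map (g ,_) (allFin κ)) (walks ρ)

   vars : X -> List Var
   vars v = map (λ (g , i) -> g v , i) varW

   V K : ℕ
   V = length varW
   K = k ^ V

   vars-length : ∀ v -> length (vars v) ≡ V
   vars-length v = length-map _ varW

   ∈vars : ∀ {v z} i -> near ρ v z -> (z , i) ∈ vars v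
   ∈vars {v} i (via {g} g∈ refl) = ∈-map⁺ (λ (g , i) -> g v , i) (∈-concatMap _ (walks ρ) g∈ (∈-map⁺ (g ,_) (∈-allFin i)))

   vars∈ : ∀ {v z i} -> (z , i) ∈ vars v -> near ρ v z
   vars∈ {v} m with ∈-map⁻ (λ (g , i) -> g v , i) m
   ... | (g , i) , m' , refl with concatMap-∈ (λ g -> map (g ,_) (allFin κ)) (walks ρ) m'
   ...   | g' , g∈ , m'' with ∈-map⁻ (g' ,_) m''
   ...     | _ , _ , refl = via g∈ refl

   isA : X -> Asg -> ℕ
   isA v ω = ⟦ A v ω ⟧

   isA-dep : ∀ v -> DependsOn (_∈ vars v) (isA v)
   isA-dep v ω ω' h = ⟦⟧-cong (local v ω ω' λ z i n -> h _ (∈vars i n)) (local v ω' ω λ z i n -> sym (h _ (∈vars i n)))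

   -- K times the conditional probability of the event at v, given the variables in the mask.
   M : X -> Asg -> Mask -> ℕ
   M v ω T = E T (vars v) (isA v) ω

   AgreeOn : List Var -> Asg -> Mask -> Asg -> Mask -> Set
   AgreeOn zs ω T ω' T' = ∀ z -> z ∈ zs -> T z ≡ T' z × ω z ≡ ω' z

   M-agree : ∀ v ω T ω' T' -> AgreeOn (vars v) ω T ω' T' -> M v ω T ≡ M v ω' T'
   M-agree v ω T ω' T' h = E-mask (vars v) (λ z m -> fst (h z m)) (isA v) ω
    ∙ (E-depends (isA-dep v) T' (vars v) ω ω' λ z m -> snd (h z m))

   -- Once every variable of an event is set, its weight is all or nothing.
   M-decided : ∀ v ω T -> (∀ z -> z ∈ vars v -> T z ≡ true) -> M v ω T ≡ K * isA v ω
   M-decided v ω T h = go (vars v) h ∙ cong (λ n -> k ^ n * isA v ω) (vars-length v)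
    where
    go : ∀ zs -> (∀ z -> z ∈ zs -> T z ≡ true) -> E T zs (isA v) ω ≡ k ^ length zs * isA v ω
    go [] h = sym (+-identityʳ _)
    go (z ∷ zs) h rewrite h z (here refl) = vals-const _ ∙ cong (k *_) (go zs λ z m -> h z (there m)) ∙ sym (*-assoc k _ _)

   M-step : ∀ v ω T x -> T x ≡ false -> ∑ vals (λ a -> M v (upd x a ω) (add T x)) ≡ k * M v ω T
   M-step v ω T x tx = martingale (isA-dep v) T (vars v) x ω (λ z m -> m) tx

   M-other : ∀ v ω T x a -> x ∉ vars v -> M v (upd x a ω) (add T x) ≡ M v ω T
   M-other v ω T x a x∉ = M-agree v _ _ _ _ λ z m -> add-other T x z (ne z m) , upd-other x a ω z (ne z m)
    where
    ne : ∀ z -> z ∈ vars v -> z ≢ x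
    ne z m refl = x∉ m

   M-meas : ∀ {ω T} -> BState ω T -> Meas (λ x -> M x ω T)
   M-meas {ω} {T} b = go varW (λ g i m -> pt m) (plot-const b)
    where
    pt : ∀ {g i} -> (g , i) ∈ varW -> Pt g
    pt m with concatMap-∈ (λ g -> map (g ,_) (allFin κ)) (walks ρ) m
    ... | g' , g∈ , m'' with ∈-map⁻ (g' ,_) m''
    ...   | _ , _ , refl = λ bU -> walks-pt ρ _ g∈ bU
    go : ∀ ws -> (∀ g i -> (g , i) ∈ ws -> Pt g) -> ∀ {Ω} -> Plot Ω -> Meas (λ x -> E T (map (λ (g , i) -> g x , i) ws) (isA x) (Ω x))
    go [] h p = meas-⟦⟧ (measurable p)
    go ((g , i) ∷ ws) h p = meas-∑ vals λ a _ -> go ws (λ g' i' m -> h g' i' (there m))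
     (plot-if (meas-pt (b-mask b i) (h g i (here refl))) p (plot-upd p (h g i (here refl)) i a))

   far : X -> X -> Set
   far u v = ¬ near (ρ + ρ) u v

   far-disjoint : ∀ {u v z} -> far u v -> z ∈ vars u -> z ∉ vars v
   far-disjoint f m m' = f (near-trans (vars∈ m) (near-sym (vars∈ m')))

   ΠM : List X -> Asg -> Mask -> ℕ
   ΠM τ ω T = ∏ τ λ v -> M v ω T

   -- Events of a far tuple have no variable in common, so fixing one variable moves at most one
   -- factor, and this factor is a martingale.
   ΠM-step : ∀ τ -> AllPairs far τ -> ∀ ω T x -> T x ≡ false -> ∑ vals (λ a -> ΠM τ (upd x a ω) (add T x)) ≡ k * ΠM τ ω T
   ΠM-step [] f ω T x tx = vals-const 1
   ΠM-step (v ∷ τ) (fv ∷ f) ω T x tx with dec (x ∈ vars v)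
   ... | yes x∈ = (∑-cong vals λ a -> cong (M v (upd x a ω) (add T x) *_) (∏-cong∈ τ λ u u∈ ->
       M-other u ω T x a (far-disjoint (All-∈ fv u∈) x∈)))
      ∙ ∑-*ʳ vals _ _ ∙ cong (_* ΠM τ ω T) (M-step v ω T x tx) ∙ *-assoc k _ _
   ... | no x∉ = (∑-cong vals λ a -> cong (_* ΠM τ (upd x a ω) (add T x)) (M-other v ω T x a x∉))
      ∙ ∑-*ˡ vals (M v ω T) _ ∙ cong (M v ω T *_) (ΠM-step τ f ω T x tx) ∙ x∙yz≈y∙xz (M v ω T) k (ΠM τ ω T)

   Pot : List (List X) -> Asg -> Mask -> ℕ
   Pot ts ω T = ∑ ts λ τ -> ΠM τ ω T

   Pot-step : ∀ ts -> (∀ {τ} -> τ ∈ ts -> AllPairs far τ) -> ∀ ω T x -> T x ≡ false -> ∑ vals (λ a -> Pot ts (upd x a ω) (add T x)) ≡ k * Pot ts ω T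
   Pot-step ts f ω T x tx = ∑-swap vals ts _ ∙ (∑-cong∈ ts λ τ m -> ΠM-step τ (f m) ω T x tx) ∙ ∑-*ˡ ts k _

   Pot-agree : ∀ ts ω T ω' T' -> (∀ {τ v} -> τ ∈ ts -> v ∈ τ -> AgreeOn (vars v) ω T ω' T') -> Pot ts ω T ≡ Pot ts ω' T'
   Pot-agree ts ω T ω' T' h = ∑-cong∈ ts λ τ τ∈ -> ∏-cong∈ τ λ v v∈ -> M-agree v ω T ω' T' (h τ∈ v∈)

   addAll : Mask -> List Var -> Mask
   addAll T [] = T
   addAll T (x ∷ xs) = addAll (add T x) xs

   addAll-other : ∀ T xs z -> z ∉ xs -> addAll T xs z ≡ T z
   addAll-other T [] z z∉ = refl
   addAll-other T (x ∷ xs) z z∉ = addAll-other (add T x) xs z (z∉ ∘ there) ∙ add-other T x z (z∉ ∘ here)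

   addAll-mem : ∀ T xs z -> z ∈ xs -> addAll T xs z ≡ true
   addAll-mem T (x ∷ xs) z m with dec (z ∈ xs)
   addAll-mem T (x ∷ xs) z m | yes m' = addAll-mem (add T x) xs z m'
   addAll-mem T (x ∷ xs) z (here refl) | no n = addAll-other (add T x) xs z n ∙ add-same T x
   addAll-mem T (x ∷ xs) z (there m) | no n = ⊥-elim (n m)

   Pot-E : ∀ ts -> (∀ {τ} -> τ ∈ ts -> AllPairs far τ) -> ∀ xs -> Unique xs -> ∀ ω T -> (∀ x -> x ∈ xs -> T x ≡ false) ->
    E₀ xs (λ ω -> Pot ts ω (addAll T xs)) ω ≡ k ^ length xs * Pot ts ω T
   Pot-E ts f [] u ω T h = sym (+-identityʳ _)
   Pot-E ts f (x ∷ xs) (nx ∷ u) ω T h = (∑-cong vals λ a -> Pot-E ts f xs u (upd x a ω) (add T x) λ z m -> (add-other T x z λ { refl -> All-∈ nx m refl }) ∙ h z (there m))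
    ∙ ∑-*ˡ vals (k ^ length xs) _ ∙ cong (k ^ length xs *_) (Pot-step ts f ω T x (h x (here refl))) ∙ x∙yz≈yx∙z (k ^ length xs) k _

   -- The potentials to be controlled during a sweep. `nb` only has to list those that meet the
   -- potential of y in a variable unset at the start; its size D is what the growth per stage
   -- depends on.
   record Family : Set₁ where
    field
     r D : ℕ
     0<D : 1 ≤ D
     tuples : X -> List (List X)
     tuples-far : ∀ {y τ} -> τ ∈ tuples y -> AllPairs far τ
     tuples-near : ∀ {y τ v} -> τ ∈ tuples y -> v ∈ τ -> near r y v
     tuples-meas : ∀ {ω T} -> BState ω T -> Meas (λ y -> Pot (tuples y) ω T)
     T₀ : Mask
     nb : X -> List X
     nb-≤ : ∀ y -> length (nb y) ≤ D
     nb-meets : ∀ {y y' τ τ' v v' z i} -> τ ∈ tuples y -> v ∈ τ -> τ' ∈ tuples y' -> v' ∈ τ' ->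
      near ρ v z -> near ρ v' z -> T₀ (z , i) ≡ false -> y' ∈ nb y

   module Step (F : Family) (P : ℕ) where
    open Family F

    Φ : X -> Asg -> Mask -> ℕ
    Φ y = Pot (tuples y)

    λ' : ℕ
    λ' = 4 * D

    -- Conditional probability above 1/P. The variables of such an event are frozen, so that the
    -- probability never passes k/P: the last variable set before freezing multiplies it by at most
    -- k.
    Dangerous : Asg -> Mask -> X -> Set
    Dangerous ω T v = K < M v ω T * P

    Frozen : Asg -> Mask -> X -> Set
    Frozen ω T z = ∃[ v ] near ρ z v × Dangerous ω T v

    b-Dangerous : ∀ {ω T} -> BState ω T -> Borel (Dangerous ω T)
    b-Dangerous b = b-≤ (meas-const (suc K)) (meas-map enum-ℕ (M-meas b) (_* P))

    b-Frozen : ∀ {ω T} -> BState ω T -> Borel (Frozen ω T)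
    b-Frozen b = b-∃near (λ _ v -> Dangerous _ _ v) λ g mg -> mg (b-Dangerous b)

    -- Sparseness: an event sees at most one variable of the class, so its weight grows at most by k
    -- in a stage. The scale of the components: all new variables that one potential sees lie in one
    -- component.
    record Class : Set₁ where
     field
      W : X -> Set
      idx : Fin κ
      W-borel : Borel W
      W-finite : ComponentFinite W (r + ρ + (r + ρ))
      W-sparse : ∀ {x x'} -> W x -> W x' -> near (ρ + ρ) x x' -> x ≡ x'

    record Next (ω : Asg) (T : Mask) (c : Class) (ω' : Asg) (T' : Mask) : Set₁ where
     open Class c
     field
      borel : BState ω' T'
      keep-T : ∀ z -> T z ≡ true -> T' z ≡ true
      keep-ω : ∀ z -> T z ≡ true -> ω' z ≡ ω z
      bounded : ∀ v -> M v ω T * P ≤ k * K -> M v ω' T' * P ≤ k * K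
      mult : ∀ v -> M v ω' T' ≤ k * M v ω T
      persists : ∀ v -> Dangerous ω T v -> Dangerous ω' T' v
      settled : ∀ x -> W x -> T' (x , idx) ≡ true ⊎ Frozen ω' T' x
      potential : ∀ y -> Φ y ω' T' ≤ λ' * Φ y ω T

    -- By Markov a potential exceeds 4D times its mean with probability at most 1/(4D), precisely
    -- what the finite local lemma asks for. It is applied inside each finite component, and
    -- `Selection` chooses among its solutions.
    step-exists : ∀ ω T -> BState ω T -> (∀ z -> T₀ z ≡ true -> T z ≡ true) -> ∀ c -> ∃[ ω' ] ∃[ T' ] Next ω T c ω' T'
    step-exists ω T b T₀⊆ c = ω' , T' , record
     { borel = bstate b-ω' b-T'
     ; keep-T = λ z t -> T'-old z t
     ; keep-ω = λ z t -> cong (if_then ω^ (choice (fst z)) z else ω z) (¬new z t)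
     ; bounded = bounded
     ; mult = M-mult
     ; persists = λ v d -> subst (λ n -> K < n * P) (sym (frozen-M v d)) d
     ; settled = settled
     ; potential = potential
     }
     where
     open Class c
     open Dense κ k 0<k
     R ϱ : ℕ
     ϱ = r + ρ
     R = ϱ + ϱ
     W' : X -> Set
     W' x = W x × T (x , idx) ≡ false × ¬ Frozen ω T x
     b-W' : Borel W'
     b-W' = b-× W-borel (b-× (b-mask b idx false) (b-¬ (b-Frozen b)))
     New : Var -> Set
     New (x , i) = i ≡ idx × W' x
     new : Var -> Bool
     new z with dec (New z)
     ... | yes _ = true
     ... | no _ = false
     new-yes : ∀ z -> New z -> new z ≡ true
     new-yes z n with dec (New z)
     ... | yes _ = refl
     ... | no nn = ⊥-elim (nn n)
     new-no : ∀ z -> ¬ New z -> new z ≡ false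
     new-no z nn with dec (New z)
     ... | yes n = ⊥-elim (nn n)
     ... | no _ = refl
     byNew : ∀ z {Q : Set} -> (New z -> Q) -> (¬ New z -> Q) -> Q
     byNew z f g with dec (New z)
     ... | yes n = f n
     ... | no nn = g nn
     new-holds : ∀ z -> new z ≡ true -> New z
     new-holds z e with dec (New z)
     ... | yes n = n
     ¬new : ∀ z -> T z ≡ true -> new z ≡ false
     ¬new (x , i) t = new-no _ λ { (refl , _ , tf , _) -> case trans (sym t) tf of λ () }
     meas-new : ∀ i -> Meas (λ x -> new (x , i))
     meas-new i true = b-resp (λ x n -> new-yes (x , i) n) (λ x e -> new-holds (x , i) e) (b-× (b-const (i ≡ idx)) b-W')
     meas-new i false = b-resp (λ x nn -> new-no (x , i) nn) (λ x e n -> case trans (sym (new-yes (x , i) n)) e of λ ()) (b-¬ (b-× (b-const (i ≡ idx)) b-W'))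
     T' : Mask
     T' z = if new z then true else T z
     T'-new : ∀ z -> New z -> T' z ≡ true
     T'-new z n rewrite new-yes z n = refl
     T'-old : ∀ z -> T z ≡ true -> T' z ≡ true
     T'-old z t rewrite ¬new z t = t
     ω^ : ℕ -> Asg
     ω^ n (x , i) = assignment n x i
     ωn : ℕ -> Asg
     ωn n z = if new z then ω^ n z else ω z
     meas-if : ∀ {V : Set} {b : X -> Bool} {F H : X -> V} -> Meas b -> Meas F -> Meas H -> Meas (λ x -> if b x then F x else H x)
     meas-if {b = b} {F} {H} mb mF mH v = b-resp to from (b-⊎ (b-× (mb true) (mF v)) (b-× (mb false) (mH v)))
      where
      to : ∀ x -> (b x ≡ true × F x ≡ v) ⊎ (b x ≡ false × H x ≡ v) -> (if b x then F x else H x) ≡ v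
      to x (inj₁ (e , q)) rewrite e = q
      to x (inj₂ (e , q)) rewrite e = q
      from : ∀ x -> (if b x then F x else H x) ≡ v -> (b x ≡ true × F x ≡ v) ⊎ (b x ≡ false × H x ≡ v)
      from x q with b x
      ... | true = inj₁ (refl , q)
      ... | false = inj₂ (refl , q)
     b-T' : ∀ i -> Meas (λ x -> T' (x , i))
     b-T' i = meas-if (meas-new i) (meas-const true) (b-mask b i)
     b-ωn : ∀ n -> BState (ωn n) T'
     b-ωn n = bstate (λ i -> meas-if (meas-new i) (assignment-meas n i) (b-asg b i)) b-T'
     good : ℕ -> X -> Set
     good n y = Φ y (ωn n) T' ≤ λ' * Φ y ω T
     b-good : ∀ n -> Borel (good n)
     b-good n = b-≤ (tuples-meas (b-ωn n)) (meas-map enum-ℕ (tuples-meas b) (λ' *_))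
     reach-support : ∀ {y τ v z i} -> τ ∈ tuples y -> v ∈ τ -> (z , i) ∈ vars v -> near ϱ y z
     reach-support τ∈ v∈ z∈ = near-trans (tuples-near τ∈ v∈) (vars∈ z∈)

     solvable : ∀ x -> W' x -> ∃[ n ] ∀ x' -> Conn W' R x x' -> ∀ y -> near ϱ x' y -> good n y
     solvable x wx = let (n , dense) = assignment-dense L λ x i -> ωL (x , i) in n , λ x' s y n' -> fit n dense x' s y n'
      where
      L xs' : List X
      L = fst (W-finite x (fst wx))
      xs' = sel (λ x' -> Conn W' R x x' × W' x') (dedup L)
      weaken : ∀ {x x'} -> Conn W' R x x' -> Conn W R x x'
      weaken nil = nil
      weaken (((w , _) , (w' , _) , n) ◅ s) = (w , w' , n) ◅ weaken s
      conn-W : ∀ {x x'} -> W' x -> Conn W' R x x' -> W' x'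
      conn-W w nil = w
      conn-W w ((_ , w' , _) ◅ s) = conn-W w' s
      ∈xs' : ∀ {x'} -> Conn W' R x x' -> x' ∈ xs'
      ∈xs' s = ∈sel (dedup L) (∈dedup L (snd (W-finite x (fst wx)) _ (weaken s))) (s , conn-W wx s)
      xs : List Var
      xs = map (_, idx) xs'
      xs-unique : Unique xs
      xs-unique = go xs' (sel-unique (dedup-unique L))
       where
       go : ∀ zs -> Unique zs -> Unique (map (_, idx) zs)
       go [] [] = []
       go (z ∷ zs) (nz ∷ u) = All-tab (map (_, idx) zs) (λ w m e -> case ∈-map⁻ (_, idx) m of λ
        { (w' , w'∈ , refl) -> All-∈ nz w'∈ (cong fst e) }) ∷ go zs u
      xs∈ : ∀ {z} -> z ∈ xs -> New z × Conn W' R x (fst z)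
      xs∈ m = case ∈-map⁻ (_, idx) m of λ { (w' , w'∈ , refl) -> let (_ , s , w) = sel⊆ (dedup L) w'∈ in (refl , w) , s }
      xs-unset : ∀ z -> z ∈ xs -> T z ≡ false
      xs-unset (z , i) m = case xs∈ m of λ { ((refl , _ , t , _) , _) -> t }
      ys : List X
      ys = concatMap (ball ϱ) xs'
      Bad : X -> Asg -> Set
      Bad y ω̂ = ¬ (Φ y ω̂ T' ≤ λ' * Φ y ω T)
      dep : X -> Var -> Set
      dep y z = ∃[ τ ] ∃[ v ] τ ∈ tuples y × v ∈ τ × z ∈ vars v
      Φ-cong : ∀ y ω₁ ω₂ -> (∀ z -> dep y z -> ω₁ z ≡ ω₂ z) -> Φ y ω₁ T' ≡ Φ y ω₂ T'
      Φ-cong y ω₁ ω₂ h = Pot-agree (tuples y) ω₁ T' ω₂ T' λ {τ} {v} τ∈ v∈ z z∈ -> refl , h z (τ , v , τ∈ , v∈ , z∈)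
      loc : ∀ y ω₁ ω₂ -> (∀ z -> dep y z -> ω₁ z ≡ ω₂ z) -> Bad y ω₁ -> Bad y ω₂
      loc y ω₁ ω₂ h = subst (λ n -> ¬ (n ≤ λ' * Φ y ω T)) (Φ-cong y ω₁ ω₂ h)
      sharing : ∀ y y' z -> y ∈ ys -> y' ∈ ys -> z ∈ xs -> dep y z -> dep y' z -> y' ∈ nb y
      sharing y y' z _ _ z∈ (τ , v , τ∈ , v∈ , zv) (τ' , v' , τ∈' , v∈' , zv') =
       nb-meets τ∈ v∈ τ∈' v∈' (vars∈ zv) (vars∈ zv') (unset₀ z (xs-unset z z∈))
       where
       unset₀ : ∀ z -> T z ≡ false -> T₀ z ≡ false
       unset₀ z e = casesB (T₀ z) (λ eq -> case trans (sym (T₀⊆ z eq)) e of λ ()) id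
      in-comp : ∀ {y z i} -> y ∈ ys -> near ϱ y z -> New (z , i) -> Conn W' R x z
      in-comp {y} y∈ n (refl , w) = case concatMap-∈ (ball ϱ) xs' y∈ of λ { (x' , x'∈ , y∈') ->
       let (_ , s , w') = sel⊆ (dedup L) x'∈ in s ◅◅ ((w' , w , near-trans {ϱ} (ball⇒near y∈') n) ◅ nil) }
      mask-agree : ∀ y -> y ∈ ys -> ∀ z -> dep y z -> T' z ≡ addAll T xs z
      mask-agree y y∈ z@(w , i) (τ , v , τ∈ , v∈ , zv) = byNew z (λ n -> T'-new z n ∙ (sym (addAll-mem T xs z (case n of λ
          { (refl , _) -> ∈-map⁺ (_, idx) (∈xs' (in-comp y∈ (reach-support τ∈ v∈ zv) n)) }))))
       λ nn -> cong (if_then true else T z) (new-no z nn) ∙ sym (addAll-other T xs z λ m -> nn (fst (xs∈ m)))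
      expectation : ∀ y -> y ∈ ys -> E₀ xs (λ ω -> Φ y ω T') ω ≡ k ^ length xs * Φ y ω T
      expectation y y∈ = (E-cong none xs (λ ω̂ -> Pot-agree (tuples y) ω̂ T' ω̂ (addAll T xs)
        λ {τ} {v} τ∈ v∈ z z∈ -> mask-agree y y∈ z (τ , v , τ∈ , v∈ , z∈) , refl) ω)
       ∙ Pot-E (tuples y) (tuples-far {y}) xs xs-unique ω T xs-unset
      prob : ∀ y -> y ∈ ys -> 4 * D * E₀ xs (λ ω -> ⟦ Bad y ω ⟧) ω ≤ k ^ length xs
      -- A potential equal to zero must stay zero; its mean is zero, so it is positive with
      -- probability zero.
      prob y y∈ = casesN (Φ y ω T)
       (λ eq -> (from≡ ((cong (4 * D *_) (n≤0⇒n≡0 (E-mono none xs pointwise₀ ω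
          » from≡ (expectation y y∈ ∙ cong (k ^ length xs *_) eq ∙ *-zeroʳ (k ^ length xs))))) ∙ *-zeroʳ (4 * D))) » z≤n)
       (λ φ eq -> *-cancelʳ-≤ _ _ (suc φ) (begin
        _ ≡⟨ xy∙z≈y∙xz (4 * D) (E₀ xs bad ω) (suc φ) ⟩
        _ ≡⟨ sym (E-*ʳ none xs bad _ ω) ⟩
        _ ≤⟨ E-mono none xs (λ ω̂ -> subst (λ n -> bad ω̂ * (4 * D * n) ≤ Φ y ω̂ T') eq (pointwise ω̂)) ω ⟩
        _ ≡⟨ expectation y y∈ ∙ cong (k ^ length xs *_) eq ⟩
        _ ∎))
       where
       bad : Asg -> ℕ
       bad ω̂ = ⟦ Bad y ω̂ ⟧
       pointwise : ∀ ω̂ -> bad ω̂ * (4 * D * Φ y ω T) ≤ Φ y ω̂ T'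
       pointwise ω̂ = cases (Bad y ω̂)
        (λ n -> from≡ (cong (_* (4 * D * Φ y ω T)) (⟦⟧-yes n) ∙ *-identityˡ _) » <⇒≤ (≰⇒> n))
        (λ n -> from≡ (cong (_* (4 * D * Φ y ω T)) (⟦⟧-no n)) » z≤n)
       pointwise₀ : ∀ ω̂ -> bad ω̂ ≤ Φ y ω̂ T'
       pointwise₀ ω̂ = cases (Bad y ω̂)
        (λ n -> from≡ (⟦⟧-yes n) » s≤s z≤n » ≰⇒> n)
        (λ n -> from≡ (⟦⟧-no n) » z≤n)
      found : ∃[ ω̂ ] (∀ z -> z ∉ xs -> ω̂ z ≡ ω z) × (∀ y -> y ∈ ys -> ¬ Bad y ω̂)
      found = LLL.LLL k 0<k Bad dep loc xs ω D 0<D nb nb-≤ ys sharing prob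
      ωL : Asg
      ωL = fst found
      fit : ∀ n -> (∀ x -> x ∈ L -> ∀ i -> assignment n x i ≡ ωL (x , i)) -> ∀ x' -> Conn W' R x x' -> ∀ y -> near ϱ x' y -> good n y
      fit n dense x' s y n' = subst (_≤ λ' * Φ y ω T) (Φ-cong y ωL (ωn n) agree) (byContra (snd (snd found) y y∈))
       where
       y∈ : y ∈ ys
       y∈ = ∈-concatMap (ball ϱ) xs' (∈xs' s) (near⇒ball n')
       agree : ∀ z -> dep y z -> ωL z ≡ ωn n z
       agree z@(w , i) (τ , v , τ∈ , v∈ , zv) = byNew z
        (λ nw -> sym (dense w (snd (W-finite x (fst wx)) w (weaken (in-comp y∈ (reach-support τ∈ v∈ zv) nw))) i)
         ∙ sym (cong (if_then ω^ n z else ω z) (new-yes z nw)))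
        (λ nn -> (fst (snd found) z λ m -> nn (fst (xs∈ m))) ∙ sym (cong (if_then ω^ n z else ω z) (new-no z nn)))

     open Selection W' R ϱ b-W' good b-good solvable

     ω' : Asg
     ω' z = if new z then ω^ (choice (fst z)) z else ω z

     b-ω' : ∀ i -> Meas (λ x -> ω' (x , i))
     b-ω' i = meas-if (meas-new i) (λ v -> b-resp (λ { x (n , refl , q) -> q }) (λ x q -> choice x , refl , q)
      (b-∃ enum-ℕ λ n -> b-× (choice-meas n) (assignment-meas n i v))) (b-asg b i)

     untouched : ∀ v -> (∀ z -> z ∈ vars v -> ¬ New z) -> AgreeOn (vars v) ω' T' ω T
     untouched v h z m = cong (if_then true else T z) (new-no z (h z m)) , cong (if_then ω^ (choice (fst z)) z else ω z) (new-no z (h z m))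

     potential : ∀ y -> Φ y ω' T' ≤ λ' * Φ y ω T
     -- If y sees a new variable at x, all new variables that it sees lie in the component of x,
     -- where a single assignment was used.
     potential y = cases (∃[ x ] W' x × near ϱ y x)
      (λ (x , w , n) -> subst (_≤ λ' * Φ y ω T) (Pot-agree (tuples y) (ωn (choice x)) T' ω' T' (agree x w n))
         (choice-good x y w (near-sym n)))
      (λ nx -> (from≡ (Pot-agree (tuples y) ω' T' ω T λ {τ} {v} τ∈ v∈ ->
         untouched v λ { (z , i) zv (_ , w) -> nx (z , w , reach-support τ∈ v∈ zv) }))
        » from≡ (sym (*-identityˡ _)) » *≤ˡ (Φ y ω T) (0<D » m≤m+n D _))
      where
      agree : ∀ x -> W' x -> near ϱ y x -> ∀ {τ v} -> τ ∈ tuples y -> v ∈ τ -> AgreeOn (vars v) (ωn (choice x)) T' ω' T'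
      agree x w n {τ} {v} τ∈ v∈ z@(u , i) zv = refl , byNew z
       (λ { (_ , w') -> cong (λ n -> if new z then ω^ n z else ω z) (choice-const x u (w , w' , near-trans {ϱ} {ϱ} (near-sym n) (reach-support τ∈ v∈ zv))) })
       (λ nn -> cong (if_then ω^ (choice x) z else ω z) (new-no z nn) ∙ sym (cong (if_then ω^ (choice u) z else ω z) (new-no z nn)))

     frozen-M : ∀ v -> Dangerous ω T v -> M v ω' T' ≡ M v ω T
     frozen-M v d = M-agree v ω' T' ω T (untouched v λ { (z , i) zv (_ , _ , _ , nf) -> nf (v , near-sym (vars∈ zv) , d) })

     M-mult : ∀ v -> M v ω' T' ≤ k * M v ω T
     M-mult v = cases (∃[ z ] z ∈ vars v × New z)
      (λ (z , zv , nz) -> begin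
       _ ≡⟨ M-agree v ω' T' (upd z (ω' z) ω) (add T z) (agree z zv nz) ⟩
       _ ≤⟨ ∑-member vals (λ a -> M v (upd z a ω) (add T z)) (∈-allFin (ω' z)) ⟩
       _ ≡⟨ M-step v ω T z (unset nz) ⟩
       _ ∎)
      (λ nz -> from≡ (M-agree v ω' T' ω T (untouched v λ z m n -> nz (z , m , n)) ∙ sym (*-identityˡ _)) » *≤ˡ _ 0<k)
      where
      unset : ∀ {z} -> New z -> T z ≡ false
      unset (refl , _ , t , _) = t
      only : ∀ z -> z ∈ vars v -> New z -> ∀ z' -> z' ∈ vars v -> New z' -> z' ≡ z
      only (u , _) m (refl , w) (u' , _) m' (refl , w') = cong (_, idx)
       (W-sparse (fst w') (fst w) (near-trans (near-sym (vars∈ m')) (vars∈ m)))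
      agree : ∀ z -> z ∈ vars v -> New z -> AgreeOn (vars v) ω' T' (upd z (ω' z) ω) (add T z)
      agree z m nz z' m' = cases (z' ≡ z)
       (λ { refl -> T'-new z nz ∙ sym (add-same T z) , sym (upd-same z (ω' z) ω) })
       (λ ne -> cong (if_then true else T z') (new-no z' (ne ∘ only z m nz z' m')) ∙ sym (add-other T z z' ne) ,
           cong (if_then ω^ (choice (fst z')) z' else ω z') (new-no z' (ne ∘ only z m nz z' m')) ∙ sym (upd-other z (ω' z) ω z' ne))

     bounded : ∀ v -> M v ω T * P ≤ k * K -> M v ω' T' * P ≤ k * K
     bounded v h = cases (Dangerous ω T v)
      (λ d -> subst (λ n -> n * P ≤ k * K) (sym (frozen-M v d)) h)
      (λ nd -> *≤ˡ P (M-mult v) » from≡ (*-assoc k _ P) » *≤ʳ k (≮⇒≥ nd))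

     settled : ∀ x -> W x -> T' (x , idx) ≡ true ⊎ Frozen ω' T' x
     settled x w = casesB (T (x , idx)) (λ eq -> inj₁ (T'-old (x , idx) eq)) λ eq -> cases (Frozen ω T x)
      (λ (v , n , d) -> inj₂ (v , n , subst (λ n -> K < n * P) (sym (frozen-M v d)) d))
      (λ nf -> inj₁ (T'-new (x , idx) (refl , w , eq , nf)))

    abstract
     step : ∀ ω T -> BState ω T -> (∀ z -> T₀ z ≡ true -> T z ≡ true) -> ∀ c -> ∃[ ω' ] ∃[ T' ] Next ω T c ω' T'
     step = step-exists

   module Sweeps (F : Family) (P : ℕ) where
    open Family F
    open Step F P public

    record Swept (ω : Asg) (T : Mask) (n : ℕ) (ω' : Asg) (T' : Mask) : Set₁ where
     field
      borel : BState ω' T'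
      keep-T : ∀ z -> T z ≡ true -> T' z ≡ true
      keep-ω : ∀ z -> T z ≡ true -> ω' z ≡ ω z
      bounded : ∀ v -> M v ω T * P ≤ k * K -> M v ω' T' * P ≤ k * K
      mult : ∀ v -> M v ω' T' ≤ k ^ n * M v ω T
      persists : ∀ v -> Dangerous ω T v -> Dangerous ω' T' v
      potential : ∀ y -> Φ y ω' T' ≤ λ' ^ n * Φ y ω T

    Settled : Asg -> Mask -> Class -> Set
    Settled ω T c = ∀ x -> Class.W c x -> T (x , Class.idx c) ≡ true ⊎ Frozen ω T x

    sweep : ∀ cs ω T -> BState ω T -> (∀ z -> T₀ z ≡ true -> T z ≡ true) ->
     ∃[ ω' ] ∃[ T' ] Swept ω T (length cs) ω' T' × All (Settled ω' T') cs
    sweep [] ω T b h = ω , T , record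
     { borel = b ; keep-T = λ z t -> t ; keep-ω = λ z t -> refl ; bounded = λ v x -> x ; mult = λ v -> from≡ (sym (+-identityʳ _))
     ; persists = λ v d -> d ; potential = λ y -> from≡ (sym (+-identityʳ _)) } , []
    sweep (c ∷ cs) ω T b h = ω₂ , T₂ , record
     { borel = Swept.borel Sw
     ; keep-T = λ z t -> Swept.keep-T Sw z (Next.keep-T N z t)
     ; keep-ω = λ z t -> Swept.keep-ω Sw z (Next.keep-T N z t) ∙ Next.keep-ω N z t
     ; bounded = λ v x -> Swept.bounded Sw v (Next.bounded N v x)
     ; mult = λ v -> chain {k} {k ^ length cs} (Swept.mult Sw v) (Next.mult N v)
     ; persists = λ v d -> Swept.persists Sw v (Next.persists N v d)
     ; potential = λ y -> chain {λ'} {λ' ^ length cs} (Swept.potential Sw y) (Next.potential N y) } ,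
     now ∷ snd (snd (snd rest))
     where
     first : ∃[ ω' ] ∃[ T' ] Next ω T c ω' T'
     first = step ω T b h c
     ω₁ = fst first
     T₁ = fst (snd first)
     N : Next ω T c ω₁ T₁
     N = snd (snd first)
     rest : ∃[ ω' ] ∃[ T' ] Swept ω₁ T₁ (length cs) ω' T' × All (Settled ω' T') cs
     rest = sweep cs ω₁ T₁ (Next.borel N) (λ z t -> Next.keep-T N z (h z t))
     ω₂ = fst rest
     T₂ = fst (snd rest)
     Sw : Swept ω₁ T₁ (length cs) ω₂ T₂
     Sw = fst (snd (snd rest))
     now : Settled ω₂ T₂ c
     now x w = case Next.settled N x w of λ
      { (inj₁ t) -> inj₁ (Swept.keep-T Sw _ t) ; (inj₂ (v , n , d)) -> inj₂ (v , n , Swept.persists Sw v d) }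
     chain : ∀ {a b x y z} -> x ≤ b * y -> y ≤ a * z -> x ≤ a * b * z
     chain {a} {b} {x} {y} {z} p q = p » *≤ʳ b q » from≡ (x∙yz≈yx∙z b a z)

   -- Vertices whose ρ-balls can meet receive different colours, so that colour classes are sparse.
   spread : Colouring.Relation S
   spread = record
    { I = Fin (length (walks (ρ + ρ))) ; enum = enum-Fin _ ; fam = List.lookup (walks (ρ + ρ))
    ; fam-pt = λ i b -> walks-pt (ρ + ρ) _ (∈-lookup i) b
    ; _~_ = λ x y -> x ≢ y × near (ρ + ρ) x y
    ; ~-sym = λ (ne , n) -> ne ∘ sym , near-sym n ; ~-irrefl = λ (ne , _) -> ne refl
    ; ~-fam = λ { (_ , via g∈ e) -> index g∈ , cong (λ f -> f _) (sym (lookup-index g∈)) ∙ e }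
    ; b-~ = λ mg mh -> b-× (b-¬ (b-≡ mg mh)) (b-near (ρ + ρ) mg mh)
    ; nbrs = ball (ρ + ρ) ; ∈nbrs = λ (_ , n) -> near⇒ball n }

   open Colouring.Greedy S spread using (colour; colour-meas; colour-proper; colour-≤)

   colours : ℕ
   colours = suc (B ^ (ρ + ρ))

   module Classes (F : Family) (P : ℕ) where
    open Asi asi
    open Family F
    open Sweeps F P public

    private
     R = r + ρ + (r + ρ)

     class : Fin (suc s) -> Fin colours -> Fin κ -> Class
     class u c i = record
      { W = λ x -> U R u x × colour x ≡ toℕ c ; idx = i
      ; W-borel = b-× (U-borel R u) (colour-meas (toℕ c))
      ; W-finite = λ x w -> let (L , h) = U-finite R u x (fst w) in L , λ y s -> h y (weaken s)
      ; W-sparse = λ (_ , e) (_ , e') n -> byContra λ ne -> colour-proper (ne , n) (e ∙ sym e') }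
      where
      weaken : ∀ {x y} -> Conn (λ x -> U R u x × colour x ≡ toℕ c) R x y -> Conn (U R u) R x y
      weaken nil = nil
      weaken (((w , _) , (w' , _) , n) ◅ s) = (w , w' , n) ◅ weaken s

     row : Fin (suc s) -> Fin colours -> List Class
     row u c = map (class u c) (allFin κ)

     block : Fin (suc s) -> List Class
     block u = concatMap (row u) (allFin colours)

    -- Their number involves s, κ and the size of balls of radius 2ρ, but not the radius r of the
    -- tuples.
    classes : List Class
    classes = concatMap block (allFin (suc s))

    classes-length : length classes ≡ suc s * (colours * κ)
    classes-length = (length-concatMap block (allFin (suc s)) (colours * κ) λ u -> (length-concatMap (row u) (allFin colours) κ λ c -> length-map (class u c) (allFin κ) ∙ length-allFin κ)
     ∙ cong (_* κ) (length-allFin colours)) ∙ cong (_* (colours * κ)) (length-allFin (suc s))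

    covered : ∀ {ω T} -> All (Settled ω T) classes -> ∀ x i -> T (x , i) ≡ true ⊎ Frozen ω T x
    covered st x i = let
     (u , ux) = U-cover R x
     c<  = s≤s (colour-≤ x (B ^ (ρ + ρ)) (λ L uq h -> unique-length uq (λ m -> near⇒ball (snd (h m))) » from≡ (ball-length (ρ + ρ) x)) » ≤-refl)
     in All-∈ st (∈-concatMap block (allFin (suc s)) (∈-allFin u) (∈-concatMap (row u) (allFin colours) (∈-allFin (fromℕ< c<)) (∈-map⁺ (class u (fromℕ< c<)) (∈-allFin i))))
      x (ux , sym (toℕ-fromℕ< c<))

   -- A tuple is encoded by a tour with jumps of length at most h on which some points are flagged.
   -- Touring a tree with n edges depth first takes 2n jumps, so there are at most (2 B^h)^(2n)
   -- tuples.
   Move : Set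
   Move = (X -> X) × Bool

   moves : ℕ -> List Move
   moves h = concatMap (λ g -> (g , true) ∷ (g , false) ∷ []) (walks h)

   moves-length : ∀ h -> length (moves h) ≡ B ^ h * 2
   moves-length h = (length-concatMap (λ g -> (g , true) ∷ (g , false) ∷ []) (walks h) 2 λ _ -> refl) ∙ cong (_* 2) (walks-length h)

   ∈moves : ∀ h {g} b -> g ∈ walks h -> (g , b) ∈ moves h
   ∈moves h true m = ∈-concatMap (λ g -> (g , true) ∷ (g , false) ∷ []) (walks h) m (here refl)
   ∈moves h false m = ∈-concatMap (λ g -> (g , true) ∷ (g , false) ∷ []) (walks h) m (there (here refl))

   moves∈ : ∀ h {m} -> m ∈ moves h -> fst m ∈ walks h
   moves∈ h m∈ with concatMap-∈ (λ g -> (g , true) ∷ (g , false) ∷ []) (walks h) m∈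
   ... | g , g∈ , here refl = g∈
   ... | g , g∈ , there (here refl) = g∈

   flag : Bool -> X -> List X -> List X
   flag true x l = x ∷ l
   flag false x l = l

   flagged visited : X -> List Move -> List X
   flagged p [] = []
   flagged p ((g , b) ∷ ms) = flag b (g p) (flagged (g p) ms)
   visited p [] = []
   visited p ((g , b) ∷ ms) = g p ∷ visited (g p) ms

   flagged-visited : ∀ {Q : X -> Set} p ms -> All Q (visited p ms) -> All Q (flagged p ms)
   flagged-visited p [] [] = []
   flagged-visited p ((g , true) ∷ ms) (q ∷ qs) = q ∷ flagged-visited (g p) ms qs
   flagged-visited p ((g , false) ∷ ms) (q ∷ qs) = flagged-visited (g p) ms qs

   visited-near : ∀ h p ms -> All (_∈ moves h) ms -> All (near (length ms * h) p) (visited p ms)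
   visited-near h p [] [] = []
   visited-near h p ((g , b) ∷ ms) (m ∷ all) = near-mono (m≤m+n h _) (via (moves∈ h m) refl) ∷
    All-tab (visited (g p) ms) λ v v∈ -> near-trans {h} (via (moves∈ h m) refl) (All-∈ (visited-near h (g p) ms all) v∈)

   module Family' (h r n : ℕ) (Act : X -> Set) (b-Act : Borel Act) where

    Ok : X -> List Move -> Set
    Ok y ms = AllPairs far (y ∷ flagged y ms) × All (near r y) (visited y ms) × All Act (y ∷ visited y ms) × length (flagged y ms) ≡ n

    plans : List (List Move)
    plans = seqs (moves h) (n + n)

    tuples : X -> List (List X)
    tuples y = map (λ ms -> y ∷ flagged y ms) (sel (Ok y) plans)

    tuples∈ : ∀ {y τ} -> τ ∈ tuples y -> ∃[ ms ] ms ∈ plans × Ok y ms × τ ≡ y ∷ flagged y ms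
    tuples∈ {y} m with ∈-map⁻ (λ ms -> y ∷ flagged y ms) m
    ... | ms , ms∈ , e = let (a , b) = sel⊆ plans ms∈ in ms , a , b , e

    ∈tuples : ∀ {y ms} -> ms ∈ plans -> Ok y ms -> (y ∷ flagged y ms) ∈ tuples y
    ∈tuples {y} m ok = ∈-map⁺ (λ ms -> y ∷ flagged y ms) (∈sel plans m ok)

    tuples-far : ∀ {y τ} -> τ ∈ tuples y -> AllPairs far τ
    tuples-far m with tuples∈ m
    ... | ms , _ , ok , refl = fst ok

    tuples-near : ∀ {y τ v} -> τ ∈ tuples y -> v ∈ τ -> near r y v
    tuples-near {y} m v∈ with tuples∈ m
    tuples-near {y} m (here refl) | ms , _ , ok , refl = near-refl r y
    tuples-near {y} m (there v∈) | ms , _ , ok , refl = All-∈ (flagged-visited y ms (fst (snd ok))) v∈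

    private
     plan∈ : ∀ {ms} -> ms ∈ plans -> All (_∈ moves h) ms
     plan∈ m = fst (seqs∈ (moves h) (n + n) m)

     step-pt : ∀ {g b p} -> (g , b) ∈ moves h -> Pt p -> Pt (g ∘ p)
     step-pt m mp b = mp (walks-pt h _ (moves∈ h m) b)

     b-visited : ∀ {Q : X -> X -> Set} -> (∀ {g} -> Pt g -> Borel (λ x -> Q x (g x))) -> ∀ ms -> All (_∈ moves h) ms -> ∀ {p} -> Pt p -> Borel (λ x -> All (Q x) (visited (p x) ms))
     b-visited bQ [] [] mp = b-resp (λ _ _ -> []) (λ _ _ -> tt) b-⊤
     b-visited bQ ((g , b) ∷ ms) (m ∷ all) mp = b-resp (λ { x (q , qs) -> q ∷ qs }) (λ { x (q ∷ qs) -> q , qs })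
      (b-× (bQ (step-pt m mp)) (b-visited bQ ms all (step-pt m mp)))

     b-flagged : ∀ {Q : X -> X -> Set} -> (∀ {g} -> Pt g -> Borel (λ x -> Q x (g x))) -> ∀ ms -> All (_∈ moves h) ms -> ∀ {p} -> Pt p -> Borel (λ x -> All (Q x) (flagged (p x) ms))
     b-flagged bQ [] [] mp = b-resp (λ _ _ -> []) (λ _ _ -> tt) b-⊤
     b-flagged bQ ((g , true) ∷ ms) (m ∷ all) mp = b-resp (λ { x (q , qs) -> q ∷ qs }) (λ { x (q ∷ qs) -> q , qs })
      (b-× (bQ (step-pt m mp)) (b-flagged bQ ms all (step-pt m mp)))
     b-flagged bQ ((g , false) ∷ ms) (m ∷ all) mp = b-flagged bQ ms all (step-pt m mp)

     b-far : ∀ {g g'} -> Pt g -> Pt g' -> Borel (λ x -> far (g x) (g' x))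
     b-far mg mg' = b-¬ (b-near (ρ + ρ) mg mg')

     b-pairs : ∀ ms -> All (_∈ moves h) ms -> ∀ {p} -> Pt p -> Borel (λ x -> AllPairs far (flagged (p x) ms))
     b-pairs [] [] mp = b-resp (λ _ _ -> []) (λ _ _ -> tt) b-⊤
     b-pairs ((g , true) ∷ ms) (m ∷ all) mp = b-resp (λ { x (q , qs) -> q ∷ qs }) (λ { x (q ∷ qs) -> q , qs })
      (b-× (b-flagged (λ mg' -> b-far (step-pt m mp) mg') ms all (step-pt m mp)) (b-pairs ms all (step-pt m mp)))
     b-pairs ((g , false) ∷ ms) (m ∷ all) mp = b-pairs ms all (step-pt m mp)

     meas-count : ∀ ms -> All (_∈ moves h) ms -> ∀ {p} -> Pt p -> Meas (λ x -> length (flagged (p x) ms))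
     meas-count [] [] mp = meas-const 0
     meas-count ((g , true) ∷ ms) (m ∷ all) mp = meas-map enum-ℕ (meas-count ms all (step-pt m mp)) suc
     meas-count ((g , false) ∷ ms) (m ∷ all) mp = meas-count ms all (step-pt m mp)

     meas-Π : ∀ {ω T} -> BState ω T -> ∀ ms -> All (_∈ moves h) ms -> ∀ {p} -> Pt p -> Meas (λ x -> ΠM (flagged (p x) ms) ω T)
     meas-Π b [] [] mp = meas-const 1
     meas-Π b ((g , true) ∷ ms) (m ∷ all) mp = meas-map₂ enum-ℕ enum-ℕ (meas-pt (M-meas b) (step-pt m mp)) (meas-Π b ms all (step-pt m mp)) _*_
     meas-Π b ((g , false) ∷ ms) (m ∷ all) mp = meas-Π b ms all (step-pt m mp)

    b-Ok : ∀ ms -> ms ∈ plans -> Borel (λ y -> Ok y ms)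
    b-Ok ms m = b-× (b-resp (λ { x (q , qs) -> q ∷ qs }) (λ { x (q ∷ qs) -> q , qs }) (b-× (b-flagged (λ mg -> b-far pt-id mg) ms all pt-id) (b-pairs ms all pt-id)))
     (b-× (b-visited (λ mg -> b-near r pt-id mg) ms all pt-id)
     (b-× (b-resp (λ { x (q , qs) -> q ∷ qs }) (λ { x (q ∷ qs) -> q , qs }) (b-× b-Act (b-visited (λ mg -> mg b-Act) ms all pt-id)))
      (meas-count ms all pt-id n)))
     where
     all = plan∈ m

    tuples-meas : ∀ {ω T} -> BState ω T -> Meas (λ y -> Pot (tuples y) ω T)
    tuples-meas {ω} {T} b v = b-resp (λ y -> trans (sym (expand y))) (λ y -> trans (expand y))
     (meas-∑ plans (λ ms m -> meas-map₂ enum-ℕ enum-ℕ (meas-⟦⟧ (b-Ok ms m)) (meas-map₂ enum-ℕ enum-ℕ (M-meas b) (meas-Π b ms (plan∈ m) pt-id) _*_) _*_) v)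
     where
     expand : ∀ y -> ∑ plans (λ ms -> ⟦ Ok y ms ⟧ * (M y ω T * ΠM (flagged y ms) ω T)) ≡ Pot (tuples y) ω T
     expand y = sym (∑-map (λ ms -> y ∷ flagged y ms) (sel (Ok y) plans) _ ∙ ∑-sel plans _)

    plans-length : length plans ≡ (B ^ h * 2) ^ (n + n)
    plans-length = seqs-length (moves h) (n + n) ∙ cong (_^ (n + n)) (moves-length h)

    private
     Π-power : ∀ τ ω T c P -> (∀ v -> v ∈ τ -> M v ω T * P ≤ c) -> ΠM τ ω T * P ^ length τ ≤ c ^ length τ
     Π-power [] ω T c P hyp = ≤-refl
     Π-power (v ∷ τ) ω T c P hyp = from≡ (*-interchange (M v ω T) (ΠM τ ω T) P (P ^ length τ))
      » *≤ (hyp v (here refl)) (Π-power τ ω T c P λ u m -> hyp u (there m))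

     Π-power' : ∀ τ ω T c P -> (∀ v -> v ∈ τ -> c ≤ M v ω T * P) -> c ^ length τ ≤ ΠM τ ω T * P ^ length τ
     Π-power' [] ω T c P hyp = ≤-refl
     Π-power' (v ∷ τ) ω T c P hyp = *≤ (hyp v (here refl)) (Π-power' τ ω T c P λ u m -> hyp u (there m))
      » from≡ (*-interchange (M v ω T) P (ΠM τ ω T) (P ^ length τ))

     tuple-length : ∀ {y τ} -> τ ∈ tuples y -> length τ ≡ suc n
     tuple-length m with tuples∈ m
     ... | ms , _ , ok , refl = cong suc (snd (snd (snd ok)))

    potential-≤ : ∀ y ω T P -> (∀ v -> M v ω T * P ≤ K) -> Pot (tuples y) ω T * P ^ suc n ≤ (B ^ h * 2) ^ (n + n) * K ^ suc n
    potential-≤ y ω T P hyp = begin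
     _ ≡⟨ sym (∑-*ʳ (tuples y) _ _) ⟩
     _ ≤⟨ ∑-≤const (tuples y) (K ^ suc n) (λ τ m -> subst (λ l -> ΠM τ ω T * P ^ l ≤ K ^ l) (tuple-length m) (Π-power τ ω T K P λ v _ -> hyp v)) ⟩
     _ ≤⟨ *≤ˡ (K ^ suc n) (from≡ (length-map _ (sel (Ok y) plans)) » List.length-filter _ plans » from≡ plans-length) ⟩
     _ ∎

    potential-≥ : ∀ y τ ω T P -> τ ∈ tuples y -> (∀ v -> v ∈ τ -> K ≤ M v ω T * P) -> K ^ suc n ≤ Pot (tuples y) ω T * P ^ suc n
    potential-≥ y τ ω T P m hyp = subst (λ l -> K ^ l ≤ ΠM τ ω T * P ^ l) (tuple-length m) (Π-power' τ ω T K P hyp)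
     » *≤ˡ (P ^ suc n) (∑-member (tuples y) (λ τ -> ΠM τ ω T) m)

   record Inserted (h : ℕ) (p : X) (ms : List Move) (u z : X) : Set₁ where
    field
     ms' : List Move
     moves' : All (_∈ moves h) ms'
     length' : length ms' ≡ suc (suc (length ms))
     before after : List X
     flagged≡ : flagged p ms ≡ before ++ after
     flagged'≡ : flagged p ms' ≡ before ++ z ∷ after
     visited' : ∀ {Q : X -> Set} -> Q u -> Q z -> All Q (visited p ms) -> All Q (visited p ms')

   -- The tour is interrupted at u by a detour to z and back; only z is flagged. A jump back exists
   -- because nearness is symmetric.
   insert : ∀ h p ms u z -> All (_∈ moves h) ms -> u ∈ p ∷ flagged p ms -> near h u z -> Inserted h p ms u z
   insert h p ms u z all (here refl) (via {g} g∈ refl) = detour (near-sym (via {walk = g} g∈ refl))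
    where
    detour : near h (g u) u -> Inserted h u ms u (g u)
    detour (via {g⁻} g⁻∈ e) = record
     { ms' = (g , true) ∷ (g⁻ , false) ∷ ms ; moves' = ∈moves h true g∈ ∷ ∈moves h false g⁻∈ ∷ all ; length' = refl
     ; before = [] ; after = flagged u ms ; flagged≡ = refl ; flagged'≡ = cong (λ w -> g u ∷ flagged w ms) e
     ; visited' = λ {Q} qu qz qs -> qz ∷ subst (λ w -> All Q (w ∷ visited w ms)) (sym e) (qu ∷ qs) }
   insert h p ((g , b) ∷ ms) u z (m ∷ all) (there u∈) nz = record
     { ms' = (g , b) ∷ ms' ; moves' = m ∷ moves' ; length' = cong suc length'
     ; before = flag b (g p) before ; after = after
     ; flagged≡ = cong (flag b (g p)) flagged≡ ∙ flag-++ b ; flagged'≡ = cong (flag b (g p)) flagged'≡ ∙ flag-++ b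
     ; visited' = λ { qu qz (q ∷ qs) -> q ∷ visited' qu qz qs } }
    where
    inner : ∀ b -> u ∈ flag b (g p) (flagged (g p) ms) -> u ∈ g p ∷ flagged (g p) ms
    inner true m = m
    inner false m = there m
    open Inserted (insert h (g p) ms u z all (inner b u∈) nz)
    flag-++ : ∀ b {x l l'} -> flag b x (l ++ l') ≡ flag b x l ++ l'
    flag-++ true = refl
    flag-++ false = refl

   far-sym : ∀ {u v} -> far u v -> far v u
   far-sym f n = f (near-sym n)

   All-insert : ∀ {Q : X -> Set} l {z r} -> Q z -> All Q (l ++ r) -> All Q (l ++ z ∷ r)
   All-insert [] qz qs = qz ∷ qs
   All-insert (x ∷ l) qz (q ∷ qs) = q ∷ All-insert l qz qs

   pairs-insert : ∀ l {z r} -> All (far z) (l ++ r) -> AllPairs far (l ++ r) -> AllPairs far (l ++ z ∷ r)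
   pairs-insert [] fz ap = fz ∷ ap
   pairs-insert (x ∷ l) (f ∷ fz) (fx ∷ ap) = All-insert l (far-sym f) fx ∷ pairs-insert l fz ap

   -- A far set grown from y by jumps stops before it has n points besides y, as no such tuple
   -- exists. When it cannot grow, its points cover the component of y within 2ρ: otherwise a first
   -- uncovered point on a path could be added.
   module Cover (h h₀ n : ℕ) (h₀≤h : ρ + ρ + h₀ ≤ h) (Z : X -> Set) (y : X) (Zy : Z y)
    (none : ∀ ms -> ms ∈ seqs (moves h) (n + n) -> AllPairs far (y ∷ flagged y ms) -> All Z (visited y ms) -> length (flagged y ms) ≢ n) where

    Covered : List X -> X -> Set
    Covered Q v = ∃[ u ] u ∈ Q × near (ρ + ρ) u v

    private
     crossing : ∀ Q a v -> Covered Q a -> ¬ Covered Q v -> Conn Z h₀ a v -> ∃[ b ] ∃[ z ] Covered Q b × ¬ Covered Q z × In Z h₀ b z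
     crossing Q a .a c nc nil = ⊥-elim (nc c)
     crossing Q a v c nc (_◅_ {j = b} i s) = cases (Covered Q b) (λ cb -> crossing Q b v cb nc s) (λ nb -> a , b , c , nb , i)

     grow : ∀ d m ms -> m + d ≡ n -> All (_∈ moves h) ms -> length ms ≡ m + m -> length (flagged y ms) ≡ m ->
      AllPairs far (y ∷ flagged y ms) -> All Z (visited y ms) -> ∃[ Q ] length Q ≤ n × (∀ v -> Conn Z h₀ y v -> Covered Q v)
     grow zero m ms e all len cnt ap vz = ⊥-elim (none ms
      (subst (λ l -> ms ∈ seqs (moves h) l) (len ∙ cong₂ _+_ m≡n m≡n) (∈seqs (moves h) ms all)) ap vz (cnt ∙ m≡n))
      where
      m≡n = sym (+-identityʳ m) ∙ e
     grow (suc d) m ms e all len cnt ap vz = cases (∃[ v ] Conn Z h₀ y v × ¬ Covered Q v)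
      (λ (v , s , nc) -> extend (crossing Q y v (y , here refl , near-refl _ y) nc s))
      (λ ne -> Q , s≤s (from≡ cnt) » s≤s (m≤m+n m d) » from≡ (sym (+-suc m d) ∙ e) , λ v s -> byContra λ nc -> ne (v , s , nc))
      where
      Q = y ∷ flagged y ms
      extend : ∃[ b ] ∃[ z ] Covered Q b × ¬ Covered Q z × In Z h₀ b z -> ∃[ Q ] length Q ≤ n × (∀ v -> Conn Z h₀ y v -> Covered Q v)
      extend (b , z , (u , u∈ , ub) , nc , (zb , zz , bz)) = grow d (suc m) ms' (sym (+-suc m d) ∙ e) moves'
        (length' ∙ cong (suc ∘ suc) len ∙ cong suc (sym (+-suc m m)))
        (cong length flagged'≡ ∙ (List.length-++ before ∙ (+-suc (length before) (length after)
         ∙ cong suc (sym (List.length-++ before) ∙ cong length (sym flagged≡) ∙ cnt))))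
        (subst (λ l -> AllPairs far (y ∷ l)) (sym flagged'≡) (pairs-insert (y ∷ before) (subst (λ l -> All (far z) (y ∷ l)) flagged≡ far-z) (subst (λ l -> AllPairs far (y ∷ l)) flagged≡ ap)))
        (visited' Zu zz vz)
       where
       open Inserted (insert h y ms u z all u∈ (near-mono h₀≤h (near-trans ub bz)))
       far-z : All (far z) Q
       far-z = All-tab Q λ w w∈ n -> nc (w , w∈ , near-sym n)
       Zu : Z u
       Zu = case u∈ of λ { (here refl) -> Zy ; (there m) -> All-∈ (flagged-visited y ms vz) m }

    cover : ∃[ Q ] length Q ≤ n × (∀ v -> Conn Z h₀ y v -> Covered Q v)
    cover = grow n 0 [] refl [] refl refl ([] ∷ []) []

   -- Jump lengths. `h₂` joins dangerous events that freeze unset variables at distance 2ρ, `h₁`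
   -- joins representatives of active events at distance `h₂`; both include 2ρ for passing to a
   -- covering point. `q₁` and `q₂` count the moves.
   h₂ h₁ q₁ q₂ : ℕ
   h₂ = ρ + ρ + (ρ + (ρ + ρ) + ρ)
   h₁ = ρ + ρ + (ρ + ρ + h₂ + (ρ + ρ))
   q₁ = B ^ h₁ * 2
   q₂ = B ^ h₂ * 2

   -- Inverse probabilities with room for the next level. `P₂` leaves the finite local lemma its 4
   -- B^(2ρ) after an overshoot by k; `P₁` beats the tours of the second sweep after such an
   -- overshoot, `P₀` those of the first. The number of stages does not occur.
   P₂ P₁ P₀ : ℕ
   P₂ = 4 * k * B ^ (ρ + ρ)
   P₁ = k * (2 * (q₂ * q₂) * P₂)
   P₀ = 2 * (q₁ * q₁) * P₁

   0<B : 1 ≤ B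
   0<B = nonempty stay
    where
    nonempty : ∀ {n} -> Fin n -> 1 ≤ n
    nonempty fzero = s≤s z≤n
    nonempty (fsuc _) = s≤s z≤n

   0<K : 1 ≤ K
   0<K = 1≤^ V 0<k

   0<q₁ : 1 ≤ q₁
   0<q₁ = 1≤* (1≤^ h₁ 0<B) (s≤s z≤n)

   0<q₂ : 1 ≤ q₂
   0<q₂ = 1≤* (1≤^ h₂ 0<B) (s≤s z≤n)

   0<P₂ : 1 ≤ P₂
   0<P₂ = 1≤* (1≤* {4} (s≤s z≤n) 0<k) (1≤^ (ρ + ρ) 0<B)

   k<P₂ : k < P₂
   k<P₂ = (+≤ˡ k 0<k » m≤m+n (k + k) (k + k) » from≡ (ring6 k)) » from≡ (sym (*-identityʳ (4 * k))) » *≤ʳ (4 * k) (1≤^ (ρ + ρ) 0<B)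

   P₂≤P₁ : P₂ ≤ P₁
   P₂≤P₁ = from≡ (sym (*-identityˡ P₂)) » *≤ˡ P₂ (1≤* 0<k (1≤* {2} (s≤s z≤n) (1≤* 0<q₂ 0<q₂))) » from≡ (*-assoc k _ P₂)

   0<P₁ : 1 ≤ P₁
   0<P₁ = 0<P₂ » P₂≤P₁

   P₁≤P₀ : P₁ ≤ P₀
   P₁≤P₀ = from≡ (sym (*-identityˡ P₁)) » *≤ˡ P₁ (1≤* {2} (s≤s z≤n) (1≤* 0<q₁ 0<q₁))

   stages : ℕ
   stages = suc (Asi.s asi) * (colours * κ)

   -- As functions of the tuple length n of the second sweep: the radius of its tuples, the radius
   -- in which the first sweep must bound clusters, and the tuple length of the first sweep.
   r₂ r₁ n₁ : ℕ -> ℕ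
   r₂ n = (n + n) * h₂
   r₁ n = ρ + ρ + (r₂ n + (ρ + ρ) + r₂ n + r₂ n) + (ρ + ρ)
   n₁ n = stages * (2 + B * (r₁ n + ρ + (ρ + r₁ n)))

   width : ℕ
   width = B ^ (ρ + ρ + (ρ + ρ))

   D₂ : ℕ -> ℕ
   D₂ n = suc (n₁ n * width)

   -- For a fixed number of stages, `D₂` is linear in n, so 2^(n+1) wins. The linearity is the gain
   -- of the first sweep.
   enough : ∃[ n ] (4 * D₂ n) ^ stages < 2 ^ suc n
   enough = let (n , lt) = poly<exp (48 * stages * B * h₂ * width) (4 * suc (stages * (2 + B * (14 * ρ)) * width)) stages in
    n , subst (λ x -> x ^ stages < 2 ^ suc n) (ring7 stages B h₂ width n ρ) lt

   m₂ R₂ R₁ m₁ : ℕ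
   m₂ = fst enough
   R₂ = r₂ m₂
   R₁ = r₁ m₂
   m₁ = n₁ m₂

   Danger : ℕ -> Asg -> Mask -> X -> Set
   Danger P ω T v = K < M v ω T * P

   Within : X -> X -> Set
   Within = near (ρ + ρ)

   -- Clusters are bounded only inside the ball of radius `R₁`, which contains every chain that the
   -- second sweep looks at.
   record Level₁ (ω : Asg) (T : Mask) : Set₁ where
    field
     borel : BState ω T
     bounded : ∀ v -> M v ω T * P₁ ≤ k * K
     frozen : ∀ x i -> T (x , i) ≡ true ⊎ (∃[ v ] near ρ x v × Danger P₁ ω T v)
     clusters : ∀ y -> Danger P₁ ω T y -> ∃[ Q ] length Q ≤ m₁ ×
      (∀ v -> Conn (λ v -> Danger P₁ ω T v × near R₁ y v) (ρ + ρ + h₂ + (ρ + ρ)) y v -> ∃[ u ] u ∈ Q × Within u v)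

   record Level₂ (ω : Asg) (T : Mask) : Set₁ where
    field
     borel : BState ω T
     bounded : ∀ v -> M v ω T * P₂ ≤ k * K
     frozen : ∀ x i -> T (x , i) ≡ true ⊎ (∃[ v ] near ρ x v × Danger P₂ ω T v)
     clusters : ∀ y -> Danger P₂ ω T y -> ∃[ Q ] length Q ≤ m₂ ×
      (∀ v -> Conn (Danger P₂ ω T) (ρ + (ρ + ρ) + ρ) y v -> ∃[ u ] u ∈ Q × Within u v)

   ω₀ : Asg
   ω₀ _ = fromℕ< 0<k

   module First (small : ∀ v -> M v ω₀ none * P₀ ≤ K) where
    private
     module T = Family' h₁ R₁ m₁ (λ _ -> ⊤) b-⊤
     D₁ : ℕ
     D₁ = B ^ (R₁ + ρ + (ρ + R₁))

    family : Family
    family = record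
     { r = R₁ ; D = D₁ ; 0<D = 1≤^ (R₁ + ρ + (ρ + R₁)) 0<B ; tuples = T.tuples ; tuples-far = λ {y} -> T.tuples-far {y} ; tuples-near = λ {y} -> T.tuples-near {y}
     ; tuples-meas = T.tuples-meas ; T₀ = none ; nb = ball (R₁ + ρ + (ρ + R₁)) ; nb-≤ = λ y -> from≡ (ball-length (R₁ + ρ + (ρ + R₁)) y)
     ; nb-meets = λ {y} {y'} {_} {_} {_} {_} {z} τ∈ v∈ τ'∈ v'∈ vz v'z _ -> near⇒ball (near-trans {R₁ + ρ} (near-trans {R₁} (T.tuples-near {y} τ∈ v∈) vz)
       (near-sym {ρ + R₁} (subst (λ t -> near t y' z) (+-comm R₁ ρ) (near-trans {R₁} (T.tuples-near {y'} τ'∈ v'∈) v'z)))) }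

    open Classes family P₁

    -- The number of interacting potentials is exponential in the radius `R₁`, which is already
    -- fixed; `m₁` is a large enough multiple of it.
    stages-small : λ' ^ length classes < 2 ^ suc m₁
    stages-small = begin-strict
     _ ≡⟨ cong ((4 * D₁) ^_) classes-length ⟩
     _ ≤⟨ ^-monoˡ-≤ stages (*≤ʳ 4 (b^x≤ B (R₁ + ρ + (ρ + R₁)))) ⟩
     _ ≡⟨ cong (_^ stages) (sym (^-distribˡ-+-* 2 2 (B * (R₁ + ρ + (ρ + R₁))))) ⟩
     _ ≡⟨ ^-*-assoc 2 (2 + B * (R₁ + ρ + (ρ + R₁))) stages ⟩
     _ ≡⟨ cong (2 ^_) (*-comm (2 + B * (R₁ + ρ + (ρ + R₁))) stages) ⟩
     2 ^ m₁ <⟨ ^-monoʳ-< 2 (s≤s (s≤s z≤n)) (n<1+n m₁) ⟩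
     _ ∎

    abstract
     level₁ : ∃[ ω ] ∃[ T ] Level₁ ω T
     level₁ = ω , T , record
      { borel = Swept.borel Sw
      ; bounded = λ v -> Swept.bounded Sw v (*≤ʳ (M v ω₀ none) P₁≤P₀ » small v » from≡ (sym (*-identityˡ K)) » *≤ˡ K 0<k)
      ; frozen = covered (snd (snd (snd swept)))
      ; clusters = λ y dy -> Cover.cover h₁ (ρ + ρ + h₂ + (ρ + ρ)) m₁ ≤-refl (λ v -> Danger P₁ ω T v × near R₁ y v) y (dy , near-refl R₁ y) (none' y dy) }
      where
      swept : ∃[ ω' ] ∃[ T' ] Swept ω₀ none (length classes) ω' T' × All (Settled ω' T') classes
      swept = sweep classes ω₀ none (bstate (λ i -> meas-const _) (λ i -> meas-const false)) (λ z ())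
      ω : Asg
      ω = fst swept
      T : Mask
      T = fst (snd swept)
      Sw : Swept ω₀ none (length classes) ω T
      Sw = fst (snd (snd swept))
      none' : ∀ y -> Danger P₁ ω T y -> ∀ ms -> ms ∈ T.plans -> AllPairs far (y ∷ flagged y ms) -> All (λ v -> Danger P₁ ω T v × near R₁ y v) (visited y ms) -> length (flagged y ms) ≢ m₁
      none' y dy ms m ap az len = <⇒≱ stages-small (squeeze m₁ 0<K 0<P₁ 0<q₁ (T.potential-≤ y ω₀ none P₀ small) (Swept.potential Sw y)
        (T.potential-≥ y (y ∷ flagged y ms) ω T P₁ (T.∈tuples m (ap , All-tab (visited y ms) (λ v v∈ -> snd (All-∈ az v∈)) , All-tab (y ∷ visited y ms) (λ _ _ -> tt) , len))
         λ { v (here refl) -> <⇒≤ dy ; v (there v∈) -> <⇒≤ (fst (All-∈ (flagged-visited y ms az) v∈)) }))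

   module Second (ω₁ : Asg) (T₁ : Mask) (L₁ : Level₁ ω₁ T₁) where
    open Level₁ L₁

    Act : X -> Set
    Act v = 1 ≤ M v ω₁ T₁

    b-Act : Borel Act
    b-Act = b-≤ (meas-const 1) (M-meas borel)

    D₁ : X -> Set
    D₁ = Danger P₁ ω₁ T₁

    -- If all variables of v are set, its weight is 0 or K, and `bounded` excludes K because k < P₁.
    -- So an event of positive weight has an unset variable, frozen by a dangerous event nearby.
    active-danger : ∀ v -> Act v -> ∃[ d ] Within v d × D₁ d
    active-danger v av = cases (∃[ z ] z ∈ vars v × T₁ z ≡ false)
     (λ { ((x , i) , z∈ , unset) -> case frozen x i of λ
      { (inj₁ set) -> case trans (sym set) unset of λ () ; (inj₂ (d , n , dd)) -> d , near-trans (vars∈ z∈) n , dd } })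
     (λ none -> ⊥-elim (decided (M-decided v ω₁ T₁ λ z m -> casesB (T₁ z) id λ e -> ⊥-elim (none (z , m , e)))))
     where
     decided : M v ω₁ T₁ ≡ K * isA v ω₁ -> ⊥
     decided e = cases (A v ω₁)
      (λ a -> <⇒≱ (k<P₂ » P₂≤P₁) (*-cancel 0<K (from≡ (*-comm P₁ K) » subst (λ n -> n * P₁ ≤ k * K) (e ∙ cong (K *_) (⟦⟧-yes a) ∙ *-identityʳ K) (bounded v))))
      (λ na -> 1+n≰n (av » from≡ (e ∙ cong (K *_) (⟦⟧-no na) ∙ *-zeroʳ K)))

    rep : X -> X
    rep a with dec (Act a)
    ... | yes act = fst (active-danger a act)
    ... | no _ = a

    rep-spec : ∀ a -> Act a -> Within a (rep a) × D₁ (rep a)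
    rep-spec a act with dec (Act a)
    ... | yes act' = snd (active-danger a act')
    ... | no n = ⊥-elim (n act)

    nb : X -> List X
    nb y with dec (D₁ (rep y))
    ... | yes d = concatMap (ball (ρ + ρ + (ρ + ρ))) (fst (clusters (rep y) d))
    ... | no _ = []

    nb-≤ : ∀ y -> length (nb y) ≤ D₂ m₂
    nb-≤ y with dec (D₁ (rep y))
    ... | yes d = from≡ (length-concatMap (ball (ρ + ρ + (ρ + ρ))) (fst (clusters (rep y) d)) width (ball-length (ρ + ρ + (ρ + ρ))))
        » *≤ˡ width (fst (snd (clusters (rep y) d))) » n≤1+n _
    ... | no _ = z≤n

    ∈nb : ∀ y y' -> Act y' -> (d : D₁ (rep y)) -> Conn (λ v -> D₁ v × near R₁ (rep y) v) (ρ + ρ + h₂ + (ρ + ρ)) (rep y) (rep y') -> y' ∈ nb y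
    ∈nb y y' ay' d s with dec (D₁ (rep y))
    ... | no n = ⊥-elim (n d)
    ... | yes d' = let (u , u∈ , n) = snd (snd (clusters (rep y) d')) (rep y') s in
      ∈-concatMap (ball (ρ + ρ + (ρ + ρ))) (fst (clusters (rep y) d')) u∈ (near⇒ball (near-trans n (near-sym (fst (rep-spec y' ay')))))

    visited-conn : ∀ (Q : X -> Set) p ms -> All (_∈ moves h₂) ms -> All Q (p ∷ visited p ms) -> ∀ {v} -> v ∈ p ∷ visited p ms -> Conn Q h₂ p v
    visited-conn Q p ms all qs (here refl) = nil
    visited-conn Q p ((g , b) ∷ ms) (m ∷ all) (qp ∷ q ∷ qs) (there v∈) = (qp , q , via (moves∈ h₂ m) refl) ◅ visited-conn Q (g p) ms all (q ∷ qs) v∈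

    -- Two tours through events that share a variable join up to a chain of active events, all of it
    -- near y.
    link : ∀ R {y y' v v'} ms ms' -> All (_∈ moves h₂) ms -> All (_∈ moves h₂) ms' -> All Act (y ∷ visited y ms) -> All Act (y' ∷ visited y' ms') ->
     All (near R y) (y ∷ visited y ms) -> All (near R y') (y' ∷ visited y' ms') -> v ∈ y ∷ visited y ms -> v' ∈ y' ∷ visited y' ms' -> near (ρ + ρ) v v' ->
     Conn (λ a -> Act a × near (R + (ρ + ρ) + R + R) y a) h₂ y y'
    link R {y} {y'} ms ms' mv mv' acts acts' nears nears' v∈ v'∈ vv' = visited-conn Q y ms mv qs v∈ ◅◅
      ((All-∈ qs v∈ , All-∈ qs' v'∈ , near-mono (m≤m+n _ _) vv') ◅ conn-sym (visited-conn Q y' ms' mv' qs' v'∈))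
     where
     Q : X -> Set
     Q a = Act a × near (R + (ρ + ρ) + R + R) y a
     qs : All Q (y ∷ visited y ms)
     qs = All-tab _ λ a m -> All-∈ acts m , near-mono (m≤m+n R (ρ + ρ) » m≤m+n _ R » m≤m+n _ R) (All-∈ nears m)
     qs' : All Q (y' ∷ visited y' ms')
     qs' = All-tab _ λ a m -> All-∈ acts' m ,
      near-trans {R + (ρ + ρ) + R} (near-trans {R + (ρ + ρ)} (near-trans {R} (All-∈ nears v∈) vv') (near-sym (All-∈ nears' v'∈))) (All-∈ nears' m)

    -- Active events are replaced by dangerous ones of the first sweep. The chain then lies in one
    -- cluster, so at most (cluster size) · (ball size) potentials can meet the one at y.
    represent : ∀ s {y a b} -> Act y -> Conn (λ a -> Act a × near s y a) h₂ a b ->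
     Conn (λ w -> D₁ w × near (ρ + ρ + s + (ρ + ρ)) (rep y) w) (ρ + ρ + h₂ + (ρ + ρ)) (rep a) (rep b)
    represent s ay nil = nil
    represent s {y} {a} ay (_◅_ {j = c} (qa , qc , n) t) = (at qa , at qc ,
      near-trans {ρ + ρ + h₂} (near-trans {ρ + ρ} (near-sym (fst (rep-spec a (fst qa)))) n) (fst (rep-spec c (fst qc)))) ◅ represent s ay t
     where
     at : ∀ {a} -> Act a × near s y a -> D₁ (rep a) × near (ρ + ρ + s + (ρ + ρ)) (rep y) (rep a)
     at {a} (aa , na) = snd (rep-spec a aa) , near-trans {ρ + ρ + s} (near-trans {ρ + ρ} (near-sym (fst (rep-spec y ay))) na) (fst (rep-spec a aa))

    private
     module T = Family' h₂ R₂ m₂ Act b-Act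

     sub : ∀ {y ms v τ} -> τ ≡ y ∷ flagged y ms -> v ∈ τ -> v ∈ y ∷ visited y ms
     sub refl (here e) = here e
     sub {y} {ms} refl (there m) = there (All-∈ (flagged-visited {_∈ visited y ms} y ms (All-tab (visited y ms) λ _ m -> m)) m)

    meets : ∀ {y y' τ τ' v v' z i} -> τ ∈ T.tuples y -> v ∈ τ -> τ' ∈ T.tuples y' -> v' ∈ τ' ->
     near ρ v z -> near ρ v' z -> T₁ (z , i) ≡ false -> y' ∈ nb y
    meets {y} {y'} τ∈ v∈ τ'∈ v'∈ vz v'z _ =
     let (ms , ms∈ , (_ , nears , acts , _) , e) = T.tuples∈ {y} τ∈ ; (ms' , ms'∈ , (_ , nears' , acts' , _) , e') = T.tuples∈ {y'} τ'∈ ; ay = All-∈ acts (here refl)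
     in ∈nb y y' (All-∈ acts' (here refl)) (snd (rep-spec y ay)) (represent _ ay (link R₂ ms ms' (fst (seqs∈ (moves h₂) (m₂ + m₂) ms∈))
      (fst (seqs∈ (moves h₂) (m₂ + m₂) ms'∈)) acts acts' (near-refl R₂ y ∷ nears) (near-refl R₂ y' ∷ nears') (sub e v∈) (sub e' v'∈) (near-trans vz (near-sym v'z))))

    family : Family
    family = record
     { r = R₂ ; D = D₂ m₂ ; 0<D = s≤s z≤n ; tuples = T.tuples ; tuples-far = λ {y} -> T.tuples-far {y} ; tuples-near = λ {y} -> T.tuples-near {y}
     ; tuples-meas = T.tuples-meas ; T₀ = T₁ ; nb = nb ; nb-≤ = nb-≤ ; nb-meets = λ {y} {y'} -> meets {y} {y'} }

    open Classes family P₂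

    stages-small : λ' ^ length classes < 2 ^ suc m₂
    stages-small = subst (λ n -> (4 * D₂ m₂) ^ n < 2 ^ suc m₂) (sym classes-length) (snd enough)

    start : ∀ v -> M v ω₁ T₁ * (2 * (q₂ * q₂) * P₂) ≤ K
    start v = *-cancel 0<k (from≡ (xy∙z≈x∙zy (M v ω₁ T₁) _ k) » bounded v » from≡ (*-comm k K))

    abstract
     level₂ : ∃[ ω ] ∃[ T ] Level₂ ω T
     level₂ = ω , T , record
      { borel = Swept.borel Sw
      ; bounded = λ v -> Swept.bounded Sw v (*≤ʳ (M v ω₁ T₁) P₂≤P₁ » bounded v)
      ; frozen = covered (snd (snd (snd swept)))
      ; clusters = λ y dy -> Cover.cover h₂ (ρ + (ρ + ρ) + ρ) m₂ ≤-refl (Danger P₂ ω T) y dy (none' y dy) }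
      where
      swept : ∃[ ω' ] ∃[ T' ] Swept ω₁ T₁ (length classes) ω' T' × All (Settled ω' T') classes
      swept = sweep classes ω₁ T₁ borel (λ z t -> t)
      ω : Asg
      ω = fst swept
      T : Mask
      T = fst (snd swept)
      Sw : Swept ω₁ T₁ (length classes) ω T
      Sw = fst (snd (snd swept))
      act : ∀ v -> Danger P₂ ω T v -> Act v
      act v d = byContra λ na -> let z = n≤0⇒n≡0 (≤-pred (≰⇒> na)) in
       case ≤-trans d (*≤ˡ P₂ (Swept.mult Sw v) » from≡ (cong (λ m -> k ^ length classes * m * P₂) z ∙ cong (_* P₂) (*-zeroʳ (k ^ length classes)))) of λ ()
      none' : ∀ y -> Danger P₂ ω T y -> ∀ ms -> ms ∈ T.plans -> AllPairs far (y ∷ flagged y ms) -> All (Danger P₂ ω T) (visited y ms) -> length (flagged y ms) ≢ m₂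
      none' y dy ms m ap az len = <⇒≱ stages-small (squeeze m₂ 0<K 0<P₂ 0<q₂ (T.potential-≤ y ω₁ T₁ (2 * (q₂ * q₂) * P₂) start) (Swept.potential Sw y)
        (T.potential-≥ y (y ∷ flagged y ms) ω T P₂ (T.∈tuples m (ap ,
          (case seqs∈ (moves h₂) (m₂ + m₂) m of λ { (all , e) -> subst (λ l -> All (near (l * h₂) y) (visited y ms)) e (visited-near h₂ y ms all) }) ,
          (act y dy ∷ All-tab (visited y ms) λ v v∈ -> act v (All-∈ az v∈)) , len))
         λ { v (here refl) -> <⇒≤ dy ; v (there v∈) -> <⇒≤ (All-∈ (flagged-visited y ms az) v∈) }))

   Solution : Set₁
   Solution = ∃[ ω ] (∀ i -> Meas (λ x -> ω (x , i))) × (∀ v -> ¬ A v ω)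

   module Third (ω₂ : Asg) (T₂ : Mask) (L₂ : Level₂ ω₂ T₂) where
    open Level₂ L₂
    open Dense κ k 0<k

    W : X -> Set
    W x = ∃[ i ] T₂ (x , i) ≡ false

    b-W : Borel W
    b-W = b-∃ (enum-Fin κ) λ i -> b-mask borel i false

    D₂' : X -> Set
    D₂' = Danger P₂ ω₂ T₂

    unset-danger : ∀ x -> W x -> ∃[ d ] near ρ x d × D₂' d
    unset-danger x (i , e) = case frozen x i of λ { (inj₁ t) -> case trans (sym t) e of λ () ; (inj₂ d) -> d }

    R : ℕ
    R = ρ + ρ

    connect : ∀ {x x'} (w : W x) (w' : W x') -> Conn W R x x' -> ∀ {d} -> near ρ x d -> D₂' d -> ∀ {d'} -> near ρ x' d' -> D₂' d' -> Conn D₂' (ρ + (ρ + ρ) + ρ) d d'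
    connect w w' nil n d n' d' = (d , d' , near-trans {ρ + (ρ + ρ)} (near-mono (m≤m+n ρ (ρ + ρ)) (near-sym n)) n') ◅ nil
    connect w w' ((_ , wj , m) ◅ s) n d n' d' = let (e , ne , de) = unset-danger _ wj in
     (d , de , near-trans {ρ + (ρ + ρ)} (near-trans {ρ} (near-sym n) m) ne) ◅ connect wj w' s ne de n' d'

    conn-W : ∀ {x x'} -> W x -> Conn W R x x' -> W x'
    conn-W w nil = w
    conn-W w ((_ , w' , _) ◅ s) = conn-W w' s

    finite : ComponentFinite W R
    finite x w = concatMap (ball (ρ + ρ + ρ)) Q , λ x' s -> let (d' , n' , dd') = unset-danger x' (conn-W w s) ; (u , u∈ , n) = snd (snd (clusters d dd)) d' (connect w (conn-W w s) s nd dd n' dd') in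
      ∈-concatMap (ball (ρ + ρ + ρ)) Q u∈ (near⇒ball (near-trans {ρ + ρ} n (near-sym n')))
     where
     d = fst (unset-danger x w)
     nd = fst (snd (unset-danger x w))
     dd = snd (snd (unset-danger x w))
     Q = fst (clusters d dd)

    fill : (X -> ℕ) -> Asg
    fill c (x , i) = if T₂ (x , i) then ω₂ (x , i) else assignment (c x) x i

    fill-set : ∀ c z -> T₂ z ≡ true -> fill c z ≡ ω₂ z
    fill-set c (x , i) t = cong (λ b -> if b then ω₂ (x , i) else assignment (c x) x i) t

    fill-unset : ∀ c x i -> T₂ (x , i) ≡ false -> fill c (x , i) ≡ assignment (c x) x i
    fill-unset c x i t = cong (λ b -> if b then ω₂ (x , i) else assignment (c x) x i) t

    meas-fill : ∀ {c} -> Meas c -> ∀ i -> Meas (λ x -> fill c (x , i))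
    meas-fill {c} mc i v = b-resp
     (λ { x (inj₁ (t , e)) -> fill-set c (x , i) t ∙ e ; x (inj₂ (t , n , refl , e)) -> fill-unset c x i t ∙ e })
     (λ x e -> casesB (T₂ (x , i)) (λ t -> inj₁ (t , sym (fill-set c (x , i) t) ∙ e)) λ t -> inj₂ (t , c x , refl , sym (fill-unset c x i t) ∙ e))
     (b-⊎ (b-× (b-mask borel i true) (b-asg borel i v)) (b-× (b-mask borel i false) (b-∃ enum-ℕ λ n -> b-× (mc n) (assignment-meas n i v))))

    good : ℕ -> X -> Set
    good n y = ¬ A y (fill (λ _ -> n))

    b-good : ∀ n -> Borel (good n)
    b-good n = b-¬ (measurable {λ _ -> fill (λ _ -> n)} (plot-const {fill (λ _ -> n)} {none} (bstate (meas-fill (meas-const n)) (λ i -> meas-const false))))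

    -- `P₂` was chosen to turn `bounded` into the hypothesis of the finite local lemma.
    weight : ∀ y -> 4 * B ^ (ρ + ρ) * M y ω₂ T₂ ≤ K
    weight y = *-cancel 0<k (from≡ (ring13 (B ^ (ρ + ρ)) (M y ω₂ T₂) k) » bounded y » from≡ (*-comm k K))

    module Component (x : X) (w : W x) where
     L xs' : List X
     L = fst (finite x w)
     xs' = sel (λ x' -> Conn W R x x') (dedup L)

     ∈xs' : ∀ {x'} -> Conn W R x x' -> x' ∈ xs'
     ∈xs' s = ∈sel (dedup L) (∈dedup L (snd (finite x w) _ s)) s

     cell : X -> List Var
     cell x' = map (x' ,_) (allFin κ)

     xs : List Var
     xs = sel (λ z -> T₂ z ≡ false) (concatMap cell xs')

     xs∈ : ∀ {z} -> z ∈ xs -> T₂ z ≡ false × Conn W R x (fst z)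
     xs∈ {z} m = let (m' , unset) = sel⊆ (concatMap cell xs') m ; (x' , x'∈ , m'') = concatMap-∈ cell xs' m' in
      case ∈-map⁻ (x' ,_) m'' of λ { (i , _ , e) -> unset , subst (λ z -> Conn W R x (fst z)) (sym e) (snd (sel⊆ (dedup L) x'∈)) }

     ∈xs : ∀ {x'} i -> Conn W R x x' -> T₂ (x' , i) ≡ false -> (x' , i) ∈ xs
     ∈xs {x'} i s unset = ∈sel (concatMap cell xs') (∈-concatMap cell xs' (∈xs' s) (∈-map⁺ (x' ,_) (∈-allFin i))) unset

     ys : List X
     ys = concatMap (ball ρ) xs'

     inside : ∀ {y z} -> y ∈ ys -> z ∈ vars y -> T₂ z ≡ false -> z ∈ xs
     inside {y} {z , i} y∈ z∈ unset = let (x' , x'∈ , y∈') = concatMap-∈ (ball ρ) xs' y∈ in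
      ∈xs i (snd (sel⊆ (dedup L) x'∈) ◅◅ ((conn-W w (snd (sel⊆ (dedup L) x'∈)) , (i , unset) , near-trans {ρ} (ball⇒near y∈') (vars∈ z∈)) ◅ nil)) unset

     -- All unset variables of y lie in xs, so averaging over xs amounts to conditioning on the
     -- mask: both sides are the double average over xs and over the variables of y.
     expectation : ∀ y -> y ∈ ys -> K * E₀ xs (isA y) ω₂ ≡ k ^ length xs * M y ω₂ T₂
     expectation y y∈ = (sym ((E-blind T₂ (vars y) (E₀ xs (isA y)) ω₂ (E₀ xs (isA y) ω₂) (λ ω' h -> E-dep (isA-dep y) none xs ω' ω₂ λ z zy -> λ
        { (inj₂ z∉) -> casesB (T₂ z) (λ t -> h z (inj₁ t)) λ t -> ⊥-elim (z∉ (inside y∈ zy t)) }))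
       ∙ cong (λ n -> k ^ n * E₀ xs (isA y) ω₂) (vars-length y)))
      ∙ (sym (E-comm-mask (dep⇒resp (isA-dep y)) T₂ xs (vars y) ω₂ λ z m -> fst (xs∈ m))
       ∙ (E-fixed none xs (E T₂ (vars y) (isA y)) ω₂ (M y ω₂ T₂) λ ω' h -> E-dep (isA-dep y) T₂ (vars y) ω' ω₂ λ z zy -> λ
        { (inj₁ t) -> h z λ m -> case trans (sym t) (fst (xs∈ m)) of λ () ; (inj₂ z∉) -> ⊥-elim (z∉ zy) }))

     prob : ∀ y -> y ∈ ys -> 4 * B ^ (ρ + ρ) * E₀ xs (λ ω -> ⟦ A y ω ⟧) ω₂ ≤ k ^ length xs
     prob y y∈ = *-cancel 0<K (begin
      _ ≡⟨ xy∙z≈x∙zy (4 * B ^ (ρ + ρ)) (E₀ xs (isA y) ω₂) K ⟩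
      _ ≡⟨ cong (4 * B ^ (ρ + ρ) *_) (expectation y y∈) ⟩
      _ ≡⟨ x∙yz≈y∙xz (4 * B ^ (ρ + ρ)) (k ^ length xs) (M y ω₂ T₂) ⟩
      _ ≤⟨ *≤ʳ (k ^ length xs) (weight y) ⟩
      _ ∎)

     found : ∃[ ω ] (∀ z -> z ∉ xs -> ω z ≡ ω₂ z) × (∀ y -> y ∈ ys -> ¬ A y ω)
     found = LLL.LLL k 0<k A (λ y z -> z ∈ vars y) (λ y ω ω' h -> local y ω ω' λ z i n -> h (z , i) (∈vars i n)) xs ω₂ (B ^ (ρ + ρ))
      (1≤^ (ρ + ρ) 0<B) (ball (ρ + ρ)) (λ y -> from≡ (ball-length (ρ + ρ) y)) ys
      (λ y y' z _ _ _ d d' -> near⇒ball (near-trans {ρ} (vars∈ d) (near-sym (vars∈ d')))) prob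

     solved : ∃[ n ] ∀ x' -> Conn W R x x' -> ∀ y -> near ρ x' y -> good n y
     solved = n , λ x' s y n' bad -> let y∈ = ∈-concatMap (ball ρ) xs' (∈xs' s) (near⇒ball n') in
       snd (snd found) y y∈ (local y (fill (λ _ -> n)) ωL (λ z i nz -> agree y∈ z i nz) bad)
      where
      ωL : Asg
      ωL = fst found
      dense : ∃[ n ] ∀ x -> x ∈ L -> ∀ i -> assignment n x i ≡ ωL (x , i)
      dense = assignment-dense L λ x i -> ωL (x , i)
      n : ℕ
      n = fst dense
      agree : ∀ {y} -> y ∈ ys -> ∀ z i -> near ρ y z -> fill (λ _ -> n) (z , i) ≡ ωL (z , i)
      agree {y} y∈ z i nz = casesB (T₂ (z , i))
       (λ t -> fill-set (λ _ -> n) (z , i) t ∙ sym (fst (snd found) (z , i) λ m -> case trans (sym t) (fst (xs∈ m)) of λ ()))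
       (λ t -> fill-unset (λ _ -> n) z i t ∙ snd dense z (snd (finite x w) z (snd (xs∈ (inside y∈ (∈vars i nz) t)))) i)

    open Selection W R ρ b-W good b-good Component.solved

    abstract
     solution : Solution
     solution = fill choice , meas-fill choice-meas , avoid
      where
      avoid : ∀ y -> ¬ A y (fill choice)
      avoid y bad = cases (∃[ z ] near ρ y z × W z)
       (λ (z , n , w) -> choice-good z y w (near-sym n) (local y (fill choice) (fill (λ _ -> choice z)) (λ u i nu -> casesB (T₂ (u , i))
        (λ t -> fill-set choice (u , i) t ∙ sym (fill-set (λ _ -> choice z) (u , i) t))
        (λ t -> fill-unset choice u i t ∙ cong (λ c -> assignment c u i) (choice-const u z ((i , t) , w , near-trans {ρ} (near-sym nu) n)) ∙ sym (fill-unset (λ _ -> choice z) u i t))) bad))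
       (λ none -> let set = λ z i n -> casesB (T₂ (z , i)) id (λ t -> ⊥-elim (none (z , n , i , t))) ; bad₂ = local y (fill choice) ω₂ (λ z i n -> fill-set choice (z , i) (set z i n)) bad
        in <⇒≱ k<P₂ (*-cancel 0<K (from≡ (*-comm P₂ K) » (subst (λ m -> m * P₂ ≤ k * K)
          ((M-decided y ω₂ T₂ λ { (z , i) m -> set z i (vars∈ m) }) ∙ cong (K *_) (⟦⟧-yes bad₂) ∙ *-identityʳ K) (bounded y)))))

   localLemma : (∀ v -> M v ω₀ none * P₀ ≤ K) -> Solution
   localLemma small = let (ω₁ , T₁ , L₁) = First.level₁ small ; (ω₂ , T₂ , L₂) = Second.level₂ ω₁ T₁ L₁ in Third.solution ω₂ T₂ L₂

  -- Random choices on the graph.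

  module OnGraph (asi : Asi) (Gr : Graph) where
   open Graph Gr public

   private
    h₂ h₁ : ℕ -> ℕ
    h₂ ρ = ρ + ρ + (ρ + (ρ + ρ) + ρ)
    h₁ ρ = ρ + ρ + (ρ + ρ + h₂ ρ + (ρ + ρ))

    -- `P₀` as a function of the radius and the number of values. Neither κ nor the asi occurs in
    -- it.
    raw-cost : ℕ -> ℕ -> ℕ
    raw-cost ρ k = 2 * ((B ^ h₁ ρ * 2) * (B ^ h₁ ρ * 2)) * (k * (2 * ((B ^ h₂ ρ * 2) * (B ^ h₂ ρ * 2)) * (4 * k * B ^ (ρ + ρ))))

   abstract
    cost : ℕ -> ℕ -> ℕ
    cost = raw-cost

    cost-eq : ∀ ρ k -> cost ρ k ≡ raw-cost ρ k
    cost-eq ρ k = refl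

   module Events (κ k ρ : ℕ) (0<k : 1 ≤ k) (h : ℕ) {I : Set} (Bad : I -> X -> (X × Fin κ -> Fin k) -> Set) where
    open Vars κ k

    blockOf : X -> List Var
    blockOf v = map (λ (g , i) -> g v , i) (concatMap (λ g -> map (g ,_) (allFin κ)) (walks ρ))

    ∈block : ∀ {v z} i -> near ρ v z -> (z , i) ∈ blockOf v
    ∈block {v} i (via {g} g∈ refl) = ∈-map⁺ (λ (g , i) -> g v , i) (∈-concatMap _ (walks ρ) g∈ (∈-map⁺ (g ,_) (∈-allFin i)))

    Local : Set
    Local = ∀ j v ω ω' -> (∀ z i -> near ρ v z -> ω (z , i) ≡ ω' (z , i)) -> Bad j v ω -> Bad j v ω'
    Measurable : Set₁
    Measurable = ∀ j {Ω} -> Plot Ω -> Borel (λ x -> Bad j x (Ω x))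

    Rare : I -> X -> List Var -> Set
    Rare j v xs = ∀ ω -> E₀ xs (λ ω -> ⟦ Bad j v ω ⟧) ω * 2 ^ h ≤ k ^ length xs

    never : ∀ j v -> (∀ ω -> ¬ Bad j v ω) -> Rare j v (blockOf v)
    never j v nb ω = *≤ˡ (2 ^ h) (from≡ (E-null none (blockOf v) (λ ω -> ⟦⟧-no (nb ω)) ω)) » z≤n

    on-block : Local -> ∀ j v xs -> (∀ {z} -> z ∈ xs -> z ∈ blockOf v) -> Rare j v xs -> Rare j v (blockOf v)
    on-block loc j v xs inside le ω = (E-bound resp (blockOf v) xs ω (2 ^ h) 1 inside (1≤^ (length xs) 0<k) λ ω -> le ω » from≡ (sym (*-identityʳ _))) » from≡ (*-identityʳ _)
     where
     resp : Resp (λ ω -> ⟦ Bad j v ω ⟧)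
     resp ω ω' e = ⟦⟧-cong (loc j v ω ω' λ z i _ -> e _ tt) (loc j v ω' ω λ z i _ -> sym (e _ tt))

    -- A union bound over the kinds of events at a vertex brings the individual probabilities 2^(-h)
    -- below 1/`cost`.
    Solvable : Set₁
    Solvable = (J : List I) -> length J * cost ρ k ≤ 2 ^ h -> Local -> Measurable -> (∀ j v -> Rare j v (blockOf v)) ->
     ∃[ ω ] (∀ i -> Meas (λ x -> ω (x , i))) × (∀ v j -> j ∈ J -> ¬ Bad j v ω)

    solve-exists : Solvable
    solve-exists J budget loc meas small = let (ω , m , avoid) = LocalLemma.localLemma asi C total in ω , m , λ v j j∈ bad -> avoid v (⇒any j∈ bad)
     where
     C : CSP
     C = record { κ = κ ; k = k ; ρ = ρ ; 0<k = 0<k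
      ; A = λ v ω -> Any (λ j -> Bad j v ω) J
      ; local = λ v ω ω' agree a -> let (j , j∈ , bad) = any⇒ a in ⇒any j∈ (loc j v ω ω' agree bad)
      ; measurable = λ pΩ -> b-any J λ j _ -> meas j pΩ }
     M = LocalLemma.M asi C
     K = LocalLemma.K asi C
     P₀ = LocalLemma.P₀ asi C
     ω₀ = LocalLemma.ω₀ asi C
     vars-length = LocalLemma.vars-length asi C
     union : ∀ v ω -> ⟦ Any (λ j -> Bad j v ω) J ⟧ ≤ ∑ J λ j -> ⟦ Bad j v ω ⟧
     union v ω = cases (Any (λ j -> Bad j v ω) J)
      (λ a -> let (j , j∈ , bad) = any⇒ a in from≡ (⟦⟧-yes a ∙ sym (⟦⟧-yes bad)) » ∑-member J (λ j -> ⟦ Bad j v ω ⟧) j∈)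
      (λ n -> from≡ (⟦⟧-no n) » z≤n)
     total : ∀ v -> M v ω₀ none * P₀ ≤ K
     total v = *-cancel {c = 2 ^ h} (1≤^ h (s≤s z≤n)) (begin
      _ ≤⟨ *≤ˡ (2 ^ h) (*≤ˡ P₀ (E-mono none (blockOf v) (union v) ω₀ » from≡ (E-∑ none (blockOf v) J _ ω₀))) ⟩
      _ ≡⟨ xy∙z≈xz∙y (∑ J λ j -> E₀ (blockOf v) (λ ω -> ⟦ Bad j v ω ⟧) ω₀) P₀ (2 ^ h) ⟩
      _ ≡⟨ cong (_* P₀) (sym (∑-*ʳ J _ (2 ^ h))) ⟩
      _ ≤⟨ *≤ˡ P₀ (∑-≤const J _ λ j _ -> small j v ω₀) ⟩
      _ ≡⟨ xy∙z≈y∙xz (length J) (k ^ length (blockOf v)) P₀ ⟩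
      _ ≤⟨ *≤ʳ (k ^ length (blockOf v)) (subst (λ c -> length J * c ≤ 2 ^ h) (cost-eq ρ k) budget) ⟩
      _ ≡⟨ cong (λ n -> k ^ n * 2 ^ h) (vars-length v) ⟩
      _ ∎)

    abstract
     solve : Solvable
     solve = solve-exists

   -- G = g + 2; the deviation allowed for a sum of mean at most Gν.
   dev : ℕ -> ℕ -> ℕ -> ℕ
   dev g h ν = (4 + g) * ν + (2 + g) * h

   -- Activation of vertices with probability 1/n.

   module PhaseA (q : ℕ) (Y : X -> Set) (L : Fin q -> X -> Set) (bY : Borel Y) (bL : ∀ c -> Borel (L c)) (n' : ℕ)
    (cap : Maybe (Fin q) -> ℕ) (g h ρ : ℕ) (1≤ρ : 1 ≤ ρ) (budget : 2 * suc q * cost ρ (suc n') ≤ 2 ^ h) where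

    n G : ℕ
    n = suc n'
    G = 2 + g

    -- `nothing` stands for all undecided vertices, so that plain degrees are treated along with the
    -- degrees of colours.
    Set' : Maybe (Fin q) -> X -> Set
    Set' nothing u = Y u
    Set' (just c) u = Y u × L c u

    b-Set : ∀ c -> Borel (Set' c)
    b-Set nothing = bY
    b-Set (just c) = b-× bY (bL c)

    t : Maybe (Fin q) -> X -> ℕ
    t c v = ∑ (nbrs v) λ u -> ⟦ Set' c u ⟧

    meas-t : ∀ c -> Meas (t c)
    meas-t c = meas-nbrs pt-id λ mh -> meas-⟦⟧ (mh (b-Set c))

    row : Bool -> List (Maybe (Fin q) × Bool)
    row b = map (_, b) (nothing ∷ map just (allFin q))

    J : List (Maybe (Fin q) × Bool)
    J = concatMap row (true ∷ false ∷ [])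

    J-length : length J ≡ 2 * suc q
    J-length = length-concatMap row (true ∷ false ∷ []) (suc q) λ b -> length-map (_, b) (nothing ∷ map just (allFin q))
     ∙ cong suc (length-map just (allFin q) ∙ length-allFin q)

    ∈J : ∀ c b -> (c , b) ∈ J
    ∈J c b = ∈-concatMap row (true ∷ false ∷ []) (bools b) (∈-map⁺ (_, b) (all c))
     where
     bools : ∀ b -> b ∈ true ∷ false ∷ []
     bools true = here refl
     bools false = there (here refl)
     all : ∀ c -> c ∈ nothing ∷ map just (allFin q)
     all nothing = here refl
     all (just c) = there (∈-map⁺ just (∈-allFin c))

    open Vars 1 n

    Act : Asg -> X -> Set
    Act ω u = ω (u , fzero) ≡ fzero

    In' : Maybe (Fin q) -> Bool -> Asg -> X -> Set
    In' c true ω u = Set' c u × ¬ Act ω u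
    In' c false ω u = Set' c u × Act ω u

    count : Maybe (Fin q) -> Bool -> X -> Asg -> ℕ
    count c b v ω = ∑ (nbrs v) λ u -> ⟦ In' c b ω u ⟧

    rate : Bool -> ℕ
    rate true = n'
    rate false = 1

    -- For the vertices that stay, the bound follows the actual count `t c v`, since these bounds
    -- will be summed over a list; for the activated ones the cap suffices.
    ν : Maybe (Fin q) -> Bool -> X -> ℕ
    ν c true v = ceil (t c v * n') (suc g + n' * G)
    ν c false v = ceil (cap c) (suc g)

    Guard : Maybe (Fin q) -> Bool -> X -> Set
    Guard c true v = ⊤
    Guard c false v = t c v ≤ n * cap c

    Bad : Maybe (Fin q) × Bool -> X -> Asg -> Set
    Bad (c , b) v ω = Guard c b v × dev g h (ν c b v) ≤ count c b v ω

    open Events 1 n ρ (s≤s z≤n) h Bad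

    private
     In-cong : ∀ c b ω ω' u -> ω (u , fzero) ≡ ω' (u , fzero) -> In' c b ω u -> In' c b ω' u
     In-cong c true ω ω' u e (s , na) = s , λ a -> na (e ∙ a)
     In-cong c false ω ω' u e (s , a) = s , sym e ∙ a

     count-cong : ∀ c b v ω ω' -> (∀ u -> u ∈ nbrs v -> ω (u , fzero) ≡ ω' (u , fzero)) -> count c b v ω ≡ count c b v ω'
     count-cong c b v ω ω' h = ∑-cong∈ (nbrs v) λ u m -> ⟦⟧-cong (In-cong c b ω ω' u (h u m)) (In-cong c b ω' ω u (sym (h u m)))

     loc : Local
     loc (c , b) v ω ω' agree (gd , le) = gd , le » from≡ (count-cong c b v ω ω' λ u m -> agree u fzero (near-mono 1≤ρ (nbrs-near m)))

     b-In : ∀ c b {Ω h} -> Plot Ω -> Pt h -> Borel (λ x -> In' c b (Ω x) (h x))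
     b-In c true pΩ mh = b-× (mh (b-Set c)) (b-¬ (pΩ mh fzero fzero))
     b-In c false pΩ mh = b-× (mh (b-Set c)) (pΩ mh fzero fzero)

     b-Guard : ∀ c b -> Borel (Guard c b)
     b-Guard c true = b-⊤
     b-Guard c false = b-≤ (meas-t c) (meas-const (n * cap c))

     meas-ν : ∀ c b -> Meas (ν c b)
     meas-ν c true = meas-map enum-ℕ (meas-t c) λ t -> ceil (t * n') (suc g + n' * G)
     meas-ν c false = meas-const (ceil (cap c) (suc g))

     meas : Measurable
     meas (c , b) pΩ = b-× (b-Guard c b) (b-≤ (meas-map enum-ℕ (meas-ν c b) (dev g h)) (meas-nbrs pt-id λ mh -> meas-⟦⟧ (b-In c b pΩ mh)))

     blk : X -> List Var
     blk u = (u , fzero) ∷ []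

     chance : ∀ c b u ω -> E₀ (blk u) (λ ω -> ⟦ In' c b ω u ⟧) ω * n ≤ n ^ 1 * (⟦ Set' c u ⟧ * rate b)
     chance c b u ω = *≤ˡ n (bound b) » from≡ (ring32 (⟦ Set' c u ⟧ * rate b) n)
      where
      val : ∀ a -> upd (u , fzero) a ω (u , fzero) ≡ a
      val a = upd-same (u , fzero) a ω
      bound : ∀ b -> ∑ vals (λ a -> ⟦ In' c b (upd (u , fzero) a ω) u ⟧) ≤ ⟦ Set' c u ⟧ * rate b
      bound true = begin
       _ ≡⟨ ∑-Fin-suc n' _ ⟩
       ⟦ In' c true (upd (u , fzero) fzero ω) u ⟧ + ∑ (allFin n') (λ a -> ⟦ In' c true (upd (u , fzero) (fsuc a) ω) u ⟧)
        ≤⟨ +≤ (from≡ (⟦⟧-no λ (_ , na) -> na (val fzero))) (∑-≤const (allFin n') ⟦ Set' c u ⟧ λ a _ -> ⟦⟧-mono fst) ⟩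
       _ ≡⟨ cong (_* ⟦ Set' c u ⟧) (length-allFin n') ⟩
       _ ≡⟨ *-comm n' _ ⟩
       _ ∎
      bound false = begin
       _ ≡⟨ ∑-Fin-suc n' _ ⟩
       ⟦ In' c false (upd (u , fzero) fzero ω) u ⟧ + ∑ (allFin n') (λ a -> ⟦ In' c false (upd (u , fzero) (fsuc a) ω) u ⟧)
        ≤⟨ +≤ (⟦⟧-mono fst) (from≡ (∑-zero (allFin n') λ a _ -> ⟦⟧-no λ (_ , e) -> case trans (sym (val (fsuc a))) e of λ ())) ⟩
       _ ≡⟨ +-identityʳ _ ∙ sym (*-identityʳ _) ⟩
       _ ∎

     mean : ∀ c b v -> Guard c b v -> ∑ (nbrs v) (λ u -> ⟦ Set' c u ⟧ * rate b) ≤ G * ν c b v * n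
     mean c true v _ = from≡ (∑-*ʳ (nbrs v) _ n') » ceil-≥ (t c v * n') (suc g + n' * G) » from≡ (ring33 g n' (ν c true v))
     mean c false v gd = from≡ (∑-*ʳ (nbrs v) _ 1 ∙ *-identityʳ _) » gd » *≤ʳ n (ceil-≥ (cap c) (suc g)) » from≡ (*-comm n _)

     small : ∀ j v -> Rare j v (blockOf v)
     small j@(c , b) v = cases (Guard c b v)
       (λ gd -> on-block loc j v (blocks (nbrs v)) inside λ ω -> *≤ˡ (2 ^ h) (E-mono none (blocks (nbrs v)) (λ ω -> ⟦⟧-mono snd) ω)
        » tail g (ν c b v) h (nbrs v) (pairs∈ (nbrs v) (nbrs-unique v) λ u u' _ _ ne -> (λ { z (here refl) e -> ne (cong fst (sym e)) }) , (λ { z (here refl) e -> ne (cong fst e) })) (mean c b v gd) ω)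
       (λ ngd -> never j v λ ω -> ngd ∘ fst)
      where
      open Products.Chernoff {Var} n blk (λ u z -> z ≡ (u , fzero)) (λ u ω -> ⟦ In' c b ω u ⟧)
       (λ u ω ω' e -> ⟦⟧-cong (In-cong c b ω ω' u (e (u , fzero) refl)) (In-cong c b ω' ω u (sym (e (u , fzero) refl)))) (λ u ω -> ⟦⟧≤1 _)
       (λ u -> ⟦ Set' c u ⟧ * rate b) n (s≤s z≤n) (chance c b)
      inside : ∀ {z} -> z ∈ blocks (nbrs v) -> z ∈ blockOf v
      inside m = case concatMap-∈ blk (nbrs v) m of λ { (u , u∈ , here refl) -> ∈block fzero (near-mono 1≤ρ (nbrs-near u∈)) }

    record Activated : Set₁ where
     field
      On : X -> Set
      b-On : Borel On
      rest : ∀ c v -> ∑ (nbrs v) (λ u -> ⟦ Set' c u × ¬ On u ⟧) < dev g h (ceil (t c v * n') (suc g + n' * G))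
      fired : ∀ c v -> t c v ≤ n * cap c -> ∑ (nbrs v) (λ u -> ⟦ Set' c u × On u ⟧) < dev g h (ceil (cap c) (suc g))

    abstract
     activate : Activated
     activate = let (ω , m , ok) = solve J (subst (λ l -> l * cost ρ n ≤ 2 ^ h) (sym J-length) budget) loc meas small in record
      { On = Act ω ; b-On = m fzero fzero
      ; rest = λ c v -> ≰⇒> λ le -> ok v (c , true) (∈J c true) (tt , le)
      ; fired = λ c v le -> ≰⇒> λ le' -> ok v (c , false) (∈J c false) (le , le') }

   -- Picks, coins and the survival of colours.

   record BData : Set₁ where
    field
     q : ℕ
     Y On : X -> Set
     L Dd : Fin q -> X -> Set
     bY : Borel Y
     bOn : Borel On
     bL : ∀ c -> Borel (L c)
     bD : ∀ c -> Borel (Dd c)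
     triangle-free : ∀ {x y z} -> x ~ y -> y ~ z -> z ~ x -> ⊥
     -- `suc k'` live colours are offered to a vertex, at most `a` activated neighbours compete for
     -- a live colour, and `dA` are activated in all. `τR` and `τ'` are the degree caps after
     -- activation and after the picks; `D` measures the weight of a list in caps `τR`.
     k' a ℓ̂ g h ρ dA τR τ' D : ℕ
     2≤ρ : 2 ≤ ρ
     a≤k : a ≤ suc k'
     list-size : ∀ v -> Y v -> ∑ (allFin q) (λ c -> ⟦ L c v ⟧) ≡ ℓ̂
     live-enough : ∀ v -> Y v -> suc k' ≤ ∑ (allFin q) (λ c -> ⟦ L c v × ¬ Dd c v ⟧)
     act-few : ∀ c v -> Y v -> L c v × ¬ Dd c v -> ∑ (nbrs v) (λ u -> ⟦ (Y u × L c u) × On u ⟧) ≤ a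
     act-degree : ∀ v -> ∑ (nbrs v) (λ u -> ⟦ Y u × On u ⟧) ≤ dA
     0<τR : 1 ≤ τR
     0<τ' : 1 ≤ τ'
     τ-ratio : τR * suc k' ≤ τ' * (suc k' + a)

   module Picking (bd : BData) where
    open BData bd

    k G : ℕ
    k = suc k'
    G = 2 + g

    -- Coordinate 0 of a vertex is its pick among the first k live colours, coordinate `fsuc c` the
    -- coin for the colour c.
    open Vars (suc q) k public
    open Tails {Var} k
    open Products {Var} k

    Act R : X -> Set
    Act u = Y u × On u
    R u = Y u × ¬ On u

    b-Act : Borel Act
    b-Act = b-× bY bOn

    b-R : Borel R
    b-R = b-× bY (b-¬ bOn)

    Live : Fin q -> X -> Set
    Live c v = L c v × ¬ Dd c v

    b-Live : ∀ c -> Borel (Live c)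
    b-Live c = b-× (bL c) (b-¬ (bD c))

    cols : List (Fin q)
    cols = allFin q

    liveList : X -> List (Fin q)
    liveList x = sel (λ c -> Live c x) cols

    pickc : X -> Fin k -> Maybe (Fin q)
    pickc x i = nthM (liveList x) (toℕ i)

    pick-live : ∀ {x i c} -> pickc x i ≡ just c -> Live c x
    pick-live {x} {i} e = snd (sel⊆ cols (nthM-∈ (liveList x) (toℕ i) e))

    pick-inj : ∀ {x i j c} -> pickc x i ≡ just c -> pickc x j ≡ just c -> i ≡ j
    pick-inj {x} {i} {j} e e' = toℕ-injective (nthM-inj (liveList x) (sel-unique (allFin⁺ q)) (toℕ i) (toℕ j) e e')

    pick-total : ∀ x i -> Y x -> ∃[ c ] pickc x i ≡ just c
    pick-total x i y = nthM-< (liveList x) (toℕ i) (toℕ<n i » live-enough x y » from≡ (sym (sel-length cols)))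

    b-pickc : ∀ i c -> Borel (λ x -> pickc x i ≡ just c)
    b-pickc i c = meas-map (enum-List (enum-Fin q)) (meas-sel cols) (λ l -> nthM l (toℕ i)) (just c)
     where
     meas-sel : ∀ cs -> Meas (λ x -> sel (λ c -> Live c x) cs)
     meas-sel [] = meas-const []
     meas-sel (c ∷ cs) v = b-resp to from
      (b-⊎ (b-× (b-Live c) (b-∃ (enum-List (enum-Fin q)) λ v' -> b-× (b-const (c ∷ v' ≡ v)) (meas-sel cs v'))) (b-× (b-¬ (b-Live c)) (meas-sel cs v)))
      where
      to : ∀ x -> (Live c x × ∃[ v' ] c ∷ v' ≡ v × sel (λ c -> Live c x) cs ≡ v') ⊎ (¬ Live c x × sel (λ c -> Live c x) cs ≡ v) -> sel (λ c -> Live c x) (c ∷ cs) ≡ v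
      to x t with dec (Live c x)
      to x (inj₁ (_ , v' , e , refl)) | yes _ = e
      to x (inj₂ (n , _)) | yes l = ⊥-elim (n l)
      to x (inj₁ (l , _)) | no n = ⊥-elim (n l)
      to x (inj₂ (_ , e)) | no n = e
      from : ∀ x -> sel (λ c -> Live c x) (c ∷ cs) ≡ v -> (Live c x × ∃[ v' ] c ∷ v' ≡ v × sel (λ c -> Live c x) cs ≡ v') ⊎ (¬ Live c x × sel (λ c -> Live c x) cs ≡ v)
      from x e with dec (Live c x)
      ... | yes l = inj₁ (l , _ , e , refl)
      ... | no n = inj₂ (n , e)

    Pl : Fin q -> X -> Set
    Pl c x = ∃[ i ] pickc x i ≡ just c

    b-Pl : ∀ c -> Borel (Pl c)
    b-Pl c = b-∃ (enum-Fin k) λ i -> b-pickc i c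

    ta : Fin q -> X -> ℕ
    ta c v = ∑ (nbrs v) λ u -> ⟦ Act u × Pl c u ⟧

    ta≤a : ∀ c v -> Y v -> Live c v -> ta c v ≤ a
    ta≤a c v y l = (∑-mono (nbrs v) λ u -> ⟦⟧-mono λ { ((yu , on) , (i , e)) -> (yu , fst (pick-live {u} {i} e)) , on }) » act-few c v y l

    -- The coin fires with probability θ/k. A live colour with t competitors gets a - t, so hits and
    -- coin together act like a competitors, and every colour of a list survives with probability at
    -- most k/(k + a).
    θ : Fin q -> X -> ℕ
    θ c v = ⟦ Live c v ⟧ * (a ∸ ta c v) + ⟦ ¬ Live c v ⟧ * a

    θ-live : ∀ c v -> Live c v -> θ c v ≡ a ∸ ta c v
    θ-live c v l = pick2 l

    θ-dead : ∀ c v -> ¬ Live c v -> θ c v ≡ a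
    θ-dead c v n = pick2' n

    meas-ta : ∀ c -> Meas (ta c)
    meas-ta c = meas-nbrs pt-id λ mh -> meas-⟦⟧ (mh (b-× b-Act (b-Pl c)))

    meas-θ : ∀ c -> Meas (θ c)
    meas-θ c = meas-map₂ enum-ℕ enum-ℕ (meas-map₂ enum-ℕ enum-ℕ (meas-⟦⟧ (b-Live c)) (meas-map enum-ℕ (meas-ta c) (a ∸_)) _*_)
     (meas-map enum-ℕ (meas-⟦⟧ (b-¬ (b-Live c))) (_* a)) _+_

    pick : Asg -> X -> Maybe (Fin q)
    pick ω u = pickc u (ω (u , fzero))

    hit : Asg -> Fin q -> X -> Set
    hit ω c u = Act u × pick ω u ≡ just c

    coin : Asg -> Fin q -> X -> Set
    coin ω c v = toℕ (ω (v , fsuc c)) < θ c v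

    -- The set of hitting vertices is a parameter, so that survival is a decreasing function of it,
    -- as negative association requires.
    killed : Fin q -> X -> (X -> Set) -> Asg -> Set
    killed c v hs ω = coin ω c v ⊎ (Live c v × ∃[ u ] v ~ u × hs u)

    surv : Asg -> Fin q -> X -> Set
    surv ω c v = ¬ killed c v (hit ω c) ω

    killed-mono : ∀ c v {hs hs'} ω ω' -> ω (v , fsuc c) ≡ ω' (v , fsuc c) -> (∀ u -> v ~ u -> hs u -> hs' u) -> killed c v hs ω -> killed c v hs' ω'
    killed-mono c v ω ω' e f (inj₁ t) = inj₁ (subst (λ i -> toℕ i < θ c v) e t)
    killed-mono c v ω ω' e f (inj₂ (l , u , vu , t)) = inj₂ (l , u , vu , f u vu t)

    hit-cong : ∀ ω ω' c u -> ω (u , fzero) ≡ ω' (u , fzero) -> hit ω c u -> hit ω' c u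
    hit-cong ω ω' c u e (act , p) = act , cong (pickc u) (sym e) ∙ p

    surv-cong : ∀ c v ω ω' -> ω (v , fsuc c) ≡ ω' (v , fsuc c) -> (∀ u -> v ~ u -> Act u -> ω (u , fzero) ≡ ω' (u , fzero)) -> surv ω c v -> surv ω' c v
    surv-cong c v ω ω' e f s k' = s (killed-mono c v ω' ω (sym e) (λ u vu t -> hit-cong ω' ω c u (sym (f u vu (fst t))) t) k')

    b-pick : ∀ {Ω h} c -> Plot Ω -> Pt h -> Borel (λ x -> pick (Ω x) (h x) ≡ just c)
    b-pick {Ω} {h} c pΩ mh = b-resp (λ { x (i , refl , e) -> e }) (λ x e -> _ , refl , e) (b-∃ (enum-Fin k) λ i -> b-× (pΩ mh fzero i) (mh (b-pickc i c)))

    b-hit : ∀ {Ω h} c -> Plot Ω -> Pt h -> Borel (λ x -> hit (Ω x) c (h x))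
    b-hit {Ω} {h} c pΩ mh = b-× (mh b-Act) (b-pick {Ω} {h} c pΩ mh)

    b-coin : ∀ {Ω h} c -> Plot Ω -> Pt h -> Borel (λ x -> coin (Ω x) c (h x))
    b-coin c pΩ mh = b-≤ (meas-map (enum-Fin k) (pΩ mh (fsuc c)) (suc ∘ toℕ)) (meas-pt (meas-θ c) mh)

    b-surv : ∀ {Ω h} c -> Plot Ω -> Pt h -> Borel (λ x -> surv (Ω x) c (h x))
    b-surv {Ω} {h} c pΩ mh = b-¬ (b-⊎ (b-coin {Ω} {h} c pΩ mh) (b-× (mh (b-Live c)) (b-∃~ mh λ mu -> b-hit {Ω} c pΩ mu)))

    acts : X -> List X
    acts x = sel Act (nbrs x)

    picks : List X -> List Var
    picks = map (_, fzero)

    blk : Fin q -> X -> List Var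
    blk c x = (x , fsuc c) ∷ picks (acts x)

    picks-unique : ∀ {ws} -> Unique ws -> Unique (picks ws)
    picks-unique [] = []
    picks-unique {w ∷ ws} (nw ∷ u) = All-tab (picks ws) (λ z m e -> case ∈-map⁻ (_, fzero) m of λ { (w' , m' , refl) -> All-∈ nw m' (cong fst e) }) ∷ picks-unique u

    surv-dep : ∀ c x -> DependsOn (_∈ blk c x) (λ ω -> ⟦ surv ω c x ⟧)
    surv-dep c x ω ω' h = ⟦⟧-cong (surv-cong c x ω ω' (h _ (here refl)) (λ u xu act -> h _ (inpick u xu act)))
      (surv-cong c x ω' ω (sym (h _ (here refl))) (λ u xu act -> sym (h _ (inpick u xu act))))
     where
     inpick : ∀ u -> x ~ u -> Act u -> (u , fzero) ∈ blk c x
     inpick u xu act = there (∈-map⁺ (_, fzero) (∈sel (nbrs x) (∈nbrs xu) act))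

    singles : ∀ (zs : List Var) -> concatMap (_∷ []) zs ≡ zs
    singles [] = refl
    singles (z ∷ zs) = cong (z ∷_) (singles zs)

    private
     miss : Fin q -> X -> Fin k -> ℕ
     miss c w i = ⟦ pickc w i ≢ just c ⟧

     miss-count : ∀ c w -> ∑ (allFin k) (miss c w) + ⟦ Pl c w ⟧ ≤ k
     miss-count c w = cases (Pl c w)
      (λ (i , e) -> +≤ʳ (∑ (allFin k) (miss c w)) (from≡ (⟦⟧-yes (i , e) ∙ sym (⟦⟧-yes e)) » ∑-member (allFin k) (λ i -> ⟦ pickc w i ≡ just c ⟧) (∈-allFin i))
       » from≡ (sym (∑-+ (allFin k) (miss c w) (λ i -> ⟦ pickc w i ≡ just c ⟧))) » ∑-≤const (allFin k) 1 (λ i _ -> one (pickc w i ≡ just c)) » from≡ (*-identityʳ _ ∙ length-allFin k))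
      (λ n -> from≡ (cong (∑ (allFin k) (miss c w) +_) (⟦⟧-no n) ∙ +-identityʳ _) » ∑-≤const (allFin k) 1 (λ i _ -> ⟦⟧≤1 _) » from≡ (*-identityʳ _ ∙ length-allFin k))
      where
      one : ∀ (Q : Set) -> ⟦ ¬ Q ⟧ + ⟦ Q ⟧ ≤ 1
      one Q = cases Q (λ x -> from≡ (cong₂ _+_ (⟦⟧-no λ n -> n x) (⟦⟧-yes x))) (λ n -> from≡ (cong₂ _+_ (⟦⟧-yes n) (⟦⟧-no n)))

     misses : ∀ c ws -> ∏ ws (λ w -> ∑ (allFin k) (miss c w)) * k ^ ∑ ws (λ w -> ⟦ Pl c w ⟧) ≤ k' ^ ∑ ws (λ w -> ⟦ Pl c w ⟧) * k ^ length ws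
     misses c [] = ≤-refl
     misses c (w ∷ ws) = begin
      _ ≡⟨ cong (m * ∏ ws (λ w -> ∑ (allFin k) (miss c w)) *_) (^-distribˡ-+-* k p s) ⟩
      _ ≡⟨ *-interchange m _ (k ^ p) (k ^ s) ⟩
      _ ≤⟨ *≤ (first p (⟦⟧≤1 _) (miss-count c w)) (misses c ws) ⟩
      _ ≡⟨ *-interchange (k' ^ p) k (k' ^ s) (k ^ length ws) ⟩
      _ ≡⟨ cong (_* (k * k ^ length ws)) (sym (^-distribˡ-+-* k' p s)) ⟩
      _ ∎
      where
      m = ∑ (allFin k) (miss c w)
      p = ⟦ Pl c w ⟧
      s = ∑ ws (λ w -> ⟦ Pl c w ⟧)
      first : ∀ p -> p ≤ 1 -> m + p ≤ k -> m * k ^ p ≤ k' ^ p * k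
      first zero _ le = from≡ (*-identityʳ m) » from≡ (sym (+-identityʳ m)) » le » from≡ (sym (*-identityˡ k))
      first (suc zero) _ le = *≤ (≤-pred (from≡ (+-comm 1 m) » le) » from≡ (sym (*-identityʳ k'))) (from≡ (*-identityʳ k))
      first (suc (suc _)) (s≤s ()) _

    -- The coin and the picks of the neighbours are independent, and a competitor misses c with
    -- probability at most 1 - 1/k; `survival` bounds the product. For a dead colour the coin alone
    -- does it.
    surv-chance : ∀ c x ω -> Y x -> L c x -> E₀ (blk c x) (λ ω -> ⟦ surv ω c x ⟧) ω * (k + a) ≤ k ^ length (blk c x) * k
    surv-chance c x ω yx lx = cases (Live c x) live dead
     where
     len : length (picks (acts x)) ≡ length (acts x)
     len = length-map (_, fzero) (acts x)
     dead : ¬ Live c x -> E₀ (blk c x) (λ ω -> ⟦ surv ω c x ⟧) ω * (k + a) ≤ k ^ length (blk c x) * k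
     dead nl = E-bound (dep⇒resp (surv-dep c x)) (blk c x) ((x , fsuc c) ∷ []) ω (k + a) k (λ { (here refl) -> here refl }) (1≤^ {k} 1 (s≤s z≤n)) λ ω -> begin
      _ ≤⟨ *≤ˡ (k + a) ((∑-mono vals λ i -> ⟦⟧-mono λ s lt -> s (inj₁ (subst₂ (λ j t -> toℕ j < t) (sym (upd-same (x , fsuc c) i ω)) (sym (θ-dead c x nl)) lt))) » ∑-above k a) ⟩
      _ ≡⟨ cong (_* (k + a)) (sym (*-identityˡ (k ∸ a))) ⟩
      _ ≤⟨ survival k' 0 a a≤k ⟩
      _ ≡⟨ ring46 k ⟩
      _ ∎
     live : Live c x -> E₀ (blk c x) (λ ω -> ⟦ surv ω c x ⟧) ω * (k + a) ≤ k ^ length (blk c x) * k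
     live l = *-cancel {c = k ^ t} (1≤^ t (s≤s z≤n)) (begin
      _ ≤⟨ *≤ˡ (k ^ t) (*≤ˡ (k + a) factor) ⟩
      _ ≡⟨ ring11 (k ∸ (a ∸ t)) _ (k + a) (k ^ t) ⟩
      _ ≤⟨ *≤ʳ ((k ∸ (a ∸ t)) * (k + a)) (subst (λ s -> ∏ (acts x) (λ w -> ∑ (allFin k) (miss c w)) * k ^ s ≤ k' ^ s * k ^ length (acts x)) t≡ (misses c (acts x))) ⟩
      _ ≡⟨ cong (λ b -> (k ∸ (a ∸ t)) * (k + b) * (k' ^ t * k ^ length (acts x))) (sym e) ⟩
      _ ≡⟨ ring47 (k ∸ (a ∸ t)) (k + (t + (a ∸ t))) (k' ^ t) (k ^ length (acts x)) ⟩
      _ ≤⟨ *≤ˡ (k ^ length (acts x)) (survival k' t (a ∸ t) (from≡ e » a≤k)) ⟩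
      _ ≡⟨ ring48 (k ^ t) k (k ^ length (acts x)) ⟩
      _ ≡⟨ cong (λ n -> k * k ^ n * k * k ^ t) (sym len) ⟩
      _ ∎)
      where
      t = ta c x
      t≤a : t ≤ a
      t≤a = ta≤a c x yx l
      e : t + (a ∸ t) ≡ a
      e = m+[n∸m]≡n t≤a
      t≡ : ∑ (acts x) (λ w -> ⟦ Pl c w ⟧) ≡ t
      t≡ = ∑-sel (nbrs x) _ ∙ (∑-cong (nbrs x) λ u -> cases (Act u)
       (λ au -> yes* au ∙ ⟦⟧-cong (au ,_) snd)
       (λ n -> no* n ∙ sym (⟦⟧-no (n ∘ fst))))
      f : Var -> Asg -> ℕ
      f (w , fzero) ω = miss c w (ω (w , fzero))
      f (w , fsuc c') ω = ⟦ ¬ (toℕ (ω (w , fsuc c')) < a ∸ t) ⟧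
      f-dep : ∀ z -> DependsOn (_≡ z) (f z)
      f-dep (w , fzero) ω ω' h = cong (miss c w) (h _ refl)
      f-dep (w , fsuc c') ω ω' h = cong (λ i -> ⟦ ¬ (toℕ i < a ∸ t) ⟧) (h _ refl)
      blk-unique : Unique (blk c x)
      blk-unique = All-tab (picks (acts x)) (λ z m e -> case ∈-map⁻ (_, fzero) m of λ { (w , _ , refl) -> case cong snd e of λ () }) ∷ picks-unique (sel-unique (nbrs-unique x))
      pairs : ∀ zs -> Unique zs -> AllPairs (λ i j -> (∀ z -> z ∈ j ∷ [] -> ¬ (z ≡ i)) × (∀ z -> z ∈ i ∷ [] -> ¬ (z ≡ j))) zs
      pairs [] [] = []
      pairs (z ∷ zs) (nz ∷ u) = All-tab zs (λ z' m -> (λ { _ (here refl) e -> All-∈ nz m (sym e) }) , (λ { _ (here refl) e -> All-∈ nz m e })) ∷ pairs zs u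
      pointwise : ∀ ω -> ⟦ surv ω c x ⟧ ≤ ∏ (blk c x) (λ z -> f z ω)
      pointwise ω = cases (surv ω c x)
       (λ s -> from≡ (⟦⟧-yes s) » (from≡ (sym ((cong₂ _*_
         (⟦⟧-yes λ lt -> s (inj₁ (subst (toℕ (ω (x , fsuc c)) <_) (sym (θ-live c x l)) lt)))
         (ones (acts x) λ w m -> ⟦⟧-yes λ p -> s (inj₂ (l , w , nbrs∈ (fst (sel⊆ (nbrs x) m)) , snd (sel⊆ (nbrs x) m) , p)))) ∙ refl))))
       (λ ns -> from≡ (⟦⟧-no ns) » z≤n)
       where
       ones : ∀ ws -> (∀ w -> w ∈ ws -> miss c w (ω (w , fzero)) ≡ 1) -> ∏ (picks ws) (λ z -> f z ω) ≡ 1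
       ones [] h = refl
       ones (w ∷ ws) h = cong₂ _*_ (h w (here refl)) (ones ws λ w' m -> h w' (there m))
      factor : E₀ (blk c x) (λ ω -> ⟦ surv ω c x ⟧) ω ≤ (k ∸ (a ∸ t)) * ∏ (acts x) (λ w -> ∑ (allFin k) (miss c w))
      factor = begin
       _ ≤⟨ E-mono none (blk c x) pointwise ω ⟩
       _ ≡⟨ cong (λ zs -> E₀ zs (λ ω -> ∏ (blk c x) (λ z -> f z ω)) ω) (sym (singles (blk c x))) ⟩
       _ ≡⟨ E-∏ (_∷ []) (λ z z' -> z' ≡ z) f f-dep (blk c x) (pairs (blk c x) blk-unique) ω ⟩
       _ ≡⟨ cong (E₀ ((x , fsuc c) ∷ []) (f (x , fsuc c)) ω *_) (∏-map (_, fzero) (acts x) (λ z -> E₀ (z ∷ []) (f z) ω)) ⟩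
       ∑ vals (λ i -> ⟦ ¬ (toℕ (upd (x , fsuc c) i ω (x , fsuc c)) < a ∸ t) ⟧) * ∏ (acts x) (λ w -> ∑ vals λ i -> miss c w (upd (w , fzero) i ω (w , fzero)))
        ≡⟨ cong₂ _*_ (∑-cong vals λ i -> cong (λ j -> ⟦ ¬ (toℕ j < a ∸ t) ⟧) (upd-same (x , fsuc c) i ω)) (∏-cong∈ (acts x) λ w _ -> ∑-cong vals λ i -> cong (miss c w) (upd-same (w , fzero) i ω)) ⟩
       _ ≤⟨ *≤ˡ _ (∑-above k (a ∸ t)) ⟩
       _ ∎

    open Association {Var} k

    dv : ℕ -> ℕ
    dv = dev g h

    t′ : Fin q -> X -> (X -> Set) -> Asg -> ℕ
    t′ c v hs ω = ∑ (nbrs v) λ u -> ⟦ (R u × L c u) × ¬ killed c u hs ω ⟧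

    -- Exponential moments need bounded weights, hence the truncation at `τ'`. It loses nothing: a
    -- colour with more than `τ'` neighbours is about to die and then weighs `τ'`.
    W : Fin q -> X -> (X -> Set) -> Asg -> ℕ
    W c v hs ω = ⟦ Dd c v ⟧ * τ' + ⟦ ¬ Dd c v ⟧ * (τ' ⊓ t′ c v hs ω)

    Xh : Fin q -> X -> (X -> Set) -> Asg -> ℕ
    Xh c v hs ω = ⟦ L c v × ¬ killed c v hs ω ⟧ * W c v hs ω

    Xw : Asg -> Fin q -> X -> ℕ
    Xw ω c v = Xh c v (hit ω c) ω

    tR : Fin q -> X -> ℕ
    tR c v = ∑ (nbrs v) λ u -> ⟦ R u × L c u ⟧

    wt : Fin q -> X -> ℕ
    wt c v = ⟦ Dd c v ⟧ * τR + ⟦ ¬ Dd c v ⟧ * tR c v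

    W≤ : ∀ c v hs ω -> W c v hs ω ≤ τ'
    W≤ c v hs ω = cases (Dd c v) (λ d -> from≡ (pick2 d)) (λ n -> from≡ (pick2' n) » ℕ.m⊓n≤m τ' _)

    Xw≤ : ∀ ω c v -> Xw ω c v ≤ τ'
    Xw≤ ω c v = *≤ (⟦⟧≤1 (L c v × ¬ killed c v (hit ω c) ω)) (W≤ c v (hit ω c) ω) » from≡ (*-identityˡ τ')

    coinsOf : X -> Fin q -> List Var
    coinsOf v c = (v , fsuc c) ∷ map (_, fsuc c) (nbrs v)

    Xh-≤ : ∀ c v {hs hs'} ω ω' -> (∀ z -> z ∈ coinsOf v c -> ω z ≡ ω' z) -> (∀ x u -> x ∈ v ∷ nbrs v -> x ~ u -> hs u -> hs' u) -> Xh c v hs' ω' ≤ Xh c v hs ω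
    Xh-≤ c v ω ω' e f = *≤ (⟦⟧-mono λ (l , s) -> l , s ∘ killed-mono c v ω ω' (e _ (here refl)) (λ u -> f v u (here refl)))
     (+≤ʳ (⟦ Dd c v ⟧ * τ') (*≤ʳ ⟦ ¬ Dd c v ⟧ (ℕ.⊓-monoʳ-≤ τ' (∑-mono∈ (nbrs v) λ x m ->
      ⟦⟧-mono λ (rl , s) -> rl , s ∘ killed-mono c x ω ω' (e _ (there (∈-map⁺ (_, fsuc c) m))) (λ u -> f x u (there m))))))

    Xh-cong : ∀ c v {hs hs'} ω ω' -> (∀ z -> z ∈ coinsOf v c -> ω z ≡ ω' z) -> (∀ x u -> x ∈ v ∷ nbrs v -> x ~ u -> hs u -> hs' u) ->
     (∀ x u -> x ∈ v ∷ nbrs v -> x ~ u -> hs' u -> hs u) -> Xh c v hs ω ≡ Xh c v hs' ω'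
    Xh-cong c v ω ω' e f f' = ℕ.≤-antisym (Xh-≤ c v ω' ω (λ z m -> sym (e z m)) f') (Xh-≤ c v ω ω' e f)

    Xw-cong : ∀ ω ω' c v -> (∀ z -> z ∈ coinsOf v c -> ω z ≡ ω' z) -> (∀ x u -> x ∈ v ∷ nbrs v -> x ~ u -> Act u -> ω (u , fzero) ≡ ω' (u , fzero)) -> Xw ω c v ≡ Xw ω' c v
    Xw-cong ω ω' c v e f = Xh-cong c v ω ω' e (λ x u m xu h -> hit-cong ω ω' c u (f x u m xu (fst h)) h)
     (λ x u m xu h -> hit-cong ω' ω c u (sym (f x u m xu (fst h))) h)

    ν₃ : ℕ
    ν₃ = ceil (D * k) (k' + a + suc g * (k + a))

    module At (v : X) (rv : R v) (mean≤ : ∑ cols (λ c -> ⟦ L c v ⟧ * wt c v) ≤ D * τR) where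

     ws : List Var
     ws = picks (sel Act (dedup (nbrs v ++ concatMap nbrs (nbrs v))))

     ws-unique : Unique ws
     ws-unique = picks-unique (sel-unique (dedup-unique (nbrs v ++ concatMap nbrs (nbrs v))))

     ∈ws : ∀ {x u} -> x ∈ v ∷ nbrs v -> x ~ u -> Act u -> (u , fzero) ∈ ws
     ∈ws {x} {u} m xu act = ∈-map⁺ (_, fzero) (∈sel (dedup (nbrs v ++ concatMap nbrs (nbrs v))) (∈dedup (nbrs v ++ concatMap nbrs (nbrs v)) (within m)) act)
      where
      within : x ∈ v ∷ nbrs v -> u ∈ nbrs v ++ concatMap nbrs (nbrs v)
      within (here refl) = ∈-++⁺ˡ (∈nbrs xu)
      within (there m) = ∈-++⁺ʳ (nbrs v) (∈-concatMap nbrs (nbrs v) m (∈nbrs xu))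

     allCoins : List Var
     allCoins = concatMap (coinsOf v) cols

     coin-index : ∀ {c z} -> z ∈ coinsOf v c -> snd z ≡ fsuc c
     coin-index (here refl) = refl
     coin-index {c} (there m) = case ∈-map⁻ (_, fsuc c) m of λ { (_ , _ , refl) -> refl }

     ws-act : ∀ {u} -> (u , fzero) ∈ ws -> Act u
     ws-act m = case ∈-map⁻ (_, fzero) m of λ { (_ , m' , refl) -> snd (sel⊆ (dedup (nbrs v ++ concatMap nbrs (nbrs v))) m') }

     N ℓ : ℕ
     N = G * τ'
     ℓ = (k + a) * τR

     f : Fin q -> Asg -> ℕ
     f c ω = N + Xw ω c v

     f-dep : ∀ c -> DependsOn (λ z -> snd z ≡ fzero ⊎ snd z ≡ fsuc c) (f c)
     f-dep c ω ω' h = cong (N +_) (Xw-cong ω ω' c v (λ z m -> h z (inj₂ (coin-index m))) (λ x u m xu _ -> h (u , fzero) (inj₁ refl)))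

     Hit : Fin q -> Var -> Fin k -> Set
     Hit c (u , fzero) i = pickc u i ≡ just c
     Hit c (u , fsuc _) i = ⊥

     Hit-one : ∀ {c c' z i} -> Hit c z i -> Hit c' z i -> c ≡ c'
     Hit-one {z = u , fzero} e e' = case trans (sym e) e' of λ { refl -> refl }

     ω₁ : Asg
     ω₁ _ = fzero

     at0 : (Var -> Set) -> X -> Set
     at0 h u = h (u , fzero)

     -- The coins are averaged out first; those of different colours are independent. What remains
     -- are functions of the hits alone, decreasing and hence negatively associated.
     F : Fin q -> (Var -> Set) -> ℕ
     F c h = E₀ (coinsOf v c) (λ ω -> N + Xh c v (at0 h) ω) ω₁

     F-antitone : ∀ c {h h'} -> (∀ z -> h z -> h' z) -> F c h' ≤ F c h
     F-antitone c h = E-mono none (coinsOf v c) (λ ω -> +≤ʳ N (Xh-≤ c v ω ω (λ _ _ -> refl) λ x u _ _ -> h (u , fzero))) ω₁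

     hits : Fin q -> Asg -> Var -> Set
     hits c ω = H Hit Hit-one F F-antitone ws c (λ _ -> ⊥) ω

     F-is : ∀ c ω -> E₀ (coinsOf v c) (f c) ω ≡ F c (hits c ω)
     F-is c ω = (E-cong-off (coinsOf v c) ω λ ω' off -> cong (N +_) (Xh-cong c v ω' ω' (λ _ _ -> refl)
       (λ x u m xu (act , p) -> inj₂ (∈ws m xu act , subst (λ i -> pickc u i ≡ just c) (off (u , fzero) (λ m -> case coin-index m of λ ())) p))
       (λ { x u m xu (inj₁ ()) ; x u m xu (inj₂ (m' , p)) -> ws-act m' , subst (λ i -> pickc u i ≡ just c) (sym (off (u , fzero) (λ m -> case coin-index m of λ ()))) p })))
      ∙ (E-dep {D = _∈ coinsOf v c} (λ ω ω' h -> cong (N +_) (Xh-cong c v ω ω' h (λ _ _ _ _ -> id) (λ _ _ _ _ -> id))) none (coinsOf v c) ω ω₁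
       λ { z m (inj₂ n) -> ⊥-elim (n m) })

     r : Fin q -> ℕ
     r c = k * (⟦ L c v ⟧ * wt c v)

     size : Fin q -> ℕ
     size c = k ^ length (ws ++ coinsOf v c)

     chance-one : ∀ c x ω -> Y x -> L c x -> (∀ {z} -> z ∈ blk c x -> z ∈ ws ++ coinsOf v c) -> E₀ (ws ++ coinsOf v c) (λ ω -> ⟦ surv ω c x ⟧) ω * (k + a) ≤ size c * k
     chance-one c x ω yx lx inside = E-bound (dep⇒resp (surv-dep c x)) (ws ++ coinsOf v c) (blk c x) ω (k + a) k inside (1≤^ (length (blk c x)) (s≤s z≤n))
      λ ω -> surv-chance c x ω yx lx

     inside-v : ∀ c {z} -> z ∈ blk c v -> z ∈ ws ++ coinsOf v c
     inside-v c (here refl) = ∈-++⁺ʳ ws (here refl)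
     inside-v c (there m) = case ∈-map⁻ (_, fzero) m of λ { (u , m' , refl) -> let (u∈ , act) = sel⊆ (nbrs v) m' in ∈-++⁺ˡ (∈ws (here refl) (nbrs∈ u∈) act) }

     inside-u : ∀ c x -> x ∈ nbrs v -> ∀ {z} -> z ∈ blk c x -> z ∈ ws ++ coinsOf v c
     inside-u c x x∈ (here refl) = ∈-++⁺ʳ ws (there (∈-map⁺ (_, fsuc c) x∈))
     inside-u c x x∈ (there m) = case ∈-map⁻ (_, fzero) m of λ { (u , m' , refl) -> let (u∈ , act) = sel⊆ (nbrs x) m' in ∈-++⁺ˡ (∈ws (there x∈) (nbrs∈ u∈) act) }

     -- Without triangles, v and a neighbour of v have no common activated neighbours.
     blocks-apart : ∀ c x -> v ~ x -> ∀ z -> z ∈ blk c x -> z ∉ blk c v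
     blocks-apart c x vx z (here refl) (here e) = ~-irrefl (subst (v ~_) (cong fst e) vx)
     blocks-apart c x vx z (here refl) (there m) = case ∈-map⁻ (_, fzero) m of λ { (_ , _ , ()) }
     blocks-apart c x vx z (there m) (here refl) = case ∈-map⁻ (_, fzero) m of λ { (_ , _ , ()) }
     blocks-apart c x vx z (there m) (there m') = case ∈-map⁻ (_, fzero) m of λ { (u , u∈ , refl) -> case ∈-map⁻ (_, fzero) m' of λ { (_ , u∈' , refl) ->
      triangle-free (nbrs∈ (fst (sel⊆ (nbrs v) u∈'))) (~-sym (nbrs∈ (fst (sel⊆ (nbrs x) u∈)))) (~-sym vx) } }

     both : Fin q -> X -> Asg -> ℕ
     both c x ω = ⟦ surv ω c v ⟧ * ⟦ surv ω c x ⟧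

     chance-two : ∀ c x ω -> L c v -> v ~ x -> R x × L c x -> E₀ (ws ++ coinsOf v c) (both c x) ω * ((k + a) * (k + a)) ≤ size c * (k * k)
     chance-two c x ω lv vx (rx , lx) = E-bound resp (ws ++ coinsOf v c) (blk c v ++ blk c x) ω ((k + a) * (k + a)) (k * k)
       (λ m -> case ∈-++⁻ (blk c v) m of λ { (inj₁ m) -> inside-v c m ; (inj₂ m) -> inside-u c x (∈nbrs vx) m }) (1≤^ (length (blk c v ++ blk c x)) (s≤s z≤n)) bound
      where
      resp : Resp (both c x)
      resp ω ω' h = cong₂ _*_ (dep⇒resp (surv-dep c v) ω ω' h) (dep⇒resp (surv-dep c x) ω ω' h)
      ev ex : Asg -> ℕ
      ev ω = E₀ (blk c v) (λ ω -> ⟦ surv ω c v ⟧) ω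
      ex ω = E₀ (blk c x) (λ ω -> ⟦ surv ω c x ⟧) ω
      split : ∀ ω -> E₀ (blk c v ++ blk c x) (both c x) ω ≡ ev ω * ex ω
      split ω = E-++ none (blk c v) (blk c x) (both c x) ω ∙ (E-cong none (blk c v) (λ ω -> E-pull (surv-dep c v) (blk c x) (λ ω -> ⟦ surv ω c x ⟧) ω (blocks-apart c x vx)) ω
       ∙ (E-pullʳ (E-depends (surv-dep c x) none (blk c x)) (blk c v) (λ ω -> ⟦ surv ω c v ⟧) ω λ z m m' -> blocks-apart c x vx z m' m))
      bound : ∀ ω -> E₀ (blk c v ++ blk c x) (both c x) ω * ((k + a) * (k + a)) ≤ k ^ length (blk c v ++ blk c x) * (k * k)
      bound ω = begin
       _ ≡⟨ cong (_* ((k + a) * (k + a))) (split ω) ∙ ring52 (ev ω) (ex ω) (k + a) ⟩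
       _ ≤⟨ *≤ (surv-chance c v ω (fst rv) lv) (surv-chance c x ω (fst rx) lx) ⟩
       _ ≡⟨ ring53 (k ^ length (blk c v)) k (k ^ length (blk c x)) ⟩
       _ ≡⟨ cong (_* (k * k)) (pow-++ k (blk c v) _) ⟩
       _ ∎

     -- A dead colour keeps weight `τ'` and survives with probability at most k/(k + a). For a live
     -- colour both v and its neighbour must keep it, independently, which gives the square;
     -- `τ-ratio` spends one of the two factors on lowering the cap from `τR` to `τ'`.
     mean-X : ∀ c ω -> E₀ (ws ++ coinsOf v c) (λ ω -> Xw ω c v) ω * ℓ ≤ size c * (τ' * r c)
     mean-X c ω = cases (L c v) (λ l -> cases (Dd c v) (dead l) (live l))
       (λ nl -> *≤ˡ ℓ (from≡ (E-null none (ws ++ coinsOf v c) (λ ω -> no* (nl ∘ fst)) ω)) » z≤n)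
      where
      xs = ws ++ coinsOf v c
      dead : L c v -> Dd c v -> E₀ xs (λ ω -> Xw ω c v) ω * ℓ ≤ size c * (τ' * r c)
      dead l d = begin
       _ ≤⟨ *≤ˡ ℓ (E-mono none xs (λ ω -> *≤ (⟦⟧-mono snd) (W≤ c v (hit ω c) ω)) ω) ⟩
       _ ≡⟨ cong (_* ℓ) (E-*ʳ none xs _ τ' ω) ⟩
       _ ≡⟨ *-interchange (E₀ xs (λ ω -> ⟦ surv ω c v ⟧) ω) τ' (k + a) τR ⟩
       _ ≤⟨ *≤ˡ (τ' * τR) (chance-one c v ω (fst rv) l (inside-v c)) ⟩
       _ ≡⟨ ring54 (size c) k τ' τR ⟩
       _ ≡⟨ cong (λ w -> size c * (τ' * (k * w))) (sym (cong₂ _*_ (⟦⟧-yes l) (pick2 d))) ⟩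
       _ ∎
      live : L c v -> ¬ Dd c v -> E₀ xs (λ ω -> Xw ω c v) ω * ℓ ≤ size c * (τ' * r c)
      live l nd = *-cancel {c = k + a} (s≤s z≤n) (begin
       _ ≡⟨ ring49 EX (k + a) τR ⟩
       _ ≤⟨ *≤ˡ τR sum ⟩
       _ ≡⟨ ring50 (size c) (tR c v) k τR ⟩
       _ ≤⟨ *≤ʳ (size c * (tR c v * k)) τ-ratio ⟩
       _ ≡⟨ ring51 (size c) (tR c v) k τ' (k + a) ⟩
       _ ≡⟨ cong (λ w -> size c * (τ' * (k * w)) * (k + a)) (sym (cong₂ _*_ (⟦⟧-yes l) (pick2' nd))) ⟩
       _ ∎)
       where
       EX = E₀ xs (λ ω -> Xw ω c v) ω
       lem₄ : ∀ s w -> s * (w * (k * k)) ≡ w * (s * (k * k))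
       lem₄ s w = sym (*-assoc s w (k * k)) ∙ cong (_* (k * k)) (*-comm s w) ∙ *-assoc w s (k * k)
       Q : X -> Set
       Q x = R x × L c x
       three : ∀ (A C D : Set) -> ⟦ C × D ⟧ ≤ ⟦ C ⟧ * ⟦ D ⟧
       three A C D = cases C (λ c -> ⟦⟧-mono snd » from≡ (sym (yes* c))) (λ n -> from≡ (⟦⟧-no (n ∘ fst)) » z≤n)
       pointwise : ∀ ω -> Xw ω c v ≤ ∑ (nbrs v) λ x -> ⟦ Q x ⟧ * both c x ω
       pointwise ω = begin
        _ ≤⟨ *≤ (⟦⟧-mono snd) (from≡ (pick2' nd) » ℕ.m⊓n≤n τ' _) ⟩
        _ ≡⟨ sym (∑-*ˡ (nbrs v) ⟦ surv ω c v ⟧ _) ⟩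
        _ ≤⟨ ∑-mono (nbrs v) (λ x -> *≤ʳ ⟦ surv ω c v ⟧ (three ⊤ (Q x) (surv ω c x)) » from≡ (x∙yz≈y∙xz ⟦ surv ω c v ⟧ ⟦ Q x ⟧ _)) ⟩
        _ ∎
       sum : EX * ((k + a) * (k + a)) ≤ size c * (tR c v * (k * k))
       sum = begin
        _ ≤⟨ *≤ˡ ((k + a) * (k + a)) (E-mono none xs pointwise ω) ⟩
        _ ≡⟨ cong (_* ((k + a) * (k + a))) (E-∑ none xs (nbrs v) (λ x ω -> ⟦ Q x ⟧ * both c x ω) ω) ⟩
        _ ≡⟨ sym (∑-*ʳ (nbrs v) _ ((k + a) * (k + a))) ⟩
        _ ≤⟨ ∑-mono∈ (nbrs v) each ⟩
        _ ≡⟨ ∑-*ʳ (nbrs v) _ (size c * (k * k)) ⟩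
        _ ≡⟨ sym (lem₄ (size c) (tR c v)) ⟩
        _ ∎
        where
        each : ∀ x -> x ∈ nbrs v -> E₀ xs (λ ω -> ⟦ Q x ⟧ * both c x ω) ω * ((k + a) * (k + a)) ≤ ⟦ Q x ⟧ * (size c * (k * k))
        each x m = begin
         _ ≡⟨ cong (_* ((k + a) * (k + a))) (E-*ˡ none xs ⟦ Q x ⟧ (both c x) ω) ⟩
         _ ≡⟨ *-assoc ⟦ Q x ⟧ _ _ ⟩
         _ ≤⟨ cases (Q x)
          (λ qx -> *≤ʳ ⟦ Q x ⟧ (chance-two c x ω l (nbrs∈ m) qx)) (λ n -> from≡ (no* n) » z≤n) ⟩
         _ ∎

     mean-f : ∀ c ω -> E₀ (ws ++ coinsOf v c) (f c) ω * ℓ ≤ size c * (τ' * (G * ℓ + r c))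
     mean-f c ω = begin
      _ ≡⟨ cong (_* ℓ) (E-+ none xs (λ _ -> N) (λ ω -> Xw ω c v) ω ∙ cong (_+ E₀ xs (λ ω -> Xw ω c v) ω) (E-const none xs N ω)) ⟩
      _ ≡⟨ *-distribʳ-+ ℓ (size c * N) _ ⟩
      _ ≤⟨ +≤ʳ (size c * N * ℓ) (mean-X c ω) ⟩
      _ ≡⟨ ring55 (size c) G τ' ℓ (r c) ⟩
      _ ∎
      where
      xs = ws ++ coinsOf v c

     Π : Asg -> ℕ
     Π ω = ∏ cols λ c -> f c ω

     all : List Var
     all = ws ++ allCoins

     mean-Π : ∀ ω -> E₀ all Π ω * ℓ ^ length cols ≤ k ^ length all * (τ' ^ length cols * ∏ cols (λ c -> G * ℓ + r c))
     mean-Π ω = *-cancel {c = KW ^ n} (1≤^ n (1≤^ (length ws) (s≤s z≤n))) (begin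
       _ ≡⟨ cong (λ e -> e * ℓ ^ n * KW ^ n) joint ⟩
       _ ≡⟨ xy∙z≈xz∙y (E₀ ws (λ ω -> ∏ cols λ c -> F c (hits c ω)) ω) (ℓ ^ n) (KW ^ n) ⟩
       _ ≤⟨ *≤ˡ (ℓ ^ n) (negative Hit Hit-one F F-antitone ws ws-unique cols (allFin⁺ q) (λ _ _ -> ⊥) ω) ⟩
       _ ≡⟨ cong (λ p -> KW * p * ℓ ^ n) (∏-cong∈ cols λ c _ -> E-cong none ws (λ ω -> sym (F-is c ω)) ω ∙ sym (E-++ none ws (coinsOf v c) (f c) ω)) ⟩
       _ ≡⟨ *-assoc KW _ (ℓ ^ n) ∙ cong (λ l -> KW * (∏ cols (λ c -> E₀ (ws ++ coinsOf v c) (f c) ω) * l)) (sym (∏-const cols ℓ)) ⟩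
       _ ≡⟨ cong (KW *_) (sym (∏-* cols _ _)) ⟩
       _ ≤⟨ *≤ʳ KW (∏-mono∈ cols λ c _ -> mean-f c ω) ⟩
       _ ≡⟨ cong (KW *_) (∏-* cols size _ ∙ cong₂ _*_ sizes (∏-* cols (λ _ -> τ') _ ∙ cong (_* ∏ cols (λ c -> G * ℓ + r c)) (∏-const cols τ'))) ⟩
       _ ≡⟨ ring56 KW (KW ^ n) (k ^ length allCoins) _ ⟩
       _ ≡⟨ cong (λ p -> p * (τ' ^ n * ∏ cols (λ c -> G * ℓ + r c)) * KW ^ n) (pow-++ k ws _) ⟩
       _ ∎)
      where
      n = length cols
      KW = k ^ length ws
      sizes : ∏ cols size ≡ KW ^ n * k ^ length allCoins
      sizes = (∏-cong∈ cols λ c _ -> sym (pow-++ k ws _))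
       ∙ ∏-* cols (λ _ -> KW) _ ∙ cong₂ _*_ (∏-const cols KW) (pow-concatMap k (coinsOf v) cols)
      pairs : AllPairs (λ c c' -> (∀ z -> z ∈ coinsOf v c' -> ¬ (snd z ≡ fzero ⊎ snd z ≡ fsuc c)) × (∀ z -> z ∈ coinsOf v c -> ¬ (snd z ≡ fzero ⊎ snd z ≡ fsuc c'))) cols
      pairs = pairs∈ cols (allFin⁺ q) λ c c' _ _ ne -> (λ { z m (inj₁ e) -> case trans (sym (coin-index m)) e of λ () ; z m (inj₂ e) -> case trans (sym (coin-index m)) e of λ { refl -> ne refl } }) ,
       (λ { z m (inj₁ e) -> case trans (sym (coin-index m)) e of λ () ; z m (inj₂ e) -> case trans (sym (coin-index m)) e of λ { refl -> ne refl } })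
      joint : E₀ all Π ω ≡ E₀ ws (λ ω -> ∏ cols λ c -> F c (hits c ω)) ω
      joint = E-++ none ws allCoins Π ω ∙ (E-cong none ws (λ ω -> E-∏ (coinsOf v) (λ c z -> snd z ≡ fzero ⊎ snd z ≡ fsuc c) f f-dep cols pairs ω ∙ (∏-cong∈ cols λ c _ -> F-is c ω)) ω)

     weights-tail : ∀ ω -> E₀ all (λ ω -> ⟦ dv ν₃ * τ' ≤ ∑ cols (λ c -> Xw ω c v) ⟧) ω * 2 ^ h ≤ k ^ length all
     weights-tail ω = exp-tail all cols (λ c ω -> Xw ω c v) r g ν₃ h τ' ℓ 0<τ' (1≤* {k + a} (s≤s z≤n) 0<τR) (λ c ω -> Xw≤ ω c v) mean ω (mean-Π ω)
      where
      mean : ∑ cols r ≤ G * ν₃ * ℓ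
      mean = begin
       _ ≡⟨ ∑-*ˡ cols k _ ⟩
       _ ≤⟨ *≤ʳ k mean≤ ⟩
       _ ≡⟨ x∙yz≈yx∙z k D τR ⟩
       _ ≤⟨ *≤ˡ τR (ceil-≥ (D * k) (k' + a + suc g * (k + a))) ⟩
       _ ≡⟨ ring60 (k + a) g ν₃ τR ⟩
       _ ∎

    C4-free : Set
    C4-free = ∀ v u u' w -> u ≢ u' -> v ~ u -> v ~ u' -> w ~ u -> w ~ u' -> w ≡ v

    Useful : Asg -> X -> X -> Set
    Useful ω w v = ∃[ c ] pick ω w ≡ just c × Live c v

    hitc : Asg -> X -> ℕ
    hitc ω v = ∑ (nbrs v) λ w -> ⟦ Act w × Useful ω w v ⟧

    ν₁ ν₂ ν₄ h₀ : ℕ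
    ν₁ = ceil (ℓ̂ * a) (k' + suc g * k)
    h₀ = dv ν₁
    ν₂ = ceil (τR * k) (k' + a + suc g * (k + a))
    ν₄ = ceil (dA * h₀) (k' + suc g * k)

    -- Hits are read from ω₀ and the pick of u from ω: the surroundings of u can be fixed while u
    -- still picks at random. With fewer than `h₀` useful hits around u, it then clashes with
    -- probability at most h₀/k.
    Clash : Asg -> Asg -> X -> Set
    Clash ω₀ ω u = Act u × (∃[ c ] pick ω u ≡ just c × (∃[ w ] u ~ w × hit ω₀ c w)) × hitc ω₀ u < h₀

    coins : Asg -> X -> ℕ
    coins ω v = ∑ cols λ c -> ⟦ L c v × coin ω c v ⟧

    Bad : Event q -> X -> Asg -> Set
    Bad overhit v ω = Y v × h₀ ≤ hitc ω v + coins ω v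
    Bad overweight v ω = (R v × ∑ cols (λ c -> ⟦ L c v ⟧ * wt c v) ≤ D * τR) × dv ν₃ * τ' ≤ ∑ cols (λ c -> Xw ω c v)
    Bad overclash v ω = dv ν₄ ≤ ∑ (nbrs v) (λ u -> ⟦ Clash ω ω u ⟧)
    Bad (overcrowded c) v ω = (C4-free × R v × tR c v ≤ τR) × dv ν₂ ≤ t′ c v (hit ω c) ω

    near₀ : ∀ {v} -> near ρ v v
    near₀ {v} = near-refl ρ v

    near₁ : ∀ {v u} -> v ~ u -> near ρ v u
    near₁ e = near-mono (n≤1+n 1 » 2≤ρ) (nbrs-near (∈nbrs e))

    near₂ : ∀ {v u w} -> v ~ u -> u ~ w -> near ρ v w
    near₂ e e' = near-mono 2≤ρ (near-trans (nbrs-near (∈nbrs e)) (nbrs-near (∈nbrs e')))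

    hitc-cong : ∀ v ω ω' -> (∀ w -> v ~ w -> Act w -> ω (w , fzero) ≡ ω' (w , fzero)) -> hitc ω v ≡ hitc ω' v
    hitc-cong v ω ω' h = ∑-cong∈ (nbrs v) λ w m -> ⟦⟧-cong
     (λ (act , c , e , l) -> act , c , cong (pickc w) (sym (h w (nbrs∈ m) act)) ∙ e , l)
     (λ (act , c , e , l) -> act , c , cong (pickc w) (h w (nbrs∈ m) act) ∙ e , l)

    Clash-cong : ∀ u ω ω' ω₁ ω₁' -> ω₁ (u , fzero) ≡ ω₁' (u , fzero) -> (∀ w -> u ~ w -> Act w -> ω (w , fzero) ≡ ω' (w , fzero)) -> Clash ω ω₁ u -> Clash ω' ω₁' u
    Clash-cong u ω ω' ω₁ ω₁' e h (act , (c , p , w , uw , ht) , lt) = act , (c , cong (pickc u) (sym e) ∙ p , w , uw , hit-cong ω ω' c w (h w uw (fst ht)) ht) ,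
     subst (_< h₀) (hitc-cong u ω ω' h) lt

    t′-cong : ∀ c v ω ω' -> (∀ u -> v ~ u -> ω (u , fsuc c) ≡ ω' (u , fsuc c)) -> (∀ u w -> v ~ u -> u ~ w -> ω (w , fzero) ≡ ω' (w , fzero)) -> t′ c v (hit ω c) ω ≡ t′ c v (hit ω' c) ω'
    t′-cong c v ω ω' e h = ∑-cong∈ (nbrs v) λ u m -> ⟦⟧-cong
     (λ (rl , s) -> rl , surv-cong c u ω ω' (e u (nbrs∈ m)) (λ w uw _ -> h u w (nbrs∈ m) uw) s)
     (λ (rl , s) -> rl , surv-cong c u ω' ω (sym (e u (nbrs∈ m))) (λ w uw _ -> sym (h u w (nbrs∈ m) uw)) s)

    hit-colours : ∀ ω u -> ∑ cols (λ c -> ⟦ Live c u × (∃[ w ] u ~ w × hit ω c w) ⟧) ≤ hitc ω u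
    hit-colours ω u = begin
     _ ≤⟨ ∑-mono cols (λ c -> (⟦⟧-mono λ (l , w , uw , act , p) -> w , ∈nbrs uw , act , p , l) » (⟦∃⟧≤∑ (nbrs u) λ w -> Act w × pick ω w ≡ just c × Live c u)) ⟩
     _ ≡⟨ ∑-swap cols (nbrs u) _ ⟩
     _ ≤⟨ ∑-mono (nbrs u) (λ w -> ∑-unique≤ cols (λ c -> Act w × pick ω w ≡ just c × Live c u) (allFin⁺ q) (λ (_ , e , _) (_ , e' , _) -> same e e') » (⟦⟧-mono λ (c , act , e , l) -> act , c , e , l)) ⟩
     _ ∎
     where
     same : ∀ {m : Maybe (Fin q)} {c c'} -> m ≡ just c -> m ≡ just c' -> c ≡ c'
     same refl refl = refl

    open Events (suc q) k ρ (s≤s z≤n) h Bad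

    loc : Local
    loc overhit v ω ω' h (y , le) = y , le » (from≡ (cong₂ _+_ (hitc-cong v ω ω' λ w e _ -> h w fzero (near₁ e))
     (∑-cong cols λ c -> cong (λ i -> ⟦ L c v × toℕ i < θ c v ⟧) (h v (fsuc c) near₀))))
    loc overweight v ω ω' h (gd , le) = gd , le » (from≡ (∑-cong cols λ c -> Xw-cong ω ω' c v
     (λ { z (here refl) -> h v (fsuc c) near₀ ; z (there m) -> case ∈-map⁻ (_, fsuc c) m of λ { (u , m' , refl) -> h u (fsuc c) (near₁ (nbrs∈ m')) } })
     (λ { x u (here refl) xu _ -> h u fzero (near₁ xu) ; x u (there m) xu _ -> h u fzero (near₂ (nbrs∈ m) xu) })))
    loc overclash v ω ω' h le = le » (from≡ (∑-cong∈ (nbrs v) λ u m -> ⟦⟧-cong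
     (Clash-cong u ω ω' ω ω' (h u fzero (near₁ (nbrs∈ m))) (λ w uw _ -> h w fzero (near₂ (nbrs∈ m) uw)))
     (Clash-cong u ω' ω ω' ω (sym (h u fzero (near₁ (nbrs∈ m)))) (λ w uw _ -> sym (h w fzero (near₂ (nbrs∈ m) uw))))))
    loc (overcrowded c) v ω ω' h (gd , le) = gd , le » from≡ (t′-cong c v ω ω' (λ u e -> h u (fsuc c) (near₁ e)) (λ u w e e' -> h w fzero (near₂ e e')))

    meas-tR : ∀ c -> Meas (tR c)
    meas-tR c = meas-nbrs pt-id λ mh -> meas-⟦⟧ (mh (b-× b-R (bL c)))

    meas-wt : ∀ c -> Meas (wt c)
    meas-wt c = meas-map₂ enum-ℕ enum-ℕ (meas-map enum-ℕ (meas-⟦⟧ (bD c)) (_* τR)) (meas-map₂ enum-ℕ enum-ℕ (meas-⟦⟧ (b-¬ (bD c))) (meas-tR c) _*_) _+_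

    meas-t′ : ∀ c {Ω} -> Plot Ω -> Meas (λ x -> t′ c x (hit (Ω x) c) (Ω x))
    meas-t′ c {Ω} pΩ = meas-nbrs pt-id λ mh -> meas-⟦⟧ (b-× (mh (b-× b-R (bL c))) (b-surv {Ω} c pΩ mh))

    meas-Xw : ∀ c {Ω} -> Plot Ω -> Meas (λ x -> Xw (Ω x) c x)
    meas-Xw c {Ω} pΩ = meas-map₂ enum-ℕ enum-ℕ (meas-⟦⟧ (b-× (bL c) (b-surv {Ω} c pΩ pt-id)))
     (meas-map₂ enum-ℕ enum-ℕ (meas-map enum-ℕ (meas-⟦⟧ (bD c)) (_* τ')) (meas-map₂ enum-ℕ enum-ℕ (meas-⟦⟧ (b-¬ (bD c))) (meas-t′ c {Ω} pΩ) λ x t -> x * (τ' ⊓ t)) _+_) _*_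

    meas-hitc : ∀ {Ω h} -> Plot Ω -> Pt h -> Meas (λ x -> hitc (Ω x) (h x))
    meas-hitc {Ω} pΩ mh = meas-nbrs mh λ mw -> meas-⟦⟧ (b-× (mw b-Act) (b-∃ (enum-Fin q) λ c -> b-× (b-pick {Ω} c pΩ mw) (mh (b-Live c))))

    b-Clash : ∀ {Ω h} -> Plot Ω -> Pt h -> Borel (λ x -> Clash (Ω x) (Ω x) (h x))
    b-Clash {Ω} pΩ mh = b-× (mh b-Act) (b-× (b-∃ (enum-Fin q) λ c -> b-× (b-pick {Ω} c pΩ mh) (b-∃~ mh λ mw -> b-hit {Ω} c pΩ mw))
     (b-≤ (meas-map enum-ℕ (meas-hitc {Ω} pΩ mh) suc) (meas-const h₀)))

    meas : Measurable
    meas overhit {Ω} pΩ = b-× bY (b-≤ (meas-const h₀) (meas-map₂ enum-ℕ enum-ℕ (meas-hitc {Ω} pΩ pt-id) (meas-∑ cols λ c _ -> meas-⟦⟧ (b-× (bL c) (b-coin {Ω} c pΩ pt-id))) _+_))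
    meas overweight {Ω} pΩ = b-× (b-× b-R (b-≤ (meas-∑ cols λ c _ -> meas-map₂ enum-ℕ enum-ℕ (meas-⟦⟧ (bL c)) (meas-wt c) _*_) (meas-const (D * τR))))
     (b-≤ (meas-const (dv ν₃ * τ')) (meas-∑ cols λ c _ -> meas-Xw c {Ω} pΩ))
    meas overclash {Ω} pΩ = b-≤ (meas-const (dv ν₄)) (meas-nbrs pt-id λ mh -> meas-⟦⟧ (b-Clash {Ω} pΩ mh))
    meas (overcrowded c) {Ω} pΩ = b-× (b-× (b-const C4-free) (b-× b-R (b-≤ (meas-tR c) (meas-const τR)))) (b-≤ (meas-const (dv ν₂)) (meas-t′ c {Ω} pΩ))

    J : List (Event q)
    J = overhit ∷ overweight ∷ overclash ∷ map overcrowded cols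

    ∈J : ∀ j -> j ∈ J
    ∈J overhit = here refl
    ∈J overweight = there (here refl)
    ∈J overclash = there (there (here refl))
    ∈J (overcrowded c) = there (there (there (∈-map⁺ overcrowded (∈-allFin c))))

    J-length : length J ≡ 3 + q
    J-length = cong (3 +_) (length-map overcrowded cols ∙ length-allFin q)

    picks≤ : ∀ u (Q : Fin q -> Set) -> ∑ vals (λ i -> ⟦ (∃[ c ] pickc u i ≡ just c × Q c) ⟧) ≤ ∑ cols (λ c -> ⟦ Pl c u × Q c ⟧)
    picks≤ u Q = begin
     _ ≤⟨ ∑-mono vals (λ i -> (⟦⟧-mono λ (c , e) -> c , ∈-allFin c , e) » (⟦∃⟧≤∑ cols λ c -> pickc u i ≡ just c × Q c)) ⟩
     _ ≡⟨ ∑-swap vals cols _ ⟩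
     _ ≤⟨ ∑-mono cols (λ c -> ∑-unique≤ vals (λ i -> pickc u i ≡ just c × Q c) (allFin⁺ k) (λ (e , _) (e' , _) -> pick-inj {u} e e') » (⟦⟧-mono λ (i , e , t) -> (i , e) , t)) ⟩
     _ ∎

    budget' : (3 + q) * cost ρ k ≤ 2 ^ h -> length J * cost ρ k ≤ 2 ^ h
    budget' = subst (λ l -> l * cost ρ k ≤ 2 ^ h) (sym J-length)

    module WithBudget (budget : (3 + q) * cost ρ k ≤ 2 ^ h) where

     module SmallHits (v : X) (y : Y v) where
      I : Set
      I = X ⊎ Fin q
      bl : I -> List Var
      bl (inj₁ u) = (u , fzero) ∷ []
      bl (inj₂ c) = (v , fsuc c) ∷ []
      f : I -> Asg -> ℕ
      f (inj₁ u) ω = ⟦ Act u × Useful ω u v ⟧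
      f (inj₂ c) ω = ⟦ L c v × coin ω c v ⟧
      dep : ∀ i -> DependsOn (_∈ bl i) (f i)
      dep (inj₁ u) ω ω' h = ⟦⟧-cong (λ (act , c , e , l) -> act , c , cong (pickc u) (sym (h _ (here refl))) ∙ e , l) (λ (act , c , e , l) -> act , c , cong (pickc u) (h _ (here refl)) ∙ e , l)
      dep (inj₂ c) ω ω' h = cong (λ i -> ⟦ L c v × toℕ i < θ c v ⟧) (h _ (here refl))
      f≤1 : ∀ i ω -> f i ω ≤ 1
      f≤1 (inj₁ u) ω = ⟦⟧≤1 _
      f≤1 (inj₂ c) ω = ⟦⟧≤1 _
      r : I -> ℕ
      r (inj₁ u) = ⟦ Act u ⟧ * ∑ cols (λ c -> ⟦ Pl c u × Live c v ⟧)
      r (inj₂ c) = ⟦ L c v ⟧ * θ c v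
      guarded : ∀ {I : Set} (is : List I) (A : Set) (Q Q' : I -> Set) n -> (∀ i -> Q i -> Q' i) -> (A -> ∑ is (λ i -> ⟦ Q' i ⟧) ≤ n) -> ∑ is (λ i -> ⟦ A × Q i ⟧) ≤ ⟦ A ⟧ * n
      guarded is A Q Q' n f le = cases A
       (λ a -> (∑-mono is λ i -> ⟦⟧-mono (f i ∘ snd)) » le a » from≡ (sym (yes* a)))
       (λ na -> from≡ (∑-zero is λ i _ -> ⟦⟧-no (na ∘ fst)) » z≤n)
      small : ∀ i ω -> E₀ (bl i) (f i) ω * k ≤ k ^ length (bl i) * r i
      small (inj₁ u) ω = (*≤ˡ k ((guarded vals (Act u) (λ i -> Useful (upd (u , fzero) i ω) u v) (λ i -> ∃[ c ] pickc u i ≡ just c × Live c v) _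
       (λ i (c , e , l) -> c , cong (pickc u) (sym (upd-same (u , fzero) i ω)) ∙ e , l) (λ _ -> picks≤ u λ c -> Live c v)) » ≤-refl)) » from≡ (ring32 (r (inj₁ u)) k)
      small (inj₂ c) ω = (*≤ˡ k (guarded vals (L c v) (λ i -> coin (upd (v , fsuc c) i ω) c v) (λ i -> toℕ i < θ c v) (θ c v)
       (λ i -> subst (λ j -> toℕ j < θ c v) (upd-same (v , fsuc c) i ω)) (λ _ -> ∑-below k (θ c v)))) » from≡ (ring32 (r (inj₂ c)) k)
      open Products.Chernoff {Var} k bl (λ i -> _∈ bl i) f dep f≤1 r k (s≤s z≤n) small
      items : List I
      items = map inj₁ (nbrs v) ++ map inj₂ cols
      items-unique : Unique items
      items-unique = Uniq.++⁺ (Uniq.map⁺ (λ { refl -> refl }) (nbrs-unique v)) (Uniq.map⁺ (λ { refl -> refl }) (allFin⁺ q))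
       λ (m , m') -> case ∈-map⁻ inj₁ m of λ { (_ , _ , refl) -> case ∈-map⁻ inj₂ m' of λ { (_ , _ , ()) } }
      apart : ∀ i j -> i ≢ j -> ∀ z -> z ∈ bl j -> z ∉ bl i
      apart (inj₁ u) (inj₁ u') ne z (here refl) (here e) = ne (cong inj₁ (sym (cong fst e)))
      apart (inj₁ u) (inj₂ c) ne z (here refl) (here ())
      apart (inj₂ c) (inj₁ u) ne z (here refl) (here ())
      apart (inj₂ c) (inj₂ c') ne z (here refl) (here refl) = ne refl
      -- For each colour on the list, competitors and coin add up to a, and for a dead colour the
      -- coin alone does; so the mean is at most ℓ̂ a / k.
      mean : ∑ items r ≤ G * ν₁ * k
      mean = begin
       _ ≡⟨ ∑-++ (map inj₁ (nbrs v)) (map inj₂ cols) r ∙ cong₂ _+_ (∑-map inj₁ (nbrs v) r) (∑-map inj₂ cols r) ⟩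
       _ ≡⟨ cong (_+ ∑ cols (λ c -> ⟦ L c v ⟧ * θ c v))
        ((∑-cong (nbrs v) λ u -> sym (∑-*ˡ cols ⟦ Act u ⟧ _)) ∙ ∑-swap (nbrs v) cols _) ⟩
       _ ≡⟨ sym (∑-+ cols _ _) ⟩
       _ ≤⟨ ∑-mono cols each ⟩
       _ ≡⟨ ∑-*ʳ cols _ a ∙ cong (_* a) (list-size v y) ⟩
       _ ≤⟨ ceil-≥ (ℓ̂ * a) (k' + suc g * k) ⟩
       _ ≡⟨ ring61 k g ν₁ ⟩
       _ ∎
       where
       both : ∀ (A C D : Set) -> ⟦ A ⟧ * ⟦ C × D ⟧ ≤ ⟦ D ⟧ * ⟦ A × C ⟧
       both A C D = cases (A × C × D) (λ (a , c , d) -> from≡ (cong₂ _*_ (⟦⟧-yes a) (⟦⟧-yes (c , d)) ∙ sym (cong₂ _*_ (⟦⟧-yes d) (⟦⟧-yes (a , c)))))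
        (λ n -> from≡ (cases A (λ a -> cong (⟦ A ⟧ *_) (⟦⟧-no λ t -> n (a , t)) ∙ *-zeroʳ ⟦ A ⟧) (λ na -> no* na)) » z≤n)
       dead : ∀ c -> ¬ Live c v -> ⟦ L c v ⟧ * θ c v ≤ ⟦ L c v ⟧ * a
       dead c nl = *≤ʳ ⟦ L c v ⟧ (from≡ (θ-dead c v nl))
       each : ∀ c -> ∑ (nbrs v) (λ u -> ⟦ Act u ⟧ * ⟦ Pl c u × Live c v ⟧) + ⟦ L c v ⟧ * θ c v ≤ ⟦ L c v ⟧ * a
       each c = cases (Live c v)
        (λ l -> begin
         _ ≤⟨ +≤ˡ (⟦ L c v ⟧ * θ c v) (∑-mono (nbrs v) λ u -> both (Act u) (Pl c u) (Live c v)) ⟩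
         _ ≡⟨ cong₂ _+_ (∑-*ˡ (nbrs v) ⟦ Live c v ⟧ _ ∙ cong (_* ta c v) (⟦⟧-yes l ∙ sym (⟦⟧-yes (fst l))))
          (cong (⟦ L c v ⟧ *_) (θ-live c v l)) ⟩
         _ ≡⟨ sym (*-distribˡ-+ ⟦ L c v ⟧ (ta c v) (a ∸ ta c v)) ⟩
         _ ≡⟨ cong (⟦ L c v ⟧ *_) (m+[n∸m]≡n (ta≤a c v y l)) ⟩
         _ ∎)
        (λ nl -> +≤ˡ (⟦ L c v ⟧ * θ c v) (from≡ (∑-zero (nbrs v) λ u _ -> cong (⟦ Act u ⟧ *_) (⟦⟧-no (nl ∘ snd)) ∙ *-zeroʳ ⟦ Act u ⟧)) » dead c nl)
      inside : ∀ {z} -> z ∈ blocks items -> z ∈ blockOf v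
      inside m = case concatMap-∈ bl items m of λ { (inj₁ u , u∈ , here refl) -> ∈block fzero (near₁ (nbrs∈ (from u∈))) ; (inj₂ c , _ , here refl) -> ∈block (fsuc c) near₀ }
       where
       from : ∀ {u} -> inj₁ u ∈ items -> u ∈ nbrs v
       from m = case ∈-++⁻ (map inj₁ (nbrs v)) m of λ { (inj₁ m) -> case ∈-map⁻ inj₁ m of λ { (_ , m' , refl) -> m' } ; (inj₂ m) -> case ∈-map⁻ inj₂ m of λ { (_ , _ , ()) } }
      result : Rare overhit v (blockOf v)
      result = on-block loc overhit v (blocks items) inside λ ω -> *≤ˡ (2 ^ h) (E-mono none (blocks items) (λ ω -> ⟦⟧-mono λ (_ , le) -> le » from≡ (sym (split ω))) ω)
        » tail g ν₁ h items (pairs∈ items items-unique λ i j _ _ ne -> apart i j ne , apart j i (ne ∘ sym)) mean ω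
       where
       split : ∀ ω -> ∑ items (λ i -> f i ω) ≡ hitc ω v + coins ω v
       split ω = ∑-++ (map inj₁ (nbrs v)) (map inj₂ cols) (λ i -> f i ω) ∙ cong₂ _+_ (∑-map inj₁ (nbrs v) (λ i -> f i ω)) (∑-map inj₂ cols (λ i -> f i ω))

     module SmallClashes (v : X) where
      bl : X -> List Var
      bl u = (u , fzero) ∷ []
      us : List X
      us = nbrs v
      b : List Var
      b = concatMap bl us
      b∋ : ∀ {z} -> z ∈ b -> ∃[ u ] v ~ u × z ≡ (u , fzero)
      b∋ m = case concatMap-∈ bl us m of λ { (u , u∈ , here refl) -> u , nbrs∈ u∈ , refl }
      -- Without triangles, the picks around a neighbour u of v are not picks of neighbours of v.
      tail-at : Rare overclash v b
      tail-at ω = (from≡ (cong (_* 2 ^ h) (E-cong-off b ω λ ω' off -> cong (λ s -> ⟦ dv ν₄ ≤ s ⟧) (∑-cong∈ us λ u m -> ⟦⟧-cong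
        (Clash-cong u ω' ω ω' ω' refl (λ w uw _ -> off (w , fzero) (outside (nbrs∈ m) uw)))
        (Clash-cong u ω ω' ω' ω' refl (λ w uw _ -> sym (off (w , fzero) (outside (nbrs∈ m) uw))))))))
        » tail g ν₄ h us (pairs∈ us (nbrs-unique v) λ i j _ _ ne -> (λ { z (here refl) (here e) -> ne (sym (cong fst e)) }) , (λ { z (here refl) (here e) -> ne (cong fst e) })) mean ω
       where
       outside : ∀ {u w} -> v ~ u -> u ~ w -> (w , fzero) ∉ b
       outside vu uw m = case b∋ m of λ { (_ , vw , refl) -> triangle-free vu uw (~-sym vw) }
       f : X -> Asg -> ℕ
       f u ω' = ⟦ Clash ω ω' u ⟧
       dep : ∀ u -> DependsOn (_∈ bl u) (f u)
       dep u ω' ω'' e = ⟦⟧-cong (Clash-cong u ω ω ω' ω'' (e _ (here refl)) (λ _ _ _ -> refl)) (Clash-cong u ω ω ω'' ω' (sym (e _ (here refl))) (λ _ _ _ -> refl))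
       r : X -> ℕ
       r u = ⟦ Act u ⟧ * h₀
       small : ∀ u ω' -> E₀ (bl u) (f u) ω' * k ≤ k ^ length (bl u) * r u
       small u ω' = *≤ˡ k picked » from≡ (ring32 (r u) k)
        where
        picked : ∑ vals (λ i -> ⟦ Clash ω (upd (u , fzero) i ω') u ⟧) ≤ r u
        picked = cases (Act u × hitc ω u < h₀)
         (λ (act , lt) -> (∑-mono vals λ i -> ⟦⟧-mono λ (_ , (c , p , t) , _) -> c , cong (pickc u) (sym (upd-same (u , fzero) i ω')) ∙ p , t)
          » (picks≤ u λ c -> ∃[ w ] u ~ w × hit ω c w) » ((∑-mono cols λ c -> ⟦⟧-mono λ ((i , e) , t) -> pick-live {u} {i} e , t) » hit-colours ω u) » <⇒≤ lt » from≡ (sym (yes* act)))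
         (λ n -> from≡ (∑-zero vals λ i _ -> ⟦⟧-no λ (act , _ , lt) -> n (act , lt)) » z≤n)
       open Products.Chernoff {Var} k bl (λ u -> _∈ bl u) f dep (λ _ _ -> ⟦⟧≤1 _) r k (s≤s z≤n) small
       act≤ : ∑ us (λ u -> ⟦ Act u ⟧) ≤ dA
       act≤ = act-degree v
       mean : ∑ us r ≤ G * ν₄ * k
       mean = from≡ (∑-*ʳ us _ h₀) » *≤ˡ h₀ act≤ » ceil-≥ (dA * h₀) (k' + suc g * k) » from≡ (ring61 k g ν₄)
      result : Rare overclash v (blockOf v)
      result = on-block loc overclash v b (λ m -> case b∋ m of λ { (u , vu , refl) -> ∈block fzero (near₁ vu) }) tail-at

     module SmallDegree (c : Fin q) (v : X) (free : C4-free) (rv : R v) (small-crowding : tR c v ≤ τR) where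
      us : List X
      us = nbrs v
      f : X -> Asg -> ℕ
      f u ω = ⟦ (R u × L c u) × surv ω c u ⟧
      dep : ∀ u -> DependsOn (_∈ blk c u) (f u)
      dep u ω ω' e = cases (surv ω c u)
       (λ s -> ⟦⟧-cong (λ (rl , _) -> rl , there' s) (λ (rl , _) -> rl , s))
       (λ n -> ⟦⟧-no (n ∘ snd) ∙ sym (⟦⟧-no λ (_ , s) -> n (⟦⟧-holds (from≡ (sym (⟦⟧-yes s)) » from≡ (sym (surv-dep c u ω ω' e))))))
       where
       there' : surv ω c u -> surv ω' c u
       there' s = ⟦⟧-holds (from≡ (sym (⟦⟧-yes s)) » from≡ (surv-dep c u ω ω' e))
      r : X -> ℕ
      r u = ⟦ R u × L c u ⟧ * k
      small : ∀ u ω -> E₀ (blk c u) (f u) ω * (k + a) ≤ k ^ length (blk c u) * r u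
      small u ω = cases (R u × L c u)
       (λ rl -> *≤ˡ (k + a) (E-mono none (blk c u) (λ ω -> ⟦⟧-mono snd) ω) » (surv-chance c u ω (fst (fst rl)) (snd rl)
        » from≡ (cong (k ^ length (blk c u) *_) (sym (yes* rl)))))
       (λ n -> *≤ˡ (k + a) (from≡ (E-null none (blk c u) (λ ω -> ⟦⟧-no (n ∘ fst)) ω)) » z≤n)
      open Products.Chernoff {Var} k (blk c) (λ u -> _∈ blk c u) f dep (λ _ _ -> ⟦⟧≤1 _) r (k + a) (s≤s z≤n) small
      -- Without 4-cycles a common neighbour of u and u' is v itself, and v has not been activated.
      apart : ∀ u u' -> u ∈ us -> u' ∈ us -> u ≢ u' -> ∀ z -> z ∈ blk c u' -> z ∉ blk c u
      apart u u' u∈ u'∈ ne z (here refl) (here e) = ne (sym (cong fst e))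
      apart u u' u∈ u'∈ ne z (here refl) (there m) = case ∈-map⁻ (_, fzero) m of λ { (_ , _ , ()) }
      apart u u' u∈ u'∈ ne z (there m) (here refl) = case ∈-map⁻ (_, fzero) m of λ { (_ , _ , ()) }
      apart u u' u∈ u'∈ ne z (there m) (there m') = case ∈-map⁻ (_, fzero) m of λ { (w , w∈ , refl) -> case ∈-map⁻ (_, fzero) m' of λ { (_ , w∈' , refl) ->
       let (wu , act) = sel⊆ (nbrs u) w∈' ; (wu' , _) = sel⊆ (nbrs u') w∈
       in snd rv (subst On (free _ _ _ _ ne (nbrs∈ u∈) (nbrs∈ u'∈) (~-sym (nbrs∈ wu)) (~-sym (nbrs∈ wu'))) (snd act)) } }
      mean : ∑ us r ≤ G * ν₂ * (k + a)
      mean = from≡ (∑-*ʳ us _ k) » *≤ˡ k small-crowding » ceil-≥ (τR * k) (k' + a + suc g * (k + a)) » from≡ (ring61 (k + a) g ν₂)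
      inside : ∀ {z} -> z ∈ blocks us -> z ∈ blockOf v
      inside m = case concatMap-∈ (blk c) us m of λ { (u , u∈ , here refl) -> ∈block (fsuc c) (near₁ (nbrs∈ u∈)) ; (u , u∈ , there m') ->
       case ∈-map⁻ (_, fzero) m' of λ { (w , w∈ , refl) -> ∈block fzero (near₂ (nbrs∈ u∈) (nbrs∈ (fst (sel⊆ (nbrs u) w∈)))) } }
      result : Rare (overcrowded c) v (blockOf v)
      result = on-block loc (overcrowded c) v (blocks us) inside λ ω -> *≤ˡ (2 ^ h) (E-mono none (blocks us) (λ ω -> ⟦⟧-mono snd) ω)
        » tail g ν₂ h us (pairs∈ us (nbrs-unique v) λ i j i∈ j∈ ne -> apart i j i∈ j∈ ne , apart j i j∈ i∈ (ne ∘ sym)) mean ω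

     small-weights : ∀ v -> R v -> ∑ cols (λ c -> ⟦ L c v ⟧ * wt c v) ≤ D * τR -> Rare overweight v (blockOf v)
     small-weights v rv mean≤ = on-block loc overweight v all inside λ ω -> *≤ˡ (2 ^ h) (E-mono none all (λ ω -> ⟦⟧-mono snd) ω) » weights-tail ω
      where
      open At v rv mean≤
      inside : ∀ {z} -> z ∈ all -> z ∈ blockOf v
      inside m = case ∈-++⁻ ws m of λ
       { (inj₁ m) -> case ∈-map⁻ (_, fzero) m of λ { (u , m' , refl) -> ∈block fzero (close (∈-++⁻ (nbrs v) (dedup⊆ (nbrs v ++ concatMap nbrs (nbrs v)) (fst (sel⊆ (dedup (nbrs v ++ concatMap nbrs (nbrs v))) m'))))) }
       ; (inj₂ m) -> case concatMap-∈ (coinsOf v) cols m of λ { (c , _ , here refl) -> ∈block (fsuc c) near₀ ; (c , _ , there m') ->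
         case ∈-map⁻ (_, fsuc c) m' of λ { (u , u∈ , refl) -> ∈block (fsuc c) (near₁ (nbrs∈ u∈)) } } }
       where
       close : ∀ {u} -> u ∈ nbrs v ⊎ u ∈ concatMap nbrs (nbrs v) -> near ρ v u
       close (inj₁ m) = near₁ (nbrs∈ m)
       close (inj₂ m) = case concatMap-∈ nbrs (nbrs v) m of λ { (w , w∈ , u∈) -> near₂ (nbrs∈ w∈) (nbrs∈ u∈) }

     small : ∀ j v -> Rare j v (blockOf v)
     small overhit v = cases (Y v) (SmallHits.result v) (λ n -> never overhit v λ ω -> n ∘ fst)
     small overweight v = cases (R v × ∑ cols (λ c -> ⟦ L c v ⟧ * wt c v) ≤ D * τR) (λ (rv , le) -> small-weights v rv le) (λ n -> never overweight v λ ω -> n ∘ fst)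
     small overclash v = SmallClashes.result v
     small (overcrowded c) v = cases (C4-free × R v × tR c v ≤ τR) (λ (free , rv , le) -> SmallDegree.result c v free rv le) (λ n -> never (overcrowded c) v λ ω -> n ∘ fst)

     record Outcome : Set₁ where
      field
       ω : Asg
       ω-meas : ∀ i -> Meas (λ x -> ω (x , i))
       few-hits : ∀ v -> Y v -> hitc ω v + coins ω v < h₀
       light : ∀ v -> R v -> ∑ cols (λ c -> ⟦ L c v ⟧ * wt c v) ≤ D * τR -> ∑ cols (λ c -> Xw ω c v) < dv ν₃ * τ'
       few-clashes : ∀ v -> ∑ (nbrs v) (λ u -> ⟦ Clash ω ω u ⟧) < dv ν₄
       sparse : C4-free -> ∀ c v -> R v -> tR c v ≤ τR -> t′ c v (hit ω c) ω < dv ν₂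

     abstract
      outcome : Outcome
      outcome = let (ω , m , ok) = solve J (budget' budget) loc meas small in record
       { ω = ω ; ω-meas = m
       ; few-hits = λ v y -> ≰⇒> λ le -> ok v overhit (∈J overhit) (y , le)
       ; light = λ v rv mean -> ≰⇒> λ le -> ok v overweight (∈J overweight) ((rv , mean) , le)
       ; few-clashes = λ v -> ≰⇒> λ le -> ok v overclash (∈J overclash) le
       ; sparse = λ free c v rv le -> ≰⇒> λ le' -> ok v (overcrowded c) (∈J (overcrowded c)) ((free , rv , le) , le') }

   -- One round of the nibble.

   module Nibble (triangle-free : ∀ {x y z} -> x ~ y -> y ~ z -> z ~ x -> ⊥) (q g h ρ : ℕ) (2≤ρ : 2 ≤ ρ) where

    C4-free : Set
    C4-free = ∀ v u u' w -> u ≢ u' -> v ~ u -> v ~ u' -> w ~ u -> w ~ u' -> w ≡ v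

    G : ℕ
    G = 2 + g

    dv : ℕ -> ℕ
    dv = dev g h

    cols : List (Fin q)
    cols = allFin q

    -- n rounds are left. Y: undecided vertices; Col c: vertices coloured c; L c: vertices whose list contains c; Dd c: vertices at which c
    -- has been given up because it is on the lists of too many undecided neighbours.
    record State (n ℓ̂ A D Dg w : ℕ) : Set₁ where
     field
      Y : X -> Set
      Col L Dd : Fin q -> X -> Set
      bY : Borel Y
      bCol : ∀ c -> Borel (Col c)
      bL : ∀ c -> Borel (L c)
      bD : ∀ c -> Borel (Dd c)
      undecided : ∀ {c x} -> Col c x -> ¬ Y x
      one-colour : ∀ {c c' x} -> Col c x -> Col c' x -> c ≡ c'
      proper : ∀ {c u v} -> u ~ v -> Col c u -> ¬ Col c v
      -- A colour used by a neighbour may stay on the list, but only as a dead one: dead colours are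
      -- never offered, and hits do not remove them.
      forbidden : ∀ {c u v} -> Y v -> v ~ u -> Col c u -> L c v -> Dd c v
      list-size : ∀ v -> Y v -> ∑ cols (λ c -> ⟦ L c v ⟧) ≡ ℓ̂

     t : Fin q -> X -> ℕ
     t c v = ∑ (nbrs v) λ u -> ⟦ Y u × L c u ⟧

     weight : Fin q -> X -> ℕ
     weight c v = ⟦ Dd c v ⟧ * (n * A) + ⟦ ¬ Dd c v ⟧ * t c v

     field
      live-degree : ∀ c v -> Y v -> L c v -> ¬ Dd c v -> t c v ≤ n * A
      -- With 4-cycles the degrees of single colours may run away from their means; only the total
      -- weight over a list is kept under control.
      mode : (C4-free × (∀ c v -> ¬ Dd c v)) ⊎ (∀ v -> Y v -> ∑ cols (λ c -> ⟦ L c v ⟧ * weight c v) ≤ D * (n * A))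
      degree : ∀ v -> ∑ (nbrs v) (λ u -> ⟦ Y u ⟧) ≤ n * Dg
      -- Activated vertices that clash get no colour and take no part in later rounds; they are left
      -- to the final greedy colouring.
      wasted : ∀ v -> ∑ (nbrs v) (λ u -> ⟦ ¬ Y u × (∀ c -> ¬ Col c u) ⟧) ≤ w

    up : ℕ -> ℕ
    up x = dv (ceil x (suc g))

    dev-mono : ∀ {ν ν'} -> ν ≤ ν' -> dv ν ≤ dv ν'
    dev-mono le = +≤ˡ ((2 + g) * h) (*≤ʳ (4 + g) le)

    dev-scale : ∀ m ν -> dv (suc m * ν) ≤ suc m * dv ν
    dev-scale m ν = +≤ʳ ((4 + g) * (suc m * ν)) (m≤m+n ((2 + g) * h) (m * ((2 + g) * h))) » from≡ (ring73 (4 + g) (suc m) ν ((2 + g) * h))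

    rest≤ : ∀ m t x -> t ≤ suc (suc m) * x -> dv (ceil (t * suc m) (suc g + suc m * G)) ≤ suc m * up x
    rest≤ m t x le = (dev-mono (ceil-least (t * suc m) (suc g + suc m * G) (suc m * ceil x (suc g)) (begin
      _ ≤⟨ *≤ˡ (suc m) (le » *≤ʳ (suc (suc m)) (ceil-≥ x (suc g))) ⟩
      _ ≡⟨ ring74 m g (ceil x (suc g)) ⟩
      _ ∎))) » dev-scale m (ceil x (suc g))

    record Step : Set₁ where
     field
      m ℓ̂ A D Dg w a' R' E A' ℓ' D' Dg' w' νA νD ν₁ ν₄ : ℕ
      st : State (suc (suc m)) ℓ̂ A D Dg w
      0<A : 1 ≤ A
      0<A' : 1 ≤ A'
      upA : up A ≤ suc a'
      upDg : up Dg ≤ Dg'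
      extra : ℓ̂ * (4 + g + G * h) ≤ E * (suc m * suc a')
      room : suc R' * suc a' + (D + E) ≤ ℓ̂
      rateA : suc a' * suc R' ≤ G * (2 + R') * νA
      A-next : dv νA ≤ A'
      rateD : (D + E) * suc R' ≤ G * (2 + R') * νD
      D-next : dv νD ≤ D'
      rateℓ : ℓ̂ ≤ G * suc R' * ν₁
      ℓ-next : ℓ' + dv ν₁ ≤ ℓ̂
      rate-w : Dg' * dv ν₁ ≤ G * (suc R' * suc a') * ν₄
      w-next : w + dv ν₄ ≤ w'
      budgetA : 2 * suc q * cost ρ (suc (suc m)) ≤ 2 ^ h
      budgetB : (3 + q) * cost ρ (suc R' * suc a') ≤ 2 ^ h

    module Round (step : Step) where
     open Step step
     open State st

     n' n R₀ a : ℕ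
     n' = suc m
     n = suc n'
     R₀ = suc R'
     a = suc a'

     cap : Maybe (Fin q) -> ℕ
     cap nothing = Dg
     cap (just _) = A

     open PhaseA q Y L bY bL n' cap g h ρ (n≤1+n 1 » 2≤ρ) budgetA using (Activated; activate)
     open Activated activate

     τR τ' : ℕ
     τR = n' * a
     τ' = n' * A'

     act≤ : ∀ c v -> t c v ≤ n * A -> ∑ (nbrs v) (λ u -> ⟦ (Y u × L c u) × On u ⟧) ≤ a
     act≤ c v le = <⇒≤ (fired (just c) v le) » upA

     tR≤ : ∀ c v -> t c v ≤ n * A -> ∑ (nbrs v) (λ u -> ⟦ (Y u × L c u) × ¬ On u ⟧) ≤ τR
     tR≤ c v le = <⇒≤ (rest (just c) v) » rest≤ m (t c v) A le » *≤ʳ n' upA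

     τ-ratio : τR * (R₀ * a) ≤ τ' * (R₀ * a + a)
     τ-ratio = begin
      _ ≡⟨ ring69 n' a R' ⟩
      _ ≤⟨ *≤ʳ (n' * a) (rateA » (*≤ˡ νA (from≡ (*-comm G (2 + R'))) » (from≡ (*-assoc (2 + R') G νA) » (*≤ʳ (2 + R')
       ((*≤ˡ νA (n≤1+n G » n≤1+n (3 + g)) » m≤m+n ((4 + g) * νA) ((2 + g) * h)) » A-next))))) ⟩
      _ ≡⟨ ring70 n' a R' A' ⟩
      _ ∎

     tR wt : Fin q -> X -> ℕ
     tR c v = ∑ (nbrs v) λ u -> ⟦ (Y u × ¬ On u) × L c u ⟧
     wt c v = ⟦ Dd c v ⟧ * τR + ⟦ ¬ Dd c v ⟧ * tR c v

     swap-R : ∀ c v -> tR c v ≤ ∑ (nbrs v) (λ u -> ⟦ (Y u × L c u) × ¬ On u ⟧)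
     swap-R c v = ∑-mono (nbrs v) λ u -> ⟦⟧-mono λ ((y , n) , l) -> (y , l) , n

     -- Activation multiplies each degree by (n - 1)/n up to a relative and an additive error. The
     -- relative one is covered by the rounding up of A to a; the additive ones sum over the list to
     -- at most E caps.
     mean : (∀ v -> Y v -> ∑ cols (λ c -> ⟦ L c v ⟧ * weight c v) ≤ D * (n * A)) -> ∀ v -> Y v -> ∑ cols (λ c -> ⟦ L c v ⟧ * wt c v) ≤ (D + E) * τR
     mean hyp v y = *-cancel {c = K * A} (1≤* {K} (s≤s z≤n) 0<A) (begin
       _ ≡⟨ sym (∑-*ʳ cols _ _) ⟩
       _ ≤⟨ ∑-mono cols each ⟩
       _ ≡⟨ ∑-+ cols _ _ ∙ cong₂ _+_ (∑-*ˡ cols (n' * a * G) _) (∑-*ˡ cols (K * A * C) _ ∙ cong (K * A * C *_) (list-size v y)) ⟩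
       _ ≤⟨ +≤ (*≤ʳ (n' * a * G) (hyp v y)) (from≡ (ring71 K A C ℓ̂)) ⟩
       _ ≤⟨ +≤ʳ (n' * a * G * (D * (n * A))) (*≤ʳ (K * A) extra) ⟩
       _ ≡⟨ ring72 n' a G D n A E ⟩
       _ ∎)
      where
      K C : ℕ
      K = n * G
      C = 4 + g + G * h
      C' : ℕ
      C' = (4 + g) + (2 + g) * h
      live : ∀ c -> tR c v * (K * A) ≤ n' * a * G * t c v + K * A * C
      live c = begin
       _ ≤⟨ *≤ˡ (K * A) (swap-R c v » <⇒≤ (rest (just c) v)) ⟩
       _ ≡⟨ ring62 (4 + g) ν ((2 + g) * h) K A ⟩
       _ ≤⟨ +≤ˡ ((2 + g) * h * K * A) (*≤ˡ A (*≤ʳ (4 + g) (ceil-< (t c v * n') (suc g + n' * G)))) ⟩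
       _ ≡⟨ ring63 (4 + g) (t c v) n' K A ((2 + g) * h) ⟩
       _ ≤⟨ +≤ˡ (K * A * C') (*≤ˡ (t c v) (*≤ʳ n' A≤a)) ⟩
       _ ≡⟨ cong (λ z -> z * t c v + K * A * C') (sym (*-assoc n' a G)) ⟩
       _ ∎
       where
       ν = ceil (t c v * n') (suc g + n' * G)
       A≤a : (4 + g) * A ≤ a * G
       A≤a = *≤ʳ (4 + g) (ceil-≥ A (suc g)) » from≡ (x∙yz≈xz∙y (4 + g) G (ceil A (suc g))) » *≤ˡ G (m≤m+n ((4 + g) * ceil A (suc g)) ((2 + g) * h) » upA)
      each : ∀ c -> ⟦ L c v ⟧ * wt c v * (K * A) ≤ n' * a * G * (⟦ L c v ⟧ * weight c v) + K * A * C * ⟦ L c v ⟧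
      each c = begin
       _ ≡⟨ *-assoc ⟦ L c v ⟧ _ _ ⟩
       _ ≤⟨ *≤ʳ ⟦ L c v ⟧ (cases (Dd c v)
        (λ d -> subst₂ (λ x y -> x * (K * A) ≤ n' * a * G * y + K * A * C) (sym (pick2 d)) (sym (pick2 d)) (from≡ (ring65 n' a n G A) » m≤m+n _ _))
        (λ nd -> subst₂ (λ x y -> x * (K * A) ≤ n' * a * G * y + K * A * C) (sym (pick2' nd)) (sym (pick2' nd)) (live c))) ⟩
       _ ≡⟨ ring64 ⟦ L c v ⟧ (n' * a * G) (weight c v) (K * A * C) ⟩
       _ ∎

     0<τR : 1 ≤ τR
     0<τR = s≤s z≤n

     -- Dead colours carry the maximal weight, so there are at most D + E of them.
     few-dead : ∀ v -> Y v -> ∑ cols (λ c -> ⟦ L c v × Dd c v ⟧) ≤ D + E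
     few-dead v y = case mode of λ
      { (inj₁ (_ , none)) -> from≡ (∑-zero cols λ c _ -> ⟦⟧-no (none c v ∘ snd)) » z≤n
      ; (inj₂ hyp) -> *-cancel {c = τR} 0<τR (from≡ (sym (∑-*ʳ cols _ τR)) » ∑-mono cols each » mean hyp v y) }
      where
      each : ∀ c -> ⟦ L c v × Dd c v ⟧ * τR ≤ ⟦ L c v ⟧ * wt c v
      each c = cases (L c v × Dd c v)
       (λ (l , d) -> from≡ (cong (_* τR) (⟦⟧-yes (l , d)) ∙ sym (cong₂ _*_ (⟦⟧-yes l) (pick2 d))))
       (λ n -> from≡ (no* n) » z≤n)

     live-enough : ∀ v -> Y v -> R₀ * a ≤ ∑ cols (λ c -> ⟦ L c v × ¬ Dd c v ⟧)
     live-enough v y = +-cancelʳ-≤ _ _ _ (begin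
      _ ≤⟨ room ⟩
      ℓ̂ ≡⟨ sym (list-size v y) ⟩
      _ ≤⟨ ∑-mono cols (λ c -> split (L c v) (Dd c v)) ⟩
      _ ≡⟨ ∑-+ cols _ _ ⟩
      _ ≤⟨ +≤ʳ (∑ cols (λ c -> ⟦ L c v × ¬ Dd c v ⟧)) (few-dead v y) ⟩
      _ ∎)
      where
      split : ∀ (C F : Set) -> ⟦ C ⟧ ≤ ⟦ C × ¬ F ⟧ + ⟦ C × F ⟧
      split C F = cases F (λ f -> ⟦⟧-mono (_, f) » m≤n+m _ _) (λ nf -> ⟦⟧-mono (_, nf) » m≤m+n _ _)

     data' : BData
     data' = record
      { q = q ; Y = Y ; On = On ; L = L ; Dd = Dd ; bY = bY ; bOn = b-On ; bL = bL ; bD = bD ; triangle-free = triangle-free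
      ; k' = a' + R' * suc a' ; a = a ; ℓ̂ = ℓ̂ ; g = g ; h = h ; ρ = ρ ; dA = Dg' ; τR = τR ; τ' = τ' ; D = D + E
      ; 2≤ρ = 2≤ρ ; a≤k = m≤m+n a _ ; list-size = list-size ; live-enough = live-enough
      ; act-few = λ c v y (l , nd) -> act≤ c v (live-degree c v y l nd)
      ; act-degree = λ v -> <⇒≤ (fired nothing v (degree v)) » upDg
      ; 0<τR = 0<τR ; 0<τ' = 1≤* {n'} (s≤s z≤n) 0<A' ; τ-ratio = τ-ratio }

     private
      module PB = Picking data'
      module OB = PB.WithBudget budgetB

     open OB.Outcome OB.outcome
     open PB using (R; Act; surv; hit; pick; killed)

     Conf : X -> Set
     Conf u = ∃[ c ] pick ω u ≡ just c × (∃[ w ] u ~ w × hit ω c w)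

     New Col' Sv L' Dd' : Fin q -> X -> Set
     New c u = (Act u × pick ω u ≡ just c) × ¬ Conf u
     Col' c u = Col c u ⊎ New c u
     Sv c u = L c u × surv ω c u
     L' c u = Sv c u × Trim.before (λ c' -> Sv c' u) c < ℓ'
     Dd' c u = Dd c u ⊎ ((R u × L c u) × τ' < PB.t′ c u (hit ω c) ω)

     private
      plot : PB.Plot (λ _ -> ω)
      plot mh i = meas-pt (ω-meas i) mh

      b-Sv : ∀ c -> Borel (Sv c)
      b-Sv c = b-× (bL c) (PB.b-surv {λ _ -> ω} {λ x -> x} c plot pt-id)

      b-Conf : Borel Conf
      b-Conf = b-∃ (enum-Fin q) λ c -> b-× (PB.b-pick {λ _ -> ω} {λ x -> x} c plot pt-id) (b-∃~ pt-id λ {f} mw -> PB.b-hit {λ _ -> ω} {f} c plot mw)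

      same : ∀ {m : Maybe (Fin q)} {c c'} -> m ≡ just c -> m ≡ just c' -> c ≡ c'
      same refl refl = refl

      ν₁≤ : PB.ν₁ ≤ ν₁
      ν₁≤ = ceil-least _ _ ν₁ (*≤ˡ a rateℓ » from≡ (ring66 g R' ν₁ a'))

      slow : ∀ x y ν -> x * R₀ ≤ G * (2 + R') * ν -> y * x * (R₀ * a) ≤ suc (a' + R' * suc a' + a + suc g * (R₀ * a + a)) * (y * ν)
      slow x y ν le = from≡ (ring67 y x R' a') » *≤ʳ (y * a) le » from≡ (ring68 y a' g R' ν)

      ν₂≤ : PB.dv PB.ν₂ ≤ τ'
      ν₂≤ = dev-mono (ceil-least (τR * (R₀ * a)) (a' + R' * suc a' + a + suc g * (R₀ * a + a)) (n' * νA) (slow a n' νA rateA)) » dev-scale m νA » *≤ʳ n' A-next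

      ν₃≤ : PB.dv PB.ν₃ ≤ D'
      ν₃≤ = (dev-mono (ceil-least _ _ νD
       (subst₂ (λ x y -> x * (R₀ * a) ≤ suc (a' + R' * suc a' + a + suc g * (R₀ * a + a)) * y) (*-identityˡ (D + E)) (*-identityˡ νD) (slow (D + E) 1 νD rateD)))) » D-next

      ν₄≤ : PB.dv PB.ν₄ ≤ dv ν₄
      ν₄≤ = dev-mono (ceil-least (Dg' * PB.h₀) (a' + R' * suc a' + suc g * (R₀ * a)) ν₄ (*≤ʳ Dg' (dev-mono ν₁≤) » rate-w))

      enough : ∀ v -> Y v -> ℓ' ≤ ∑ cols (λ c -> ⟦ Sv c v ⟧)
      enough v y = +-cancelʳ-≤ _ _ _ (begin
       _ ≤⟨ ℓ-next ⟩
       ℓ̂ ≡⟨ sym (list-size v y) ⟩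
       _ ≤⟨ ∑-mono cols each ⟩
       _ ≡⟨ ∑-+ cols _ _ ∙ cong (∑ cols (λ c -> ⟦ Sv c v ⟧) +_) (∑-+ cols _ _) ⟩
       _ ≤⟨ +≤ʳ (∑ cols (λ c -> ⟦ Sv c v ⟧))
        (+≤ˡ (PB.coins ω v) (PB.hit-colours ω v) » <⇒≤ (few-hits v y) » dev-mono ν₁≤) ⟩
       _ ∎)
       where
       each : ∀ c -> ⟦ L c v ⟧ ≤ ⟦ Sv c v ⟧ + (⟦ PB.Live c v × (∃[ u ] v ~ u × hit ω c u) ⟧ + ⟦ L c v × PB.coin ω c v ⟧)
       each c = cases (killed c v (hit ω c) ω)
        (λ { (inj₁ co) -> ⟦⟧-mono (_, co) » (m≤n+m ⟦ L c v × PB.coin ω c v ⟧ _) » m≤n+m _ ⟦ Sv c v ⟧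
          ; (inj₂ (l , u , vu , t)) -> ⟦⟧-mono (λ _ -> l , u , vu , t) » (m≤m+n ⟦ PB.Live c v × (∃[ u ] v ~ u × hit ω c u) ⟧ _) » m≤n+m _ ⟦ Sv c v ⟧ })
        (λ nk -> ⟦⟧-mono (_, nk) » m≤m+n ⟦ Sv c v ⟧ _)

      t'' : Fin q -> X -> ℕ
      t'' c v = ∑ (nbrs v) λ u -> ⟦ R u × L' c u ⟧

      t''≤ : ∀ c v -> t'' c v ≤ PB.t′ c v (hit ω c) ω
      t''≤ c v = ∑-mono (nbrs v) λ u -> ⟦⟧-mono λ (r , (l , s) , _) -> (r , l) , s

      alive : ∀ c v -> R v -> L' c v -> ¬ Dd' c v -> PB.t′ c v (hit ω c) ω ≤ τ'
      alive c v r l nd = ≮⇒≥ λ lt -> nd (inj₂ ((r , fst (fst l)) , lt))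

      mode' : (C4-free × (∀ c v -> ¬ Dd' c v)) ⊎ (∀ v -> R v -> ∑ cols (λ c -> ⟦ L' c v ⟧ * (⟦ Dd' c v ⟧ * τ' + ⟦ ¬ Dd' c v ⟧ * t'' c v)) ≤ D' * τ')
      mode' = case mode of λ
       { (inj₁ (free , nd)) -> inj₁ (free , λ { c v (inj₁ d) -> nd c v d
        ; c v (inj₂ ((r , l) , lt)) -> <⇒≱ lt (<⇒≤ (sparse free c v r (swap-R c v » tR≤ c v (live-degree c v (fst r) l (nd c v)))) » ν₂≤) })
       ; (inj₂ hyp) -> inj₂ λ v r -> ∑-mono cols (each v r) » <⇒≤ (light v r (mean hyp v (fst r))) » *≤ˡ τ' ν₃≤ }
       where
       each : ∀ v -> R v -> ∀ c -> ⟦ L' c v ⟧ * (⟦ Dd' c v ⟧ * τ' + ⟦ ¬ Dd' c v ⟧ * t'' c v) ≤ PB.Xw ω c v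
       each v r c = cases (L' c v)
        (λ l -> *≤ (⟦⟧-mono fst) (cases (Dd c v)
         (λ d -> from≡ (pick2 (inj₁ d) ∙ sym (pick2 d)))
         (λ nd -> cases (τ' < PB.t′ c v (hit ω c) ω)
          (λ lt -> from≡ (pick2 (inj₂ ((r , fst (fst l)) , lt)) ∙ sym (pick2' nd ∙ ℕ.m≤n⇒m⊓n≡m (<⇒≤ lt))))
          (λ nlt -> from≡ (pick2' λ { (inj₁ d) -> nd d ; (inj₂ (_ , lt)) -> nlt lt }) » (t''≤ c v
           » from≡ (sym (pick2' nd ∙ ℕ.m≥n⇒m⊓n≡n (≮⇒≥ nlt))))))))
        (λ nl -> from≡ (no* nl) » z≤n)

      list-size' : ∀ v -> R v -> ∑ cols (λ c -> ⟦ L' c v ⟧) ≡ ℓ'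
      list-size' v r = Trim.kept q (λ c -> Sv c v) 0 ℓ' ∙ ℕ.m≥n⇒m⊓n≡n (enough v (fst r))

      wasted' : ∀ v -> ∑ (nbrs v) (λ u -> ⟦ ¬ R u × (∀ c -> ¬ Col' c u) ⟧) ≤ w'
      wasted' v = ∑-mono (nbrs v) each » (from≡ (∑-+ (nbrs v) _ _)
        » +≤ (wasted v) (<⇒≤ (few-clashes v) » ν₄≤) » w-next)
       where
       each : ∀ u -> ⟦ ¬ R u × (∀ c -> ¬ Col' c u) ⟧ ≤ ⟦ ¬ Y u × (∀ c -> ¬ Col c u) ⟧ + ⟦ PB.Clash ω ω u ⟧
       each u = cases (Y u)
        (λ y -> (⟦⟧-mono λ (nr , nc) -> let act = (y , byContra (λ off -> nr (y , off))) in act , byContra (λ nconf -> unpicked act nconf nc) ,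
         <-≤-trans (≤-<-trans (m≤m+n _ _) (few-hits u y)) ≤-refl) » m≤n+m ⟦ PB.Clash ω ω u ⟧ _)
        (λ ny -> (⟦⟧-mono λ (_ , nc) -> ny , λ c -> nc c ∘ inj₁) » (m≤m+n ⟦ ¬ Y u × (∀ c -> ¬ Col c u) ⟧ _))
        where
        unpicked : Act u -> ¬ Conf u -> (∀ c -> ¬ Col' c u) -> ⊥
        unpicked act nconf nc = let (c , e) = PB.pick-total u (ω (u , fzero)) (fst act) in nc c (inj₂ ((act , e) , nconf))

      -- An old colour next to v is dead at v by `forbidden` and cannot be picked there; two equal
      -- new colours on an edge would be a conflict.
      proper' : ∀ {c u v} -> u ~ v -> Col' c u -> ¬ Col' c v
      proper' uv (inj₁ cu) (inj₁ cv) = proper uv cu cv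
      proper' {c} {u} {v} uv (inj₁ cu) (inj₂ ((act , e) , _)) = let l , nd = PB.pick-live {v} {ω (v , fzero)} e in nd (forbidden (fst act) (~-sym uv) cu l)
      proper' {c} {u} {v} uv (inj₂ ((act , e) , _)) (inj₁ cv) = let l , nd = PB.pick-live {u} {ω (u , fzero)} e in nd (forbidden (fst act) uv cv l)
      proper' {c} {u} {v} uv (inj₂ ((_ , e) , nconf)) (inj₂ ((act' , e') , _)) = nconf (c , e , v , uv , act' , e')

     next : State (suc m) ℓ' A' D' Dg' w'
     next = record
      { Y = R ; Col = Col' ; L = L' ; Dd = Dd'
      ; bY = PB.b-R
      ; bCol = λ c -> b-⊎ (bCol c) (b-× (b-× PB.b-Act (PB.b-pick {λ _ -> ω} {λ x -> x} c plot pt-id)) (b-¬ b-Conf))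
      ; bL = λ c -> b-× (b-Sv c) (b-≤ (meas-map enum-ℕ (meas-∑ cols λ c' _ -> meas-⟦⟧ (b-× (b-const _) (b-Sv c'))) suc) (meas-const ℓ'))
      ; bD = λ c -> b-⊎ (bD c) (b-× (b-× PB.b-R (bL c)) (b-≤ (meas-const (suc τ')) (PB.meas-t′ c {λ _ -> ω} plot)))
      ; undecided = λ { (inj₁ cx) (y , _) -> undecided cx y ; (inj₂ ((act , _) , _)) (_ , off) -> off (snd act) }
      ; one-colour = λ { (inj₁ x) (inj₁ y) -> one-colour x y ; (inj₁ x) (inj₂ ((act , _) , _)) -> ⊥-elim (undecided x (fst act))
               ; (inj₂ ((act , _) , _)) (inj₁ y) -> ⊥-elim (undecided y (fst act)) ; (inj₂ ((_ , e) , _)) (inj₂ ((_ , e') , _)) -> same e e' }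
      ; proper = proper'
      ; forbidden = λ { (y , _) vu (inj₁ cu) ((l , _) , _) -> inj₁ (forbidden y vu cu l)
              -- Had the colour been live at v, the newly coloured neighbour would have hit and
              -- removed it.
              ; {c} {u} {v} _ vu (inj₂ ((act , e) , _)) ((l , s) , _) -> byContra λ nd -> s (inj₂ ((l , nd ∘ inj₁) , u , vu , act , e)) }
      ; list-size = list-size'
      ; live-degree = λ c v r l nd -> t''≤ c v » alive c v r l nd
      ; mode = mode'
      ; degree = λ v -> <⇒≤ (rest nothing v) » rest≤ m (∑ (nbrs v) λ u -> ⟦ Y u ⟧) Dg (degree v) » *≤ʳ n' upDg
      ; wasted = wasted' }

   -- All rounds, and the final greedy colouring.

   module Run (triangle-free : ∀ {x y z} -> x ~ y -> y ~ z -> z ~ x -> ⊥) (C : Constants) where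
    open Constants C
    open Nibble triangle-free q g h ρ 2≤ρ

    R : ℕ
    R = suc R'

    module _ (budget : ∀ k -> k ≤ K -> (3 + 2 * q) * cost ρ k ≤ 2 ^ h) where

     module Advance (m b y Dg w : ℕ) (T≤y : T ≤ y) (T≤ŷ : T ≤ Arithmetic.At.ŷ C y T≤y) (n₁≤m : n₁ ≤ m) (b<B : suc b ≤ Bₘ) (lists : R * α + (δ + 2) ≤ suc b)
      (Dg≤ : Dg + ι ≤ 2 * γ) (ℓ≤K : suc b * y ≤ K) (n≤K' : suc (suc m) ≤ K) where
      open Arithmetic.At C y T≤y

      1≤y : 1 ≤ y
      1≤y = 1≤T » T≤y

      extra : suc b * y * (4 + g + (2 + g) * h) ≤ E * (suc m * a)
      extra = begin
       _ ≤⟨ *≤ˡ σ (*≤ˡ y b<B) ⟩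
       _ ≡⟨ xy∙z≈xz∙y Bₘ y σ ⟩
       _ ≤⟨ *≤ˡ y enough-dead ⟩
       _ ≡⟨ ring106 E (suc n₁) α y ⟩
       _ ≤⟨ *≤ʳ E (*≤ (s≤s n₁≤m) a≥) ⟩
       _ ∎
       where
       σ = 4 + g + (2 + g) * h

      rate-w : (Dg + ι) * dv (ν₁ b) ≤ (2 + g) * (R * a) * ν₄
      rate-w = *-cancel {c = R} (s≤s z≤n) (begin
       _ ≡⟨ xy∙z≈x∙zy (Dg + ι) (dv (ν₁ b)) R ⟩
       _ ≤⟨ *≤ Dg≤ (few-hits b b<B) ⟩
       _ ≡⟨ ring107 γ _ ⟩
       _ ≤⟨ *≤ˡ (R * a) clash-rate ⟩
       _ ≡⟨ ring108 (2 + g) R ν₄ (R * a) ⟩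
       _ ∎)

      advance : ∀ a' -> a ≡ suc a' -> State (suc (suc m)) (suc b * y) (α * y) (δ * y) Dg w -> State (suc m) (b * ŷ) (α * ŷ) (δ * ŷ) (Dg + ι) (w + ω₀)
      advance a' e st = Round.next (record
       { st = st ; a' = a' ; R' = R' ; E = E ; νA = νA ; νD = νD ; ν₁ = ν₁ b ; ν₄ = ν₄ ; 0<A = 1≤* 1≤α 1≤y ; 0<A' = 1≤* 1≤α (1≤T » T≤ŷ)
       ; upA = from≡ e ; upDg = degree-step Dg (m≤m+n Dg ι » Dg≤) ; extra = subst (λ z -> suc b * y * (4 + g + (2 + g) * h) ≤ E * (suc m * z)) e extra
       ; room = subst (λ z -> R * z + (δ * y + E) ≤ suc b * y) e (room (suc b) lists) ; rateA = subst (λ z -> z * R ≤ (2 + g) * (2 + R') * νA) e rateA ; A-next = A-next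
       ; rateD = rateD ; D-next = D-next ; rateℓ = rateℓ b ; ℓ-next = ℓ-next b b<B
       ; rate-w = subst (λ z -> (Dg + ι) * dv (ν₁ b) ≤ (2 + g) * (R * z) * ν₄) e rate-w ; w-next = ≤-refl
       ; budgetA = *≤ˡ (cost ρ (suc (suc m))) (n≤1+n (2 * suc q) » from≡ (ring109 q)) » budget (suc (suc m)) n≤K'
       ; budgetB = *≤ˡ (cost ρ (R * suc a')) (+≤ʳ 3 (m≤m+n q (q + 0))) » budget (R * suc a') (subst (λ z -> R * z ≤ suc b * y) e (m≤m+n _ _ » room (suc b) lists) » ℓ≤K) })

     abstract
      advance : ∀ m b y Dg w (T≤y : T ≤ y) -> T ≤ Arithmetic.At.ŷ C y T≤y -> n₁ ≤ m -> suc b ≤ Bₘ -> R * α + (δ + 2) ≤ suc b -> Dg + ι ≤ 2 * γ -> suc b * y ≤ K -> suc (suc m) ≤ K ->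
       State (suc (suc m)) (suc b * y) (α * y) (δ * y) Dg w -> State (suc m) (b * Arithmetic.At.ŷ C y T≤y) (α * Arithmetic.At.ŷ C y T≤y) (δ * Arithmetic.At.ŷ C y T≤y) (Dg + ι) (w + ω₀)
      advance m b y Dg w T≤y T≤ŷ h₁ h₂ h₃ h₄ h₅ h₆ = casesN (Arithmetic.At.a C y T≤y)
       (λ e -> ⊥-elim (<⇒≱ (1≤* 1≤α (1≤T » T≤y)) (Arithmetic.At.a≥ C y T≤y » from≡ e)))
       (λ a' e -> Advance.advance m b y Dg w T≤y T≤ŷ h₁ h₂ h₃ h₄ h₅ h₆ a' e)

     -- `i` rounds to come, `j` done. `far` is kept because it yields y ≥ T at every round, by
     -- `threshold`.
     record Reach (i j : ℕ) : Set₁ where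
      field
       y : ℕ
       far : y₀ * R ^ j ≤ y * suc R ^ j
       ℓ≤K : (i + b₀) * y ≤ K
       state : State (suc (i + n₁)) ((i + b₀) * y) (α * y) (δ * y) (γ + j * ι) (j * ω₀)

     large : ∀ {y} j -> j ≤ J -> y₀ * R ^ j ≤ y * suc R ^ j -> T ≤ y
     large {y} j le far = *-cancel {c = suc R ^ J} (1≤^ J (s≤s z≤n)) (begin
      _ ≤⟨ threshold ⟩
      _ ≡⟨ cong (λ z -> y₀ * R ^ z) (sym (m+[n∸m]≡n le)) ⟩
      _ ≡⟨ cong (y₀ *_) (^-distribˡ-+-* R j _) ∙ sym (*-assoc y₀ _ _) ⟩
      _ ≤⟨ *≤ far (^-monoˡ-≤ (J ∸ j) (n≤1+n R)) ⟩
      _ ≡⟨ *-assoc y _ _ ∙ cong (y *_) (sym (^-distribˡ-+-* _ j _)) ⟩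
      _ ≡⟨ cong (λ z -> y * suc R ^ z) (m+[n∸m]≡n le) ⟩
      _ ∎)

     module Start (Δ : ℕ) (degree≤ : ∀ v -> length (nbrs v) ≤ Δ) (Δ≤A : Δ ≤ suc (J + n₁) * (α * y₀)) (Δ≤γ : Δ ≤ suc (J + n₁) * γ)
      (mode₀ : C4-free ⊎ q * Δ ≤ δ * y₀ * (suc (J + n₁) * (α * y₀))) where

      initial : Reach J 0
      initial = record
       { y = y₀ ; far = ≤-refl ; ℓ≤K = subst (_≤ K) q-is q≤K
       ; state = record
        { Y = λ _ -> ⊤ ; Col = λ _ _ -> ⊥ ; L = λ _ _ -> ⊤ ; Dd = λ _ _ -> ⊥
        ; bY = b-⊤ ; bCol = λ _ -> b-const ⊥ ; bL = λ _ -> b-⊤ ; bD = λ _ -> b-const ⊥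
        ; undecided = λ () ; one-colour = λ () ; proper = λ _ () ; forbidden = λ _ _ ()
        ; list-size = λ v _ -> ((∑-cong cols λ c -> ⟦⟧-yes tt) ∙ ∑-const cols 1 ∙ *-identityʳ _ ∙ length-allFin q) ∙ q-is
        ; live-degree = λ c v _ _ _ -> (deg v λ u -> ⟦⟧≤1 _) » Δ≤A
        ; mode = case mode₀ of λ { (inj₁ free) -> inj₁ (free , λ _ _ ()) ; (inj₂ le) -> inj₂ λ v _ -> weights v » le }
        ; degree = λ v -> (deg v λ u -> ⟦⟧≤1 _) » Δ≤γ » *≤ʳ (suc (J + n₁)) (from≡ (sym (+-identityʳ γ)))
        ; wasted = λ v -> from≡ (∑-zero (nbrs v) λ u _ -> ⟦⟧-no λ (n , _) -> n tt) } }
       where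
       deg : ∀ v {f : X -> ℕ} -> (∀ u -> f u ≤ 1) -> ∑ (nbrs v) f ≤ Δ
       deg v le = (∑-≤const (nbrs v) 1 λ u _ -> le u) » from≡ (*-identityʳ _) » degree≤ v
       weights : ∀ v -> ∑ cols (λ c -> ⟦ ⊤ ⟧ * (⟦ ⊥ ⟧ * (suc (J + n₁) * (α * y₀)) + ⟦ ¬ ⊥ ⟧ * ∑ (nbrs v) (λ u -> ⟦ ⊤ × ⊤ ⟧))) ≤ q * Δ
       weights v = (∑-≤const cols Δ λ c _ -> each) » from≡ (cong (_* Δ) (length-allFin q))
        where
        each : ⟦ ⊤ ⟧ * (⟦ ⊥ ⟧ * (suc (J + n₁) * (α * y₀)) + ⟦ ¬ ⊥ ⟧ * ∑ (nbrs v) (λ u -> ⟦ ⊤ × ⊤ ⟧)) ≤ Δ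
        each = begin
         _ ≤⟨ *≤ (⟦⟧≤1 ⊤) (+≤ (from≡ (cong (_* (suc (J + n₁) * (α * y₀))) (⟦⟧-no {P = ⊥} λ ())))
          (*≤ (⟦⟧≤1 (¬ ⊥)) (deg v λ u -> ⟦⟧≤1 _))) ⟩
         _ ≡⟨ *-identityˡ _ ∙ *-identityˡ Δ ⟩
         Δ ∎

      run : ∀ j i -> i + j ≡ J -> Reach i j
      run zero i e = subst (λ z -> Reach z 0) (sym (sym (+-identityʳ i) ∙ e)) initial
      run (suc j) i e = go (run j (suc i) e')
       where
       e' : suc i + j ≡ J
       e' = sym (+-suc i j) ∙ e
       i<J : suc i ≤ J
       i<J = m≤m+n _ j » from≡ e'
       j<J : suc j ≤ J
       j<J = m≤n+m _ i » from≡ e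
       go : Reach (suc i) j -> Reach i (suc j)
       go r = record
        { y = ŷ ; far = far' ; ℓ≤K = (m≤m+n _ _ » ℓ-next (i + b₀) b<B) » ℓ≤K
        ; state = subst₂ (State (suc (i + n₁)) ((i + b₀) * ŷ) (α * ŷ) (δ * ŷ)) (+-assoc γ _ ι ∙ cong (γ +_) (+-comm _ ι)) (+-comm _ ω₀)
          (advance (i + n₁) (i + b₀) y (γ + j * ι) (j * ω₀) T≤y (large (suc j) j<J far') (m≤n+m n₁ i) b<B
           (enough-lists » m≤n+m b₀ i » n≤1+n _)
           (from≡ (+-assoc γ _ ι ∙ cong (γ +_) (+-comm _ ι)) » +≤ʳ γ (*≤ˡ ι j<J » degree-total) » from≡ (cong (γ +_) (sym (+-identityʳ γ))))
           ℓ≤K (s≤s (+≤ˡ n₁ i<J) » n≤K) state) }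
        where
        open Reach r
        T≤y : T ≤ y
        T≤y = large j (n≤1+n j » j<J) far
        b<B : suc (i + b₀) ≤ Bₘ
        b<B = +≤ˡ b₀ i<J » J+b₀≤B
        open Arithmetic.At C y T≤y
        far' : y₀ * R ^ suc j ≤ ŷ * suc R ^ suc j
        far' = begin
         _ ≡⟨ x∙yz≈y∙xz y₀ R _ ⟩
         _ ≤⟨ *≤ʳ R far ⟩
         _ ≡⟨ sym (*-assoc R y _) ⟩
         _ ≤⟨ *≤ˡ (suc R ^ j) decay ⟩
         _ ≡⟨ xy∙z≈y∙xz (suc R) ŷ (suc R ^ j) ⟩
         _ ∎

      abstract
       final : Reach 0 J
       final = run J 0 refl

      open Reach final
      open State state

      Left : X -> Set
      Left x = ∀ c -> ¬ Col c x

      private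
       b-Left : Borel Left
       b-Left = b-∀ (enum-Fin q) λ c -> b-¬ (bCol c)

       left-graph : Colouring.Relation S
       left-graph = record
        { I = Fin B' ; enum = enum-Fin B' ; fam = port ; fam-pt = port-pt ; _~_ = λ x y -> (Left x × Left y) × x ~ y
        ; ~-sym = λ ((l , l') , e) -> (l' , l) , ~-sym e ; ~-irrefl = λ (_ , e) -> ~-irrefl e ; ~-fam = λ (_ , e) -> port-all e
        ; b-~ = λ mg mh -> b-× (b-× (mg b-Left) (mh b-Left)) (b-~ mg mh) ; nbrs = nbrs ; ∈nbrs = λ (_ , e) -> ∈nbrs e }
        where
        B' = B

       module Col' = Colouring.Greedy S left-graph

      -- An uncoloured neighbour is undecided or was wasted in some round; both kinds are few, so p
      -- + 1 further colours finish the job.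
      left≤ : ∀ v -> ∑ (nbrs v) (λ u -> ⟦ Left u ⟧) ≤ p
      left≤ v = begin
       _ ≤⟨ ∑-mono (nbrs v) (λ u -> cases (Y u) (λ y -> (⟦⟧-mono λ _ -> y) » m≤m+n ⟦ Y u ⟧ _) (λ n -> (⟦⟧-mono λ l -> n , l) » (m≤n+m ⟦ ¬ Y u × Left u ⟧ _))) ⟩
       _ ≡⟨ ∑-+ (nbrs v) _ _ ⟩
       _ ≤⟨ +≤ (degree v) (wasted v) ⟩
       _ ≤⟨ +≤ˡ (J * ω₀) (*≤ʳ (suc n₁) (+≤ʳ γ degree-total » from≡ (cong (γ +_) (sym (+-identityʳ γ))))) ⟩
       p ∎

      F : X -> ℕ
      F x with dec (∃[ c ] Col c x)
      ... | yes (c , _) = toℕ c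
      ... | no _ = q + Col'.colour x

      F-col : ∀ {c x} -> Col c x -> F x ≡ toℕ c
      F-col {c} {x} cx with dec (∃[ c ] Col c x)
      ... | yes (c' , cx') = cong toℕ (one-colour cx' cx)
      ... | no n = ⊥-elim (n (c , cx))

      F-left : ∀ {x} -> Left x -> F x ≡ q + Col'.colour x
      F-left {x} l with dec (∃[ c ] Col c x)
      ... | yes (c , cx) = ⊥-elim (l c cx)
      ... | no _ = refl

      either : ∀ {ℓ} {Q : Set ℓ} x -> (∀ c -> Col c x -> Q) -> (Left x -> Q) -> Q
      either x f g' = cases (∃[ c ] Col c x) (λ (c , cx) -> f c cx) (λ n -> g' λ c cx -> n (c , cx))

      F-meas : Meas F
      F-meas v = b-resp (λ { x (inj₁ (c , e , cx)) -> F-col cx ∙ e ; x (inj₂ (l , e)) -> F-left l ∙ e })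
       (λ x e -> either x (λ c cx -> inj₁ (c , sym (F-col cx) ∙ e , cx)) (λ l -> inj₂ (l , sym (F-left l) ∙ e)))
       (b-⊎ (b-∃ (enum-Fin q) λ c -> b-× (b-const _) (bCol c)) (b-× b-Left (meas-map enum-ℕ Col'.colour-meas (q +_) v)))

      F-< : ∀ x -> F x < q + suc p
      F-< x = either x (λ c cx -> s≤s (from≡ (F-col cx)) » toℕ<n c » m≤m+n q _)
       (λ l -> s≤s (from≡ (F-left l)) » ((s≤s (+≤ʳ q (Col'.colour-≤ x p λ L u h ->
        (unique-length u λ m -> ∈sel (nbrs x) (∈nbrs (snd (h m))) (snd (fst (h m)))) » from≡ (sel-length (nbrs x)) » left≤ x))) » from≡ (sym (+-suc q p))))

      F-proper : ∀ {x y} -> x ~ y -> F x ≢ F y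
      F-proper {x} {y} e eq = either x
       (λ c cx -> either y (λ c' cy -> proper e cx (subst (λ z -> Col z y) (toℕ-injective (sym (F-col cy) ∙ sym eq ∙ F-col cx)) cy))
        (λ l -> <⇒≱ (toℕ<n c) (m≤m+n q _ » from≡ (sym (F-left l) ∙ sym eq ∙ F-col cx))))
       (λ l -> either y (λ c cy -> <⇒≱ (toℕ<n c) (m≤m+n q _ » from≡ (sym (F-left l) ∙ eq ∙ F-col cy)))
        (λ l' -> Col'.colour-proper ((l , l') , e) (ℕ.+-cancelˡ-≡ q _ _ (sym (F-left l) ∙ eq ∙ F-left l'))))

 open import Defs

 open PolishSpaces

 -- Analytic relations on a Polish space.

 module Analytic {X : Set} {d : X -> X -> ℝ} (Sp : Space X d) where
  open Space Sp

  near-≤ : ∀ {m n x y} -> m ≤ n -> Near n x y -> Near m x y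
  near-≤ {m} {n} le h with m≤n⇒m<n∨m≡n le
  ... | inj₂ refl = h
  near-≤ {m} {suc n} le h | inj₁ (s≤s lt) = near-≤ lt (n-mono {n} h)

  Bor : (X -> Set) -> Set₁
  Bor = σ⟨ IsOpen d ⟩

  Ball : ℕ × ℕ -> X -> Set
  Ball (i , n) y = Near (suc n) (pts i) y

  ball-open : ∀ b -> IsOpen d (Ball b)
  ball-open b = near⇒open λ y h -> n-open h

  sys : Sys
  sys = record
   { X = X ; Borel = Bor
   ; b-resp = λ f g -> respects ((λ {x} -> f x) , (λ {x} -> g x)) ; b-¬ = complement
   ; b-∃ℕ = λ {P} h -> union P h
   ; base = λ n -> Ball (unpair n) ; base-borel = λ n -> generator (ball-open (unpair n))
   ; separates = λ x y h -> n-eq λ n -> let (i , ni) = dense x (suc n) ; (k , e) = unpair-surj i n in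
     n-tri {n} ni (subst (λ b -> Ball b y) e (fst (h k) (subst (λ b -> Ball b x) (sym e) (n-sym {suc n} ni)))) }

  -- Subsets of Baire space times X². Analytic relations are the projections of the closed ones.
  Rel₂ : Set₁
  Rel₂ = (ℕ -> ℕ) -> X -> X -> Set

  Closed : Rel₂ -> Set
  Closed Φ = ∀ α x y -> ¬ Φ α x y -> ∃[ n ] ∀ β x' y' -> (∀ k -> k < n -> β k ≡ α k) -> Near n x x' -> Near n y y' -> ¬ Φ β x' y'

  Analytic : (X -> X -> Set) -> Set₁
  Analytic E = Σ[ Φ ∈ Rel₂ ] Closed Φ × (∀ x y -> (E x y -> ∃[ α ] Φ α x y) × ((∃[ α ] Φ α x y) -> E x y))

  an-resp : ∀ {E F} -> (∀ x y -> E x y -> F x y) -> (∀ x y -> F x y -> E x y) -> Analytic E -> Analytic F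
  an-resp f g (Φ , c , h) = Φ , c , λ x y -> (λ e -> fst (h x y) (g x y e)) , (λ e -> f x y (snd (h x y) e))

  an-closed : ∀ {E : X -> X -> Set} -> (∀ x y -> ¬ E x y -> ∃[ n ] ∀ x' y' -> Near n x x' -> Near n y y' -> ¬ E x' y') -> Analytic E
  an-closed {E} c = (λ _ x y -> E x y) , (λ α x y ne -> let (n , h) = c x y ne in n , λ β x' y' _ nx ny -> h x' y' nx ny) ,
   λ x y -> (λ e -> (λ _ -> 0) , e) , snd

  an-flip : ∀ {E} -> Analytic E -> Analytic (λ x y -> E y x)
  an-flip (Φ , c , h) = (λ α x y -> Φ α y x) , (λ α x y ne -> let (n , f) = c α y x ne in n , λ β x' y' a nx ny -> f β y' x' a ny nx) , λ x y -> h y x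

  closed-resp : ∀ {Φ} -> Closed Φ -> ∀ α β x y -> (∀ k -> β k ≡ α k) -> Φ β x y -> Φ α x y
  closed-resp c α β x y e φ = byContra λ nφ -> let (n , h) = c α x y nφ in h β x y (λ k _ -> e k) (n-refl n x) (n-refl n y) φ

  an-∃ : ∀ {E : ℕ -> X -> X -> Set} -> (∀ n -> Analytic (E n)) -> Analytic (λ x y -> ∃[ n ] E n x y)
  an-∃ {E} a = Φ , closed , λ x y -> to x y , from x y
   where
   Φ : Rel₂
   Φ α x y = fst (a (α 0)) (λ k -> α (suc k)) x y
   closed : Closed Φ
   closed α x y ne = let (n , h) = fst (snd (a (α 0))) (λ k -> α (suc k)) x y ne in
    suc n , λ β x' y' e nx ny φ -> h (λ k -> β (suc k)) x' y' (λ k lt -> e (suc k) (s≤s lt)) (n-mono {n} nx) (n-mono {n} ny)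
     (subst (λ i -> fst (a i) (λ k -> β (suc k)) x' y') (e 0 (s≤s z≤n)) φ)
   to : ∀ x y -> ∃[ n ] E n x y -> ∃[ α ] Φ α x y
   to x y (n , e) = let (α , φ) = fst (snd (snd (a n)) x y) e in (λ { zero -> n ; (suc k) -> α k }) , φ
   from : ∀ x y -> ∃[ α ] Φ α x y -> ∃[ n ] E n x y
   from x y (α , φ) = α 0 , snd (snd (snd (a (α 0))) x y) ((λ k -> α (suc k)) , φ)

  pair : ℕ -> ℕ -> ℕ
  pair n k = fst (unpair-surj n k)

  bounded : ∀ (f : ℕ -> ℕ) m -> ∃[ N ] m ≤ N × (∀ k -> k < m -> f k < N)
  bounded f zero = 0 , z≤n , λ k ()
  bounded f (suc m) = let (N , m≤ , h) = bounded f m in suc (N ⊔ f m) , s≤s (m≤ » m≤m⊔n N (f m)) , λ k -> λ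
   { (s≤s k≤) -> case m≤n⇒m<n∨m≡n k≤ of λ { (inj₁ lt) -> h k lt » m≤m⊔n N (f m) » n≤1+n _ ; (inj₂ refl) -> s≤s (m≤n⊔m N (f m)) } }

  -- One point of Baire space codes a sequence of witnesses through the pairing. A neighbourhood
  -- only reads finitely many terms of one of them, and `bounded` finds the initial segment that
  -- contains these.
  an-∀ : ∀ {E : ℕ -> X -> X -> Set} -> (∀ n -> Analytic (E n)) -> Analytic (λ x y -> ∀ n -> E n x y)
  an-∀ {E} a = Φ , closed , λ x y -> to x y , from x y
   where
   Φ : Rel₂
   Φ α x y = ∀ n -> fst (a n) (λ k -> α (pair n k)) x y
   closed : Closed Φ
   closed α x y ne = let (n , nφ) = ¬∀⇒∃¬ ne ; (m , h) = fst (snd (a n)) (λ k -> α (pair n k)) x y nφ ; (N , m≤ , f) = bounded (pair n) m in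
    N , λ β x' y' e nx ny φ -> h (λ k -> β (pair n k)) x' y' (λ k lt -> e (pair n k) (f k lt)) (near-≤ m≤ nx) (near-≤ m≤ ny) (φ n)
   to : ∀ x y -> (∀ n -> E n x y) -> ∃[ α ] Φ α x y
   to x y e = α , λ n -> closed-resp (fst (snd (a n))) (λ k -> α (pair n k)) (fst (names n)) x y (λ k -> sym (code n k)) (snd (names n))
    where
    names : ∀ n -> ∃[ α ] fst (a n) α x y
    names n = fst (snd (snd (a n)) x y) (e n)
    α : ℕ -> ℕ
    α j = fst (names (fst (unpair j))) (snd (unpair j))
    code : ∀ n k -> α (pair n k) ≡ fst (names n) k
    code n k = cong (λ p -> fst (names (fst p)) (snd p)) (snd (unpair-surj n k))
   from : ∀ x y -> ∃[ α ] Φ α x y -> ∀ n -> E n x y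
   from x y (α , φ) n = snd (snd (snd (a n)) x y) ((λ k -> α (pair n k)) , φ n)

  an-× : ∀ {E F} -> Analytic E -> Analytic F -> Analytic (λ x y -> E x y × F x y)
  an-× {E} {F} a b = an-resp {λ x y -> ∀ n -> Pick n x y} (λ x y h -> h 0 , h 1) (λ x y (e , f) -> λ { zero -> e ; (suc _) -> f }) (an-∀ λ { zero -> a ; (suc _) -> b })
   where
   Pick : ℕ -> X -> X -> Set
   Pick zero = E
   Pick (suc _) = F

  an-⊎ : ∀ {E F} -> Analytic E -> Analytic F -> Analytic (λ x y -> E x y ⊎ F x y)
  an-⊎ {E} {F} a b = an-resp {λ x y -> ∃[ n ] Pick n x y} (λ { x y (zero , e) -> inj₁ e ; x y (suc _ , f) -> inj₂ f })
   (λ { x y (inj₁ e) -> 0 , e ; x y (inj₂ f) -> 1 , f }) (an-∃ λ { zero -> a ; (suc _) -> b })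
   where
   Pick : ℕ -> X -> X -> Set
   Pick zero = E
   Pick (suc _) = F

  -- Both the relation and its complement are analytic. This is stable under complements and
  -- countable unions, so that induction along a σ-algebra reaches all Borel relations.
  Bi : (X -> X -> Set) -> Set₁
  Bi E = Analytic E × Analytic (λ x y -> ¬ E x y)

  bi-¬ : ∀ {E} -> Bi E -> Bi (λ x y -> ¬ E x y)
  bi-¬ (a , b) = b , an-resp (λ x y e n -> n e) (λ x y -> byContra) a

  bi-∃ : ∀ {E : ℕ -> X -> X -> Set} -> (∀ n -> Bi (E n)) -> Bi (λ x y -> ∃[ n ] E n x y)
  bi-∃ h = an-∃ (λ n -> fst (h n)) , an-resp (λ x y f (n , e) -> f n e) (λ x y f n e -> f (n , e)) (an-∀ λ n -> snd (h n))

  bi-resp : ∀ {E F} -> (∀ x y -> E x y -> F x y) -> (∀ x y -> F x y -> E x y) -> Bi E -> Bi F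
  bi-resp f g (a , b) = an-resp f g a , an-resp (λ x y n e -> n (g x y e)) (λ x y n e -> n (f x y e)) b

  bi-⊥ : Bi (λ _ _ -> ⊥)
  bi-⊥ = an-closed (λ x y _ -> 0 , λ _ _ _ _ e -> e) , an-closed (λ x y n -> ⊥-elim (n λ e -> e))

  bi-open : ∀ {U} -> IsOpen d U -> Bi (λ x _ -> U x)
  bi-open {U} o = an-resp {λ x y -> ∃[ n ] Inner n x} (λ x y (n , h) -> h x (n-refl n x)) (λ x y u -> open⇒near o x u) (an-∃ λ n -> an-closed (closed n)) ,
    an-closed λ x y nn -> let (n , h) = open⇒near o x (byContra nn) in n , λ x' _ nx _ nu -> nu (h x' nx)
   where
   Inner : ℕ -> X -> Set
   Inner n x = ∀ z -> Near n x z -> U z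
   closed : ∀ n x (y : X) -> ¬ Inner n x -> ∃[ m ] ∀ x' y' -> Near m x x' -> Near m y y' -> ¬ Inner n x'
   closed n x _ ni = let (z , nz) = ¬∀⇒∃¬ ni ; xz = byContra (λ f -> nz λ h -> ⊥-elim (f h)) ; (m , h) = n-open (n-sym {n} xz) in
    m , λ x' _ nx _ inn -> nz λ _ -> inn z (n-sym {n} (h x' nx))

  bi-borel : ∀ {U} -> Bor U -> Bi (λ x _ -> U x)
  bi-borel (generator o) = bi-open o
  bi-borel empty = bi-⊥
  bi-borel (complement b) = bi-¬ (bi-borel b)
  bi-borel (union U h) = bi-∃ λ n -> bi-borel (h n)
  bi-borel (respects (f , g) b) = bi-resp (λ x _ -> f) (λ x _ -> g) (bi-borel b)

  bi-flip : ∀ {E} -> Bi E -> Bi (λ x y -> E y x)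
  bi-flip (a , b) = an-flip a , an-flip b

  bi-× : ∀ {E F} -> Bi E -> Bi F -> Bi (λ x y -> E x y × F x y)
  bi-× (a , a') (b , b') = an-× a b , an-resp (λ { x y (inj₁ n) (e , _) -> n e ; x y (inj₂ n) (_ , f) -> n f })
   (λ x y n -> byContra λ m -> m (inj₁ λ e -> m (inj₂ λ f -> n (e , f)))) (an-⊎ a' b')

  -- A scheme refines a set along the tree of finite sequences so that every branch of nonempty
  -- pieces shrinks to a point of the set.
  Piece : Rel₂ -> List ℕ -> (ℕ -> ℕ) -> X -> X -> Set
  Piece Φ [] α x y = ⊤
  Piece Φ (c ∷ u) α x y = α (length u) ≡ fst (unpair c) × Near (length u) (pts (fst (unpair (snd (unpair c))))) x ×
   Near (length u) (pts (snd (unpair (snd (unpair c))))) y × Piece Φ u α x y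

  prefix : (ℕ -> ℕ) -> ℕ -> List ℕ
  prefix γ zero = []
  prefix γ (suc n) = γ n ∷ prefix γ n

  length-prefix : ∀ γ n -> length (prefix γ n) ≡ n
  length-prefix γ zero = refl
  length-prefix γ (suc n) = cong suc (length-prefix γ n)

  module Scheme {E : X -> X -> Set} (a : Analytic E) where
   private
    Φ = fst a
    closed = fst (snd a)

   Cell : List ℕ -> X -> Set
   Cell u x = ∃[ α ] ∃[ y ] Φ α x y × Piece Φ u α x y

   cell-root : ∀ x y -> E x y -> Cell [] x
   cell-root x y e = let (α , φ) = fst (snd (snd a) x y) e in α , y , φ , tt

   cell-split : ∀ u x -> Cell u x -> ∃[ c ] Cell (c ∷ u) x
   cell-split u x (α , y , φ , p) = let
    (i , ni) = dense x (length u) ; (j , nj) = dense y (length u)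
    (ij , e) = unpair-surj i j ; (c , e') = unpair-surj (α (length u)) ij
    e₂ = cong (unpair ∘ snd) e' ∙ e
    in c , α , y , φ , sym (cong fst e') , subst (λ k -> Near (length u) (pts k) x) (sym (cong fst e₂)) (n-sym {length u} ni) ,
     subst (λ k -> Near (length u) (pts k) y) (sym (cong snd e₂)) (n-sym {length u} nj) , p

   module Branch (γ : ℕ -> ℕ) (inhabited : ∀ n -> ∃[ x ] Cell (prefix γ n) x) where
    private
     α : ℕ -> ℕ
     α n = fst (unpair (γ n))
     p q : ℕ -> X
     p n = pts (fst (unpair (snd (unpair (γ n)))))
     q n = pts (snd (unpair (snd (unpair (γ n)))))

     at : ∀ n {β x y} k -> k < n -> Piece Φ (prefix γ n) β x y -> β k ≡ α k × Near k (p k) x × Near k (q k) y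
     at (suc n) {β} k (s≤s k≤) (e , nx , ny , rest) with m≤n⇒m<n∨m≡n k≤
     ... | inj₁ lt = at n k lt rest
     ... | inj₂ refl = cong β (sym (length-prefix γ n)) ∙ e , subst (λ m -> Near m (p n) _) (length-prefix γ n) nx , subst (λ m -> Near m (q n) _) (length-prefix γ n) ny

     step : ∀ (r : ℕ -> X) -> (∀ n -> ∃[ z ] ∀ k -> k < n -> Near k (r k) z) -> Σ[ x ∈ X ] ∀ n -> Near n (r (suc (suc (suc n)))) x
     step r h = n-complete (λ n -> r (suc n)) λ n -> let (z , f) = h (suc (suc (suc n))) in
      n-tri {n} (f (suc n) (s≤s (n≤1+n _))) (n-sym {suc n} (n-mono {suc n} (f (suc (suc n)) ≤-refl)))

     limx = step p λ n -> let (x , β , y , _ , pc) = inhabited n in x , λ k lt -> fst (snd (at n {β} {x} {y} k lt pc))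
     limy = step q λ n -> let (x , β , y , _ , pc) = inhabited n in y , λ k lt -> snd (snd (at n {β} {x} {y} k lt pc))

    point : X
    point = fst limx

    private
     close : ∀ (r : ℕ -> X) x -> (∀ n -> Near n (r (suc (suc (suc n)))) x) -> ∀ n {z} -> (∀ k -> k < suc (suc (suc (suc (suc n)))) -> Near k (r k) z) -> Near n x z
     close r x h n f = n-tri {n} (n-sym {suc n} (h (suc n))) (near-≤ (s≤s (n≤1+n n » n≤1+n _ » n≤1+n _)) (f (suc (suc (suc (suc n)))) ≤-refl))

    -- The limit is compared with the centre number n + 4, and a piece of depth n + 5 is the first
    -- to control this centre.
    shrinks : ∀ n x -> Cell (prefix γ (5 + n)) x -> Near n point x
    shrinks n x (β , y , _ , pc) = close p point (snd limx) n λ k lt -> fst (snd (at (5 + n) {β} {x} {y} k lt pc))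

    point-in : ∃[ y ] E point y
    point-in = y , snd (snd (snd a) point y) (α , byContra λ nφ -> let
      (n , h) = closed α point y nφ ; (x' , β , y' , φ , pc) = inhabited (5 + n)
      get = λ k lt -> at (5 + n) {β} {x'} {y'} k lt pc
     in h β x' y' (λ k lt -> fst (get k (lt » m≤n+m n 5))) (shrinks n x' (β , y' , φ , pc)) (close q y (snd limy) n λ k lt -> snd (snd (get k lt))) φ)
     where
     y = fst limy

 -- Novikov separation, and Borel functions through finite sections.

 module Uniformization {X : Set} {d : X -> X -> ℝ} (Sp : Space X d) where
  open Space Sp
  open Analytic Sp
  open Logic sys using (Pt; pt-id; pt-∘; b-≡; b-∃; b-∀; b-×; b-⊎; b-→; b-¬; b-⊤; b-const; b-resp)

  module Separation (K : ℕ) where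

   -- Borel hulls without a common point; for two sets this is separation in Lusin's sense.
   Sep : (Fin K -> X -> Set) -> Set₁
   Sep F = Σ[ H ∈ (Fin K -> X -> Set) ] (∀ i -> Bor (H i)) × (∀ i x -> F i x -> H i x) × ¬ (∃[ x ] ∀ i -> H i x)

   sep-mono : ∀ {F F'} -> (∀ i x -> F' i x -> F i x) -> Sep F -> Sep F'
   sep-mono h (H , b , s , e) = H , b , (λ i x f -> s i x (h i x f)) , e

   replace : (Fin K -> X -> Set) -> Fin K -> (X -> Set) -> Fin K -> X -> Set
   replace F j U i with dec (i ≡ j)
   ... | yes _ = U
   ... | no _ = F i

   replace-to : ∀ F j U x -> U x -> replace F j U j x
   replace-to F j U x h with dec (j ≡ j)
   ... | yes _ = h
   ... | no n = ⊥-elim (n refl)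

   replace-other : ∀ F j U i x -> i ≢ j -> F i x -> replace F j U i x
   replace-other F j U i x ne h with dec (i ≡ j)
   ... | yes e = ⊥-elim (ne e)
   ... | no _ = h

   -- When each piece of the j-th set can be separated, take the union of the hulls at j and their
   -- intersection at every other index.
   sep-split : ∀ F j (G : ℕ -> X -> Set) -> (∀ x -> F j x -> ∃[ c ] G c x) -> (∀ c -> Sep (replace F j (G c))) -> Sep F
   sep-split F j G cov s = H , bH , sub , empty'
    where
    h : ℕ -> Fin K -> X -> Set
    h c = fst (s c)
    H : Fin K -> X -> Set
    H i x = (i ≡ j -> ∃[ c ] h c j x) × (i ≢ j -> ∀ c -> h c i x)
    bH : ∀ i -> Bor (H i)
    bH i = b-× (b-→ (b-const (i ≡ j)) (b-∃ enum-ℕ λ c -> fst (snd (s c)) j)) (b-→ (b-const (i ≢ j)) (b-∀ enum-ℕ λ c -> fst (snd (s c)) i))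
    sub : ∀ i x -> F i x -> H i x
    sub i x f = (λ { refl -> let (c , g) = cov x f in c , fst (snd (snd (s c))) i x (replace-to F i (G c) x g) }) ,
     λ ne c -> fst (snd (snd (s c))) i x (replace-other F j (G c) i x ne f)
    empty' : ¬ (∃[ x ] ∀ i -> H i x)
    empty' (x , all) = let (c , hc) = fst (all j) refl in snd (snd (snd (s c))) (x , λ i -> cases (i ≡ j)
     (λ e -> subst (λ i -> h c i x) (sym e) hc) (λ ne -> snd (all i) ne c))

   refine : ∀ F (G : Fin K -> ℕ -> X -> Set) -> (∀ i x -> F i x -> ∃[ c ] G i c x) -> ¬ Sep F -> ∃[ c ] ¬ Sep (λ i -> G i (c i))
   refine F G cov ns = let (c , n) = go (allFin K) in c , λ s -> n (sep-mono (λ i x h -> fst h (∈-allFin i)) s)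
    where
    Mix : List (Fin K) -> (Fin K -> ℕ) -> Fin K -> X -> Set
    Mix js c i x = (i ∈ js -> G i (c i) x) × (i ∉ js -> F i x)
    go : ∀ js -> ∃[ c ] ¬ Sep (Mix js c)
    go [] = (λ _ -> 0) , λ s -> ns (sep-mono (λ i x f -> (λ ()) , λ _ -> f) s)
    go (j ∷ js) = let (c , n) = go js in cases (j ∈ js)
     (λ j∈ -> c , λ s -> n (sep-mono (λ i x (g , f) -> (λ { (here refl) -> g j∈ ; (there m) -> g m }) , λ i∉ -> f (i∉ ∘ there)) s))
     (λ j∉ -> let (m , nm) = ¬∀⇒∃¬ {P = λ m -> Sep (replace (Mix js c) j (G j m))} (λ all -> n (sep-split (Mix js c) j (G j) (λ x h -> cov j x (snd h j∉)) all)) in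
      upd c j m , λ s -> nm (sep-mono (λ i x -> new c m i x) s))
     where
     upd : (Fin K -> ℕ) -> Fin K -> ℕ -> Fin K -> ℕ
     upd c j m i with dec (i ≡ j)
     ... | yes _ = m
     ... | no _ = c i
     new : ∀ c m i x -> replace (Mix js c) j (G j m) i x -> Mix (j ∷ js) (upd c j m) i x
     new c m i x h with dec (i ≡ j)
     ... | yes refl = (λ _ -> h) , λ n -> ⊥-elim (n (here refl))
     ... | no ne = (λ { (here e) -> ⊥-elim (ne e) ; (there m') -> fst h m' }) , λ n -> snd h (n ∘ there)

   -- Otherwise `refine` produces K branches of cells that never become separable. Their limits
   -- coincide, since disjoint balls around two different limits would separate the cells, and the
   -- common limit lies in all the sets.
   separate : ∀ {E : Fin K -> X -> X -> Set} -> (∀ i -> Analytic (E i)) -> 1 ≤ K -> ¬ (∃[ x ] ∀ i -> ∃[ y ] E i x y) -> Sep (λ i x -> ∃[ y ] E i x y)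
   separate {E} a 0<K disjoint = byContra λ ns -> contra (λ s -> ns (sep-mono (λ i x (y , e) -> Scheme.cell-root (a i) x y e) s))
    where
    C : Fin K -> List ℕ -> X -> Set
    C i = Scheme.Cell (a i)
    contra : ¬ Sep (λ i -> C i []) -> ⊥
    contra ns = disjoint (point i₀ , λ i -> subst (λ x -> ∃[ y ] E i x y) (byContra (apart i)) (Scheme.Branch.point-in (a i) (γ i) (inhabited i)))
     where
     State : Set₁
     State = Σ[ u ∈ (Fin K -> List ℕ) ] ¬ Sep (λ i -> C i (u i))
     next : (s : State) -> ∃[ c ] ¬ Sep (λ i -> C i (c i ∷ fst s i))
     next (u , n) = refine (λ i -> C i (u i)) (λ i c -> C i (c ∷ u i)) (λ i x -> Scheme.cell-split (a i) (u i) x) n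
     state : ℕ -> State
     state zero = (λ _ -> []) , ns
     state (suc n) = (λ i -> fst (next (state n)) i ∷ fst (state n) i) , snd (next (state n))
     γ : Fin K -> ℕ -> ℕ
     γ i n = fst (next (state n)) i
     path : ∀ i n -> fst (state n) i ≡ prefix (γ i) n
     path i zero = refl
     path i (suc n) = cong (γ i n ∷_) (path i n)
     inhabited : ∀ i n -> ∃[ x ] C i (prefix (γ i) n) x
     inhabited i n = byContra λ none -> snd (state n) ((λ j x -> i ≢ j) , (λ j -> b-const (i ≢ j)) ,
      (λ j x c e -> none (x , subst (λ u -> C i u x) (path i n) (subst (λ j -> C j (fst (state n) j) x) (sym e) c))) , λ (x , all) -> all i refl)
     point : Fin K -> X
     point i = Scheme.Branch.point (a i) (γ i) (inhabited i)
     i₀ : Fin K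
     i₀ = fromℕ< 0<K
     apart : ∀ i -> point i ≢ point i₀ -> ⊥
     apart i ne = let (n , far) = ¬∀⇒∃¬ {P = λ n -> Near n (point i) (point i₀)} (λ all -> ne (n-eq all)) in
      snd (state (5 + suc n)) (H n , (λ j -> b-× (b-→ (b-const (j ≡ i)) (generator (ball n (point i)))) (b-→ (b-const (j ≡ i₀)) (generator (ball n (point i₀))))) ,
       (λ j x c -> (λ { refl -> shrink j n x c }) , (λ { refl -> shrink j n x c })) ,
       λ (x , all) -> far (n-tri {n} (fst (all i) refl) (n-sym {suc n} (snd (all i₀) refl))))
      where
      ball : ∀ n x -> IsOpen d (Near (suc n) x)
      ball n x = near⇒open λ y h -> n-open h
      H : ℕ -> Fin K -> X -> Set
      H n j x = (j ≡ i -> Near (suc n) (point i) x) × (j ≡ i₀ -> Near (suc n) (point i₀) x)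
      shrink : ∀ j n x -> C j (fst (state (5 + suc n)) j) x -> Near (suc n) (point j) x
      shrink j n x c = Scheme.Branch.shrinks (a j) (γ j) (inhabited j) (suc n) x (subst (λ u -> C j u x) (path j (5 + suc n)) c)

  Index : Set
  Index = ℕ × ℕ

  enum-Index : Enum Index
  enum-Index = enum-× enum-ℕ enum-ℕ

  nth : List Index -> ℕ -> Index
  nth [] _ = 0 , 0
  nth (b ∷ l) zero = b
  nth (b ∷ l) (suc n) = nth l n

  nth-∈ : ∀ l n -> n < length l -> nth l n ∈ l
  nth-∈ (b ∷ l) zero lt = here refl
  nth-∈ (b ∷ l) (suc n) (s≤s lt) = there (nth-∈ l n lt)

  Disjoint : Index -> Index -> Set
  Disjoint b c = ∀ z -> Ball b z -> ¬ Ball c z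

  nth-pairs : ∀ l m n -> AllPairs Disjoint l -> m < n -> n < length l -> Disjoint (nth l m) (nth l n)
  nth-pairs (b ∷ l) zero (suc n) (ds ∷ _) _ (s≤s lt) = All-∈ ds (nth-∈ l n lt)
  nth-pairs (b ∷ l) (suc m) (suc n) (_ ∷ ps) (s≤s m<n) (s≤s lt) = nth-pairs l m n ps m<n lt

  -- Relations with at most Δ points in each section: Borel functions through every point.
  module Bounded (E : X -> X -> Set) (bi : Bi E) (Δ : ℕ) (thin : ∀ x (L : List X) -> Unique L -> All (E x) L -> length L ≤ Δ) where

   private
    Eb : Index -> X -> X -> Set
    Eb b x y = E x y × Ball b y

    Eb-an : ∀ b -> Analytic (Eb b)
    Eb-an b = an-× (fst bi) (an-flip (fst (bi-open (ball-open b))))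

    open Separation (suc Δ)

    thin' : ∀ l -> AllPairs Disjoint l -> length l ≡ suc Δ -> ¬ (∃[ x ] ∀ (i : Fin (suc Δ)) -> ∃[ y ] Eb (nth l (toℕ i)) x y)
    thin' l ap len (x , h) = 1+n≰n (from≡ (sym (List.length-map pt (allFin (suc Δ)) ∙ List.length-tabulate id))
      » (thin x (map pt (allFin (suc Δ))) (Uniq.map⁺ inj (Uniq.allFin⁺ (suc Δ)))
       (All-tab (map pt (allFin (suc Δ))) λ y m -> let (i , _ , e) = Mem.∈-map⁻ pt m in subst (E x) (sym e) (fst (snd (h i))))))
     where
     pt : Fin (suc Δ) -> X
     pt i = fst (h i)
     clash : ∀ i j -> toℕ i < toℕ j -> pt i ≢ pt j
     clash i j lt e = nth-pairs l (toℕ i) (toℕ j) ap lt (toℕ<n j » from≡ (sym len)) (pt i) (snd (snd (h i)))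
      (subst (Ball (nth l (toℕ j))) (sym e) (snd (snd (h j))))
     inj : ∀ {i j} -> pt i ≡ pt j -> i ≡ j
     inj {i} {j} e = byContra λ ne -> case ≤-total (toℕ i) (toℕ j) of λ
      { (inj₁ le) -> case m≤n⇒m<n∨m≡n le of λ { (inj₁ lt) -> clash i j lt e ; (inj₂ q) -> ne (toℕ-injective q) }
      ; (inj₂ le) -> case m≤n⇒m<n∨m≡n le of λ { (inj₁ lt) -> clash j i lt (sym e) ; (inj₂ q) -> ne (sym (toℕ-injective q)) } }

    Full : List Index -> Set
    Full l = AllPairs Disjoint l × length l ≡ suc Δ

    hull : ∀ l -> Full l -> Sep (λ i x -> ∃[ y ] Eb (nth l (toℕ i)) x y)
    hull l (ap , len) = separate (λ i -> Eb-an (nth l (toℕ i))) (s≤s z≤n) (thin' l ap len)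

    hullAt : ∀ l -> Dec (Full l) -> Fin (suc Δ) -> X -> Set
    hullAt l (yes f) i x = fst (hull l f) i x
    hullAt l (no _) i x = ⊤

    b-hullAt : ∀ l D i -> Bor (hullAt l D i)
    b-hullAt l (yes f) i = fst (snd (hull l f)) i
    b-hullAt l (no _) i = b-⊤

    hullAt-⊇ : ∀ l D i x y -> Eb (nth l (toℕ i)) x y -> hullAt l D i x
    hullAt-⊇ l (yes f) i x y e = fst (snd (snd (hull l f))) i x (y , e)
    hullAt-⊇ l (no _) i x y e = tt

    hullAt-∅ : ∀ l D -> Full l -> ∀ x -> ¬ (∀ i -> hullAt l D i x)
    hullAt-∅ l (yes f) _ x all = snd (snd (snd (hull l f))) (x , all)
    hullAt-∅ l (no n) f x all = n f

    -- A Borel set containing each x whose section meets the ball b. Intersecting over all the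
    -- places where b occurs in a list of Δ + 1 disjoint balls ensures that no x lies in the hulls
    -- of Δ + 1 disjoint balls.
    Hull : Index -> X -> Set
    Hull b x = ∀ l i -> nth l (toℕ i) ≡ b -> hullAt l (dec (Full l)) i x

    b-Hull : ∀ b -> Bor (Hull b)
    b-Hull b = b-∀ (enum-List enum-Index) λ l -> b-∀ (enum-Fin (suc Δ)) λ i -> b-→ (b-const (nth l (toℕ i) ≡ b)) (b-hullAt l (dec (Full l)) i)

    hull-⊇ : ∀ b x y -> E x y -> Ball b y -> Hull b x
    hull-⊇ b x y e yb l i refl = hullAt-⊇ l (dec (Full l)) i x y (e , yb)

    hull-thin : ∀ x l -> AllPairs Disjoint l -> All (λ b -> Hull b x) l -> length l ≢ suc Δ
    hull-thin x l ap all len = hullAt-∅ l (dec (Full l)) (ap , len) x λ i -> All-∈ all (nth-∈ l (toℕ i) (toℕ<n i » from≡ (sym len))) l i refl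

    Sub : Index -> Index -> Set
    Sub c b = ∀ z -> Ball c z -> Ball b z

    Wide : Index -> X -> Set
    Wide (i , n) z = Near n (pts i) z

    -- Inside b the hulls single out one point: x lies in hulls of arbitrarily small balls, and any
    -- two such balls nearly meet. The condition mentions only countably many Borel sets, so the
    -- limit is a Borel function of x.
    Cauchy : Index -> X -> Set
    Cauchy b x = (∀ n -> ∃[ c ] n ≤ snd c × Sub c b × Hull c x) ×
     (∀ c c' -> Sub c b -> Sub c' b -> Hull c x -> Hull c' x -> ∃[ z ] Wide c z × Wide c' z)

    b-Cauchy : ∀ b -> Bor (Cauchy b)
    b-Cauchy b = b-× (b-∀ enum-ℕ λ n -> b-∃ enum-Index λ c -> b-× (b-const _) (b-× (b-const _) (b-Hull c)))
     (b-∀ enum-Index λ c -> b-∀ enum-Index λ c' -> b-→ (b-const _) (b-→ (b-const _) (b-→ (b-Hull c) (b-→ (b-Hull c') (b-const _)))))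

    module Limit (b : Index) (x : X) (g : Cauchy b x) where
     c : ℕ -> Index
     c n = fst (fst g n)
     c-deep : ∀ n -> n ≤ snd (c n)
     c-deep n = fst (snd (fst g n))
     c-sub : ∀ n -> Sub (c n) b
     c-sub n = fst (snd (snd (fst g n)))
     c-hull : ∀ n -> Hull (c n) x
     c-hull n = snd (snd (snd (fst g n)))
     centre : ℕ -> X
     centre n = pts (fst (c n))

     near-centre : ∀ e -> Sub e b -> Hull e x -> ∀ m n -> m < snd e -> m < n -> Near m (pts (fst e)) (centre n)
     near-centre e sub h m n me mn = let (z , w , w') = snd g e (c n) sub (c-sub n) h (c-hull n) in
      n-tri {m} (near-≤ me w) (n-sym {suc m} (near-≤ (mn » c-deep n) w'))

     limit = n-complete (λ n -> centre (suc n)) λ n -> near-centre (c (suc n)) (c-sub (suc n)) (c-hull (suc n)) n (suc (suc n)) (c-deep (suc n)) (s≤s (n≤1+n n))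

     point : X
     point = fst limit

     near-point : ∀ e -> Sub e b -> Hull e x -> ∀ m -> suc m < snd e -> Near m (pts (fst e)) point
     near-point e sub h m me = n-tri {m} (near-centre e sub h (suc m) (suc (suc (suc (suc m)))) me (s≤s (s≤s (n≤1+n m » n≤1+n _)))) (snd limit (suc m))

   pick : Index -> X -> X
   pick b x with dec (Cauchy b x)
   ... | yes g = Limit.point b x g
   -- The default makes `pick b` total and is Borel as the identity.
   ... | no _ = x

   private
    pick-open : ∀ b U -> IsOpen d U -> Bor (λ x -> U (pick b x))
    pick-open b U o = b-resp to from
     (b-⊎ (b-× (b-Cauchy b) (b-∃ (enum-× enum-Index enum-ℕ) λ (e , m) -> b-× (b-const (suc m < snd e × Sub e b × (∀ z -> Near m (pts (fst e)) z -> U z))) (b-Hull e)))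
      (b-× (b-¬ (b-Cauchy b)) (generator o)))
     where
     Deep : X -> Set
     Deep x = Cauchy b x × ∃[ em ] (suc (snd em) < snd (fst em) × Sub (fst em) b × (∀ z -> Near (snd em) (pts (fst (fst em))) z -> U z)) × Hull (fst em) x
     to : ∀ x -> Deep x ⊎ (¬ Cauchy b x × U x) -> U (pick b x)
     to x h with dec (Cauchy b x)
     to x (inj₁ (_ , (e , m) , (lt , sub , inU) , he)) | yes g = inU _ (Limit.near-point b x g e sub he m lt)
     to x (inj₂ (n , _)) | yes g = ⊥-elim (n g)
     to x (inj₁ (g , _)) | no n = ⊥-elim (n g)
     to x (inj₂ (_ , u)) | no n = u
     from : ∀ x -> U (pick b x) -> Deep x ⊎ (¬ Cauchy b x × U x)
     from x u with dec (Cauchy b x)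
     ... | no n = inj₂ (n , u)
     ... | yes g = let
       open Limit b x g
       (N , h) = open⇒near o point u
       n = suc (suc (suc N))
      in inj₁ (g , (c n , suc N) , (c-deep n , c-sub n , λ z nz -> h z (n-tri {N} (n-sym {suc N} (near-point' N)) nz)) , c-hull n)
      where
      near-point' : ∀ N -> Near (suc N) (Limit.centre b x g (suc (suc (suc N)))) (Limit.point b x g)
      near-point' N = let open Limit b x g in near-point (c (suc (suc (suc N)))) (c-sub _) (c-hull _) (suc N) (c-deep _)

   pick-pt : ∀ b -> Pt (pick b)
   pick-pt b (generator {U} o) = pick-open b U o
   pick-pt b empty = empty
   pick-pt b (complement h) = complement (pick-pt b h)
   pick-pt b (union U h) = union (λ n x -> U n (pick b x)) λ n -> pick-pt b (h n)
   pick-pt b (respects (f , g) h) = respects ((λ {x} -> f) , (λ {x} -> g)) (pick-pt b h)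

   private
    inside : ∀ b y -> Ball b y -> ∀ n -> ∃[ c ] n ≤ snd c × Sub c b × Ball c y × (∀ z -> Ball c z -> Near n y z)
    inside b y yb n = let
      (N , h) = open⇒near (ball-open b) y yb ; m = n ⊔ N ; (i , ni) = dense y (suc m)
      close = λ z (nz : Near (suc m) (pts i) z) -> n-tri {m} ni nz
     in (i , m) , m≤m⊔n n N , (λ z nz -> h z (near-≤ (m≤n⊔m n N) (close z nz))) , n-sym {suc m} ni , λ z nz -> near-≤ (m≤m⊔n n N) (close z nz)

    Chain : X -> X -> ℕ -> Set
    Chain x y k = ∃[ b ] ∃[ l ] length l ≡ k × Ball b y × AllPairs Disjoint (b ∷ l) × All (λ b -> Hull b x) (b ∷ l)

    longest : ∀ x y -> E x y -> ∃[ k ] Chain x y k × ¬ Chain x y (suc k)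
    longest x y e = byContra λ none -> up none Δ
     where
     start : Chain x y 0
     start = let (i , ni) = dense y 1 in (i , 0) , [] , refl , n-sym {1} ni , [] ∷ [] , hull-⊇ (i , 0) x y e (n-sym {1} ni) ∷ []
     up : ¬ (∃[ k ] Chain x y k × ¬ Chain x y (suc k)) -> ∀ k -> ⊥
     up none _ = let (b , l , len , _ , ap , all) = all-chains Δ in hull-thin x (b ∷ l) ap all (cong suc len)
      where
      all-chains : ∀ k -> Chain x y k
      all-chains zero = start
      all-chains (suc k) = byContra λ nc -> none (k , all-chains k , nc)

    disjoint-sub : ∀ {c b e} -> Sub c b -> Disjoint b e -> Disjoint c e
    disjoint-sub s dj z zc ze = dj z (s z zc) ze

   -- Choose a ball b around y with the longest list of further disjoint balls whose hulls contain
   -- x; `hull-thin` bounds the length. A ball inside b with x in its hull but away from y would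
   -- lengthen the list after shrinking b around y, so b is Cauchy with limit y.
   pick-all : ∀ x y -> E x y -> ∃[ b ] pick b x ≡ y
   pick-all x y e = use (longest x y e)
    where
    is-cauchy : ∀ k b l -> length l ≡ k -> Ball b y -> All (Disjoint b) l -> AllPairs Disjoint l -> All (λ b -> Hull b x) l -> ¬ Chain x y (suc k) -> Cauchy b x
    is-cauchy k b l len yb dj ap hl top = (λ n -> let (c , deep , sub , yc , _) = inside b y yb n in c , deep , sub , hull-⊇ c x y e yc) , meet
     where
     extend : ∀ c -> Sub c b -> Hull c x -> ¬ Wide c y -> ⊥
     extend c sub hc ny = let (c' , deep , sub' , yc' , near') = inside b y yb (suc (snd c)) in
      top (c' , c ∷ l , cong suc len , yc' ,
       ((λ z zc' zc -> ny (n-tri {snd c} zc (n-sym {suc (snd c)} (near' z zc')))) ∷ All-tab l (λ e' m -> disjoint-sub sub' (All-∈ dj m))) ∷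
        All-tab l (λ e' m -> disjoint-sub sub (All-∈ dj m)) ∷ ap ,
       hull-⊇ c' x y e yc' ∷ hc ∷ hl)
     meet : ∀ c c' -> Sub c b -> Sub c' b -> Hull c x -> Hull c' x -> ∃[ z ] Wide c z × Wide c' z
     meet c c' s s' h h' = y , byContra (extend c s h) , byContra (extend c' s' h')
    use : ∃[ k ] Chain x y k × ¬ Chain x y (suc k) -> ∃[ b ] pick b x ≡ y
    finish : ∀ b -> Ball b y -> Cauchy b x -> pick b x ≡ y
    use (k , (b , l , len , yb , (dj ∷ ap) , (hb ∷ hl)) , top) = b , finish b yb (is-cauchy k b l len yb dj ap hl top)
    finish b yb g with dec (Cauchy b x)
    ... | no n = ⊥-elim (n g)
    ... | yes g' = n-eq λ N -> let (c , deep , sub , yc , _) = inside b y yb (suc (suc (suc N))) in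
      n-tri {N} (n-sym {suc N} (Limit.near-point b x g' c sub (hull-⊇ c x y e yc) (suc N) deep)) (near-≤ (n≤1+n _ » n≤1+n _ » n≤1+n _ » s≤s deep) yc)

 -- From walks to paths without repetition.

 module Paths {X : Set} (_~_ : Rel X 0ℓ) where

  data Trail : X -> X -> List X -> Set where
   stop : ∀ x -> Trail x x (x ∷ [])
   go : ∀ {x z y l} -> x ~ z -> Trail z y l -> Trail x y (x ∷ l)

  at : X -> List X -> ℕ -> X
  at d [] n = d
  at d (x ∷ l) zero = x
  at d (x ∷ l) (suc n) = at d l n

  suffix : ∀ {x z y l} -> Trail z y l -> Unique l -> x ∈ l -> ∃[ l' ] Trail x y l' × Unique l' × length l' ≤ length l
  suffix t@(stop _) u (here refl) = _ , t , u , ≤-refl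
  suffix t@(go _ _) u (here refl) = _ , t , u , ≤-refl
  suffix (go e t) (_ ∷ u) (there m) = let (l' , t' , u' , le) = suffix t u m in l' , t' , u' , le » n≤1+n _

  prepend : ∀ {x z y l} -> x ~ z -> Trail z y l -> Unique l -> ∃[ l' ] Trail x y l' × Unique l' × length l' ≤ suc (length l)
  prepend {x} {l = l} e t u = cases (x ∈ l)
   (λ m -> let (l' , t' , u' , le) = suffix t u m in l' , t' , u' , le » n≤1+n _)
   (λ n -> x ∷ l , go e t , All-tab l (λ w m q -> n (subst (_∈ l) (sym q) m)) ∷ u , ≤-refl)

  at-inj : ∀ d l -> Unique l -> ∀ i j -> i < length l -> j < length l -> at d l i ≡ at d l j -> i ≡ j
  at-inj d (x ∷ l) (nx ∷ u) zero zero _ _ e = refl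
  at-inj d (x ∷ l) (nx ∷ u) zero (suc j) _ (s≤s lt) e = ⊥-elim (All-∈ nx (at-∈ l j lt) e)
   where
   at-∈ : ∀ l j -> j < length l -> at d l j ∈ l
   at-∈ (x ∷ l) zero lt = here refl
   at-∈ (x ∷ l) (suc j) (s≤s lt) = there (at-∈ l j lt)
  at-inj d (x ∷ l) (nx ∷ u) (suc i) zero (s≤s lt) _ e = ⊥-elim (All-∈ nx (at-∈ l i lt) (sym e))
   where
   at-∈ : ∀ l j -> j < length l -> at d l j ∈ l
   at-∈ (x ∷ l) zero lt = here refl
   at-∈ (x ∷ l) (suc j) (s≤s lt) = there (at-∈ l j lt)
  at-inj d (x ∷ l) (nx ∷ u) (suc i) (suc j) (s≤s lt) (s≤s lt') e = cong suc (at-inj d l u i j lt lt' e)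

  trail-first : ∀ {x y l} d -> Trail x y l -> at d l 0 ≡ x
  trail-first d (stop x) = refl
  trail-first d (go _ _) = refl

  trail-last : ∀ {x y l} d k -> Trail x y l -> length l ≡ suc k -> at d l k ≡ y
  trail-last d zero (stop x) e = refl
  trail-last d (suc k) (go _ t) e = trail-last d k t (suc-injective e)
  trail-last d zero (go _ (stop _)) ()
  trail-last d zero (go _ (go _ _)) ()

  trail-edge : ∀ {x y l} d i -> Trail x y l -> suc i < length l -> at d l i ~ at d l (suc i)
  trail-edge d zero (go e t) lt = subst (_ ~_) (sym (trail-first d t)) e
  trail-edge d (suc i) (go e t) (s≤s lt) = trail-edge d i t lt
  trail-edge d i (stop x) (s≤s ())

  trail⇒path : ∀ {x y l} -> Trail x y l -> Unique l -> ∃[ k ] suc k ≡ length l × Path _~_ k x y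
  trail⇒path {x} {y} {l} t u with length l in e
  ... | zero = ⊥-elim (nonempty t e)
   where
   nonempty : ∀ {x y l} -> Trail x y l -> length l ≢ 0
   nonempty (stop _) ()
   nonempty (go _ _) ()
  ... | suc k = k , refl , (λ i -> at x l (toℕ i)) ,
     (λ {i} {j} q -> toℕ-injective (at-inj x l u (toℕ i) (toℕ j) (toℕ<n i » from≡ (sym e)) (toℕ<n j » from≡ (sym e)) q)) ,
     (λ i -> subst (λ n -> at x l n ~ at x l (suc (toℕ i))) (sym (Fin.toℕ-inject₁ i)) (trail-edge x (toℕ i) t (s≤s (toℕ<n i) » from≡ (sym e)))) ,
     trail-first x t , cong (at x l) (Fin.toℕ-fromℕ k) ∙ trail-last x k t e

 -- Ports and separating covers of a Borel graph.

 module Setup (G : BorelGraph) (Δ : ℕ) (maxDeg : FiniteMaxDegree G Δ) (asi-finite : FiniteAsi G) where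
  open BorelGraph G renaming (_~_ to infix 4 _~_)

  d : Carrier -> Carrier -> ℝ
  d = fst polish

  x₀ : Carrier
  x₀ = fst (snd maxDeg)

  Sp : Space Carrier d
  Sp = space (snd polish) x₀

  open Analytic Sp hiding (pair)
  open Logic sys hiding (X)

  toBor : ∀ {U} -> IsBorel U -> Bor U
  toBor {U} = Equivalence.to (IsPolish.generated (snd polish) U)

  fromBor : ∀ {U} -> Bor U -> IsBorel U
  fromBor {U} = Equivalence.from (IsPolish.generated (snd polish) U)

  bi₂ : ∀ {P} -> σ⟨ IsRectangle ⟩ P -> Bi (λ x y -> P (x , y))
  bi₂ (generator (rectangle a b)) = bi-× (bi-borel (toBor a)) (bi-flip (bi-borel (toBor b)))
  bi₂ empty = bi-⊥
  bi₂ (complement h) = bi-¬ (bi₂ h)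
  bi₂ (union U h) = bi-∃ λ n -> bi₂ (h n)
  bi₂ (respects (f , g) h) = bi-resp (λ x y -> f) (λ x y -> g) (bi₂ h)

  b₂ : ∀ {P g h} -> σ⟨ IsRectangle ⟩ P -> Pt g -> Pt h -> Borel (λ x -> P (g x , h x))
  b₂ (generator (rectangle a b)) mg mh = b-× (mg (toBor a)) (mh (toBor b))
  b₂ empty mg mh = b-const ⊥
  b₂ (complement p) mg mh = b-¬ (b₂ p mg mh)
  b₂ (union U p) mg mh = b-∃ enum-ℕ λ n -> b₂ (p n) mg mh
  b₂ (respects (f , f') p) mg mh = b-resp (λ x -> f) (λ x -> f') (b₂ p mg mh)

  N : Carrier -> List Carrier
  N x = fst (fst (snd (fst maxDeg x)))

  N-length : ∀ x -> length (N x) ≤ Δ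
  N-length x = from≡ (fst (snd (snd (fst (snd (fst maxDeg x)))))) » snd (snd (fst maxDeg x))

  ∈N : ∀ {x y} -> x ~ y -> y ∈ N x
  ∈N {x} {y} = Equivalence.from (snd (snd (snd (fst (snd (fst maxDeg x))))) y)

  open Uniformization Sp using (Index; enum-Index)
  private
   module LN = Uniformization.Bounded Sp _~_ (bi₂ borel) Δ (λ x L u a -> (unique-length u λ m -> ∈N (All-∈ a m)) » N-length x)

  abstract
   pick : Index -> Carrier -> Carrier
   pick = LN.pick

   pick-pt : ∀ b -> Pt (pick b)
   pick-pt = LN.pick-pt

   pick-all : ∀ x y -> x ~ y -> ∃[ b ] pick b x ≡ y
   pick-all = LN.pick-all

  b-~ : ∀ {g h} -> Pt g -> Pt h -> Borel (λ x -> g x ~ h x)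
  b-~ mg mh = b₂ borel mg mh

  -- A colouring proper up to distance two distinguishes the neighbours of each vertex, so that a
  -- colour names at most one neighbour; these names become the ports.
  Second : Carrier -> Carrier -> Set
  Second x y = x ≢ y × (x ~ y ⊎ (∃[ z ] x ~ z × z ~ y))

  second : Colouring.Relation sys
  second = record
   { I = Bool × Index × Index ; enum = enum-× enum-Bool (enum-× enum-Index enum-Index)
   ; fam = fam ; fam-pt = fam-pt ; _~_ = Second
   ; ~-sym = λ { (ne , inj₁ e) -> ne ∘ sym , inj₁ (symmetric e) ; (ne , inj₂ (z , e , e')) -> ne ∘ sym , inj₂ (z , symmetric e' , symmetric e) }
   ; ~-irrefl = λ (ne , _) -> ne refl
   ; ~-fam = fam-all
   ; b-~ = λ {g} {h} mg mh -> b-× (b-¬ (b-≡ mg mh)) (b-⊎ (b-~ mg mh) (b-resp (λ { x (b , e , e') -> pick b (g x) , e , e' })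
     (λ { x (z , e , e') -> let (b , q) = pick-all (g x) z e in b , subst (g x ~_) (sym q) e , subst (_~ h x) (sym q) e' })
     (b-∃ enum-Index λ b -> b-× (b-~ mg (λ u -> mg (pick-pt b u))) (b-~ (λ u -> mg (pick-pt b u)) mh))))
   ; nbrs = λ x -> N x ++ concatMap N (N x)
   ; ∈nbrs = λ { {x} (_ , inj₁ e) -> ∈-++⁺ˡ (∈N e) ; {x} (_ , inj₂ (z , e , e')) -> ∈-++⁺ʳ (N x) (∈-concatMap N (N x) (∈N e) (∈N e')) } }
   where
   fam : Bool × Index × Index -> Carrier -> Carrier
   fam (true , b , b') x = pick b' (pick b x)
   fam (false , b , _) x = pick b x
   fam-pt : ∀ i -> Pt (fam i)
   fam-pt (true , b , b') u = pick-pt b (pick-pt b' u)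
   fam-pt (false , b , _) u = pick-pt b u
   fam-all : ∀ {x y} -> Second x y -> ∃[ i ] fam i x ≡ y
   fam-all {x} {y} (_ , inj₁ e) = let (b , q) = pick-all x y e in (false , b , b) , q
   fam-all {x} {y} (_ , inj₂ (z , e , e')) = let (b , q) = pick-all x z e ; (b' , q') = pick-all z y e' in (true , b , b') , cong (pick b') q ∙ q'

  top : ℕ
  top = Δ + Δ * Δ

  private
   module C = Colouring.Greedy sys second

  abstract
   colour : Carrier -> ℕ
   colour = C.colour

   colour-meas : Meas colour
   colour-meas = C.colour-meas

   colour-proper : ∀ {x y} -> Second x y -> colour x ≢ colour y
   colour-proper = C.colour-proper

   colour-top : ∀ x -> colour x ≤ top
   colour-top x = C.colour-≤ x top λ L u h -> (unique-length u λ m -> Colouring.Relation.∈nbrs second (h m))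
    » from≡ (length-++ (N x)) » +≤ (N-length x) (bound (N x) » *≤ˡ Δ (N-length x))
    where
    bound : ∀ l -> length (concatMap N l) ≤ length l * Δ
    bound [] = z≤n
    bound (y ∷ l) = from≡ (length-++ (N y)) » +≤ (N-length y) (bound l)

  Has : ℕ -> Carrier -> Carrier -> Set
  Has c x y = x ~ y × colour y ≡ c

  has-unique : ∀ {c x y y'} -> Has c x y -> Has c x y' -> y ≡ y'
  has-unique {c} {x} (e , q) (e' , q') = byContra λ ne -> colour-proper (ne , inj₂ (x , symmetric e , e')) (q ∙ sym q')

  neighbour : ℕ -> Carrier -> Carrier
  neighbour c x with dec (∃[ y ] Has c x y)
  ... | yes (y , _) = y
  ... | no _ = x

  neighbour-has : ∀ {c x y} -> Has c x y -> neighbour c x ≡ y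
  neighbour-has {c} {x} {y} h with dec (∃[ y ] Has c x y)
  ... | yes (y' , h') = has-unique h' h
  ... | no n = ⊥-elim (n (y , h))

  neighbour-none : ∀ {c x} -> ¬ (∃[ y ] Has c x y) -> neighbour c x ≡ x
  neighbour-none {c} {x} n with dec (∃[ y ] Has c x y)
  ... | yes h = ⊥-elim (n h)
  ... | no _ = refl

  neighbour-pt : ∀ c -> Pt (neighbour c)
  neighbour-pt c {U} bU = b-resp to from (b-⊎ (b-∃ enum-Index λ b -> b-× (b-Has b) (pick-pt b bU)) (b-× (b-¬ (b-∃ enum-Index b-Has)) bU))
   where
   b-Has : ∀ b -> Borel (λ x -> Has c x (pick b x))
   b-Has b = b-× (b-~ pt-id (λ u -> pick-pt b u)) (meas-pt colour-meas (λ u -> pick-pt b u) c)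
   found : ∀ {x y} -> Has c x y -> ∃[ b ] pick b x ≡ y
   found {x} {y} h = pick-all x y (fst h)
   to : ∀ x -> (∃[ b ] Has c x (pick b x) × U (pick b x)) ⊎ (¬ (∃[ b ] Has c x (pick b x)) × U x) -> U (neighbour c x)
   to x (inj₁ (b , h , u)) = subst U (sym (neighbour-has h)) u
   to x (inj₂ (n , u)) = subst U (sym (neighbour-none λ (y , h) -> let (b , q) = found h in n (b , subst (Has c x) (sym q) h))) u
   from : ∀ x -> U (neighbour c x) -> (∃[ b ] Has c x (pick b x) × U (pick b x)) ⊎ (¬ (∃[ b ] Has c x (pick b x)) × U x)
   from x u = cases (∃[ y ] Has c x y)
    (λ (y , h) -> let (b , q) = found h in inj₁ (b , subst (Has c x) (sym q) h , subst U (neighbour-has h ∙ sym q) u))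
    (λ n -> inj₂ ((λ (b , h) -> n (pick b x , h)) , subst U (neighbour-none n) u))

  port : Fin (suc (suc top)) -> Carrier -> Carrier
  port fzero x = x
  port (fsuc c) x = neighbour (toℕ c) x

  port-~ : ∀ c x -> port c x ≡ x ⊎ x ~ port c x
  port-~ fzero x = inj₁ refl
  port-~ (fsuc c) x = cases (∃[ y ] Has (toℕ c) x y) (λ (y , h) -> inj₂ (subst (x ~_) (sym (neighbour-has h)) (fst h))) (λ n -> inj₁ (neighbour-none n))

  port-all : ∀ {x y} -> x ~ y -> ∃[ c ] port c x ≡ y
  port-all {x} {y} e = fsuc (fromℕ< (s≤s (colour-top y))) , neighbour-has (e , sym (toℕ-fromℕ< (s≤s (colour-top y))))

  ports : Ports sys
  ports = record
   { B = suc (suc top) ; port = port ; port-pt = λ { fzero u -> u ; (fsuc c) u -> neighbour-pt (toℕ c) u }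
   ; stay = fzero ; stay-id = λ x -> refl
   ; back = λ c x -> case port-~ c x of λ { (inj₁ e) -> fzero , e ; (inj₂ e) -> port-all (symmetric e) } }

  open Geometry sys ports using (near; near-unstep; via; ComponentFinite; Conn)

  near-trail : ∀ {r x y} -> near r x y -> ∃[ l ] Paths.Trail _~_ x y l × Unique l × length l ≤ suc r
  near-trail {zero} {x} (via (here refl) refl) = x ∷ [] , Paths.stop x , [] ∷ [] , ≤-refl
  near-trail {suc r} {x} {y} n = let (c , m) = near-unstep n ; (l , t , u , le) = near-trail {r} m in case port-~ c x of λ
   { (inj₁ e) -> l , subst (λ z -> Paths.Trail _~_ z y l) e t , u , le » n≤1+n _
   ; (inj₂ e) -> let (l' , t' , u' , le') = Paths.prepend _~_ e t u in l' , t' , u' , le' » s≤s le }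

  near-power : ∀ {r x y} -> x ≢ y -> near r x y -> Power _~_ r x y
  near-power ne n = let (l , t , u , le) = near-trail n ; (k , e , p) = Paths.trail⇒path _~_ t u in ne , k , ≤-pred (from≡ e » le) , p

  asi : Structure.Asi sys ports
  asi = record
   { s = s ; U = λ R u -> part R (toℕ u)
   ; U-borel = λ R u -> part-borel R (toℕ u) ; U-cover = cover ; U-finite = λ R u -> finite R (toℕ u) }
   where
   s : ℕ
   s = fst asi-finite
   t : ℕ -> ℕ
   t R = fst (snd asi-finite R)
   t≤ : ∀ R -> t R ≤ s
   t≤ R = fst (snd (snd asi-finite R))
   partition : ∀ R -> SeparatingPartition V (Power _~_ R) (t R)
   partition R = fst (snd (snd (snd asi-finite R)))
   -- Empty for indices beyond `t R`, so that s + 1 parts serve every R.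
   part : ℕ -> ℕ -> Carrier -> Set
   part R u x = Σ[ lt ∈ u < suc (t R) ] fst (partition R) (fromℕ< lt) x
   part-borel : ∀ R u -> Borel (part R u)
   part-borel R u = cases (u < suc (t R))
    (λ lt -> b-resp (λ x h -> lt , h) (λ x (lt' , h) -> subst (λ l -> fst (partition R) (fromℕ< l) x) (ℕ.≤-irrelevant lt' lt) h) (toBor (fst (snd (partition R)) (fromℕ< lt))))
    (λ nlt -> b-resp (λ x ()) (λ x (lt , _) -> nlt lt) (b-const ⊥))
   cover : ∀ R x -> ∃[ u ] part R (toℕ {suc s} u) x
   cover R x = let (i , h) = fst (snd (snd (partition R))) x ; lt = toℕ<n i ; lt' = lt » s≤s (t≤ R) in
    fromℕ< lt' , subst (λ u -> part R u x) (sym (toℕ-fromℕ< lt')) (lt , subst (λ j -> fst (partition R) j x) (sym (fromℕ<-toℕ i lt)) h)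
   finite : ∀ R u -> ComponentFinite (part R u) R
   finite R u x (lt , h) = let (k , l , _ , _ , mem) = snd (snd (snd (snd (partition R)))) (fromℕ< lt) x h in
    l , λ y c -> Equivalence.from (mem y) (convert c)
    where
    P : Carrier -> Set
    P = fst (partition R) (fromℕ< lt)
    down : ∀ {x} -> part R u x -> P x
    down {x} (lt' , h') = subst (λ l -> fst (partition R) (fromℕ< l) x) (ℕ.≤-irrelevant lt' lt) h'
    convert : ∀ {x y} -> Conn (part R u) R x y -> Star (Induced (Power _~_ R) P) x y
    convert nil = nil
    convert {x} (_◅_ {j = z} (px , pz , n) c) = cases (x ≡ z) (λ { refl -> convert c }) (λ ne -> (down px , down pz , near-power ne n) ◅ convert c)

 -- Choice of the parameters.

 record _≤2^_ (a i : ℕ) : Set where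
  constructor pow
  field holds : a ≤ 2 ^ i

 infixr 7 _⊗_
 _⊗_ : ∀ {a b i j} -> a ≤2^ i -> b ≤2^ j -> (a * b) ≤2^ (i + j)
 _⊗_ {i = i} {j} (pow p) (pow r) = pow (*≤ p r » from≡ (sym (^-distribˡ-+-* 2 i j)))

 pow-≤ : ∀ {a i} n -> a ≤2^ i -> (a ^ n) ≤2^ (i * n)
 pow-≤ {a} {i} n (pow p) = pow (^-monoˡ-≤ n p » from≡ (^-*-assoc 2 i n))

 double : ∀ m -> 2 * suc m ^ suc m ≤ suc (suc m) ^ suc m
 double m = *-cancel {c = n} (s≤s z≤n) (begin
  _ ≡⟨ ring110 _ n ⟩
  _ ≤⟨ bernoulli⁺ n n ⟩
  _ ≡⟨ *-comm n _ ⟩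
  _ ∎)
  where
  n = suc m

 growth : ∀ n t -> 2 ^ t * suc n ^ (suc n * t) ≤ suc (suc n) ^ (suc n * t)
 growth n t = begin
  _ ≡⟨ cong (2 ^ t *_) (sym (^-*-assoc (suc n) (suc n) t)) ⟩
  _ ≡⟨ sym (^-* 2 _ t) ⟩
  _ ≤⟨ ^-monoˡ-≤ t (double n) ⟩
  _ ≡⟨ ^-*-assoc (suc (suc n)) (suc n) t ⟩
  _ ∎

 module Sizes (N' ρ : ℕ) where
  N M h₁ h₂ : ℕ
  h₂ = ρ + ρ + (ρ + (ρ + ρ) + ρ)
  h₁ = ρ + ρ + (ρ + ρ + h₂ + (ρ + ρ))
  N = suc N'
  M = suc N * N

  -- Here x is about log Δ / (N + 1), and e = N² x is the exponent, to base 1 + 1/N, by which y may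
  -- decay. In J rounds n falls from m = 8 e² to n₁ + 1 = 8 e. Since R = (N + 1) r, every r rounds
  -- cost y a factor of at most 1 + 1/N.
  e' e r n₁ R' R J m D₀ g G bits h σ E T : ℕ -> ℕ
  e' x = pred (N * N * x)
  e x = suc (e' x)
  r x = 8 * e x
  n₁ x = e' x + 7 * e x
  R' x = n₁ x + N * r x
  R x = suc (R' x)
  J x = r x * e' x
  m x = r x * e x
  D₀ x = R x * e x + 2 + J x
  g x = 36 * D₀ x
  G x = 2 + g x
  bits x = 2 + M * suc x
  -- The exponents of the factors of the budget, in their order there; `bits x` is the exponent for
  -- Δ + 2. So h is polynomial in x.
  h x = (2 + s) + ((1 + ((u * h₁ + 1) + (u * h₁ + 1))) + (s + ((1 + ((u * h₂ + 1) + (u * h₂ + 1))) + ((2 + s) + u * (ρ + ρ)))))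
   where
   s u : ℕ
   s = bits x
   u = s + s
  σ x = 4 + g x + G x * h x
  E x = 2 * (3 + N) * σ x
  T x = 2 * (G x * G x) * σ x + ((4 + g x) * E x + (2 * G x * (2 * D₀ x + σ x) + R x * σ x))

  poly-e : Poly e
  poly-e = p-≤ (λ x -> s≤s (ℕ.pred[n]≤n) » ≤-refl) (p-+ (p-const 1) (p-* (p-const (N * N)) p-id))

  poly-e' : Poly e'
  poly-e' = p-≤ (λ x -> n≤1+n _) poly-e

  poly-r : Poly r
  poly-r = p-* (p-const 8) poly-e

  poly-R : Poly R
  poly-R = p-+ poly-r (p-* (p-const N) poly-r)

  poly-J : Poly J
  poly-J = p-* poly-r poly-e'

  poly-m : Poly m
  poly-m = p-* poly-r poly-e

  poly-D₀ : Poly D₀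
  poly-D₀ = p-+ (p-+ (p-* poly-R poly-e) (p-const 2)) poly-J

  poly-g : Poly g
  poly-g = p-* (p-const 36) poly-D₀

  poly-G : Poly G
  poly-G = p-+ (p-const 2) poly-g

  poly-bits : Poly bits
  poly-bits = p-+ (p-const 2) (p-* (p-const M) (p-+ (p-const 1) p-id))

  poly-h : Poly h
  poly-h = p-+ (p-+ (p-const 2) s) (p-+ (p-+ (p-const 1) (p-+ (uh h₁) (uh h₁))) (p-+ s (p-+ (p-+ (p-const 1) (p-+ (uh h₂) (uh h₂))) (p-+ (p-+ (p-const 2) s) (p-* u (p-const (ρ + ρ)))))))
   where
   s = poly-bits
   u = p-+ s s
   uh : ∀ k -> Poly (λ x -> (bits x + bits x) * k + 1)
   uh k = p-+ (p-* u (p-const k)) (p-const 1)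

  poly-σ : Poly σ
  poly-σ = p-+ (p-+ (p-const 4) poly-g) (p-* poly-G poly-h)

  poly-E : Poly E
  poly-E = p-* (p-const (2 * (3 + N))) poly-σ

  poly-T : Poly T
  poly-T = p-+ (p-* (p-* (p-const 2) (p-* poly-G poly-G)) poly-σ) (p-+ (p-* (p-+ (p-const 4) poly-g) poly-E)
   (p-+ (p-* (p-* (p-const 2) poly-G) (p-+ (p-* (p-const 2) poly-D₀) poly-σ)) (p-* poly-R poly-σ)))

  -- What 2^x has to exceed: the threshold for y, the roundings of the degree bound, and the
  -- lower-order terms in the number of colours. All are polynomial in x.
  need₁ need₂ need₃ : ℕ -> ℕ
  need₁ x = e x * m x * T x
  need₂ x = 2 * J x * suc (σ x) * m x
  need₃ x = 2 * D₀ x * e x + 7 * m x + J x * e x * σ x + e x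

  abstract
   large-enough : ∃[ x₀ ] ∀ x -> x₀ ≤ x -> need₁ x + (need₂ x + need₃ x) ≤ 2 ^ x
   large-enough = poly≤exp (p-+ (p-* (p-* poly-e poly-m) poly-T) (p-+ (p-* (p-* (p-* (p-const 2) poly-J) (p-+ (p-const 1) poly-σ)) poly-m)
    (p-+ (p-+ (p-+ (p-* (p-* (p-const 2) poly-D₀) poly-e) (p-* (p-const 7) poly-m)) (p-* (p-* poly-J poly-e) poly-σ)) poly-e)))

 module Choice (N' ρ x Δ : ℕ) (2≤ρ : 2 ≤ ρ)
  (lower : suc (suc N') ^ (Sizes.M N' ρ * x) ≤ Δ * suc N' ^ (Sizes.M N' ρ * x))
  (upper : Δ * suc N' ^ (Sizes.M N' ρ * suc x) < suc (suc N') ^ (Sizes.M N' ρ * suc x))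
  (big : Sizes.need₁ N' ρ x + (Sizes.need₂ N' ρ x + Sizes.need₃ N' ρ x) ≤ 2 ^ x) (20≤x : 20 ≤ x)
  (θ δ : ℕ) (1≤θ : 1 ≤ θ) (θ≤2 : θ ≤ 2) (1≤δ : 1 ≤ δ) (δ≤D₀ : δ ≤ Sizes.D₀ N' ρ x)
  (θB : θ * (Sizes.D₀ N' ρ x + δ) ≤ θ * θ * suc (Sizes.D₀ N' ρ x)) where

  private
   module Z = Sizes N' ρ
  open Z using (N; M)

  e' e r n₁ R' R J m D₀ g G h σ E T : ℕ
  e' = Z.e' x
  e = Z.e x
  r = Z.r x
  n₁ = Z.n₁ x
  R' = Z.R' x
  R = Z.R x
  J = Z.J x
  m = Z.m x
  D₀ = Z.D₀ x
  g = Z.g x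
  G = Z.G x
  h = Z.h x
  σ = Z.σ x
  E = Z.E x
  T = Z.T x

  -- `y₀` makes the initial cap m e y₀ on the degree of a colour about θ Δ, so θ = 2 allows twice
  -- the maximum degree. A list has B = D₀ + δ units, of which δ may die.
  b₀ B m' γ ι ν₄ y₀ q : ℕ
  b₀ = R * e + (δ + 2)
  B = D₀ + δ
  m' = e' + n₁ * e
  γ = ceil Δ m'
  ι = ceil (4 * γ + G * σ) (suc g)
  ν₄ = ceil (36 * γ) (R' + suc g * R)
  y₀ = ceil (θ * Δ) (m' + e' * m)
  q = (J + b₀) * y₀

  e-is : e ≡ N * N * x
  e-is = go (N * N * x) ((s≤s z≤n » 20≤x) » m≤m+n x _)
   where
   go : ∀ k -> 1 ≤ k -> suc (pred k) ≡ k
   go (suc k) _ = refl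

  J+b₀ : J + b₀ ≡ B
  J+b₀ = ring114 J (R * e) δ

  n-is : suc (J + n₁) ≡ m
  n-is = ring115 e'

  J≤m : J ≤ m
  J≤m = *≤ʳ r (n≤1+n e')

  1≤m : 1 ≤ m
  1≤m = s≤s z≤n

  -- Δ lies between the powers, so exceeds 2 ^ x and every polynomial in x.
  split : M * x ≡ N * N * x + N * x
  split = ring116 N x

  2^x≤Δ : 2 ^ x ≤ Δ
  2^x≤Δ = *-cancel {c = N ^ (M * x)} (1≤^ (M * x) (s≤s z≤n)) (begin
   _ ≡⟨ cong (λ z -> 2 ^ x * N ^ z) split ⟩
   _ ≡⟨ cong (2 ^ x *_) (^-distribˡ-+-* N (N * N * x) (N * x)) ⟩
   _ ≡⟨ x∙yz≈y∙xz (2 ^ x) (N ^ (N * N * x)) (N ^ (N * x)) ⟩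
   _ ≤⟨ *≤ (^-monoˡ-≤ (N * N * x) (n≤1+n N)) (growth N' x) ⟩
   _ ≡⟨ sym (^-distribˡ-+-* (suc N) (N * N * x) (N * x)) ⟩
   _ ≡⟨ cong (suc N ^_) (sym split) ⟩
   _ ≤⟨ lower ⟩
   _ ∎)

  need₁≤ : e * m * T ≤ 2 ^ x
  need₁≤ = m≤m+n _ _ » big

  need₂≤ : 2 * J * suc σ * m ≤ Δ
  need₂≤ = (m≤m+n (2 * J * suc σ * m) (Z.need₃ x) » m≤n+m _ (e * m * T)) » big » 2^x≤Δ

  need₃≤ : 2 * D₀ * e + 7 * m + J * e * σ + e ≤ Δ
  need₃≤ = (m≤n+m _ (Z.need₂ x) » m≤n+m _ (e * m * T)) » big » 2^x≤Δ

  Δ<2^ : Δ < 2 ^ (M * suc x)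
  Δ<2^ = ≰⇒> λ le -> <⇒≱ upper (begin
   _ ≤⟨ ^-monoˡ-≤ (M * suc x) (s≤s (m≤m+n N N') » from≡ (ring117 N')) ⟩
   _ ≡⟨ ^-* 2 N (M * suc x) ⟩
   _ ≤⟨ *≤ˡ _ le ⟩
   _ ∎)

  D₀≤ : D₀ ≤ (2 + N) * m
  D₀≤ = begin
   _ ≤⟨ +≤ˡ J (+≤ʳ (R * e) (s≤s (s≤s z≤n) » m≤m+n 8 (8 * e'))) ⟩
   _ ≡⟨ ring118 N e' ⟩
   _ ∎

  B≤2D₀ : B ≤ 2 * D₀
  B≤2D₀ = +≤ʳ D₀ δ≤D₀ » from≡ (cong (D₀ +_) (sym (+-identityʳ D₀)))

  Re≤D₀ : R * e ≤ D₀
  Re≤D₀ = m≤m+n _ 2 » m≤m+n _ J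

  2≤D₀ : 2 ≤ D₀
  2≤D₀ = m≤n+m 2 (R * e) » m≤m+n _ J

  3Rα≤G : 3 * (R * e) ≤ G
  3Rα≤G = *≤ʳ 3 Re≤D₀ » *≤ˡ D₀ (m≤m+n 3 33) » m≤n+m _ 2

  18B≤g : 18 * B ≤ g
  18B≤g = *≤ʳ 18 B≤2D₀ » from≡ (sym (*-assoc 18 2 D₀))

  2B≤R² : 2 * B ≤ R * R
  2B≤R² = begin
   2 * B ≤⟨ *≤ʳ 2 (B≤2D₀ » *≤ʳ 2 D₀≤) ⟩
   _ ≤⟨ m≤m+n _ (32 * (2 * N * N + 3 * N) * (e * e)) ⟩
   _ ≡⟨ ring119 N e ⟩
   R * R ∎

  B≤6Rα : B ≤ 6 * (R * e)
  B≤6Rα = begin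
   B ≤⟨ B≤2D₀ » *≤ʳ 2 D₀≤ ⟩
   _ ≤⟨ m≤m+n _ _ ⟩
   _ ≡⟨ ring120 N e ⟩
   _ ∎

  2≤g : 2 ≤ g
  2≤g = 2≤D₀ » m≤m+n D₀ _

  T₁ : 2 * (G * G) * σ ≤ T
  T₁ = m≤m+n _ _

  T₂ : (4 + g) * E ≤ T
  T₂ = m≤m+n _ _ » m≤n+m _ (2 * (G * G) * σ)

  T₃ : 2 * G * (B + σ) ≤ T
  T₃ = *≤ʳ (2 * G) (+≤ˡ σ B≤2D₀) » m≤m+n _ (R * σ) » m≤n+m _ ((4 + g) * E) » m≤n+m _ (2 * (G * G) * σ)

  T₄ : R * σ ≤ T
  T₄ = m≤n+m _ (2 * G * (2 * D₀ + σ)) » m≤n+m _ ((4 + g) * E) » m≤n+m _ (2 * (G * G) * σ)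

  enough-dead : B * σ ≤ E * (suc n₁ * e)
  enough-dead = begin
   B * σ ≤⟨ *≤ˡ σ (B≤2D₀ » *≤ʳ 2 (D₀≤ » *≤ˡ m (n≤1+n (2 + N)))) ⟩
   _ ≡⟨ ring121 (3 + N) m σ ⟩
   _ ∎

  γ≥ : Δ ≤ m * γ
  γ≥ = ceil-≥ Δ m'

  γ≤ : m * γ ≤ Δ + m
  γ≤ = ceil-< Δ m'

  private
   module Ar = Bounds g h

  degree-step : ∀ z -> z ≤ 2 * γ -> (4 + g) * ceil z (suc g) + (2 + g) * h ≤ z + ι
  degree-step z z≤ = *-cancel {c = G} (s≤s z≤n) (begin
   _ ≡⟨ *-comm (Ar.up z) G ⟩
   _ ≤⟨ Ar.G*up z ⟩
   _ ≡⟨ ring122 g z _ ⟩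
   _ ≤⟨ +≤ʳ (G * z) (+≤ˡ (G * σ) (*≤ʳ 2 z≤ » from≡ (sym (*-assoc 2 2 γ)))) ⟩
   _ ≤⟨ +≤ʳ (G * z) (ceil-≥ (4 * γ + G * σ) (suc g)) ⟩
   _ ≡⟨ sym (*-distribˡ-+ G z ι) ∙ *-comm G (z + ι) ⟩
   _ ∎)

  -- Degrees below 2 γ grow by about 4 γ / G per round and G exceeds 8 J, so all rounds together add
  -- about half of γ; the additive errors take less than the other half.
  degree-total : J * ι ≤ γ
  degree-total = *-cancel {c = G + G} (s≤s z≤n) (begin
   _ ≡⟨ ring123 J ι G ⟩
   _ ≤⟨ *≤ʳ (2 * J) (ceil-< (4 * γ + G * σ) (suc g)) ⟩
   _ ≡⟨ ring124 J γ G σ ⟩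
   _ ≤⟨ +≤ (*≤ˡ γ 8J≤G) (*≤ˡ G few) ⟩
   _ ≡⟨ ring125 G γ ⟩
   _ ∎)
   where
   8J≤G : 8 * J ≤ G
   8J≤G = *≤ʳ 8 (m≤n+m J (R * e + 2)) » *≤ˡ D₀ (m≤m+n 8 28) » m≤n+m _ 2
   few : 2 * J * suc σ ≤ γ
   few = *-cancel {c = m} 1≤m (need₂≤ » γ≥ » from≡ (*-comm m γ))

  clash-rate : 36 * γ ≤ G * R * ν₄
  clash-rate = ceil-≥ _ _

  y₀≥ : θ * Δ ≤ e * m * y₀
  y₀≥ = ceil-≥ _ _

  y₀≤ : e * m * y₀ ≤ θ * Δ + e * m
  y₀≤ = ceil-< _ _

  -- Bernoulli with R = (N + 1) r: (1 - 1/(R + 1))^r ≥ 1 - r/(R + 1), and this is at least N/(N +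
  -- 1).
  one-step : N * suc R ^ r ≤ suc N * R ^ r
  one-step = *-cancel {c = suc (N * r)} (s≤s z≤n) (begin
   _ ≡⟨ *-assoc N (suc R ^ r) (suc (N * r)) ⟩
   _ ≤⟨ *≤ʳ N (+-cancelʳ-≤ (r * suc R ^ r) _ _ (from≡ (ring126 (suc R ^ r) N r) » bernoulli⁻ R r)) ⟩
   _ ≡⟨ ring127 N (R ^ r) r ⟩
   _ ≤⟨ *≤ˡ (R ^ r) (+≤ʳ (N * suc N * r) (n≤1+n N)) ⟩
   _ ≡⟨ ring128 N r (R ^ r) ⟩
   _ ∎)

  all-steps : N ^ e' * suc R ^ J ≤ suc N ^ e' * R ^ J
  all-steps = begin
   _ ≡⟨ cong (N ^ e' *_) (sym (^-*-assoc _ r e')) ⟩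
   _ ≡⟨ sym (^-* N _ e') ⟩
   _ ≤⟨ ^-monoˡ-≤ e' one-step ⟩
   _ ≡⟨ ^-* _ _ e' ⟩
   _ ≡⟨ cong (suc N ^ e' *_) (^-*-assoc R r e') ⟩
   _ ∎

  -- M x = e + N x: the powers of 1 + 1/N with exponent e pay for the decay of y, those with
  -- exponent N x yield 2^x and pay for the polynomial e m T.
  y₀-large : suc N ^ e * T ≤ y₀ * N ^ e
  y₀-large = *-cancel {c = e * m * N ^ (N * x)} (1≤* {e * m} (1≤* {e} {m} (s≤s z≤n) 1≤m) (1≤^ (N * x) (s≤s z≤n))) (begin
   _ ≡⟨ ring129 (suc N ^ e) T (e * m) (N ^ (N * x)) ⟩
   _ ≤⟨ *≤ʳ (suc N ^ e) (*≤ˡ (N ^ (N * x)) need₁≤ » growth N' x) ⟩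
   _ ≡⟨ sym (^-distribˡ-+-* _ e _) ⟩
   _ ≡⟨ cong (suc N ^_) Mx ⟩
   _ ≤⟨ lower ⟩
   _ ≡⟨ cong (λ z -> Δ * N ^ z) (sym Mx) ⟩
   _ ≡⟨ cong (Δ *_) (^-distribˡ-+-* N e _) ⟩
   _ ≤⟨ *≤ˡ (N ^ e * N ^ (N * x)) ((from≡ (sym (*-identityˡ Δ)) » *≤ˡ Δ 1≤θ) » y₀≥) ⟩
   _ ≡⟨ ring130 (e * m) y₀ (N ^ e) (N ^ (N * x)) ⟩
   _ ∎)
   where
   Mx : e + N * x ≡ M * x
   Mx = cong (_+ N * x) e-is ∙ sym split

  threshold : T * suc R ^ J ≤ y₀ * R ^ J
  threshold = *-cancel {c = N ^ e} (1≤^ e (s≤s z≤n)) (begin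
   _ ≡⟨ ring35 T (suc R ^ J) N (N ^ e') ⟩
   _ ≤⟨ *≤ (*≤ʳ T (n≤1+n N)) all-steps ⟩
   _ ≡⟨ ring131 T (suc N) (suc N ^ e') (R ^ J) ⟩
   _ ≤⟨ *≤ˡ _ y₀-large ⟩
   _ ≡⟨ xy∙z≈xz∙y y₀ _ _ ⟩
   _ ∎)

  D₀+1≤ : suc D₀ ≤ (3 + N) * m
  D₀+1≤ = +≤ 1≤m D₀≤ » ≤-refl

  -- One factor θ comes from `y₀`, the other from the list length B, which is doubled when half of a
  -- list may die.
  q-bound : e * q ≤ θ * θ * (3 + N) * Δ + B * e
  q-bound = *-cancel {c = m} 1≤m (begin
   _ ≡⟨ cong (λ b -> e * (b * y₀) * m) J+b₀ ⟩
   _ ≡⟨ ring132 e B y₀ m ⟩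
   _ ≤⟨ *≤ʳ B y₀≤ ⟩
   _ ≡⟨ ring133 B θ Δ e m ⟩
   _ ≤⟨ +≤ˡ (B * e * m) (*≤ˡ Δ (θB » *≤ʳ (θ * θ) D₀+1≤)) ⟩
   _ ≡⟨ ring134 (θ * θ) (3 + N) m Δ (B * e) ⟩
   _ ∎)

  Be≤ : B * e + (7 * m + J * e * σ + e) ≤ Δ
  Be≤ = +≤ˡ _ (*≤ˡ e B≤2D₀) » from≡ (ring135 (2 * D₀ * e) (7 * m) (J * e * σ) e) » need₃≤

  q≤Δ : q ≤ Δ
  q≤Δ = *-cancel {c = e} (s≤s z≤n) (begin
   q * e ≡⟨ *-comm q e ⟩
   e * q ≤⟨ q-bound ⟩
   _ ≤⟨ +≤ (*≤ˡ Δ (*≤ˡ (3 + N) (*≤ θ≤2 θ≤2))) (m≤m+n (B * e) _ » Be≤) ⟩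
   _ ≡⟨ +-comm _ Δ ⟩
   _ ≤⟨ *≤ˡ Δ e-large ⟩
   e * Δ ≡⟨ *-comm e Δ ⟩
   Δ * e ∎)
   where
   e-large : suc (4 * (3 + N)) ≤ e
   e-large = (m≤m+n _ (16 * N' + 20 * N' * N' + 20 * N' + 3) » from≡ (ring136 N')) » *≤ʳ (N * N) 20≤x » from≡ (sym e-is)

  m≤Δ : m ≤ Δ
  m≤Δ = ((m≤m+n m (6 * m) » m≤m+n _ (J * e * σ)) » m≤m+n _ e » m≤n+m _ (B * e)) » Be≤

  constants : Constants
  constants = record
   { g = g ; h = h ; ρ = ρ ; R' = R' ; α = e ; δ = δ ; E = E ; T = T ; Bₘ = B ; b₀ = b₀ ; n₁ = n₁ ; J = J ; γ = γ ; ι = ι ; ν₄ = ν₄ ; y₀ = y₀ ; q = q ; K = Δ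
   ; 2≤ρ = 2≤ρ ; 1≤α = s≤s z≤n ; 1≤δ = 1≤δ ; 2≤g = 2≤g ; 1≤T = 1≤* {R} {σ} (s≤s z≤n) (s≤s z≤n) » T₄
   ; 3Rα≤G = 3Rα≤G ; 18B≤g = 18B≤g ; 2B≤R² = 2B≤R² ; B≤6Rα = B≤6Rα ; T₁ = T₁ ; T₂ = T₂ ; T₃ = T₃ ; T₄ = T₄
   ; J+b₀≤B = from≡ J+b₀ ; enough-lists = ≤-refl ; enough-dead = enough-dead
   ; degree-step = degree-step ; degree-total = degree-total ; clash-rate = clash-rate ; threshold = threshold
   ; q-is = refl ; q≤K = q≤Δ ; n≤K = from≡ n-is » m≤Δ }

  open Constants constants using (p; ω₀)

  ω₀≤ : R * ω₀ ≤ 72 * γ + R * σ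
  ω₀≤ = *-cancel {c = G} (s≤s z≤n) (begin
   _ ≡⟨ ring137 R g ν₄ h ⟩
   _ ≤⟨ +≤ˡ (G * R * (G * h)) (*≤ʳ (4 + g) (ceil-< (36 * γ) (R' + suc g * R))) ⟩
   _ ≡⟨ ring138 g γ R h ⟩
   _ ≤⟨ +≤ˡ (R * σ * G) (*≤ˡ (36 * γ) (m≤m+n (4 + g) g) » from≡ (ring139 g γ)) ⟩
   _ ≡⟨ sym (*-distribʳ-+ G (72 * γ) (R * σ)) ⟩
   _ ∎)

  wasted-total : J * e * ω₀ ≤ 5 * (m * γ) + J * e * σ
  wasted-total = *-cancel {c = R} (s≤s z≤n) (begin
   _ ≡⟨ xy∙z≈x∙zy (J * e) ω₀ R ⟩
   _ ≤⟨ *≤ʳ (J * e) ω₀≤ ⟩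
   _ ≡⟨ ring140 J e γ R σ ⟩
   _ ≤⟨ +≤ˡ (J * e * σ * R) (*≤ (*≤ˡ γ J≤m) 72e≤) ⟩
   _ ≡⟨ ring141 (m * γ) R (J * e * σ) ⟩
   _ ∎)
   where
   72e≤ : 72 * e ≤ 5 * R
   72e≤ = m≤m+n _ _ » from≡ (ring142 e N')

  -- The colours of the nibble give N + 3; the final colouring adds 2 for undecided and 5 for wasted
  -- neighbours, and all lower-order terms add 1.
  total : e * (q + suc p) ≤ θ * θ * (11 + N) * Δ
  total = begin
   _ ≡⟨ ring143 e q r γ J ω₀ ⟩
   _ ≤⟨ +≤ q-bound (+≤ˡ e (+≤ʳ (2 * (m * γ)) wasted-total)) ⟩
   _ ≡⟨ ring144 (θ * θ * (3 + N) * Δ) (B * e) (m * γ) (J * e * σ) e ⟩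
   _ ≤⟨ +≤ʳ (θ * θ * (3 + N) * Δ) (+≤ˡ (B * e + (J * e * σ + e)) (*≤ʳ 7 γ≤)) ⟩
   _ ≡⟨ ring145 (θ * θ * (3 + N) * Δ) Δ m (B * e) (J * e * σ) e ⟩
   _ ≤⟨ +≤ʳ (θ * θ * (3 + N) * Δ) (+≤ʳ (7 * Δ) Be≤) ⟩
   _ ≡⟨ ring146 (θ * θ) (3 + N) Δ ⟩
   _ ≤⟨ +≤ʳ (θ * θ * (3 + N) * Δ) (*≤ˡ (8 * Δ) (*≤ 1≤θ 1≤θ)) ⟩
   _ ≡⟨ ring147 (θ * θ) N Δ ⟩
   _ ∎

  affordable : ∀ k -> k ≤ Δ -> let B₀ = suc (suc (Δ + Δ * Δ)) ; q₁ = B₀ ^ Z.h₁ * 2 ; q₂ = B₀ ^ Z.h₂ * 2 in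
   (3 + 2 * q) * (2 * (q₁ * q₁) * (k * (2 * (q₂ * q₂) * (4 * k * B₀ ^ (ρ + ρ))))) ≤ 2 ^ h
  affordable k k≤ = _≤2^_.holds (few ⊗ (two ⊗ (far Z.h₁ ⊗ far Z.h₁)) ⊗ small ⊗ (two ⊗ (far Z.h₂ ⊗ far Z.h₂)) ⊗ (four ⊗ small) ⊗ pow-≤ (ρ + ρ) ports)
   where
   s : ℕ
   s = Z.bits x
   two : 2 ≤2^ 1
   two = pow ≤-refl
   four : 4 ≤2^ 2
   four = pow ≤-refl
   Δ+2≤ : 2 + Δ ≤ 2 ^ s
   Δ+2≤ = begin
    2 + Δ ≤⟨ +≤ (*≤ʳ 2 (1≤^ (M * suc x) (s≤s z≤n))) (<⇒≤ Δ<2^) ⟩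
    _ ≤⟨ m≤m+n _ P ⟩
    _ ≡⟨ ring111 P ⟩
    _ ∎
    where
    P = 2 ^ (M * suc x)
   small : k ≤2^ s
   small = pow (k≤ » m≤n+m Δ 2 » Δ+2≤)
   ports : suc (suc (Δ + Δ * Δ)) ≤2^ (s + s)
   ports = pow ((m≤m+n _ _ » from≡ (ring112 Δ)) » _≤2^_.holds (pow {2 + Δ} {s} Δ+2≤ ⊗ pow {2 + Δ} {s} Δ+2≤))
   far : ∀ i -> (suc (suc (Δ + Δ * Δ)) ^ i * 2) ≤2^ ((s + s) * i + 1)
   far i = pow-≤ i ports ⊗ two
   few : (3 + 2 * q) ≤2^ (2 + s)
   few = pow (begin
    _ ≤⟨ +≤ʳ 3 (*≤ʳ 2 q≤Δ) ⟩
    _ ≤⟨ n≤1+n _ ⟩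
    _ ≡⟨ ring113 Δ ⟩
    _ ≤⟨ *≤ʳ 2 Δ+2≤ ⟩
    _ ≤⟨ m≤m+n _ _ ⟩
    _ ∎)

 -- Upper bounds for the logarithm, and clearing of denominators.

 module Logarithms where

  open import Data.Integer using (+_)

  harmonic-mono : ∀ n j -> harmonic j ℚ.≤ harmonic (n + j)
  harmonic-mono zero    j = ℚ.≤-refl
  harmonic-mono (suc n) j = harmonic-mono n j
   ⟫ (ℚ.≤-reflexive (sym (ℚ.+-identityʳ _))
    ⟫ (ℚ.+-monoʳ-≤ (harmonic (n + j))
     (ℚ.≤-reflexive (sym (frac-0 (n + j)))
      ⟫ frac-≤ 0 (n + j) 1 (n + j) z≤n)))

  harmonic-≤ : ∀ {i j} -> i ≤ j -> harmonic i ℚ.≤ harmonic j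
  harmonic-≤ {i} {j} le = subst (λ z -> harmonic i ℚ.≤ harmonic z) (m∸n+n≡m le) (harmonic-mono (j ∸ i) i)

  logSum-nonneg : ∀ m i -> 0ℚ ℚ.≤ logSum (suc m) i
  logSum-nonneg m i = ℚ.≤-reflexive (sym (ℚ.+-inverseʳ (harmonic (suc i))))
   ⟫ ℚ.+-monoˡ-≤ (ℚ.- harmonic (suc i)) (harmonic-≤ (ℕ.m≤m*n (suc i) (suc m)))

  log-nonneg : ∀ n i -> 0ℚ ℚ.≤ seq (log n) i
  log-nonneg zero    i = ℚ.≤-refl
  log-nonneg (suc m) i = logSum-nonneg m i

  ·-nonneg : ∀ n x i -> 0ℚ ℚ.≤ seq x i -> 0ℚ ℚ.≤ seq (n ·ℝ x) i
  ·-nonneg zero    x i 0≤x = ℚ.≤-refl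
  ·-nonneg (suc n) x i 0≤x =
   ℚ.≤-reflexive (sym (ℚ.+-identityʳ 0ℚ)) ⟫ ℚ.+-mono-≤ 0≤x (·-nonneg n x i 0≤x)

  ·-mono : ∀ {m n} x i -> 0ℚ ℚ.≤ seq x i -> m ≤ n -> seq (m ·ℝ x) i ℚ.≤ seq (n ·ℝ x) i
  ·-mono {n = n} x i 0≤x z≤n   = ·-nonneg n x i 0≤x
  ·-mono x i 0≤x (s≤s m≤n) = ℚ.+-monoʳ-≤ (seq x i) (·-mono x i 0≤x m≤n)

  frac-+ : ∀ a c b -> + a / suc b ℚ.+ + c / suc b ≡ + (a + c) / suc b
  frac-+ zero c b = cong (ℚ._+ (+ c / suc b)) (frac-0 b) ∙ ℚ.+-identityˡ _
  frac-+ (suc a) c b = cong (ℚ._+ (+ c / suc b)) (sym (frac-+1 a b) ∙ ℚ.+-comm (+ a / suc b) _) ∙ (ℚ.+-assoc (+ 1 / suc b) _ _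
   ∙ cong (+ 1 / suc b ℚ.+_) (frac-+ a c b) ∙ ℚ.+-comm (+ 1 / suc b) _ ∙ frac-+1 (a + c) b)

  ·-≤ : ∀ n x i a b -> seq x i ℚ.≤ + a / suc b -> seq (n ·ℝ x) i ℚ.≤ + (n * a) / suc b
  ·-≤ zero x i a b le = ℚ.≤-reflexive (sym (frac-0 b))
  ·-≤ (suc n) x i a b le = ℚ.+-mono-≤ le (·-≤ n x i a b le) ⟫ ℚ.≤-reflexive (frac-+ a _ b)

  ·-≥ : ∀ n x i a b -> + a / suc b ℚ.≤ seq x i -> + (n * a) / suc b ℚ.≤ seq (n ·ℝ x) i
  ·-≥ zero x i a b le = ℚ.≤-reflexive (frac-0 b)
  ·-≥ (suc n) x i a b le = ℚ.≤-reflexive (sym (frac-+ a _ b)) ⟫ ℚ.+-mono-≤ le (·-≥ n x i a b le)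

  -- Along the points k N^(j−i) (N+1)^i the harmonic sum grows by at most 1/N per step.
  harmonic-powers : ∀ N' j k -> harmonic (k * suc (suc N') ^ j) ℚ.≤ harmonic (k * suc N' ^ j) ℚ.+ + j / suc N'
  harmonic-powers N' zero k = ℚ.≤-reflexive (sym (cong (λ z -> harmonic (k * 1) ℚ.+ z) (frac-0 N') ∙ ℚ.+-identityʳ _))
  harmonic-powers N' (suc j) k = subst (λ z -> harmonic z ℚ.≤ harmonic (k * suc N * N ^ j) ℚ.+ + j / N) (*-assoc k _ _) (harmonic-powers N' j (k * suc N))
    ⟫ ((ℚ.+-monoˡ-≤ _ (subst (λ z -> harmonic z ℚ.≤ harmonic p ℚ.+ + 1 / N) (ring148 k _ N) (harmonic-upper s p
     ⟫ ℚ.+-monoʳ-≤ (harmonic p) (frac-≤ s p 1 N' (from≡ (xy∙z≈x∙zy k (N ^ j) N) » n≤1+n p » from≡ (sym (*-identityˡ (suc p))))))))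
    ⟫ ℚ.≤-reflexive (ℚ.+-assoc (harmonic p) _ _ ∙ cong (λ z -> harmonic p ℚ.+ z) (ℚ.+-comm (+ 1 / N) (+ j / N) ∙ frac-+1 j N')))
   where
   N s p : ℕ
   N = suc N'
   s = k * N ^ j
   p = k * (N * N ^ j)

  -- log n ≤ t log(1 + 1/N) ≤ t/N. `logSum` increases with its index, so the mesh may be refined
  -- until the points (1 + 1/N)^j of the subdivision become integers.
  logSum-≤-powers : ∀ N' t m i -> suc m * suc N' ^ t ≤ suc (suc N') ^ t -> logSum (suc m) i ℚ.≤ + t / suc N'
  logSum-≤-powers N' t m i le = subst (λ z -> logSum (suc m) i ℚ.≤ logSum (suc m) z) (m∸n+n≡m i≤) (logSum-mono m i (k ∸ i))
    ⟫ (subst (λ z -> harmonic (z * suc m) ℚ.- harmonic z ℚ.≤ + t / N) (sym k-is) (ℚ.+-monoˡ-≤ (ℚ.- harmonic (suc i * N ^ t)) (harmonic-≤ grow ⟫ harmonic-powers N' t (suc i))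
     ⟫ ℚ.≤-reflexive (cancel (harmonic (suc i * N ^ t)) (+ t / N))))
   where
   N : ℕ
   N = suc N'
   k : ℕ
   k = pred (suc i * N ^ t)
   1≤ : 1 ≤ N ^ t
   1≤ = ℕ.m^n>0 N t
   k-is : suc k ≡ suc i * N ^ t
   k-is = ℕ.suc-pred (suc i * N ^ t) {{ℕ.>-nonZero (*≤ (s≤s (z≤n {i})) 1≤)}}
   i≤ : i ≤ k
   i≤ = ≤-pred ((from≡ (sym (*-identityʳ (suc i))) » *≤ʳ (suc i) 1≤) » from≡ (sym k-is))
   grow : suc i * N ^ t * suc m ≤ suc i * suc N ^ t
   grow = from≡ (xy∙z≈x∙zy (suc i) (N ^ t) (suc m)) » *≤ʳ (suc i) le
   cancel : ∀ x y -> (x ℚ.+ y) ℚ.- x ≡ y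
   cancel x y = cong (ℚ._+ (ℚ.- x)) (ℚ.+-comm x y) ∙ ℚ.+-assoc y x _ ∙ cong (λ z -> y ℚ.+ z) (ℚ.+-inverseʳ x) ∙ ℚ.+-identityʳ y

  log-≤-powers : ∀ N' t n i -> n * suc N' ^ t ≤ suc (suc N') ^ t -> seq (log n) i ℚ.≤ + t / suc N'
  log-≤-powers N' t zero i le = ℚ.≤-reflexive (sym (frac-0 N')) ⟫ frac-≤ 0 N' t N' z≤n
  log-≤-powers N' t (suc m) i le = logSum-≤-powers N' t m i le

  colouring⇒chromaticBound : ∀ G c q Δ -> BorelColouring G q -> q ·ℝ log Δ ≤ℝ Δ ·ℝ c -> ChromaticBound G c Δ
  colouring⇒chromaticBound G c q Δ col bound = let (χ , isχ , min , χ≤q) = least (BorelColouring G) q col in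
   χ , (isχ , min) , λ ε 0<ε -> fst (bound ε 0<ε) , λ n N≤n -> ·-mono (log Δ) n (log-nonneg Δ n) χ≤q ⟫ snd (bound ε 0<ε) n N≤n

  -- ε is bounded below by 1/(τ+1) from some index on.
  count⇒bound : ∀ N' t τ k q Δ ε -> (∃[ i₀ ] ∀ i -> i₀ ≤ i -> + 1 / suc τ ℚ.≤ seq ε i) -> Δ * suc N' ^ t ≤ suc (suc N') ^ t ->
   q * t * suc τ ≤ Δ * suc (k * suc τ) * suc N' -> q ·ℝ log Δ ≤ℝ Δ ·ℝ (fromℕ k +ℝ ε)
  count⇒bound N' t τ k q Δ ε (i₀ , far) power count ε' 0<ε' = i₀ , λ i i≥ -> ·-≤ q (log Δ) i t N' (log-≤-powers N' t Δ i power)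
   ⟫ (frac-≤ (q * t) N' (Δ * suc (k * suc τ)) τ count
   ⟫ ((·-≥ Δ (fromℕ k +ℝ ε) i (suc (k * suc τ)) τ (ℚ.≤-reflexive (sym (frac-+1 (k * suc τ) τ))
    ⟫ ℚ.+-mono-≤ (frac-≤ (k * suc τ) τ k 0 (from≡ (*-identityʳ _))) (far i i≥)))
    ⟫ ℚ.≤-reflexive (sym (ℚ.+-identityʳ _)) ⟫ ℚ.+-monoʳ-≤ (seq (Δ ·ℝ (fromℕ k +ℝ ε)) i) (ℚ.<⇒≤ 0<ε')))

  fromℕ-positive : ∀ n -> 1 ≤ n -> 0ℝ <ℝ fromℕ n
  fromℕ-positive n le = + 1 / 1 , from-yes (0ℚ ℚ.<? + 1 / 1) , 0 , λ _ _ -> ℚ.≤-reflexive (ℚ.+-identityˡ _) ⟫ frac-≤ 1 0 n 0 (*≤ˡ 1 le)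

  fromℕ-reflects-≤ : ∀ m n -> fromℕ m ≤ℝ fromℕ n -> m ≤ n
  fromℕ-reflects-≤ m n le = ≮⇒≥ λ lt -> ℚ.<-irrefl refl (ℚ.<-≤-trans (ℚ.+-monoʳ-< (+ n / 1) (from-yes (½ ℚ.<? + 1 / 1)))
   (ℚ.≤-reflexive (frac-+1 n 0) ⟫ frac-≤ (suc n) 0 m 0 (*≤ˡ 1 lt) ⟫ snd (le ½ (from-yes (0ℚ ℚ.<? ½))) _ ≤-refl))

  eventually-positive : ∀ ε -> 0ℝ <ℝ ε -> ∃[ τ ] ∃[ i₀ ] ∀ i -> i₀ ≤ i -> + 1 / suc τ ℚ.≤ seq ε i
  eventually-positive ε (η , 0<η , i₀ , far) = let (τ , le) = archimedean η 0<η in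
   τ , i₀ , λ i i≥ -> le ⟫ ℚ.≤-reflexive (sym (ℚ.+-identityˡ η)) ⟫ far i i≥

 open Logarithms

 -- The two colourings of a Borel graph.

 module Assembly (H : BorelGraph) (Δ : ℕ) (maxDeg : FiniteMaxDegree H Δ) (asi-finite : FiniteAsi H) where
  open Setup H Δ maxDeg asi-finite
  open Analytic Sp using (sys)
  open BorelGraph H renaming (_~_ to infix 4 _~_)

  graph : Structure.Graph sys ports
  graph = record
   { _~_ = _~_ ; ~-sym = symmetric ; ~-irrefl = irreflexive refl ; b-~ = b-~ ; port-all = port-all
   ; port-inj = λ {x} {c} {c'} -> inj {x} {c} {c'} }
   where
   has : ∀ {x} c -> x ~ neighbour c x -> colour (neighbour c x) ≡ c
   has {x} c e = cases (∃[ y ] Has c x y) (λ (y , h) -> subst (λ z -> colour z ≡ c) (sym (neighbour-has h)) (snd h))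
    (λ n -> ⊥-elim (irreflexive refl (subst (x ~_) (neighbour-none n) e)))
   inj : ∀ {x c c'} -> x ~ port c x -> x ~ port c' x -> port c x ≡ port c' x -> c ≡ c'
   inj {c = fzero} e e' q = ⊥-elim (irreflexive refl e)
   inj {c = fsuc c} {fzero} e e' q = ⊥-elim (irreflexive refl e')
   inj {c = fsuc c} {fsuc c'} e e' q = cong fsuc (toℕ-injective (sym (has (toℕ c) e) ∙ cong colour q ∙ has (toℕ c') e'))

  open Structure.Graph graph using (nbrs; nbrs-unique; nbrs∈)

  degree≤ : ∀ v -> length (nbrs v) ≤ Δ
  degree≤ v = (unique-length (nbrs-unique v) λ m -> ∈N (nbrs∈ m)) » N-length v

  distinct : ∀ {x y} -> x ~ y -> x ≢ y
  distinct e refl = irreflexive refl e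

  cycle : ∀ {x y l} n -> length l ≡ suc n -> Paths.Trail _~_ x y l -> Unique l -> y ~ x -> ¬ NoCycle H (suc n)
  cycle {x} {y} n len t u e none = let (k , k≡ , path) = Paths.trail⇒path _~_ t u in
   none (x , y , subst (λ k -> Path _~_ k x y) (suc-injective (k≡ ∙ len)) path , e)

  triangle-free : NoCycle H 3 -> ∀ {x y z} -> x ~ y -> y ~ z -> z ~ x -> ⊥
  triangle-free none {x} {y} {z} xy yz zx = cycle 2 refl (Paths.go xy (Paths.go yz (Paths.stop z)))
   ((distinct xy ∷ (distinct zx ∘ sym) ∷ []) ∷ (distinct yz ∷ []) ∷ [] ∷ []) zx none

  C4-free : NoCycle H 4 -> ∀ v u u' w -> u ≢ u' -> v ~ u -> v ~ u' -> w ~ u -> w ~ u' -> w ≡ v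
  C4-free none v u u' w ne vu vu' wu wu' = byContra λ w≢v -> cycle 3 refl
   (Paths.go vu (Paths.go (symmetric wu) (Paths.go wu' (Paths.stop u'))))
   ((distinct vu ∷ (w≢v ∘ sym) ∷ distinct vu' ∷ []) ∷ ((distinct wu ∘ sym) ∷ ne ∷ []) ∷ (distinct wu' ∷ []) ∷ [] ∷ []) (symmetric vu') none

  colouring : ∀ Q (F : Carrier -> ℕ) -> Logic.Meas sys F -> (∀ x -> F x < Q) -> (∀ {x y} -> x ~ y -> F x ≢ F y) -> BorelColouring H Q
  colouring Q F F-meas F-< F-proper = (λ x -> fromℕ< (F-< x)) ,
   (λ c -> fromBor (Logic.b-resp sys (λ x e -> toℕ-injective (toℕ-fromℕ< (F-< x) ∙ e)) (λ x e -> sym (toℕ-fromℕ< (F-< x)) ∙ cong toℕ e) (F-meas (toℕ c)))) ,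
   λ x y e q -> F-proper e (sym (toℕ-fromℕ< (F-< x)) ∙ cong toℕ q ∙ toℕ-fromℕ< (F-< y))

  module _ (no-triangle : NoCycle H 3) (N' ρ x : ℕ) (2≤ρ : 2 ≤ ρ)
   (lower : suc (suc N') ^ (Sizes.M N' ρ * x) ≤ Δ * suc N' ^ (Sizes.M N' ρ * x))
   (upper : Δ * suc N' ^ (Sizes.M N' ρ * suc x) < suc (suc N') ^ (Sizes.M N' ρ * suc x))
   (big : Sizes.need₁ N' ρ x + (Sizes.need₂ N' ρ x + Sizes.need₃ N' ρ x) ≤ 2 ^ x) (20≤x : 20 ≤ x) where

   Goal : ℕ -> Set₁
   Goal θ = ∃[ Q ] BorelColouring H Q × Sizes.e N' ρ x * Q ≤ θ * θ * (11 + suc N') * Δ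

   module _ (θ δ : ℕ) (1≤θ : 1 ≤ θ) (θ≤2 : θ ≤ 2) (1≤δ : 1 ≤ δ) (δ≤D₀ : δ ≤ Sizes.D₀ N' ρ x)
    (θB : θ * (Sizes.D₀ N' ρ x + δ) ≤ θ * θ * suc (Sizes.D₀ N' ρ x)) where
    open Choice N' ρ x Δ 2≤ρ lower upper big 20≤x θ δ 1≤θ θ≤2 1≤δ δ≤D₀ θB

    budget : ∀ k -> k ≤ Δ -> (3 + 2 * q) * Structure.OnGraph.cost sys ports asi graph ρ k ≤ 2 ^ h
    budget k le = subst (λ z -> (3 + 2 * q) * z ≤ 2 ^ h) (sym (Structure.OnGraph.cost-eq sys ports asi graph ρ k)) (affordable k le)

    Δ≤A : Δ ≤ suc (J + n₁) * (e * y₀)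
    Δ≤A = (from≡ (sym (*-identityˡ Δ)) » *≤ˡ Δ 1≤θ) » y₀≥ » from≡ (xy∙z≈y∙xz e m y₀ ∙ cong (_* (e * y₀)) (sym n-is))

    coloured : Structure.OnGraph.Nibble.C4-free sys ports asi graph (triangle-free no-triangle) q g h ρ 2≤ρ ⊎ q * Δ ≤ δ * y₀ * (suc (J + n₁) * (e * y₀)) -> Goal θ
    coloured mode₀ = q + suc (Constants.p constants) , colouring _ St.F St.F-meas St.F-< St.F-proper , total
     where
     module St = Structure.OnGraph.Run.Start sys ports asi graph (triangle-free no-triangle) constants budget Δ degree≤ Δ≤A (γ≥ » from≡ (cong (_* γ) (sym n-is))) mode₀

   -- θ = 1, as degrees of single colours concentrate; no colour dies, and δ = 1 is the least value
   -- that the constants admit.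
   sparse-colouring : NoCycle H 4 -> Goal 1
   sparse-colouring none = coloured 1 1 (s≤s z≤n) (s≤s z≤n) (s≤s z≤n) 1≤D₀ (from≡ (ring149 _)) (inj₁ (C4-free none))
    where
    1≤D₀ : 1 ≤ Sizes.D₀ N' ρ x
    1≤D₀ = (n≤1+n 1 » m≤n+m 2 (Sizes.R N' ρ x * Sizes.e N' ρ x)) » m≤m+n _ (Sizes.J N' ρ x)

   -- With δ = D₀ half of a list may die. Since e m y₀ ≥ 2 Δ, the initial weight q Δ = 2 D₀ y₀ Δ
   -- stays within δ y₀ caps.
   triangle-free-colouring : Goal 2
   triangle-free-colouring = coloured 2 D₀ 1≤2 ≤-refl 1≤D₀ ≤-refl θB (inj₂ weights)
    where
    D₀ : ℕ
    D₀ = Sizes.D₀ N' ρ x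
    1≤2 : 1 ≤ 2
    1≤2 = s≤s z≤n
    1≤D₀ : 1 ≤ D₀
    1≤D₀ = (n≤1+n 1 » m≤n+m 2 (Sizes.R N' ρ x * Sizes.e N' ρ x)) » m≤m+n _ (Sizes.J N' ρ x)
    θB : 2 * (D₀ + D₀) ≤ 2 * 2 * suc D₀
    θB = m≤m+n _ 4 » from≡ (ring150 D₀)
    module Ch = Choice N' ρ x Δ 2≤ρ lower upper big 20≤x 2 D₀ 1≤2 ≤-refl 1≤D₀ ≤-refl θB
    weights : Ch.q * Δ ≤ D₀ * Ch.y₀ * (suc (Ch.J + Ch.n₁) * (Ch.e * Ch.y₀))
    weights = from≡ (cong (λ b -> b * Ch.y₀ * Δ) Ch.J+b₀ ∙ ring151 D₀ Ch.y₀ Δ) » (*≤ʳ (D₀ * Ch.y₀) Ch.y₀≥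
     » from≡ (ring152 D₀ Ch.y₀ Ch.e Ch.m ∙ cong (λ z -> D₀ * Ch.y₀ * (z * (Ch.e * Ch.y₀))) (sym Ch.n-is)))

 -- Choice of N and x for a given ε and Δ, and the final count.

 module Main where

  open import Data.Integer using (+_)

  abstract
   -- Survival at a neighbour and clashes of a neighbour involve picks at distance two.
   radius : ∃[ ρ ] 2 ≤ ρ
   radius = 2 , ≤-refl

   -- 188 = 4 · 47, with 4 ≥ θ² and 47 from `cubic`; 1/(τ + 1) is a lower bound for ε.
   fine : ∀ τ -> ∃[ N' ] 188 * suc τ ≤ suc N'
   fine τ = 188 * suc τ , n≤1+n _

  ρ : ℕ
  ρ = fst radius

  scale : ∀ N' x₀ Δ -> let N = suc N' ; M = suc N * N in suc N ^ (M * x₀) ≤ Δ ->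
   ∃[ x ] x₀ ≤ x × suc N ^ (M * x) ≤ Δ * N ^ (M * x) × Δ * N ^ (M * suc x) < suc N ^ (M * suc x)
  scale N' x₀ Δ large = let (x , Px , min , _) = least Passed Δ passed in x , ≮⇒≥ (early x Px) , late x min , Px
   where
   N M : ℕ
   N = suc N'
   M = suc N * N
   Passed : ℕ -> Set
   Passed x = Δ * N ^ (M * suc x) < suc N ^ (M * suc x)
   Mx : ∀ x -> M * x ≡ N * (suc N * x)
   Mx x = ring153 N x
   passed : Passed Δ
   passed = begin-strict
    _ <⟨ ℕ.*-monoˡ-< (N ^ (M * suc Δ)) {{ℕ.>-nonZero (1≤^ (M * suc Δ) (s≤s z≤n))}} (n<2^n Δ) ⟩
    _ ≤⟨ *≤ˡ (N ^ (M * suc Δ)) (^-monoʳ-≤ 2 (n≤1+n Δ » m≤m+n (suc Δ) (N * suc Δ))) ⟩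
    _ ≡⟨ cong (λ z -> 2 ^ (suc N * suc Δ) * N ^ z) (Mx (suc Δ)) ⟩
    _ ≤⟨ growth N' (suc N * suc Δ) ⟩
    _ ≡⟨ cong (suc N ^_) (sym (Mx (suc Δ))) ⟩
    _ ∎
   1≤Δ : 1 ≤ Δ
   1≤Δ = 1≤^ (M * x₀) (s≤s z≤n) » large
   early : ∀ x -> Passed x -> ¬ x < x₀
   early x Px lt = <⇒≱ Px (begin
    _ ≤⟨ ^-monoʳ-≤ _ (*≤ʳ M lt) ⟩
    _ ≤⟨ large ⟩
    Δ ≡⟨ sym (*-identityʳ Δ) ⟩
    Δ * 1 ≤⟨ *≤ʳ Δ (1≤^ (M * suc x) (s≤s z≤n)) ⟩
    _ ∎)
   late : ∀ x -> (∀ j -> Passed j -> x ≤ j) -> suc N ^ (M * x) ≤ Δ * N ^ (M * x)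
   late zero min = subst (λ z -> suc N ^ z ≤ Δ * N ^ z) (sym (*-zeroʳ M)) (1≤Δ » from≡ (sym (*-identityʳ Δ)))
   late (suc x) min = ≮⇒≥ λ lt -> 1+n≰n (min x lt)

  count : ∀ τ N' θ x Q Δ -> let N = suc N' in 188 * suc τ ≤ N -> θ ≤ 2 -> N ≤ x -> N * N * x * Q ≤ θ * θ * (11 + N) * Δ ->
   Q * (suc N * N * suc x) * suc τ ≤ Δ * suc (θ * θ * suc τ) * N
  count τ N' θ x Q Δ N≥ θ≤2 N≤x le = *-cancel {c = N * N * x * N} (1≤* {N * N * x} ((s≤s z≤n » N≤x) » m≤m+n x _) (s≤s z≤n)) (begin
   _ ≡⟨ ring158 Q N x _ ⟩
   _ ≤⟨ *≤ le (*≤ʳ (suc N * N * suc τ) Nx) ⟩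
   _ ≡⟨ ring159 (θ * θ) N Δ (suc τ) x ⟩
   _ ≤⟨ *≤ˡ _ main ⟩
   _ ≡⟨ ring160 _ N x Δ ⟩
   _ ∎)
   where
   N a : ℕ
   N = suc N'
   a = θ * θ * suc τ
   Nx : N * suc x ≤ suc N * x
   Nx = from≡ (ℕ.*-suc N x) » +≤ˡ _ N≤x
   main : a * ((11 + N) * (suc N * suc N)) ≤ suc a * (N * N * N)
   main = begin
    _ ≤⟨ *≤ʳ a (cubic N') ⟩
    _ ≡⟨ ring154 a (N * N * N) (N * N) ⟩
    _ ≤⟨ +≤ʳ (a * (N * N * N)) (*≤ˡ (N * N) (*≤ˡ 47 (*≤ˡ (suc τ) (*≤ θ≤2 θ≤2)) » from≡ (ring155 (suc τ)) » N≥)) ⟩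
    _ ≡⟨ ring156 a N ⟩
    _ ∎
    where
    -- With N = n + 1 the left side is N³ + 13 N² + 23 N + 11, and 13 + 23 + 11 = 47.
    cubic : ∀ n -> (11 + suc n) * (suc (suc n) * suc (suc n)) ≤ suc n * suc n * suc n + 47 * (suc n * suc n)
    cubic n = m≤m+n _ _ » from≡ (ring157 n)

  Result : ℝ -> Set₂
  Result ε = Σ[ Δ₀ ∈ ℝ ] (0ℝ <ℝ Δ₀ ×
   ((G : BorelGraph) (Δ : ℕ) ->
    FiniteMaxDegree G Δ -> Δ₀ ≤ℝ fromℕ Δ -> FiniteAsi G ->
    (NoCycle G 3 -> ChromaticBound G (fromℕ 4 +ℝ ε) Δ) ×
    (NoCycle G 3 × NoCycle G 4 -> ChromaticBound G (fromℕ 1 +ℝ ε) Δ)))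

  module Bound (ε : ℝ) (τ : ℕ) (far : ∃[ i₀ ] ∀ i -> i₀ ≤ i -> + 1 / suc τ ℚ.≤ seq ε i) (N' : ℕ) (N≥ : 188 * suc τ ≤ suc N') where
   N M x₁ x₀ D : ℕ
   N = suc N'
   M = suc N * N
   x₁ = fst (Sizes.large-enough N' ρ)
   x₀ = x₁ + (N + 20)
   D = suc N ^ (M * x₀)

   module At (G : BorelGraph) (Δ : ℕ) (maxDeg : FiniteMaxDegree G Δ) (fa : FiniteAsi G) (x : ℕ) (x₀≤x : x₀ ≤ x)
    (lower : suc N ^ (M * x) ≤ Δ * N ^ (M * x)) (upper : Δ * N ^ (M * suc x) < suc N ^ (M * suc x)) where

    big : Sizes.need₁ N' ρ x + (Sizes.need₂ N' ρ x + Sizes.need₃ N' ρ x) ≤ 2 ^ x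
    big = snd (Sizes.large-enough N' ρ) x (m≤m+n x₁ _ » x₀≤x)

    20≤x : 20 ≤ x
    20≤x = (m≤n+m 20 N » m≤n+m _ x₁) » x₀≤x

    N≤x : N ≤ x
    N≤x = (m≤m+n N 20 » m≤n+m _ x₁) » x₀≤x

    e-is : Sizes.e N' ρ x ≡ N * N * x
    e-is = go (N * N * x) ((s≤s z≤n » N≤x) » m≤m+n x _)
     where
     go : ∀ k -> 1 ≤ k -> suc (pred k) ≡ k
     go (suc k) _ = refl

    conclude : ∀ θ -> θ ≤ 2 -> (∃[ Q ] BorelColouring G Q × Sizes.e N' ρ x * Q ≤ θ * θ * (11 + N) * Δ) -> ChromaticBound G (fromℕ (θ * θ) +ℝ ε) Δ
    conclude θ θ≤2 (Q , col , le) = colouring⇒chromaticBound G (fromℕ (θ * θ) +ℝ ε) Q Δ col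
     (count⇒bound N' (M * suc x) τ (θ * θ) Q Δ ε far (<⇒≤ upper) (count τ N' θ x Q Δ N≥ θ≤2 N≤x (subst (λ z -> z * Q ≤ θ * θ * (11 + N) * Δ) e-is le)))

    triangle-free : NoCycle G 3 -> ChromaticBound G (fromℕ 4 +ℝ ε) Δ
    triangle-free no₃ = conclude 2 ≤-refl (Assembly.triangle-free-colouring G Δ maxDeg fa no₃ N' ρ x (snd radius) lower upper big 20≤x)

    sparse : NoCycle G 3 × NoCycle G 4 -> ChromaticBound G (fromℕ 1 +ℝ ε) Δ
    sparse (no₃ , no₄) = conclude 1 (s≤s z≤n) (Assembly.sparse-colouring G Δ maxDeg fa no₃ N' ρ x (snd radius) lower upper big 20≤x no₄)

   result : Result ε
   result = fromℕ D , fromℕ-positive D (1≤^ (M * x₀) (s≤s z≤n)) , λ G Δ maxDeg large fa ->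
    let (x , x₀≤x , lower , upper) = scale N' x₀ Δ (fromℕ-reflects-≤ D Δ large) in
    At.triangle-free G Δ maxDeg fa x x₀≤x lower upper , At.sparse G Δ maxDeg fa x x₀≤x lower upper

  abstract
   theorem : ∀ ε -> 0ℝ <ℝ ε -> Result ε
   theorem ε 0<ε = let (τ , far) = eventually-positive ε 0<ε ; (N' , N≥) = fine τ in Bound.result ε τ far N' N≥

open import Defs

theorem1p18 :
    (∀ {ℓ} → ExcludedMiddle ℓ) →
    (ε : ℝ) → 0ℝ <ℝ ε →
    Σ[ Δ₀ ∈ ℝ ] (0ℝ <ℝ Δ₀ ×
      ((G : BorelGraph) (Δ : ℕ) →
        FiniteMaxDegree G Δ → Δ₀ ≤ℝ fromℕ Δ → FiniteAsi G →
        (NoCycle G 3 → ChromaticBound G (fromℕ 4 +ℝ ε) Δ) ×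
        (NoCycle G 3 × NoCycle G 4 → ChromaticBound G (fromℕ 1 +ℝ ε) Δ)))
theorem1p18 em = Main.theorem em
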